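{- Let $R$ be a rule set belonging to the Simion class, and let $\Delta_n=\Delta_n(R)$ for $n\ge0$ (assumed to be triangulations of $\partial P_n$ for $n\ge1$). Let $F(\widehat{\mathcal F},x,y,z)=\sum_{n\ge0}\sum_{\sigma} x^{\mathrm{fw}(\sigma)}y^{\mathrm{bw}(\sigma)}z^n$, the inner sum over saturated faces $\sigma$ of $\Delta_n$. If pairs of type $THTH$ nest and pairs of type $HTHT$ do not nest, then $$F(\widehat{\mathcal F},x,y,z)=\frac{C(yz(z+1))+z}{1+z}+\frac{xz\,(1+zC(yz(z+1)))\,C(yz(z+1))^2}{(1+z)\,(1-2C(yz(z+1))xz-C(yz(z+1))^2xz^2)}.$$ If pairs of type $THTH$ do not nest and pairs of type $HTHT$ nest, then $$F(\widehat{\mathcal F},x,y,z)=\frac{C(xz(z+1))+z}{1+z}+\frac{yz\,(1+zC(xz(z+1)))\,C(xz(z+1))^2}{(1+z)\,(1-2C(xz(z+1))yz-C(xz(z+1))^2yz^2)}.$$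
   Context: $P_n$ is the convex hull of $e_j-e_i$ ($i\ne j$) in $\mathbb{R}^{n+1}$. An arrow $(i,j)$, $i\ne j\in\{1,\dots,n+1\}$, has tail $i$, head $j$; it is forward if $i<j$, backward if $i>j$; $V_n$ is the set of arrows ($V_0=\emptyset$). For two arrows with four distinct endpoints $p_1<\dots<p_4$, the type is the $T/H$ word recording whether $p_1,\dots,p_4$ are tails or heads; the two tails and two heads can be matched in two ways; for types $THTH,HTHT$ one matching nests (joins $\{p_1,p_4\},\{p_2,p_3\}$), for $THHT,HTTH$ one crosses (joins $\{p_1,p_3\},\{p_2,p_4\}$), for $TTHH,HHTT$ one nests and the other crosses. A rule set $R$ chooses for each of the six types which of the two matchings is an edge ("nests"/"does not nest", "crosses"/"does not cross", "nests"/"crosses"). $\Delta_n(R)$ is the flag complex on $V_n$ whose edges are: pairs of distinct arrows with a common tail, pairs with a common head, and pairs with four distinct endpoints equal to the matching chosen by $R$ for their type; $\Delta_0=\{\emptyset\}$. The Simion class: exactly one of $THTH$, $HTHT$ nests, and if both $THHT$ and $HTTH$ cross then both $TTHH$ and $HHTT$ nest. For a face $\sigma$, $\mathrm{fw}(\sigma)$, $\mathrm{bw}(\sigma)$ are its numbers of forward and backward arrows. For $n\ge1$ a set $\sigma\subseteq V_n$ is saturated if the set of endpoints of its arrows is $\{1,\dots,n+1\}$; the empty subset of $V_0$ is saturated. $C(u)=\sum_{n\ge0}C_nu^n=\frac{1-\sqrt{1-4u}}{2u}$ is the Catalan generating function. -}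

module Defs where

open import Data.Bool using (Bool; true; false; _∧_; _∨_; not; if_then_else_; T)
open import Data.Nat as ℕ using (ℕ; zero; suc; _∸_; _≡ᵇ_; _<ᵇ_)
open import Data.Nat.DivMod using (_/_)
open import Data.Nat.Combinatorics using (_C_)
open import Data.Integer as ℤ using (ℤ; +_; 0ℤ; 1ℤ)
open import Data.List using (List; []; _∷_; length; filterᵇ; upTo; concatMap; map; _++_)
open import Data.Bool.ListAction using (all; any)
open import Data.Product using (_×_; _,_; proj₁; proj₂)
open import Data.Maybe using (Maybe; just; nothing)
open import Data.Sum using (_⊎_)
open import Relation.Binary.PropositionalEquality using (_≡_; _≢_)

-- Arrows.  The endpoints {1,…,n+1} are encoded as {0,…,n}.
-- An arrow is a pair (tail , head) with tail ≢ head.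

Arrow : Set
Arrow = ℕ × ℕ

tail head : Arrow → ℕ
tail = proj₁
head = proj₂

forward backward : Arrow → Bool
forward  (i , j) = i <ᵇ j
backward (i , j) = j <ᵇ i

allArrows : ℕ → List Arrow
allArrows n =
  concatMap (λ i → concatMap (λ j → if i ≡ᵇ j then [] else (i , j) ∷ []) (upTo (suc n)))
            (upTo (suc n))

sublists : {A : Set} → List A → List (List A)
sublists []       = [] ∷ []
sublists (a ∷ as) = let s = sublists as in s ++ map (a ∷_) s

data Label : Set where
  Tl Hd : Label

data PairType : Set where
  THTH HTHT THHT HTTH TTHH HHTT : PairType

-- The three perfect matchings of four points p₁<p₂<p₃<p₄:
--   nest   = {p₁p₄, p₂p₃},  cross = {p₁p₃, p₂p₄},  serial = {p₁p₂, p₃p₄}.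
data Shape : Set where
  nest cross serial : Shape

-- The two matchings joining tails to heads for each type.
allowed : PairType → Shape → Bool
allowed THTH nest   = true
allowed THTH serial = true
allowed HTHT nest   = true
allowed HTHT serial = true
allowed THHT cross  = true
allowed THHT serial = true
allowed HTTH cross  = true
allowed HTTH serial = true
allowed TTHH nest   = true
allowed TTHH cross  = true
allowed HHTT nest   = true
allowed HHTT cross  = true
allowed _    _      = false

record RuleSet : Set where
  field
    rule       : PairType → Shape
    admissible : ∀ τ → T (allowed τ (rule τ))
open RuleSet public

count< : ℕ → List ℕ → ℕ
count< p xs = length (filterᵇ (_<ᵇ p) xs)

pairType : Arrow → Arrow → Maybe PairType
pairType (t₁ , h₁) (t₂ , h₂) = classify (lab 0) (lab 1) (lab 2) (lab 3)
  where
  pts = t₁ ∷ h₁ ∷ t₂ ∷ h₂ ∷ []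
  rank : ℕ → ℕ
  rank p = count< p pts
  lab : ℕ → Label
  lab k = if (rank t₁ ≡ᵇ k) ∨ (rank t₂ ≡ᵇ k) then Tl else Hd
  classify : Label → Label → Label → Label → Maybe PairType
  classify Tl Hd Tl Hd = just THTH
  classify Hd Tl Hd Tl = just HTHT
  classify Tl Hd Hd Tl = just THHT
  classify Hd Tl Tl Hd = just HTTH
  classify Tl Tl Hd Hd = just TTHH
  classify Hd Hd Tl Tl = just HHTT
  classify _  _  _  _  = nothing

pairShape : Arrow → Arrow → Shape
pairShape (t₁ , h₁) (t₂ , h₂) =
  if ((a <ᵇ c) ∧ (d <ᵇ b)) ∨ ((c <ᵇ a) ∧ (b <ᵇ d)) then nest
  else if ((a <ᵇ c) ∧ (c <ᵇ b) ∧ (b <ᵇ d)) ∨ ((c <ᵇ a) ∧ (a <ᵇ d) ∧ (d <ᵇ b)) then cross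
  else serial
  where
  a = ℕ._⊓_ t₁ h₁
  b = ℕ._⊔_ t₁ h₁
  c = ℕ._⊓_ t₂ h₂
  d = ℕ._⊔_ t₂ h₂

shape≡ᵇ : Shape → Shape → Bool
shape≡ᵇ nest   nest   = true
shape≡ᵇ cross  cross  = true
shape≡ᵇ serial serial = true
shape≡ᵇ _      _      = false

fourDistinct : Arrow → Arrow → Bool
fourDistinct (t₁ , h₁) (t₂ , h₂) =
  not (t₁ ≡ᵇ t₂) ∧ not (t₁ ≡ᵇ h₂) ∧ not (h₁ ≡ᵇ t₂) ∧ not (h₁ ≡ᵇ h₂)

-- Edge relation of Δ_n(R) (for distinct arrows).
edge : RuleSet → Arrow → Arrow → Bool
edge R α β =
  (tail α ≡ᵇ tail β) ∨ (head α ≡ᵇ head β) ∨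
  (fourDistinct α β ∧ ruleEdge (pairType α β))
  where
  ruleEdge : Maybe PairType → Bool
  ruleEdge (just τ) = shape≡ᵇ (pairShape α β) (rule R τ)
  ruleEdge nothing  = false

-- Faces of the flag complex: sets of pairwise adjacent arrows.
isClique : RuleSet → List Arrow → Bool
isClique R []      = true
isClique R (α ∷ σ) = all (edge R α) σ ∧ isClique R σ

-- Saturated: endpoints cover {0,…,n}; for n = 0 only the empty face exists
-- and it is declared saturated.
saturated : ℕ → List Arrow → Bool
saturated zero    σ = true
saturated (suc n) σ =
  all (λ k → any (λ α → (tail α ≡ᵇ k) ∨ (head α ≡ᵇ k)) σ) (upTo (suc (suc n)))

fw bw : List Arrow → ℕ
fw σ = length (filterᵇ forward σ)
bw σ = length (filterᵇ backward σ)

satFaces : RuleSet → ℕ → ℕ → ℕ → ℕ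
satFaces R a b n =
  length (filterᵇ (λ σ → isClique R σ ∧ saturated n σ ∧ (fw σ ≡ᵇ a) ∧ (bw σ ≡ᵇ b))
                  (sublists (allArrows n)))

-- Formal power series in x, y, z with integer coefficients:
-- s a b n = coefficient of x^a y^b z^n.

Series : Set
Series = ℕ → ℕ → ℕ → ℤ

_≈S_ : Series → Series → Set
F ≈S G = ∀ a b n → F a b n ≡ G a b n

sumTo : ℕ → (ℕ → ℤ) → ℤ
sumTo zero    f = f 0
sumTo (suc m) f = sumTo m f ℤ.+ f (suc m)

infixl 6 _+S_
infixl 7 _*S_

_+S_ : Series → Series → Series
(f +S g) a b n = f a b n ℤ.+ g a b n

-S_ : Series → Series
(-S f) a b n = ℤ.- f a b n

_*S_ : Series → Series → Series
(f *S g) a b n =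
  sumTo a λ i → sumTo b λ j → sumTo n λ k →
    f i j k ℤ.* g (a ∸ i) (b ∸ j) (n ∸ k)

monoS : ℤ → ℕ → ℕ → ℕ → Series
monoS c i j k a b n = if (a ≡ᵇ i) ∧ (b ≡ᵇ j) ∧ (n ≡ᵇ k) then c else 0ℤ

constS : ℤ → Series
constS c = monoS c 0 0 0

oneS Xs Ys Zs : Series
oneS = constS 1ℤ
Xs = monoS 1ℤ 1 0 0
Ys = monoS 1ℤ 0 1 0
Zs = monoS 1ℤ 0 0 1

_^S_ : Series → ℕ → Series
f ^S zero  = oneS
f ^S suc k = f *S (f ^S k)

-- Sum of a family g 0, g 1, … whose k-th member is divisible by z^k
-- (so the coefficient of z^n only involves k ≤ n).
zSum : (ℕ → Series) → Series
zSum g a b n = sumTo n λ k → g k a b n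

catalan : ℕ → ℕ
catalan k = ((2 ℕ.* k) C k) / suc k

-- C(u) = Σ_k C_k u^k, for u divisible by z
CatS : Series → Series
CatS u = zSum λ k → constS (+ catalan k) *S (u ^S k)

-- 1/(1-g) = Σ_k g^k, for g divisible by z
geomS : Series → Series
geomS g = zSum λ k → g ^S k

rhs : Series → Series → Series
rhs u v =
  (Cu +S Zs) *S inv1pz
  +S v *S Zs *S (oneS +S Zs *S Cu) *S (Cu ^S 2) *S inv1pz
     *S geomS (constS (+ 2) *S Cu *S v *S Zs +S (Cu ^S 2) *S v *S (Zs ^S 2))
  where
  Cu     = CatS (u *S Zs *S (Zs +S oneS))
  inv1pz = geomS (-S Zs)

Fgen : RuleSet → Series
Fgen R a b n = + satFaces R a b n

SimionClass : RuleSet → Set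
SimionClass R =
  ((rule R THTH ≡ nest × rule R HTHT ≢ nest) ⊎ (rule R THTH ≢ nest × rule R HTHT ≡ nest))
  × (rule R THHT ≡ cross → rule R HTTH ≡ cross → rule R TTHH ≡ nest × rule R HHTT ≡ nest)

{-# OPTIONS --safe #-}
-- In a saturated face every point is only ever a tail or only ever a head, so a saturated face
-- lives on a word in two letters, 𝐀 and 𝐁, where 𝐀 marks the tails if THTH nests and the heads
-- if HTHT nests; let x and y be the weights of the arrows whose 𝐀-end comes first, resp. last.
-- The weighted number of saturated faces on a word is the same for all rule sets of the class:
-- it is the functional κ on ℤ[x,y]⟨𝐀,𝐁⟩ with κ(u𝐁𝐀v) = y(κ(u𝐁v) + κ(u𝐀v) + κ(uv)) and
-- κ(𝐀v𝐁) = x(κ(𝐀v) + κ(v𝐁) + κ(v)).  To see this, choose an arrow α on nodes a, b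
-- such that for any four nodes containing a and b the rule chooses the matching with α.  Then α
-- lies in every face, one of its ends is a leaf, and deleting a, b or both gives a recursion.
-- Such an arrow exists if 𝐀𝐀𝐁𝐁 nests, except when 𝐀𝐁𝐁𝐀 and 𝐁𝐀𝐀𝐁 both cross and the word has the
-- form 𝐁…𝐀; then one separates the faces containing the outermost arrow, and a bilinear
-- identity of κ with its value at x = 0 takes the place of the recursion.  If 𝐀𝐀𝐁𝐁 crosses, not
-- both mixed types cross, so compatibility of a forward with a backward arc splits into
-- conditions on its two ends; for a given backward part the count of the forward part is then a
-- count of forward arcs only, which does not see the rule for 𝐀𝐀𝐁𝐁.
--
-- For the generating function put s = zC(yz(z+1)) and c = 1 + s²y.  Then s = z + y(z+1)s², and the
-- relation for 𝐁𝐀 becomes (1 - s𝐁)(1 - s𝐀) = c(1 - z(𝐀+𝐁)), which evaluates Σ zⁿ κ((𝐀+𝐁)ⁿ).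
module Submission where

open import Defs
open import Algebra.Bundles using (CommutativeRing)
import Algebra.Properties.CommutativeSemigroup
import Algebra.Properties.Ring
import Algebra.Properties.Semiring.Mult.TCOptimised
import Algebra.Solver.Ring
import Algebra.Solver.Ring.AlmostCommutativeRing as ACR
open import Data.Bool.Base using (Bool; true; false; not; if_then_else_; _∨_; _∧_; T)
open import Data.Bool.ListAction using (all; any)
import Data.Bool.Properties as Boolₚ
open import Data.Empty using (⊥; ⊥-elim)
open import Data.Integer.Base as ℤ using (ℤ; +_; -[1+_]; 0ℤ; 1ℤ)
import Data.Integer.Properties as ℤₚ
open import Data.List.Base using (List; []; _∷_; _++_; replicate; map; length; filter; InitLast; initLast; _∷ʳ′_; filterᵇ; upTo; concatMap)
import Data.List.Membership.DecPropositional as DecMembership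
open import Data.List.Membership.Propositional using (_∈_; _∉_; find; lose)
import Data.List.Membership.Propositional.Properties as Membershipₚ
import Data.List.Properties as Listₚ
open import Data.List.Relation.Binary.Permutation.Propositional as Perm using (_↭_; prep; swap; ↭-sym; ↭-refl; ↭-trans)
import Data.List.Relation.Binary.Permutation.Propositional.Properties as Permₚ
import Data.List.Relation.Binary.Permutation.Setoid.Properties as PermutationSetoidProperties
open import Data.List.Relation.Binary.Sublist.Propositional as Sublist using (_⊆_; ⊆-refl) renaming (_∷_ to keep; _∷ʳ_ to skip)
import Data.List.Relation.Binary.Sublist.Propositional.Properties as Sublistₚ
open import Data.List.Relation.Unary.All as All using (All; []; _∷_)
import Data.List.Relation.Unary.All.Properties as Allₚ
open import Data.List.Relation.Unary.AllPairs as AllPairs using ([]; _∷_; AllPairs)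
open import Data.List.Relation.Unary.Any as Any using (Any; here; there)
import Data.List.Relation.Unary.Any.Properties as Anyₚ
open import Data.List.Relation.Unary.Unique.Propositional using (Unique)
import Data.List.Relation.Unary.Unique.Propositional.Properties as Uniqueₚ
open import Data.Maybe.Base using (Maybe; just; nothing)
open import Data.Nat.Base as ℕ using (ℕ; zero; suc; _∸_; _≡ᵇ_; z≤n; s≤s; _≤_; _<_; _<ᵇ_; _⊓_; _⊔_)
open import Data.Nat.DivMod using (_/_; m*n/n≡m)
import Data.Nat.Properties as ℕₚ
open import Data.Nat.Tactic.RingSolver using (solve-∀)
open import Data.Product using (_×_; _,_; proj₁; proj₂; ∃)
import Data.Product.Properties as Productₚ
open import Data.Sum using (_⊎_; inj₁; inj₂; [_,_]′)
open import Function.Base using (_∘_; id)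
open import Function.Bundles using (mk⇔)
open import Level using (0ℓ)
open import Relation.Binary.Definitions using (tri<; tri≈; tri>; DecidableEquality)
import Relation.Binary.PropositionalEquality as ≡
open ≡ using (_≡_; _≢_)
import Relation.Binary.Reasoning.Setoid
open import Relation.Nullary using (yes; no; ¬_; Dec; does)
open import Relation.Nullary.Decidable using (_×-dec_; map′; does-⇔; ¬?)

-- The obstacle is that each rule set offers its own arcs for removal, so the counts obey recursions
-- of different shapes. `κ` is therefore fixed once through a normal form, and each recursion is
-- proved as an identity of `κ`: two functionals that respect the relation agree once they agree on
-- the words 𝐀^p 𝐁^q. In a removal three terms arise because at most one end of the removed arc
-- meets further arcs; if both did, these arcs would form the matching that the rule rejects. In the
-- exceptional case, the faces that contain the outermost arc and the faces that avoid the arc from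
-- the first 𝐀 to the last 𝐁 consist of backward arcs only. They are counted at x = 0, where the
-- rules for the mixed types cannot be seen. The linear equations so obtained determine the count
-- only up to the factors y and 1 + y, which must be cancelled. The weights are arbitrary elements
-- of a commutative ring, because the counts are also taken at x = 0 and at y = 0.

-- Polynomial identities with integer coefficients in a commutative ring.

module IntegerSolver (K : CommutativeRing 0ℓ 0ℓ) where

  open CommutativeRing K
  open Algebra.Properties.Semiring.Mult.TCOptimised semiring using (×-homo-+; ×1-homo-*; 1+×) renaming (_×_ to _·_)
  open Algebra.Properties.Ring ring
  open Relation.Binary.Reasoning.Setoid setoid

  fromℤ : ℤ → Carrier
  fromℤ (+ n)    = n · 1#
  fromℤ -[1+ n ] = - (suc n · 1#)

  private
    fromℤ-⊖ : ∀ m n → fromℤ (m ℤ.⊖ n) ≈ m · 1# - n · 1#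
    fromℤ-⊖ zero zero = sym (-‿inverseʳ 0#)
    fromℤ-⊖ zero (suc n) = sym (+-identityˡ _)
    fromℤ-⊖ (suc m) zero = sym (trans (+-congˡ -0#≈0#) (+-identityʳ _))
    fromℤ-⊖ (suc m) (suc n) = begin
      fromℤ (suc m ℤ.⊖ suc n)              ≡⟨ ≡.cong fromℤ (ℤₚ.[1+m]⊖[1+n]≡m⊖n m n) ⟩
      fromℤ (m ℤ.⊖ n)                      ≈⟨ fromℤ-⊖ m n ⟩
      a - b                                ≈⟨ +-congˡ (+-identityˡ _) ⟨
      a + (0# - b)                         ≈⟨ +-congˡ (+-congʳ (-‿inverseʳ 1#)) ⟨
      a + ((1# - 1#) - b)                  ≈⟨ +-congˡ (+-assoc _ _ _) ⟩
      a + (1# + (- 1# - b))                ≈⟨ +-assoc _ _ _ ⟨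
      (a + 1#) + (- 1# - b)                ≈⟨ +-cong (+-comm _ _) (-‿+-comm _ _) ⟩
      (1# + a) - (1# + b)                  ≈⟨ +-cong (1+× m 1#) (-‿cong (1+× n 1#)) ⟨
      suc m · 1# - suc n · 1#              ∎
      where
      a = m · 1#
      b = n · 1#

    fromℤ-+ : ∀ i j → fromℤ (i ℤ.+ j) ≈ fromℤ i + fromℤ j
    fromℤ-+ (+ m) (+ n) = ×-homo-+ 1# m n
    fromℤ-+ (+ m) -[1+ n ] = fromℤ-⊖ m (suc n)
    fromℤ-+ -[1+ m ] (+ n) = trans (fromℤ-⊖ n (suc m)) (+-comm _ _)
    fromℤ-+ -[1+ m ] -[1+ n ] = begin
      - (suc (suc (m ℕ.+ n)) · 1#)      ≡⟨ ≡.cong (λ k → - (suc k · 1#)) (≡.sym (ℕₚ.+-suc m n)) ⟩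
      - ((suc m ℕ.+ suc n) · 1#)        ≈⟨ -‿cong (×-homo-+ 1# (suc m) (suc n)) ⟩
      - (suc m · 1# + suc n · 1#)       ≈⟨ -‿+-comm _ _ ⟨
      - (suc m · 1#) - (suc n · 1#)     ∎

    fromℤ-neg : ∀ i → fromℤ (ℤ.- i) ≈ - fromℤ i
    fromℤ-neg (+ zero) = sym -0#≈0#
    fromℤ-neg (+ suc n) = refl
    fromℤ-neg -[1+ n ] = sym (-‿involutive _)

    fromℤ-*⁺ : ∀ m j → fromℤ (+ m ℤ.* j) ≈ fromℤ (+ m) * fromℤ j
    fromℤ-*⁺ m (+ n) = trans (reflexive (≡.cong fromℤ (≡.sym (ℤₚ.pos-* m n)))) (×1-homo-* m n)
    fromℤ-*⁺ m -[1+ n ] = begin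
      fromℤ (+ m ℤ.* -[1+ n ])          ≡⟨ ≡.cong fromℤ (≡.sym (ℤₚ.neg-distribʳ-* (+ m) (+ suc n))) ⟩
      fromℤ (ℤ.- (+ m ℤ.* + suc n))     ≈⟨ fromℤ-neg (+ m ℤ.* + suc n) ⟩
      - fromℤ (+ m ℤ.* + suc n)         ≈⟨ -‿cong (fromℤ-*⁺ m (+ suc n)) ⟩
      - (m · 1# * (suc n · 1#))         ≈⟨ -‿distribʳ-* _ _ ⟩
      m · 1# * - (suc n · 1#)           ∎

    fromℤ-* : ∀ i j → fromℤ (i ℤ.* j) ≈ fromℤ i * fromℤ j
    fromℤ-* (+ m) j = fromℤ-*⁺ m j
    fromℤ-* -[1+ m ] j = begin
      fromℤ (-[1+ m ] ℤ.* j)            ≡⟨ ≡.cong fromℤ (≡.sym (ℤₚ.neg-distribˡ-* (+ suc m) j)) ⟩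
      fromℤ (ℤ.- (+ suc m ℤ.* j))       ≈⟨ fromℤ-neg (+ suc m ℤ.* j) ⟩
      - fromℤ (+ suc m ℤ.* j)           ≈⟨ -‿cong (fromℤ-*⁺ (suc m) j) ⟩
      - (suc m · 1# * fromℤ j)          ≈⟨ -‿distribˡ-* _ _ ⟩
      - (suc m · 1#) * fromℤ j          ∎

    almostK = ACR.fromCommutativeRing K

    morphism : ℤ.+-*-rawRing ACR.-Raw-AlmostCommutative⟶ almostK
    morphism = record
      { ⟦_⟧ = fromℤ
      ; +-homo = fromℤ-+
      ; *-homo = fromℤ-*
      ; -‿homo = fromℤ-neg
      ; 0-homo = refl
      ; 1-homo = refl
      }

    -- Equality in the carrier may be undecidable; the solver compares the integer coefficients
    -- instead.
    decide : ∀ i j → Maybe (fromℤ i ≈ fromℤ j)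
    decide i j with i ℤₚ.≟ j
    ... | yes i≡j = just (reflexive (≡.cong fromℤ i≡j))
    ... | no  _   = nothing

  open Algebra.Solver.Ring ℤ.+-*-rawRing almostK morphism decide public
    using (solve; _:=_; _:+_; _:*_; _:-_; :-_; con; Polynomial)

  𝟙 𝟚 𝟘 : ∀ {n} → Polynomial n
  𝟘 = con (+ 0)
  𝟙 = con (+ 1)
  𝟚 = con (+ 2)

-- Words in two letters and their mirror images.

data Letter : Set where
  𝐀 𝐁 : Letter

Word : Set
Word = List Letter

infix 8 𝐀^_ 𝐁^_

𝐀^_ 𝐁^_ : ℕ → Word
𝐀^ n = replicate n 𝐀
𝐁^ n = replicate n 𝐁

opposite : Letter → Letter
opposite 𝐀 = 𝐁
opposite 𝐁 = 𝐀

mirror : Word → Word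
mirror []      = []
mirror (l ∷ w) = mirror w ++ opposite l ∷ []

replicate-shift : ∀ {X : Set} n (l : X) w → replicate n l ++ l ∷ w ≡ l ∷ replicate n l ++ w
replicate-shift zero    l w = ≡.refl
replicate-shift (suc n) l w = ≡.cong (l ∷_) (replicate-shift n l w)

mirror-++ : ∀ u v → mirror (u ++ v) ≡ mirror v ++ mirror u
mirror-++ []      v = ≡.sym (Listₚ.++-identityʳ _)
mirror-++ (l ∷ u) v = ≡.trans (≡.cong (_++ _) (mirror-++ u v)) (Listₚ.++-assoc (mirror v) (mirror u) _)

mirror-𝐀^ : ∀ n → mirror (𝐀^ n) ≡ 𝐁^ n
mirror-𝐀^ zero    = ≡.refl
mirror-𝐀^ (suc n) = ≡.trans (≡.cong (_++ _) (mirror-𝐀^ n))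
  (≡.trans (replicate-shift n 𝐁 []) (≡.cong (𝐁 ∷_) (Listₚ.++-identityʳ _)))

mirror-𝐁^ : ∀ n → mirror (𝐁^ n) ≡ 𝐀^ n
mirror-𝐁^ zero    = ≡.refl
mirror-𝐁^ (suc n) = ≡.trans (≡.cong (_++ _) (mirror-𝐁^ n))
  (≡.trans (replicate-shift n 𝐀 []) (≡.cong (𝐀 ∷_) (Listₚ.++-identityʳ _)))

-- The functional `κ`: normal form, symmetry and recursions at the ends of a word.

-- κ is the linear functional on the free algebra ℤ[x,y]⟨𝐀,𝐁⟩ that factors through
-- the relation 𝐁𝐀 = y(𝐁 + 𝐀 + 1) and takes the normal monomial 𝐀^p 𝐁^q to the
-- weighted number D p q of staircases; e p q w is its value at 𝐀^p 𝐁^q w.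
module Canonical (K : CommutativeRing 0ℓ 0ℓ) (x y : CommutativeRing.Carrier K) where

  open CommutativeRing K hiding (zero)
  open Relation.Binary.Reasoning.Setoid setoid
  open IntegerSolver K

  -- The generating function of these numbers is Σ D p q a^p b^q = (1 - xa - xb) / (1 - xa - xb -
  -- xab); its value at a = b = s reappears in the series over all words.
  D : ℕ → ℕ → Carrier
  D zero    zero    = 1#
  D zero    (suc q) = 0#
  D (suc p) zero    = 0#
  D (suc p) (suc q) = x * (D p (suc q) + D (suc p) q + D p q)

  e : ℕ → ℕ → Word → Carrier
  e p q       []      = D p q
  e p q       (𝐁 ∷ w) = e p (suc q) w
  e p zero    (𝐀 ∷ w) = e (suc p) zero w
  e p (suc q) (𝐀 ∷ w) = y * (e p (suc q) w + e p q (𝐀 ∷ w) + e p q w)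

  κ : Word → Carrier
  κ = e 0 0

  e-𝐀^ : ∀ p i w → e p 0 (𝐀^ i ++ w) ≡ e (i ℕ.+ p) 0 w
  e-𝐀^ p zero    w = ≡.refl
  e-𝐀^ p (suc i) w = ≡.trans (e-𝐀^ (suc p) i w) (≡.cong (λ k → e k 0 w) (ℕₚ.+-suc i p))

  e-𝐁^ : ∀ p q j w → e p q (𝐁^ j ++ w) ≡ e p (j ℕ.+ q) w
  e-𝐁^ p q zero    w = ≡.refl
  e-𝐁^ p q (suc j) w = ≡.trans (e-𝐁^ p (suc q) j w) (≡.cong (λ k → e p k w) (ℕₚ.+-suc j q))

  κ-normal : ∀ p q w → κ (𝐀^ p ++ 𝐁^ q ++ w) ≡ e p q w
  κ-normal p q w = ≡.trans (e-𝐀^ 0 p _) (≡.trans (e-𝐁^ (p ℕ.+ 0) 0 q w) (≡.cong₂ (λ i j → e i j w) (ℕₚ.+-identityʳ p) (ℕₚ.+-identityʳ q)))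

  κ-𝐀^𝐁^ : ∀ p q → κ (𝐀^ p ++ 𝐁^ q) ≡ D p q
  κ-𝐀^𝐁^ p q = ≡.trans (≡.cong (λ w → κ (𝐀^ p ++ w)) (≡.sym (Listₚ.++-identityʳ (𝐁^ q)))) (κ-normal p q [])

  κ-𝐁^ : ∀ q → κ (𝐁^ suc q) ≡ 0#
  κ-𝐁^ q = κ-𝐀^𝐁^ 0 (suc q)

  -- These are the functionals that factor through the quotient by the relation. They are closed
  -- under linear combinations and under fixing a prefix or a suffix, so an identity of `κ` that is
  -- linear in a variable factor of the word is an equation between two of them.
  record Straight (F : Word → Carrier) : Set where
    constructor straight
    field pull : ∀ u v → F (u ++ 𝐁 ∷ 𝐀 ∷ v) ≈ y * (F (u ++ 𝐁 ∷ v) + F (u ++ 𝐀 ∷ v) + F (u ++ v))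
  open Straight

  private
    e-straight : ∀ p q u v → e p q (u ++ 𝐁 ∷ 𝐀 ∷ v) ≈ y * (e p q (u ++ 𝐁 ∷ v) + e p q (u ++ 𝐀 ∷ v) + e p q (u ++ v))
    e-straight p q       []      v = refl
    e-straight p q       (𝐁 ∷ u) v = e-straight p (suc q) u v
    e-straight p zero    (𝐀 ∷ u) v = e-straight (suc p) zero u v
    e-straight p (suc q) (𝐀 ∷ u) v = begin
      y * (e p (suc q) (u ++ _) + e p q (𝐀 ∷ u ++ _) + e p q (u ++ _))
        ≈⟨ *-congˡ (+-cong (+-cong (e-straight p (suc q) u v) (e-straight p q (𝐀 ∷ u) v)) (e-straight p q u v)) ⟩
      _ ≈⟨ solve 10 (λ y a b c d e f g h i →
             y :* (y :* (a :+ b :+ c) :+ y :* (d :+ e :+ f) :+ y :* (g :+ h :+ i))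
             := y :* (y :* (a :+ d :+ g) :+ y :* (b :+ e :+ h) :+ y :* (c :+ f :+ i))) refl
             y _ _ _ _ _ _ _ _ _ ⟩
      _ ∎

  κ-straight : Straight κ
  κ-straight = straight (e-straight 0 0)

  -- The relation rewrites every word into normal monomials. The induction reads a word as 𝐀^p 𝐁^q
  -- followed by an unread rest, just as `e` does.
  straight-unique : ∀ {F G} → Straight F → Straight G →
                    (∀ p q → F (𝐀^ p ++ 𝐁^ q) ≈ G (𝐀^ p ++ 𝐁^ q)) → ∀ w → F w ≈ G w
  straight-unique {F} {G} sF sG base = go 0 0
    where
    go : ∀ p q w → F (𝐀^ p ++ 𝐁^ q ++ w) ≈ G (𝐀^ p ++ 𝐁^ q ++ w)
    go p q [] rewrite Listₚ.++-identityʳ (𝐁^ q) = base p q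
    go p q (𝐁 ∷ w) = ≡.subst (λ z → F (𝐀^ p ++ z) ≈ G (𝐀^ p ++ z)) (≡.sym (replicate-shift q 𝐁 w)) (go p (suc q) w)
    go p zero (𝐀 ∷ w) = ≡.subst (λ z → F z ≈ G z) (≡.sym (replicate-shift p 𝐀 w)) (go (suc p) zero w)
    go p (suc q) (𝐀 ∷ w) = ≡.subst (λ z → F z ≈ G z) eq (begin
      F (u ++ 𝐁 ∷ 𝐀 ∷ w)                                    ≈⟨ pull sF u w ⟩
      y * (F (u ++ 𝐁 ∷ w) + F (u ++ 𝐀 ∷ w) + F (u ++ w))
        ≈⟨ *-congˡ (+-cong (+-cong (at (𝐁 ∷ w) (go p q (𝐁 ∷ w))) (at (𝐀 ∷ w) (go p q (𝐀 ∷ w)))) (at w (go p q w))) ⟩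
      y * (G (u ++ 𝐁 ∷ w) + G (u ++ 𝐀 ∷ w) + G (u ++ w))  ≈⟨ pull sG u w ⟨
      G (u ++ 𝐁 ∷ 𝐀 ∷ w)                                    ∎)
      where
      u = 𝐀^ p ++ 𝐁^ q
      at : ∀ z → F (𝐀^ p ++ 𝐁^ q ++ z) ≈ G (𝐀^ p ++ 𝐁^ q ++ z) → F (u ++ z) ≈ G (u ++ z)
      at z = ≡.subst (λ t → F t ≈ G t) (≡.sym (Listₚ.++-assoc (𝐀^ p) (𝐁^ q) z))
      eq : u ++ 𝐁 ∷ 𝐀 ∷ w ≡ 𝐀^ p ++ 𝐁^ suc q ++ 𝐀 ∷ w
      eq = ≡.trans (Listₚ.++-assoc (𝐀^ p) (𝐁^ q) _) (≡.cong (𝐀^ p ++_) (replicate-shift q 𝐁 (𝐀 ∷ w)))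

  straight-+ : ∀ {F G} → Straight F → Straight G → Straight (λ w → F w + G w)
  straight-+ sF sG = straight λ u v → trans (+-cong (pull sF u v) (pull sG u v))
    (solve 7 (λ y a b c d e f → y :* (a :+ b :+ c) :+ y :* (d :+ e :+ f)
                             := y :* (a :+ d :+ (b :+ e) :+ (c :+ f))) refl y _ _ _ _ _ _)

  straight-minus : ∀ {F G} → Straight F → Straight G → Straight (λ w → F w - G w)
  straight-minus sF sG = straight λ u v → trans (+-cong (pull sF u v) (-‿cong (pull sG u v)))
    (solve 7 (λ y a b c d e f → y :* (a :+ b :+ c) :- y :* (d :+ e :+ f)
                             := y :* (a :- d :+ (b :- e) :+ (c :- f))) refl y _ _ _ _ _ _)

  straight-* : ∀ c {F} → Straight F → Straight (λ w → c * F w)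
  straight-* k sF = straight λ u v → trans (*-congˡ (pull sF u v))
    (solve 5 (λ k y a b c → k :* (y :* (a :+ b :+ c)) := y :* (k :* a :+ k :* b :+ k :* c)) refl k y _ _ _)

  straight-ˡ : ∀ l {F} → Straight F → Straight (λ w → F (l ++ w))
  straight-ˡ l {F} sF = straight λ u v → let as = Listₚ.++-assoc l u in ≡.subst₂ _≈_ (≡.cong F (as _))
    (≡.cong₂ (λ s t → y * (s + t)) (≡.cong₂ _+_ (≡.cong F (as _)) (≡.cong F (as _))) (≡.cong F (as _)))
    (pull sF (l ++ u) v)

  straight-ʳ : ∀ r {F} → Straight F → Straight (λ w → F (w ++ r))
  straight-ʳ r {F} sF = straight λ u v → let as = λ z → ≡.sym (Listₚ.++-assoc u z r) in ≡.subst₂ _≈_ (≡.cong F (as _))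
    (≡.cong₂ (λ s t → y * (s + t)) (≡.cong₂ _+_ (≡.cong F (as _)) (≡.cong F (as _))) (≡.cong F (as _)))
    (pull sF u (v ++ r))

  -- Reversing a word and exchanging its letters fixes 𝐁𝐀 and permutes the summands 𝐁 and 𝐀 of the
  -- right-hand side, so the relation is preserved. On normal monomials the claim is the symmetry of
  -- `D`.
  κ-mirror : ∀ w → κ (mirror w) ≈ κ w
  κ-mirror = straight-unique mirrored κ-straight base
    where
    as : ∀ u v → mirror (u ++ v) ≡ mirror v ++ mirror u
    as = mirror-++
    mirrored : Straight (λ w → κ (mirror w))
    mirrored = straight λ u v → let
        eq₂ : ∀ l → mirror (u ++ l ∷ v) ≡ mirror v ++ opposite l ∷ mirror u
        eq₂ l = ≡.trans (as u (l ∷ v)) (Listₚ.++-assoc (mirror v) _ _)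
        eq₁ : mirror (u ++ 𝐁 ∷ 𝐀 ∷ v) ≡ mirror v ++ 𝐁 ∷ 𝐀 ∷ mirror u
        eq₁ = ≡.trans (as u _) (≡.trans (≡.cong (_++ mirror u) (Listₚ.++-assoc (mirror v) _ _)) (Listₚ.++-assoc (mirror v) _ _))
      in ≡.subst₂ _≈_ (≡.cong κ (≡.sym eq₁))
      (≡.cong₂ (λ s t → y * (s + t)) (≡.cong₂ _+_ (≡.cong κ (≡.sym (eq₂ 𝐁))) (≡.cong κ (≡.sym (eq₂ 𝐀)))) (≡.cong κ (≡.sym (as u v))))
      (trans (pull κ-straight (mirror v) (mirror u)) (*-congˡ (+-congʳ (+-comm _ _))))
    D-sym : ∀ p q → D p q ≈ D q p
    D-sym zero zero = refl
    D-sym zero (suc q) = refl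
    D-sym (suc p) zero = refl
    D-sym (suc p) (suc q) = *-congˡ (+-cong (trans (+-cong (D-sym p (suc q)) (D-sym (suc p) q)) (+-comm _ _)) (D-sym p q))
    base : ∀ p q → κ (mirror (𝐀^ p ++ 𝐁^ q)) ≈ κ (𝐀^ p ++ 𝐁^ q)
    base p q = begin
      κ (mirror (𝐀^ p ++ 𝐁^ q))            ≡⟨ ≡.cong κ (as (𝐀^ p) (𝐁^ q)) ⟩
      κ (mirror (𝐁^ q) ++ mirror (𝐀^ p))   ≡⟨ ≡.cong₂ (λ s t → κ (s ++ t)) (mirror-𝐁^ q) (mirror-𝐀^ p) ⟩
      κ (𝐀^ q ++ 𝐁^ p)                     ≡⟨ κ-𝐀^𝐁^ q p ⟩
      D q p                                ≈⟨ D-sym q p ⟩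
      D p q                                ≡⟨ κ-𝐀^𝐁^ p q ⟨
      κ (𝐀^ p ++ 𝐁^ q)                     ∎

  -- With the outer letters fixed, both sides respect the relation in `w`. For `w` = 𝐀^p 𝐁^q the
  -- equation is the recursion of `D`.
  κ-outer : ∀ w → κ (𝐀 ∷ w ++ 𝐁 ∷ []) ≈ x * (κ (w ++ 𝐁 ∷ []) + κ (𝐀 ∷ w) + κ w)
  κ-outer = straight-unique (straight-ˡ (𝐀 ∷ []) (straight-ʳ (𝐁 ∷ []) κ-straight))
    (straight-* x (straight-+ (straight-+ (straight-ʳ (𝐁 ∷ []) κ-straight) (straight-ˡ (𝐀 ∷ []) κ-straight)) κ-straight))
    base
    where
    app : ∀ p q → (𝐀^ p ++ 𝐁^ q) ++ 𝐁 ∷ [] ≡ 𝐀^ p ++ 𝐁^ suc q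
    app p q = ≡.trans (Listₚ.++-assoc (𝐀^ p) (𝐁^ q) _)
      (≡.cong (𝐀^ p ++_) (≡.trans (replicate-shift q 𝐁 []) (≡.cong (𝐁 ∷_) (Listₚ.++-identityʳ _))))
    base : ∀ p q → κ (𝐀 ∷ (𝐀^ p ++ 𝐁^ q) ++ 𝐁 ∷ [])
                   ≈ x * (κ ((𝐀^ p ++ 𝐁^ q) ++ 𝐁 ∷ []) + κ (𝐀 ∷ 𝐀^ p ++ 𝐁^ q) + κ (𝐀^ p ++ 𝐁^ q))
    base p q rewrite app p q | κ-𝐀^𝐁^ (suc p) (suc q) | κ-𝐀^𝐁^ p (suc q) | κ-𝐀^𝐁^ (suc p) q | κ-𝐀^𝐁^ p q = refl

  -- A certificate for equality modulo a known equation: `c` is the cofactor with which `a - b`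
  -- enters, and what remains is a polynomial identity for the solver.
  modulo : ∀ {l r a b} c → a ≈ b → l ≈ r + c * (a - b) → l ≈ r
  modulo {l} {r} {a} {b} c a≈b eq = begin
    l                ≈⟨ eq ⟩
    r + c * (a - b)  ≈⟨ +-congˡ (*-congˡ (+-congʳ a≈b)) ⟩
    r + c * (b - b)  ≈⟨ solve 3 (λ r c b → r :+ c :* (b :- b) := r) refl r c b ⟩
    r                ∎

  -- It compares a 𝐁 at the front with a 𝐁 at the back. On 𝐁^q all three values vanish, and putting
  -- an 𝐀 in front of `u` multiplies the defect of the equation by y.
  κ-rotate-𝐁 : ∀ u → (x - y) * κ (𝐁 ∷ u ++ 𝐁 ∷ []) + x * (1# + y) * κ (𝐁 ∷ u) ≈ y * (1# + x) * κ (u ++ 𝐁 ∷ [])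
  κ-rotate-𝐁 = straight-unique
    (straight-+ (straight-* _ (straight-ˡ (𝐁 ∷ []) (straight-ʳ (𝐁 ∷ []) κ-straight))) (straight-* _ (straight-ˡ (𝐁 ∷ []) κ-straight)))
    (straight-* _ (straight-ʳ (𝐁 ∷ []) κ-straight))
    base
    where
    step : ∀ u → (x - y) * κ (𝐁 ∷ u ++ 𝐁 ∷ []) + x * (1# + y) * κ (𝐁 ∷ u) ≈ y * (1# + x) * κ (u ++ 𝐁 ∷ []) →
           (x - y) * κ (𝐁 ∷ 𝐀 ∷ u ++ 𝐁 ∷ []) + x * (1# + y) * κ (𝐁 ∷ 𝐀 ∷ u) ≈ y * (1# + x) * κ (𝐀 ∷ u ++ 𝐁 ∷ [])
    step u hyp = modulo y hyp (begin
      (x - y) * κ (𝐁 ∷ 𝐀 ∷ u ++ 𝐁 ∷ []) + x * (1# + y) * κ (𝐁 ∷ 𝐀 ∷ u)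
        ≈⟨ +-congʳ (*-congˡ (*-congˡ (+-congʳ (+-congˡ (κ-outer u))))) ⟩
      _ ≈⟨ solve 7 (λ x y buB uB au u bu →
             (x :- y) :* (y :* (buB :+ x :* (uB :+ au :+ u) :+ uB)) :+ x :* (𝟙 :+ y) :* (y :* (bu :+ au :+ u))
             := y :* (𝟙 :+ x) :* (x :* (uB :+ au :+ u))
                :+ y :* ((x :- y) :* buB :+ x :* (𝟙 :+ y) :* bu :- y :* (𝟙 :+ x) :* uB)) refl
             x y _ _ _ _ _ ⟩
      _ ≈⟨ +-congʳ (*-congˡ (κ-outer u)) ⟨
      _ ∎)
    app : ∀ q → 𝐁^ q ++ 𝐁 ∷ [] ≡ 𝐁^ suc q
    app q = ≡.trans (replicate-shift q 𝐁 []) (≡.cong (𝐁 ∷_) (Listₚ.++-identityʳ _))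
    base : ∀ p q → (x - y) * κ (𝐁 ∷ (𝐀^ p ++ 𝐁^ q) ++ 𝐁 ∷ []) + x * (1# + y) * κ (𝐁 ∷ 𝐀^ p ++ 𝐁^ q)
                   ≈ y * (1# + x) * κ ((𝐀^ p ++ 𝐁^ q) ++ 𝐁 ∷ [])
    base zero q rewrite app q | κ-𝐁^ q | κ-𝐁^ (suc q) =
      solve 2 (λ x y → (x :- y) :* 𝟘 :+ x :* (𝟙 :+ y) :* 𝟘 := y :* (𝟙 :+ x) :* 𝟘) refl x y
    base (suc p) q = step (𝐀^ p ++ 𝐁^ q) (base p q)

  κ-rotate-𝐀 : ∀ u → (x - y) * κ (𝐀 ∷ u ++ 𝐀 ∷ []) + x * (1# + y) * κ (u ++ 𝐀 ∷ []) ≈ y * (1# + x) * κ (𝐀 ∷ u)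
  κ-rotate-𝐀 u = begin
    (x - y) * κ (𝐀 ∷ u ++ 𝐀 ∷ []) + x * (1# + y) * κ (u ++ 𝐀 ∷ [])
      ≈⟨ +-cong (*-congˡ (κ-mirror (𝐀 ∷ u ++ 𝐀 ∷ []))) (*-congˡ (κ-mirror (u ++ 𝐀 ∷ []))) ⟨
    (x - y) * κ (mirror (u ++ 𝐀 ∷ []) ++ 𝐁 ∷ []) + x * (1# + y) * κ (mirror (u ++ 𝐀 ∷ []))
      ≡⟨ ≡.cong (λ w → (x - y) * κ (w ++ 𝐁 ∷ []) + x * (1# + y) * κ w) (mirror-++ u (𝐀 ∷ [])) ⟩
    (x - y) * κ (𝐁 ∷ mirror u ++ 𝐁 ∷ []) + x * (1# + y) * κ (𝐁 ∷ mirror u)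
      ≈⟨ κ-rotate-𝐁 (mirror u) ⟩
    y * (1# + x) * κ (mirror u ++ 𝐁 ∷ [])
      ≈⟨ *-congˡ (κ-mirror (𝐀 ∷ u)) ⟩
    y * (1# + x) * κ (𝐀 ∷ u) ∎

  -- Induction on the leading 𝐁s: the 𝐀 is pulled through the nearest of them, and the defect that
  -- appears is the one of `κ-rotate-𝐁` for 𝐁^a `w`.
  κ-first𝐀-last𝐁 : ∀ a w → κ (𝐁^ a ++ 𝐀 ∷ w ++ 𝐁 ∷ []) ≈ x * (κ (𝐁^ a ++ w ++ 𝐁 ∷ []) + κ (𝐁^ a ++ 𝐀 ∷ w) + κ (𝐁^ a ++ w))
  κ-first𝐀-last𝐁 zero    w = κ-outer w
  κ-first𝐀-last𝐁 (suc a) w = modulo 1# (sym (κ-rotate-𝐁 (𝐁^ a ++ w))) (begin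
    κ (𝐁^ suc a ++ 𝐀 ∷ w ++ 𝐁 ∷ [])
      ≈⟨ pullˡ (w ++ 𝐁 ∷ []) ⟩
    y * (κ (𝐁^ suc a ++ w ++ 𝐁 ∷ []) + κ (𝐁^ a ++ 𝐀 ∷ w ++ 𝐁 ∷ []) + κ (𝐁^ a ++ w ++ 𝐁 ∷ []))
      ≈⟨ *-congˡ (+-congʳ (+-congˡ (κ-first𝐀-last𝐁 a w))) ⟩
    _ ≈⟨ solve 7 (λ x y bwB wB aw w bw →
           y :* (bwB :+ x :* (wB :+ aw :+ w) :+ wB)
           := x :* (bwB :+ y :* (bw :+ aw :+ w) :+ bw)
              :+ 𝟙 :* (y :* (𝟙 :+ x) :* wB :- ((x :- y) :* bwB :+ x :* (𝟙 :+ y) :* bw))) refl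
           x y _ _ _ _ _ ⟩
    x * (κ (𝐁^ suc a ++ w ++ 𝐁 ∷ []) + y * (κ (𝐁^ suc a ++ w) + κ (𝐁^ a ++ 𝐀 ∷ w) + κ (𝐁^ a ++ w)) + κ (𝐁^ suc a ++ w))
      + 1# * (y * (1# + x) * κ (𝐁^ a ++ w ++ 𝐁 ∷ []) - ((x - y) * κ (𝐁^ suc a ++ w ++ 𝐁 ∷ []) + x * (1# + y) * κ (𝐁^ suc a ++ w)))
      ≈⟨ +-cong (*-congˡ (+-congʳ (+-congˡ (pullˡ w)))) (reflexive (≡.cong (λ z → 1# * (y * (1# + x) * κ z - ((x - y) * κ (𝐁 ∷ z) + x * (1# + y) * κ (𝐁^ suc a ++ w)))) (Listₚ.++-assoc (𝐁^ a) w _))) ⟨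
    _ ∎)
    where
    pullˡ : ∀ z → κ (𝐁^ suc a ++ 𝐀 ∷ z) ≈ y * (κ (𝐁^ suc a ++ z) + κ (𝐁^ a ++ 𝐀 ∷ z) + κ (𝐁^ a ++ z))
    pullˡ z = ≡.subst₂ (λ s t → κ s ≈ y * (κ t + κ (𝐁^ a ++ 𝐀 ∷ z) + κ (𝐁^ a ++ z)))
      (replicate-shift a 𝐁 _) (replicate-shift a 𝐁 _) (Straight.pull κ-straight (𝐁^ a) z)

  κ-first𝐀-last𝐁′ : ∀ b w → κ (𝐀 ∷ w ++ 𝐁 ∷ 𝐀^ b) ≈ x * (κ (w ++ 𝐁 ∷ 𝐀^ b) + κ (𝐀 ∷ w ++ 𝐀^ b) + κ (w ++ 𝐀^ b))
  κ-first𝐀-last𝐁′ b w = begin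
    κ (𝐀 ∷ w ++ 𝐁 ∷ 𝐀^ b)
      ≈⟨ κ-mirror (𝐀 ∷ w ++ 𝐁 ∷ 𝐀^ b) ⟨
    κ (mirror (w ++ 𝐁 ∷ 𝐀^ b) ++ 𝐁 ∷ [])
      ≡⟨ ≡.cong κ (≡.trans (≡.cong (_++ 𝐁 ∷ []) eq₁) (Listₚ.++-assoc (𝐁^ b) _ _)) ⟩
    κ (𝐁^ b ++ 𝐀 ∷ mirror w ++ 𝐁 ∷ [])
      ≈⟨ κ-first𝐀-last𝐁 b (mirror w) ⟩
    x * (κ (𝐁^ b ++ mirror w ++ 𝐁 ∷ []) + κ (𝐁^ b ++ 𝐀 ∷ mirror w) + κ (𝐁^ b ++ mirror w))
      ≡⟨ ≡.cong₂ (λ s t → x * (s + t)) (≡.cong₂ _+_ (≡.cong κ (≡.trans (≡.sym (Listₚ.++-assoc (𝐁^ b) _ _)) (≡.cong (_++ 𝐁 ∷ []) (≡.sym eq₂)))) (≡.cong κ (≡.sym eq₁))) (≡.cong κ (≡.sym eq₂)) ⟩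
    x * (κ (mirror (𝐀 ∷ w ++ 𝐀^ b)) + κ (mirror (w ++ 𝐁 ∷ 𝐀^ b)) + κ (mirror (w ++ 𝐀^ b)))
      ≈⟨ *-congˡ (+-cong (trans (+-comm _ _) (+-cong (κ-mirror (w ++ 𝐁 ∷ 𝐀^ b)) (κ-mirror (𝐀 ∷ w ++ 𝐀^ b)))) (κ-mirror (w ++ 𝐀^ b))) ⟩
    x * (κ (w ++ 𝐁 ∷ 𝐀^ b) + κ (𝐀 ∷ w ++ 𝐀^ b) + κ (w ++ 𝐀^ b)) ∎
    where
    eq₁ : mirror (w ++ 𝐁 ∷ 𝐀^ b) ≡ 𝐁^ b ++ 𝐀 ∷ mirror w
    eq₁ = ≡.trans (mirror-++ w _) (≡.trans (≡.cong (λ z → (z ++ 𝐀 ∷ []) ++ mirror w) (mirror-𝐀^ b)) (Listₚ.++-assoc (𝐁^ b) _ _))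
    eq₂ : mirror (w ++ 𝐀^ b) ≡ 𝐁^ b ++ mirror w
    eq₂ = ≡.trans (mirror-++ w _) (≡.cong (_++ mirror w) (mirror-𝐀^ b))

-- The identity between `κ` and its value at x = 0.

module CrossingIdentity (K : CommutativeRing 0ℓ 0ℓ) (x y : CommutativeRing.Carrier K) where

  open CommutativeRing K hiding (zero)
  open Relation.Binary.Reasoning.Setoid setoid
  open IntegerSolver K
  open Canonical K x y
  module V = Canonical K 0# y
  open V public using () renaming (κ to κ₀)

  -- `Straight` carries x as a module parameter although its field mentions y alone, so the proof at
  -- x = 0 has to be rewrapped.
  κ₀-straight : Straight κ₀
  κ₀-straight = straight (V.Straight.pull V.κ-straight)

  -- Rewriting happens to the right of a leading 𝐀, so only normal monomials with p > 0 occur, and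
  -- on these `D` vanishes at x = 0.
  κ₀-𝐀∷ : ∀ w → κ₀ (𝐀 ∷ w) ≈ 0#
  κ₀-𝐀∷ = go 0 0
    where
    go : ∀ p q w → V.e (suc p) q w ≈ 0#
    go p zero    []      = refl
    go p (suc q) []      = zeroˡ _
    go p q       (𝐁 ∷ w) = go p (suc q) w
    go p zero    (𝐀 ∷ w) = go (suc p) zero w
    go p (suc q) (𝐀 ∷ w) = trans (*-congˡ (+-cong (+-cong (go p (suc q) w) (go p q (𝐀 ∷ w))) (go p q w)))
      (solve 1 (λ y → y :* (𝟘 :+ 𝟘 :+ 𝟘) := 𝟘) refl y)

  κ₀-∷ʳ𝐁 : ∀ w → κ₀ (w ++ 𝐁 ∷ []) ≈ 0#
  κ₀-∷ʳ𝐁 w = begin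
    κ₀ (w ++ 𝐁 ∷ [])           ≈⟨ V.κ-mirror (w ++ 𝐁 ∷ []) ⟨
    κ₀ (mirror (w ++ 𝐁 ∷ []))  ≡⟨ ≡.cong κ₀ (mirror-++ w (𝐁 ∷ [])) ⟩
    κ₀ (𝐀 ∷ mirror w)          ≈⟨ κ₀-𝐀∷ (mirror w) ⟩
    0#                         ∎

  -- In terms of 𝐁′ = 𝐁 - y and 𝐀′ = 𝐀 - y the relation reads 𝐁′𝐀′ = c with c = y(1+y);
  -- Φ and Ψ combine the values at v, 𝐁′v, v𝐀′, 𝐁′v𝐀′.
  private
    c : Carrier
    c = y * (1# + y)

    Φ Ψ : Carrier → Carrier → Carrier → Carrier → Carrier
    Φ v bv va bva = y * (c * c * v + c * (y - x) * ((bv - y * v) + (va - y * v))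
                         + (y * y - (x + x) * y - x) * (bva - y * va - y * bv + y * y * v))
    Ψ v bv va bva = (y - x) * (c * c * v + c * y * ((bv - y * v) + (va - y * v))
                         + y * y * (bva - y * va - y * bv + y * y * v))

    Φ-cong : ∀ {a a′ b b′ c c′ d d′} → a ≈ a′ → b ≈ b′ → c ≈ c′ → d ≈ d′ → Φ a b c d ≈ Φ a′ b′ c′ d′
    Φ-cong p q r s = *-congˡ (+-cong (+-cong (*-congˡ p) (*-congˡ (+-cong (+-cong q p′) (+-cong r p′))))
      (*-congˡ (+-cong (+-cong (+-cong s (-‿cong (*-congˡ r))) (-‿cong (*-congˡ q))) (*-congˡ p))))
      where p′ = -‿cong (*-congˡ p)

    Ψ-cong : ∀ {a a′ b b′ c c′ d d′} → a ≈ a′ → b ≈ b′ → c ≈ c′ → d ≈ d′ → Ψ a b c d ≈ Ψ a′ b′ c′ d′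
    Ψ-cong p q r s = *-congˡ (+-cong (+-cong (*-congˡ p) (*-congˡ (+-cong (+-cong q p′) (+-cong r p′))))
      (*-congˡ (+-cong (+-cong (+-cong s (-‿cong (*-congˡ r))) (-‿cong (*-congˡ q))) (*-congˡ p))))
      where p′ = -‿cong (*-congˡ p)

    -- In the induction for `κ-crossing`, the instance at (a+1, b+1) is reduced to those at (a,
    -- b+1), (a+1, b) and (a, b). `Φ` is the remainder on the side of `κ` and `Ψ` the one on the
    -- side of `κ₀`; the coefficients come from that reduction.
    Balanced : Word → Set
    Balanced v = Φ (κ v) (κ (𝐁 ∷ v)) (κ (v ++ 𝐀 ∷ [])) (κ (𝐁 ∷ v ++ 𝐀 ∷ []))
               ≈ Ψ (κ₀ v) (κ₀ (𝐁 ∷ v)) (κ₀ (v ++ 𝐀 ∷ [])) (κ₀ (𝐁 ∷ v ++ 𝐀 ∷ []))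

    -- A new 𝐀 in front multiplies `Φ` by y up to the defect of `κ-rotate-𝐀`, which is zero. It
    -- multiplies `Ψ` by y as well, because `κ₀` vanishes on words that begin with 𝐀.
    balanced-𝐀∷ : ∀ u → Balanced u → Balanced (𝐀 ∷ u)
    balanced-𝐀∷ u hyp = begin
      Φ (κ (𝐀 ∷ u)) (κ (𝐁 ∷ 𝐀 ∷ u)) (κ (𝐀 ∷ u ++ 𝐀 ∷ [])) (κ (𝐁 ∷ 𝐀 ∷ u ++ 𝐀 ∷ []))
        ≈⟨ solve 8 (λ x y bu au u aua bua ua →
             let c = y :* (𝟙 :+ y) ; bau = y :* (bu :+ au :+ u) ; baua = y :* (bua :+ aua :+ ua) in
             y :* (c :* c :* au :+ c :* (y :- x) :* ((bau :- y :* au) :+ (aua :- y :* au))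
               :+ (y :* y :- (x :+ x) :* y :- x) :* (baua :- y :* aua :- y :* bau :+ y :* y :* au))
             := y :* (y :* (c :* c :* u :+ c :* (y :- x) :* ((bu :- y :* u) :+ (ua :- y :* u))
               :+ (y :* y :- (x :+ x) :* y :- x) :* (bua :- y :* ua :- y :* bu :+ y :* y :* u)))
               :+ c :* y :* (y :* (𝟙 :+ x) :* au :- ((x :- y) :* aua :+ x :* (𝟙 :+ y) :* ua))) refl
             x y (κ (𝐁 ∷ u)) (κ (𝐀 ∷ u)) (κ u) (κ (𝐀 ∷ u ++ 𝐀 ∷ [])) (κ (𝐁 ∷ u ++ 𝐀 ∷ [])) (κ (u ++ 𝐀 ∷ [])) ⟩
      y * Φ (κ u) (κ (𝐁 ∷ u)) (κ (u ++ 𝐀 ∷ [])) (κ (𝐁 ∷ u ++ 𝐀 ∷ []))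
        + c * y * (y * (1# + x) * κ (𝐀 ∷ u) - ((x - y) * κ (𝐀 ∷ u ++ 𝐀 ∷ []) + x * (1# + y) * κ (u ++ 𝐀 ∷ [])))
        ≈⟨ +-cong (*-congˡ hyp) (trans (*-congˡ (trans (+-congʳ (sym (κ-rotate-𝐀 u))) (-‿inverseʳ _))) (zeroʳ _)) ⟩
      y * Ψ (κ₀ u) (κ₀ (𝐁 ∷ u)) (κ₀ (u ++ 𝐀 ∷ [])) (κ₀ (𝐁 ∷ u ++ 𝐀 ∷ [])) + 0#
        ≈⟨ solve 6 (λ x y bu u bua ua →
             let c = y :* (𝟙 :+ y) ; bau = y :* (bu :+ 𝟘 :+ u) ; baua = y :* (bua :+ 𝟘 :+ ua) in
             y :* ((y :- x) :* (c :* c :* u :+ c :* y :* ((bu :- y :* u) :+ (ua :- y :* u))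
               :+ y :* y :* (bua :- y :* ua :- y :* bu :+ y :* y :* u))) :+ 𝟘
             := (y :- x) :* (c :* c :* 𝟘 :+ c :* y :* ((bau :- y :* 𝟘) :+ (𝟘 :- y :* 𝟘))
               :+ y :* y :* (baua :- y :* 𝟘 :- y :* bau :+ y :* y :* 𝟘))) refl
             x y (κ₀ (𝐁 ∷ u)) (κ₀ u) (κ₀ (𝐁 ∷ u ++ 𝐀 ∷ [])) (κ₀ (u ++ 𝐀 ∷ [])) ⟩
      Ψ 0# (y * (κ₀ (𝐁 ∷ u) + 0# + κ₀ u)) 0# (y * (κ₀ (𝐁 ∷ u ++ 𝐀 ∷ []) + 0# + κ₀ (u ++ 𝐀 ∷ [])))
        ≈⟨ Ψ-cong au (*-congˡ (+-congʳ (+-congˡ au))) aua (*-congˡ (+-congʳ (+-congˡ aua))) ⟨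
      Ψ (κ₀ (𝐀 ∷ u)) (κ₀ (𝐁 ∷ 𝐀 ∷ u)) (κ₀ (𝐀 ∷ u ++ 𝐀 ∷ [])) (κ₀ (𝐁 ∷ 𝐀 ∷ u ++ 𝐀 ∷ [])) ∎
      where
      au = κ₀-𝐀∷ u
      aua = κ₀-𝐀∷ (u ++ 𝐀 ∷ [])

    balanced-mirror : ∀ u → Balanced (mirror u) → Balanced u
    balanced-mirror u hyp = begin
      Φ (κ u) (κ (𝐁 ∷ u)) (κ (u ++ 𝐀 ∷ [])) (κ (𝐁 ∷ u ++ 𝐀 ∷ []))
        ≈⟨ Φ-cong (κ-mirror u) (κ-mirror (𝐁 ∷ u)) (trans (reflexive (≡.cong κ (≡.sym m₁))) (κ-mirror (u ++ 𝐀 ∷ [])))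
                  (trans (reflexive (≡.cong κ (≡.sym m₂))) (κ-mirror (𝐁 ∷ u ++ 𝐀 ∷ []))) ⟨
      Φ (κ (mirror u)) (κ (mirror u ++ 𝐀 ∷ [])) (κ (𝐁 ∷ mirror u)) (κ (𝐁 ∷ mirror u ++ 𝐀 ∷ []))
        ≈⟨ *-congˡ (+-cong (+-congˡ (*-congˡ (+-comm _ _))) (*-congˡ (+-congʳ (exch _ _ _)))) ⟩
      Φ (κ (mirror u)) (κ (𝐁 ∷ mirror u)) (κ (mirror u ++ 𝐀 ∷ [])) (κ (𝐁 ∷ mirror u ++ 𝐀 ∷ []))
        ≈⟨ hyp ⟩
      Ψ (κ₀ (mirror u)) (κ₀ (𝐁 ∷ mirror u)) (κ₀ (mirror u ++ 𝐀 ∷ [])) (κ₀ (𝐁 ∷ mirror u ++ 𝐀 ∷ []))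
        ≈⟨ *-congˡ (+-cong (+-congˡ (*-congˡ (+-comm _ _))) (*-congˡ (+-congʳ (exch _ _ _)))) ⟩
      Ψ (κ₀ (mirror u)) (κ₀ (mirror u ++ 𝐀 ∷ [])) (κ₀ (𝐁 ∷ mirror u)) (κ₀ (𝐁 ∷ mirror u ++ 𝐀 ∷ []))
        ≈⟨ Ψ-cong (V.κ-mirror u) (V.κ-mirror (𝐁 ∷ u)) (trans (reflexive (≡.cong κ₀ (≡.sym m₁))) (V.κ-mirror (u ++ 𝐀 ∷ [])))
                  (trans (reflexive (≡.cong κ₀ (≡.sym m₂))) (V.κ-mirror (𝐁 ∷ u ++ 𝐀 ∷ []))) ⟩
      Ψ (κ₀ u) (κ₀ (𝐁 ∷ u)) (κ₀ (u ++ 𝐀 ∷ [])) (κ₀ (𝐁 ∷ u ++ 𝐀 ∷ [])) ∎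
      where
      exch : ∀ a b c → a - b - c ≈ a - c - b
      exch = solve 3 (λ a b c → a :- b :- c := a :- c :- b) refl
      m₁ : mirror (u ++ 𝐀 ∷ []) ≡ 𝐁 ∷ mirror u
      m₁ = mirror-++ u (𝐀 ∷ [])
      m₂ : mirror (𝐁 ∷ u ++ 𝐀 ∷ []) ≡ 𝐁 ∷ mirror u ++ 𝐀 ∷ []
      m₂ = ≡.cong (_++ 𝐀 ∷ []) m₁

    balanced-[] : Balanced []
    balanced-[] = solve 2 (λ x y →
      let c = y :* (𝟙 :+ y) ; ba = y :* (𝟘 :+ 𝟘 :+ 𝟙) in
      y :* (c :* c :* 𝟙 :+ c :* (y :- x) :* ((𝟘 :- y :* 𝟙) :+ (𝟘 :- y :* 𝟙))
        :+ (y :* y :- (x :+ x) :* y :- x) :* (ba :- y :* 𝟘 :- y :* 𝟘 :+ y :* y :* 𝟙))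
      := (y :- x) :* (c :* c :* 𝟙 :+ c :* y :* ((𝟘 :- y :* 𝟙) :+ (𝟘 :- y :* 𝟙))
        :+ y :* y :* (ba :- y :* 𝟘 :- y :* 𝟘 :+ y :* y :* 𝟙))) refl x y

    straight-Φ : ∀ {F} → Straight F → Straight (λ v → Φ (F v) (F (𝐁 ∷ v)) (F (v ++ 𝐀 ∷ [])) (F (𝐁 ∷ v ++ 𝐀 ∷ [])))
    straight-Φ s = straight-* y (straight-+ (straight-+ (straight-* (c * c) s)
        (straight-* (c * (y - x)) (straight-+ (straight-minus sb (straight-* y s)) (straight-minus sa (straight-* y s)))))
        (straight-* (y * y - (x + x) * y - x) (straight-+ (straight-minus (straight-minus sba (straight-* y sa)) (straight-* y sb)) (straight-* (y * y) s))))
      where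
      sb = straight-ˡ (𝐁 ∷ []) s
      sa = straight-ʳ (𝐀 ∷ []) s
      sba = straight-ˡ (𝐁 ∷ []) (straight-ʳ (𝐀 ∷ []) s)

    straight-Ψ : ∀ {F} → Straight F → Straight (λ v → Ψ (F v) (F (𝐁 ∷ v)) (F (v ++ 𝐀 ∷ [])) (F (𝐁 ∷ v ++ 𝐀 ∷ [])))
    straight-Ψ s = straight-* (y - x) (straight-+ (straight-+ (straight-* (c * c) s)
        (straight-* (c * y) (straight-+ (straight-minus sb (straight-* y s)) (straight-minus sa (straight-* y s)))))
        (straight-* (y * y) (straight-+ (straight-minus (straight-minus sba (straight-* y sa)) (straight-* y sb)) (straight-* (y * y) s))))
      where
      sb = straight-ˡ (𝐁 ∷ []) s
      sa = straight-ʳ (𝐀 ∷ []) s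
      sba = straight-ˡ (𝐁 ∷ []) (straight-ʳ (𝐀 ∷ []) s)

    balanced : ∀ v → Balanced v
    balanced = straight-unique (straight-Φ κ-straight) (straight-Ψ κ₀-straight)
      -- From the empty word one reaches 𝐀^q, by mirroring 𝐁^q, and by prefixing again 𝐀^p 𝐁^q.
      (λ p q → add𝐀 p (𝐁^ q) (balanced-mirror (𝐁^ q) (≡.subst Balanced (≡.trans (Listₚ.++-identityʳ _) (≡.sym (mirror-𝐁^ q))) (add𝐀 q [] balanced-[]))))
      where
      add𝐀 : ∀ p w → Balanced w → Balanced (𝐀^ p ++ w)
      add𝐀 zero    w h = h
      add𝐀 (suc p) w h = balanced-𝐀∷ (𝐀^ p ++ w) (add𝐀 p w h)

    record Corner (F : Word → Carrier) (a b : ℕ) (u : Word) : Set where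
      field
        𝐀u₀ : F (𝐁^ suc a ++ 𝐀 ∷ u ++ 𝐀^ b) ≈ y * (F (𝐁^ suc a ++ u ++ 𝐀^ b) + F (𝐁^ a ++ 𝐀 ∷ u ++ 𝐀^ b) + F (𝐁^ a ++ u ++ 𝐀^ b))
        𝐀u₁ : F (𝐁^ suc a ++ 𝐀 ∷ u ++ 𝐀^ suc b) ≈ y * (F (𝐁^ suc a ++ u ++ 𝐀^ suc b) + F (𝐁^ a ++ 𝐀 ∷ u ++ 𝐀^ suc b) + F (𝐁^ a ++ u ++ 𝐀^ suc b))
        u𝐁₀ : F (𝐁^ a ++ u ++ 𝐁 ∷ 𝐀^ suc b) ≈ y * (F (𝐁^ a ++ u ++ 𝐁 ∷ 𝐀^ b) + F (𝐁^ a ++ u ++ 𝐀^ suc b) + F (𝐁^ a ++ u ++ 𝐀^ b))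
        u𝐁₁ : F (𝐁^ suc a ++ u ++ 𝐁 ∷ 𝐀^ suc b) ≈ y * (F (𝐁^ suc a ++ u ++ 𝐁 ∷ 𝐀^ b) + F (𝐁^ suc a ++ u ++ 𝐀^ suc b) + F (𝐁^ suc a ++ u ++ 𝐀^ b))
        𝐀u𝐁₀ : F (𝐁^ suc a ++ 𝐀 ∷ u ++ 𝐁 ∷ 𝐀^ b) ≈ y * (F (𝐁^ suc a ++ u ++ 𝐁 ∷ 𝐀^ b) + F (𝐁^ a ++ 𝐀 ∷ u ++ 𝐁 ∷ 𝐀^ b) + F (𝐁^ a ++ u ++ 𝐁 ∷ 𝐀^ b))
        𝐀u𝐁₁ : F (𝐁^ suc a ++ 𝐀 ∷ u ++ 𝐁 ∷ 𝐀^ suc b) ≈ y * (F (𝐁^ suc a ++ u ++ 𝐁 ∷ 𝐀^ suc b) + F (𝐁^ a ++ 𝐀 ∷ u ++ 𝐁 ∷ 𝐀^ suc b) + F (𝐁^ a ++ u ++ 𝐁 ∷ 𝐀^ suc b))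
        𝐀u𝐁₂ : F (𝐁^ a ++ 𝐀 ∷ u ++ 𝐁 ∷ 𝐀^ suc b) ≈ y * (F (𝐁^ a ++ 𝐀 ∷ u ++ 𝐁 ∷ 𝐀^ b) + F (𝐁^ a ++ 𝐀 ∷ u ++ 𝐀^ suc b) + F (𝐁^ a ++ 𝐀 ∷ u ++ 𝐀^ b))

    corner : ∀ {F} → Straight F → ∀ a b u → Corner F a b u
    corner {F} s a b u = record
      { 𝐀u₀ = left (u ++ 𝐀^ b) ; 𝐀u₁ = left (u ++ 𝐀^ suc b)
      ; u𝐁₀ = right a u ; u𝐁₁ = right (suc a) u
      ; 𝐀u𝐁₀ = left (u ++ 𝐁 ∷ 𝐀^ b) ; 𝐀u𝐁₁ = left (u ++ 𝐁 ∷ 𝐀^ suc b)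
      ; 𝐀u𝐁₂ = right a (𝐀 ∷ u) }
      where
      left : ∀ z → F (𝐁^ suc a ++ 𝐀 ∷ z) ≈ y * (F (𝐁^ suc a ++ z) + F (𝐁^ a ++ 𝐀 ∷ z) + F (𝐁^ a ++ z))
      left z = ≡.subst₂ (λ s t → F s ≈ y * (F t + F (𝐁^ a ++ 𝐀 ∷ z) + F (𝐁^ a ++ z)))
        (replicate-shift a 𝐁 _) (replicate-shift a 𝐁 _) (Straight.pull s (𝐁^ a) z)
      right : ∀ i z → F (𝐁^ i ++ z ++ 𝐁 ∷ 𝐀^ suc b) ≈ y * (F (𝐁^ i ++ z ++ 𝐁 ∷ 𝐀^ b) + F (𝐁^ i ++ z ++ 𝐀^ suc b) + F (𝐁^ i ++ z ++ 𝐀^ b))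
      right i z = Straight.pull (straight-ˡ (𝐁^ i) s) z (𝐀^ b)

  -- Let T(a,b) be the left-hand side. If a = 0 or b = 0, the forward recursion holds and `κ₀`
  -- vanishes, so both sides are zero. Otherwise pulling at both inner borders gives T(a+1,b+1) = y
  -- T(a,b+1) + y T(a+1,b) - y² T(a,b) + `Φ`. The right-hand side obeys the same recursion with `Ψ`,
  -- and `balanced` equates the remainders.
  κ-crossing : ∀ a b u →
    y * (κ (𝐁^ a ++ 𝐀 ∷ u ++ 𝐁 ∷ 𝐀^ b) - x * (κ (𝐁^ a ++ u ++ 𝐁 ∷ 𝐀^ b) + κ (𝐁^ a ++ 𝐀 ∷ u ++ 𝐀^ b) + κ (𝐁^ a ++ u ++ 𝐀^ b)))
    ≈ (y - x) * κ₀ (𝐁^ a ++ 𝐀 ∷ u ++ 𝐁 ∷ 𝐀^ b)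
  κ-crossing zero b u = begin
    _ ≈⟨ *-congˡ (trans (+-congʳ (κ-first𝐀-last𝐁′ b u)) (-‿inverseʳ _)) ⟩
    y * 0#        ≈⟨ trans (zeroʳ _) (sym (zeroʳ _)) ⟩
    (y - x) * 0#  ≈⟨ *-congˡ (κ₀-𝐀∷ (u ++ 𝐁 ∷ 𝐀^ b)) ⟨
    _ ∎
  κ-crossing (suc a) zero u rewrite Listₚ.++-identityʳ u = begin
    _ ≈⟨ *-congˡ (trans (+-congʳ (κ-first𝐀-last𝐁 (suc a) u)) (-‿inverseʳ _)) ⟩
    y * 0#        ≈⟨ trans (zeroʳ _) (sym (zeroʳ _)) ⟩
    (y - x) * 0#  ≈⟨ *-congˡ (trans (reflexive (≡.cong κ₀ (≡.sym (Listₚ.++-assoc (𝐁^ suc a) (𝐀 ∷ u) _)))) (κ₀-∷ʳ𝐁 (𝐁^ suc a ++ 𝐀 ∷ u))) ⟨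
    _ ∎
  κ-crossing (suc a) (suc b) u = begin
    y * (κ (𝐁^ suc a ++ 𝐀 ∷ u ++ 𝐁 ∷ 𝐀^ suc b) - x * (κ (𝐁^ suc a ++ u ++ 𝐁 ∷ 𝐀^ suc b) + κ (𝐁^ suc a ++ 𝐀 ∷ u ++ 𝐀^ suc b) + U₁₁))
      ≈⟨ *-congˡ (+-cong (trans C.𝐀u𝐁₁ (*-congˡ (+-cong (+-cong C.u𝐁₁ C.𝐀u𝐁₂) C.u𝐁₀)))
           (-‿cong (*-congˡ (+-congʳ (+-cong C.u𝐁₁ C.𝐀u₁))))) ⟩
    _ ≈⟨ solve 11 (λ x y u00 u01 u10 u11 p0 p1 q0 q1 r →
           let c = y :* (𝟙 :+ y) in
           y :* (y :* (y :* (q1 :+ u11 :+ u10) :+ y :* (r :+ p1 :+ p0) :+ y :* (q0 :+ u01 :+ u00))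
                 :- x :* (y :* (q1 :+ u11 :+ u10) :+ y :* (u11 :+ p1 :+ u01) :+ u11))
           := y :* (y :* (y :* (r :+ p1 :+ p0) :- x :* (y :* (q0 :+ u01 :+ u00) :+ p1 :+ u01)))
              :+ y :* (y :* (y :* (q1 :+ r :+ q0) :- x :* (q1 :+ y :* (u10 :+ p0 :+ u00) :+ u10)))
              :- y :* y :* (y :* (r :- x :* (q0 :+ p0 :+ u00)))
              :+ y :* (c :* c :* u00 :+ c :* (y :- x) :* ((u10 :- y :* u00) :+ (u01 :- y :* u00))
               :+ (y :* y :- (x :+ x) :* y :- x) :* (u11 :- y :* u01 :- y :* u10 :+ y :* y :* u00))) refl
           x y U₀₀ U₀₁ U₁₀ U₁₁ P₀ P₁ Q₀ Q₁ R ⟩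
    y * (y * (y * (R + P₁ + P₀) - x * (y * (Q₀ + U₀₁ + U₀₀) + P₁ + U₀₁)))
      + y * (y * (y * (Q₁ + R + Q₀) - x * (Q₁ + y * (U₁₀ + P₀ + U₀₀) + U₁₀)))
      - y * y * (y * (R - x * (Q₀ + P₀ + U₀₀)))
      + Φ U₀₀ U₁₀ U₀₁ U₁₁
      ≈⟨ +-cong (+-cong (+-cong
           (*-congˡ (trans (*-congˡ (+-cong (sym C.𝐀u𝐁₂) (-‿cong (*-congˡ (+-congʳ (+-congʳ (sym C.u𝐁₀))))))) (κ-crossing a (suc b) u)))
           (*-congˡ (trans (*-congˡ (+-cong (sym C.𝐀u𝐁₀) (-‿cong (*-congˡ (+-congʳ (+-congˡ (sym C.𝐀u₀))))))) (κ-crossing (suc a) b u))))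
           (-‿cong (*-congˡ (κ-crossing a b u))))
           (≡.subst₂ (λ s t → Φ U₀₀ U₁₀ s t ≈ Ψ (κ₀ v) (κ₀ (𝐁 ∷ v)) (κ₀ (v ++ 𝐀 ∷ [])) (κ₀ (𝐁 ∷ v ++ 𝐀 ∷ []))) (≡.cong κ w₁) (≡.cong (λ z → κ (𝐁 ∷ z)) w₁) (balanced v)) ⟩
    y * ((y - x) * κ₀ (𝐁^ a ++ 𝐀 ∷ u ++ 𝐁 ∷ 𝐀^ suc b)) + y * ((y - x) * κ₀ (𝐁^ suc a ++ 𝐀 ∷ u ++ 𝐁 ∷ 𝐀^ b)) - y * y * ((y - x) * R′)
      + Ψ (κ₀ v) (κ₀ (𝐁 ∷ v)) (κ₀ (v ++ 𝐀 ∷ [])) (κ₀ (𝐁 ∷ v ++ 𝐀 ∷ []))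
      ≈⟨ +-cong (+-congʳ (+-cong (*-congˡ (*-congˡ C₀.𝐀u𝐁₂)) (*-congˡ (*-congˡ C₀.𝐀u𝐁₀))))
           (reflexive (≡.cong (λ z → Ψ (κ₀ v) (κ₀ (𝐁 ∷ v)) (κ₀ z) (κ₀ (𝐁 ∷ z))) w₁)) ⟩
    _ ≈⟨ solve 11 (λ x y u00 u01 u10 u11 p0 p1 q0 q1 r →
           let c = y :* (𝟙 :+ y) in
           y :* ((y :- x) :* (y :* (r :+ p1 :+ p0))) :+ y :* ((y :- x) :* (y :* (q1 :+ r :+ q0))) :- y :* y :* ((y :- x) :* r)
             :+ (y :- x) :* (c :* c :* u00 :+ c :* y :* ((u10 :- y :* u00) :+ (u01 :- y :* u00))
               :+ y :* y :* (u11 :- y :* u01 :- y :* u10 :+ y :* y :* u00))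
           := (y :- x) :* (y :* (y :* (q1 :+ u11 :+ u10) :+ y :* (r :+ p1 :+ p0) :+ y :* (q0 :+ u01 :+ u00)))) refl
           x y (κ₀ v) (κ₀ (𝐁^ a ++ u ++ 𝐀^ suc b)) (κ₀ (𝐁 ∷ v)) (κ₀ (𝐁^ suc a ++ u ++ 𝐀^ suc b)) (κ₀ (𝐁^ a ++ 𝐀 ∷ u ++ 𝐀^ b)) (κ₀ (𝐁^ a ++ 𝐀 ∷ u ++ 𝐀^ suc b))
               (κ₀ (𝐁^ a ++ u ++ 𝐁 ∷ 𝐀^ b)) (κ₀ (𝐁^ suc a ++ u ++ 𝐁 ∷ 𝐀^ b)) R′ ⟩
    _ ≈⟨ *-congˡ (trans C₀.𝐀u𝐁₁ (*-congˡ (+-cong (+-cong C₀.u𝐁₁ C₀.𝐀u𝐁₂) C₀.u𝐁₀))) ⟨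
    (y - x) * κ₀ (𝐁^ suc a ++ 𝐀 ∷ u ++ 𝐁 ∷ 𝐀^ suc b) ∎
    where
    module C = Corner (corner κ-straight a b u)
    module C₀ = Corner (corner κ₀-straight a b u)
    v = 𝐁^ a ++ u ++ 𝐀^ b
    w₁ : v ++ 𝐀 ∷ [] ≡ 𝐁^ a ++ u ++ 𝐀^ suc b
    w₁ = ≡.trans (Listₚ.++-assoc (𝐁^ a) _ _) (≡.cong (𝐁^ a ++_) (≡.trans (Listₚ.++-assoc u _ _)
      (≡.cong (u ++_) (≡.trans (replicate-shift b 𝐀 []) (≡.cong (𝐀 ∷_) (Listₚ.++-identityʳ _))))))
    U₀₀ = κ v
    U₀₁ = κ (𝐁^ a ++ u ++ 𝐀^ suc b)
    U₁₀ = κ (𝐁 ∷ v)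
    U₁₁ = κ (𝐁^ suc a ++ u ++ 𝐀^ suc b)
    P₀ = κ (𝐁^ a ++ 𝐀 ∷ u ++ 𝐀^ b)
    P₁ = κ (𝐁^ a ++ 𝐀 ∷ u ++ 𝐀^ suc b)
    Q₀ = κ (𝐁^ a ++ u ++ 𝐁 ∷ 𝐀^ b)
    Q₁ = κ (𝐁^ suc a ++ u ++ 𝐁 ∷ 𝐀^ b)
    R = κ (𝐁^ a ++ 𝐀 ∷ u ++ 𝐁 ∷ 𝐀^ b)
    R′ = κ₀ (𝐁^ a ++ 𝐀 ∷ u ++ 𝐁 ∷ 𝐀^ b)

-- The ring of formal power series in x, y, z.

module _ where

  module PowerSeries (K : CommutativeRing 0ℓ 0ℓ) where

    open CommutativeRing K hiding (zero)
    open Relation.Binary.Reasoning.Setoid setoid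
    open Algebra.Properties.CommutativeSemigroup +-commutativeSemigroup using (interchange; x∙yz≈y∙xz)

    PS : Set
    PS = ℕ → Carrier

    infix 4 _≋_
    _≋_ : PS → PS → Set
    f ≋ g = ∀ n → f n ≈ g n

    infixl 6 _⊕_
    infixl 7 _⊛_ _⊙_
    -- The product splits off the constant term of the first factor. This makes the ring laws plain
    -- inductions on the degree; `⊛-Σ≤` recovers the convolution sum.
    _⊕_ _⊛_ : PS → PS → PS
    (f ⊕ g) n = f n + g n
    (f ⊛ g) zero    = f 0 * g 0
    (f ⊛ g) (suc n) = f 0 * g (suc n) + ((λ i → f (suc i)) ⊛ g) n

    _⊙_ : Carrier → PS → PS
    (c ⊙ f) n = c * f n

    ⊖_ : PS → PS
    (⊖ f) n = - f n

    shift : PS → PS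
    shift f n = f (suc n)

    0ₚ 1ₚ : PS
    0ₚ n = 0#
    1ₚ zero    = 1#
    1ₚ (suc n) = 0#

    ⊛-cong : ∀ {f f′ g g′} → f ≋ f′ → g ≋ g′ → f ⊛ g ≋ f′ ⊛ g′
    ⊛-cong p q zero    = *-cong (p 0) (q 0)
    ⊛-cong p q (suc n) = +-cong (*-cong (p 0) (q (suc n))) (⊛-cong (λ i → p (suc i)) q n)

    ⊛-distribʳ : ∀ h f g → (f ⊕ g) ⊛ h ≋ f ⊛ h ⊕ g ⊛ h
    ⊛-distribʳ h f g zero    = distribʳ _ _ _
    ⊛-distribʳ h f g (suc n) = trans (+-cong (distribʳ _ _ _) (⊛-distribʳ h (shift f) (shift g) n)) (interchange _ _ _ _)

    ⊙-⊛ : ∀ c f g → (c ⊙ f) ⊛ g ≋ c ⊙ (f ⊛ g)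
    ⊙-⊛ c f g zero    = *-assoc _ _ _
    ⊙-⊛ c f g (suc n) = trans (+-cong (*-assoc _ _ _) (⊙-⊛ c (shift f) g n)) (sym (distribˡ _ _ _))

    ⊛-assoc : ∀ f g h → (f ⊛ g) ⊛ h ≋ f ⊛ (g ⊛ h)
    ⊛-assoc f g h zero    = *-assoc _ _ _
    ⊛-assoc f g h (suc n) = begin
      f 0 * g 0 * h (suc n) + ((f 0 ⊙ shift g ⊕ shift f ⊛ g) ⊛ h) n
        ≈⟨ +-congˡ (⊛-distribʳ h (f 0 ⊙ shift g) (shift f ⊛ g) n) ⟩
      f 0 * g 0 * h (suc n) + (((f 0 ⊙ shift g) ⊛ h) n + ((shift f ⊛ g) ⊛ h) n)
        ≈⟨ +-cong (*-assoc _ _ _) (+-cong (⊙-⊛ (f 0) (shift g) h n) (⊛-assoc (shift f) g h n)) ⟩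
      f 0 * (g 0 * h (suc n)) + (f 0 * (shift g ⊛ h) n + (shift f ⊛ (g ⊛ h)) n)
        ≈⟨ +-assoc _ _ _ ⟨
      f 0 * (g 0 * h (suc n)) + f 0 * (shift g ⊛ h) n + (shift f ⊛ (g ⊛ h)) n
        ≈⟨ +-congʳ (distribˡ _ _ _) ⟨
      f 0 * (g 0 * h (suc n) + (shift g ⊛ h) n) + (shift f ⊛ (g ⊛ h)) n ∎

    ⊛-sucʳ : ∀ f g n → (f ⊛ g) (suc n) ≈ f (suc n) * g 0 + (f ⊛ shift g) n
    ⊛-sucʳ f g zero    = +-comm _ _
    ⊛-sucʳ f g (suc n) = trans (+-congˡ (⊛-sucʳ (shift f) g n)) (x∙yz≈y∙xz _ _ _)

    ⊛-comm : ∀ f g → f ⊛ g ≋ g ⊛ f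
    ⊛-comm f g zero    = *-comm _ _
    ⊛-comm f g (suc n) = trans (+-cong (*-comm _ _) (⊛-comm (shift f) g n)) (sym (⊛-sucʳ g f n))

    0ₚ-⊛ : ∀ f → 0ₚ ⊛ f ≋ 0ₚ
    0ₚ-⊛ f zero    = zeroˡ _
    0ₚ-⊛ f (suc n) = trans (+-cong (zeroˡ _) (0ₚ-⊛ f n)) (+-identityˡ _)

    1ₚ-⊛ : ∀ f → 1ₚ ⊛ f ≋ f
    1ₚ-⊛ f zero    = *-identityˡ _
    1ₚ-⊛ f (suc n) = trans (+-cong (*-identityˡ _) (0ₚ-⊛ f n)) (+-identityʳ _)

    ring′ : CommutativeRing 0ℓ 0ℓ
    ring′ = record
      { Carrier = PS ; _≈_ = _≋_ ; _+_ = _⊕_ ; _*_ = _⊛_ ; -_ = ⊖_ ; 0# = 0ₚ ; 1# = 1ₚ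
      ; isCommutativeRing = record
        { isRing = record
          { +-isAbelianGroup = record
            { isGroup = record
              { isMonoid = record
                { isSemigroup = record
                  { isMagma = record
                    { isEquivalence = record
                      { refl = λ n → refl ; sym = λ p n → sym (p n) ; trans = λ p q n → trans (p n) (q n) }
                    ; ∙-cong = λ p q n → +-cong (p n) (q n) }
                  ; assoc = λ f g h n → +-assoc _ _ _ }
                ; identity = (λ f n → +-identityˡ _) , (λ f n → +-identityʳ _) }
              ; inverse = (λ f n → -‿inverseˡ _) , (λ f n → -‿inverseʳ _)
              ; ⁻¹-cong = λ p n → -‿cong (p n) }
            ; comm = λ f g n → +-comm _ _ }
          ; *-cong = ⊛-cong
          ; *-assoc = ⊛-assoc
          ; *-identity = 1ₚ-⊛ , (λ f n → trans (⊛-comm f 1ₚ n) (1ₚ-⊛ f n))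
          ; distrib = (λ f g h n → trans (⊛-comm f (g ⊕ h) n) (trans (⊛-distribʳ f g h n) (+-cong (⊛-comm g f n) (⊛-comm h f n))))
                    , ⊛-distribʳ
          }
        ; *-comm = ⊛-comm } }

    Σ≤ : ℕ → (ℕ → Carrier) → Carrier
    Σ≤ zero    f = f 0
    Σ≤ (suc m) f = Σ≤ m f + f (suc m)

    Σ≤-suc : ∀ m f → Σ≤ (suc m) f ≈ f 0 + Σ≤ m (shift f)
    Σ≤-suc zero    f = refl
    Σ≤-suc (suc m) f = trans (+-congʳ (Σ≤-suc m f)) (+-assoc _ _ _)

    ⊛-Σ≤ : ∀ f g n → (f ⊛ g) n ≈ Σ≤ n (λ i → f i * g (n ∸ i))
    ⊛-Σ≤ f g zero    = refl
    ⊛-Σ≤ f g (suc n) = trans (+-congˡ (⊛-Σ≤ (shift f) g n)) (sym (Σ≤-suc n (λ i → f i * g (suc n ∸ i))))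

    const : Carrier → PS
    const c zero    = c
    const c (suc n) = 0#

    var : PS
    var zero    = 0#
    var (suc n) = 1ₚ n

    const-⊛ : ∀ c h → const c ⊛ h ≋ c ⊙ h
    const-⊛ c h zero    = refl
    const-⊛ c h (suc n) = trans (+-congˡ (0ₚ-⊛ h n)) (+-identityʳ _)

    var-⊛-zero : ∀ h → (var ⊛ h) 0 ≈ 0#
    var-⊛-zero h = zeroˡ _

    var-⊛-suc : ∀ h n → (var ⊛ h) (suc n) ≈ h n
    var-⊛-suc h n = trans (+-cong (zeroˡ _) (1ₚ-⊛ h n)) (+-identityˡ _)

  private
    -- Iterating the construction gives ((ℤ[[z]])[[y]])[[x]], with x as the outermost variable in
    -- agreement with the argument order of `Series`.
    module N = PowerSeries ℤₚ.+-*-commutativeRing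
    module B = PowerSeries N.ring′
    module A = PowerSeries B.ring′

  sumTo-cong : ∀ n {f g : ℕ → ℤ} → (∀ i → f i ≡ g i) → sumTo n f ≡ sumTo n g
  sumTo-cong zero    p = p 0
  sumTo-cong (suc n) p = ≡.cong₂ ℤ._+_ (sumTo-cong n p) (p (suc n))

  private
    N-Σ≤ : ∀ n f → N.Σ≤ n f ≡ sumTo n f
    N-Σ≤ zero    f = ≡.refl
    N-Σ≤ (suc n) f = ≡.cong (ℤ._+ f (suc n)) (N-Σ≤ n f)

    B-Σ≤ : ∀ b f n → B.Σ≤ b f n ≡ sumTo b (λ j → f j n)
    B-Σ≤ zero    f n = ≡.refl
    B-Σ≤ (suc b) f n = ≡.cong (ℤ._+ f (suc b) n) (B-Σ≤ b f n)

    A-Σ≤ : ∀ a f b n → A.Σ≤ a f b n ≡ sumTo a (λ i → f i b n)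
    A-Σ≤ zero    f b n = ≡.refl
    A-Σ≤ (suc a) f b n = ≡.cong (ℤ._+ f (suc a) b n) (A-Σ≤ a f b n)

    ⊛≈*S : ∀ f g → (f A.⊛ g) ≈S (f *S g)
    ⊛≈*S f g a b n = ≡.trans (A.⊛-Σ≤ f g a b n) (≡.trans (A-Σ≤ a _ b n) (sumTo-cong a λ i →
      ≡.trans (B.⊛-Σ≤ (f i) (g (a ∸ i)) b n) (≡.trans (B-Σ≤ b _ n) (sumTo-cong b λ j →
        ≡.trans (N.⊛-Σ≤ (f i j) (g (a ∸ i) (b ∸ j)) n) (N-Σ≤ n _)))))

    module A′ = CommutativeRing A.ring′

    1ₚ≈oneS : A.1ₚ ≈S oneS
    1ₚ≈oneS zero zero zero = ≡.refl
    1ₚ≈oneS zero zero (suc n) = ≡.refl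
    1ₚ≈oneS zero (suc b) n = ≡.refl
    1ₚ≈oneS (suc a) b n = ≡.refl

  zeroS : Series
  zeroS _ _ _ = 0ℤ

  -- Addition and negation are literally those of the iterated ring; the product and the unit agree
  -- with it only coefficientwise, so their laws are transported along `⊛≈*S` and `1ₚ≈oneS`.
  seriesRing : CommutativeRing 0ℓ 0ℓ
  seriesRing = record
    { Carrier = Series ; _≈_ = _≈S_ ; _+_ = _+S_ ; _*_ = _*S_ ; -_ = -S_ ; 0# = zeroS ; 1# = oneS
    ; isCommutativeRing = record
      { isRing = record
        { +-isAbelianGroup = A′.+-isAbelianGroup
        ; *-cong = λ {f} {f′} {g} {g′} p q → via f g f′ g′ (A.⊛-cong p q)
        ; *-assoc = λ f g h → tr (⁻ (⊛≈*S (f *S g) h)) (tr (A.⊛-cong (⁻ (⊛≈*S f g)) (λ _ _ _ → ≡.refl))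
            (tr (A.⊛-assoc f g h) (tr (A.⊛-cong {f} {f} (λ _ _ _ → ≡.refl) (⊛≈*S g h)) (⊛≈*S f (g *S h)))))
        ; *-identity = one-*S , (λ f → tr (comm f oneS) (one-*S f))
        ; distrib = (λ f g h → tr (⁻ (⊛≈*S f (g +S h))) (tr (A′.distribˡ f g h) (A′.+-cong (⊛≈*S f g) (⊛≈*S f h))))
                  , (λ f g h → tr (⁻ (⊛≈*S (g +S h) f)) (tr (A′.distribʳ f g h) (A′.+-cong (⊛≈*S g f) (⊛≈*S h f))))
        }
      ; *-comm = comm } }
    where
    tr : ∀ {f g h : Series} → f ≈S g → g ≈S h → f ≈S h
    tr p q a b n = ≡.trans (p a b n) (q a b n)
    ⁻ : ∀ {f g : Series} → f ≈S g → g ≈S f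
    ⁻ p a b n = ≡.sym (p a b n)
    via : ∀ f g f′ g′ → (f A.⊛ g) ≈S (f′ A.⊛ g′) → (f *S g) ≈S (f′ *S g′)
    via f g f′ g′ p = tr (⁻ (⊛≈*S f g)) (tr p (⊛≈*S f′ g′))
    comm : ∀ f g → (f *S g) ≈S (g *S f)
    comm f g = via f g g f (A.⊛-comm f g)
    one-*S : ∀ f → (oneS *S f) ≈S f
    one-*S f = tr (⁻ (⊛≈*S oneS f)) (tr (A.⊛-cong {oneS} {A.1ₚ} {f} {f} (⁻ 1ₚ≈oneS) (λ _ _ _ → ≡.refl)) (A.1ₚ-⊛ f))

  private
    coefficient : ∀ {f f′ : Series} → f ≈S f′ → ∀ h a b n → (f *S h) a b n ≡ (f′ A.⊛ h) a b n
    coefficient {f} {f′} p h a b n = ≡.trans (≡.sym (⊛≈*S f h a b n)) (A.⊛-cong {f} {f′} {h} {h} p (λ _ _ _ → ≡.refl) a b n)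

    Xs-var : Xs ≈S A.var
    Xs-var zero          b       n       = ≡.refl
    Xs-var (suc zero)    zero    zero    = ≡.refl
    Xs-var (suc zero)    zero    (suc n) = ≡.refl
    Xs-var (suc zero)    (suc b) n       = ≡.refl
    Xs-var (suc (suc a)) b       n       = ≡.refl

    Ys-var : Ys ≈S A.const B.var
    Ys-var zero    zero          n       = ≡.refl
    Ys-var zero    (suc zero)    zero    = ≡.refl
    Ys-var zero    (suc zero)    (suc n) = ≡.refl
    Ys-var zero    (suc (suc b)) n       = ≡.refl
    Ys-var (suc a) b             n       = ≡.refl

    Zs-var : Zs ≈S A.const (B.const N.var)
    Zs-var zero    zero    zero          = ≡.refl
    Zs-var zero    zero    (suc zero)    = ≡.refl
    Zs-var zero    zero    (suc (suc n)) = ≡.refl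
    Zs-var zero    (suc b) n             = ≡.refl
    Zs-var (suc a) b       n             = ≡.refl

  Xs-*-zero : ∀ h b n → (Xs *S h) 0 b n ≡ 0ℤ
  Xs-*-zero h b n = ≡.trans (coefficient Xs-var h 0 b n) (A.var-⊛-zero h b n)

  Xs-*-suc : ∀ h a b n → (Xs *S h) (suc a) b n ≡ h a b n
  Xs-*-suc h a b n = ≡.trans (coefficient Xs-var h (suc a) b n) (A.var-⊛-suc h a b n)

  Ys-*-zero : ∀ h a n → (Ys *S h) a 0 n ≡ 0ℤ
  Ys-*-zero h a n = ≡.trans (coefficient Ys-var h a 0 n) (≡.trans (A.const-⊛ B.var h a 0 n) (B.var-⊛-zero (h a) n))

  Ys-*-suc : ∀ h a b n → (Ys *S h) a (suc b) n ≡ h a b n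
  Ys-*-suc h a b n = ≡.trans (coefficient Ys-var h a (suc b) n) (≡.trans (A.const-⊛ B.var h a (suc b) n) (B.var-⊛-suc (h a) b n))

  private
    Zs-*-var : ∀ h a b n → (Zs *S h) a b n ≡ (N.var N.⊛ h a b) n
    Zs-*-var h a b n = ≡.trans (coefficient Zs-var h a b n) (≡.trans (A.const-⊛ (B.const N.var) h a b n) (B.const-⊛ N.var (h a) b n))

  Zs-*-suc : ∀ h a b n → (Zs *S h) a b (suc n) ≡ h a b n
  Zs-*-suc h a b n = ≡.trans (Zs-*-var h a b (suc n)) (N.var-⊛-suc (h a b) n)

-- Filtered rings and infinite sums.

-- `Div N f` stands for divisibility of f by the N-th power of z. The axioms are what is needed to
-- pass from congruences of every order to equations.
record Filtration (K : CommutativeRing 0ℓ 0ℓ) : Set₁ where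
  open CommutativeRing K
  field
    Div       : ℕ → Carrier → Set
    div-resp  : ∀ {N f g} → f ≈ g → Div N f → Div N g
    div-zero  : ∀ {f} → Div 0 f
    div-+     : ∀ {N f g} → Div N f → Div N g → Div N (f + g)
    div-neg   : ∀ {N f} → Div N f → Div N (- f)
    div-*     : ∀ {N f} g → Div N f → Div N (g * f)
    div-suc   : ∀ {N u f} → Div 1 u → Div N f → Div (suc N) (u * f)
    separated : ∀ {f} → (∀ N → Div N f) → f ≈ 0#

module Adic (K : CommutativeRing 0ℓ 0ℓ) (F : Filtration K) where

  open CommutativeRing K hiding (zero)
  open Relation.Binary.Reasoning.Setoid setoid
  open IntegerSolver K
  open Filtration F

  difference⇒≈ : ∀ {f g} → f - g ≈ 0# → f ≈ g
  difference⇒≈ {f} {g} p = begin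
    f           ≈⟨ solve 2 (λ f g → f := (f :- g) :+ g) refl f g ⟩
    (f - g) + g ≈⟨ +-congʳ p ⟩
    0# + g      ≈⟨ +-identityˡ g ⟩
    g           ∎

  agree : ∀ {f g} → (∀ N → Div N (f - g)) → f ≈ g
  agree p = difference⇒≈ (separated p)

  partial : (ℕ → Carrier) → ℕ → Carrier
  partial G zero    = 0#
  partial G (suc N) = partial G N + G N

  -- The rate of convergence is part of the notion: the sum of the first N terms is correct modulo
  -- order N.
  IsSum : Carrier → (ℕ → Carrier) → Set
  IsSum S G = ∀ N → Div N (S - partial G N)

  partial-suc : ∀ G N → partial G (suc N) ≈ G 0 + partial (λ k → G (suc k)) N
  partial-suc G zero    = +-comm _ _
  partial-suc G (suc N) = trans (+-congʳ (partial-suc G N)) (+-assoc _ _ _)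

  partial-* : ∀ c G N → partial (λ k → c * G k) N ≈ c * partial G N
  partial-* c G zero    = sym (zeroʳ c)
  partial-* c G (suc N) = trans (+-congʳ (partial-* c G N)) (sym (distribˡ _ _ _))

  partial-+ : ∀ G H N → partial (λ k → G k + H k) N ≈ partial G N + partial H N
  partial-+ G H zero    = sym (+-identityˡ _)
  partial-+ G H (suc N) = trans (+-congʳ (partial-+ G H N))
    (solve 4 (λ a b c d → (a :+ b) :+ (c :+ d) := (a :+ c) :+ (b :+ d)) refl _ _ _ _)

  partial-cong : ∀ {G H} → (∀ k → G k ≈ H k) → ∀ N → partial G N ≈ partial H N
  partial-cong p zero    = refl
  partial-cong p (suc N) = +-cong (partial-cong p N) (p N)

  -- Iterating the hypothesis gives d k = s^N d (k+N) for every N, so d k is divisible to every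
  -- order.
  iterate-zero : ∀ {s} (d : ℕ → Carrier) → Div 1 s → (∀ k → d k ≈ s * d (suc k)) → ∀ k → d k ≈ 0#
  iterate-zero {s} d s₁ step k = separated (λ N → go N k)
    where
    go : ∀ N k → Div N (d k)
    go zero    k = div-zero
    go (suc N) k = div-resp (sym (step k)) (div-suc s₁ (go N (suc k)))

  -- If all d k have order N, then the order N + 1 spreads from d 0 = 0 upwards, since the term with
  -- u gains one order.
  backward-zero : ∀ {u} (d : ℕ → Carrier) → Div 1 u → d 0 ≈ 0# →
                  (∀ k → d (suc k) ≈ d k + u * d (suc (suc k))) → ∀ k → d k ≈ 0#
  backward-zero {u} d u₁ d₀ step k = separated (λ N → go N k)
    where
    go : ∀ N k → Div N (d k)
    go zero    k       = div-zero
    go (suc N) zero    = div-resp (trans (zeroʳ u) (sym d₀)) (div-suc u₁ (div-resp d₀ (go N 0)))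
    go (suc N) (suc k) = div-resp (sym (step k)) (div-+ (go (suc N) k) (div-suc u₁ (go N (suc (suc k)))))

  power : Carrier → ℕ → Carrier
  power g zero    = 1#
  power g (suc k) = g * power g k

  geometric : ∀ {g S} → IsSum S (power g) → Div 1 g → S ≈ 1# + g * S
  geometric {g} {S} isSum g₁ = agree go
    where
    go : ∀ N → Div N (S - (1# + g * S))
    go zero    = div-zero
    go (suc N) = div-resp (begin
      (S - partial (power g) (suc N)) - g * (S - partial (power g) N)
        ≈⟨ +-congʳ (+-congˡ (-‿cong (trans (partial-suc (power g) N) (+-congˡ (partial-* g (power g) N))))) ⟩
      (S - (1# + g * partial (power g) N)) - g * (S - partial (power g) N)
        ≈⟨ solve 3 (λ S g p → (S :- (𝟙 :+ g :* p)) :- g :* (S :- p) := S :- (𝟙 :+ g :* S)) refl S g (partial (power g) N) ⟩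
      S - (1# + g * S) ∎)
      (div-+ (isSum (suc N)) (div-neg (div-suc g₁ (isSum N))))

  inverse-of-geometric : ∀ {g S} → IsSum S (power g) → Div 1 g → S * (1# - g) ≈ 1#
  inverse-of-geometric {g} {S} isSum g₁ = begin
    S * (1# - g)          ≈⟨ solve 2 (λ S g → S :* (𝟙 :- g) := S :- g :* S) refl S g ⟩
    S - g * S             ≈⟨ +-congʳ (geometric isSum g₁) ⟩
    1# + g * S - g * S    ≈⟨ solve 2 (λ S g → 𝟙 :+ g :* S :- g :* S := 𝟙) refl S g ⟩
    1#                    ∎

-- Ballot numbers and the quadratic equation of the Catalan series.

-- The coefficient of u^n in C(u)^k; the recursion is C^(k+1) = C^k + u C^(k+2), the quadratic
-- equation of C multiplied by C^k.
ballot : ℕ → ℕ → ℕ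
ballot zero    k       = 1
ballot (suc n) zero    = 0
ballot (suc n) (suc k) = ballot (suc n) k ℕ.+ ballot n (suc (suc k))

module CatalanEquation (K : CommutativeRing 0ℓ 0ℓ) (F : Filtration K) where

  open CommutativeRing K hiding (zero)
  open Relation.Binary.Reasoning.Setoid setoid
  open IntegerSolver K
  open Filtration F
  open Adic K F

  -- The k-th ballot series is the k-th power of the Catalan series: both solve
  -- P (k+1) = P k + u P (k+2).
  catalan-equation : (ι : ℕ → Carrier) → ι 0 ≈ 0# → ι 1 ≈ 1# → (∀ m n → ι (m ℕ.+ n) ≈ ι m + ι n) →
    ∀ {u} → Div 1 u → (P : ℕ → Carrier) → (∀ k → IsSum (P k) (λ n → ι (ballot n k) * power u n)) →
    P 1 ≈ 1# + u * (P 1 * P 1)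
  catalan-equation ι ι0 ι1 ι+ {u} u₁ P isSum = begin
    P 1                        ≈⟨ P-suc 0 ⟩
    P 0 + u * P 2              ≈⟨ +-cong P₀ (*-congˡ (difference⇒≈ (backward-zero d u₁ d₀ d-step 1))) ⟩
    1# + u * (P 1 * P 1)       ∎
    where
    G : ℕ → ℕ → Carrier
    G k n = ι (ballot n k) * power u n

    P₀ : P 0 ≈ 1#
    P₀ = agree go
      where
      go : ∀ N → Div N (P 0 - 1#)
      go zero = div-zero
      go (suc N) = div-resp (+-congˡ (-‿cong (trans (partial-suc (G 0) N) (begin
        ι 1 * 1# + partial (λ n → G 0 (suc n)) N
          ≈⟨ +-cong (trans (*-identityʳ _) ι1) (trans (partial-cong (λ n → trans (*-congʳ ι0) (trans (zeroˡ _) (sym (zeroˡ 0#)))) N) (trans (partial-* 0# (λ _ → 0#) N) (zeroˡ _))) ⟩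
        1# + 0# ≈⟨ +-identityʳ _ ⟩
        1# ∎)))) (isSum 0 (suc N))

    P-suc : ∀ k → P (suc k) ≈ P k + u * P (suc (suc k))
    P-suc k = agree go
      where
      Σ₁ = λ N → partial (G k) N
      Σ₂ = λ N → partial (G (suc (suc k))) N
      expand : ∀ N → partial (G (suc k)) (suc N) ≈ Σ₁ (suc N) + u * Σ₂ N
      expand N = begin
        partial (G (suc k)) (suc N)
          ≈⟨ partial-suc (G (suc k)) N ⟩
        ι 1 * 1# + partial (λ n → G (suc k) (suc n)) N
          ≈⟨ +-congˡ (trans (partial-cong (λ n → trans (*-congʳ (ι+ (ballot (suc n) k) (ballot n (suc (suc k)))))
               (solve 4 (λ a b u p → (a :+ b) :* (u :* p) := a :* (u :* p) :+ u :* (b :* p)) refl _ _ u _)) N)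
               (trans (partial-+ _ _ N) (+-congˡ (partial-* u _ N)))) ⟩
        ι 1 * 1# + (partial (λ n → G k (suc n)) N + u * Σ₂ N)
          ≈⟨ +-assoc _ _ _ ⟨
        ι 1 * 1# + partial (λ n → G k (suc n)) N + u * Σ₂ N
          ≈⟨ +-congʳ (partial-suc (G k) N) ⟨
        Σ₁ (suc N) + u * Σ₂ N ∎
      go : ∀ N → Div N (P (suc k) - (P k + u * P (suc (suc k))))
      go zero = div-zero
      go (suc N) = div-resp (begin
        (P (suc k) - partial (G (suc k)) (suc N)) - (P k - Σ₁ (suc N)) - u * (P (suc (suc k)) - Σ₂ N)
          ≈⟨ +-congʳ (+-congʳ (+-congˡ (-‿cong (expand N)))) ⟩
        _ ≈⟨ solve 6 (λ a b c u s t → (a :- (s :+ u :* t)) :- (b :- s) :- u :* (c :- t) := a :- (b :+ u :* c)) refl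
               (P (suc k)) (P k) (P (suc (suc k))) u (Σ₁ (suc N)) (Σ₂ N) ⟩
        _ ∎)
        (div-+ (div-+ (isSum (suc k) (suc N)) (div-neg (isSum k (suc N)))) (div-neg (div-suc u₁ (isSum (suc (suc k)) N))))

    d : ℕ → Carrier
    d k = P (suc k) - P 1 * P k

    d₀ : d 0 ≈ 0#
    d₀ = trans (+-congˡ (-‿cong (trans (*-congˡ P₀) (*-identityʳ _)))) (-‿inverseʳ _)

    d-step : ∀ k → d (suc k) ≈ d k + u * d (suc (suc k))
    d-step k = begin
      P (2 ℕ.+ k) - P 1 * P (1 ℕ.+ k)
        ≈⟨ +-cong (P-suc (suc k)) (-‿cong (*-congˡ (P-suc k))) ⟩
      _ ≈⟨ solve 6 (λ p1 p a b c u → (a :+ u :* c) :- p1 :* (p :+ u :* b) := (a :- p1 :* p) :+ u :* (c :- p1 :* b)) refl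
             (P 1) (P k) (P (suc k)) (P (suc (suc k))) (P (3 ℕ.+ k)) u ⟩
      _ ∎

-- The generating function of `κ` over all words.

module WordSums (K : CommutativeRing 0ℓ 0ℓ) where

  open CommutativeRing K hiding (zero)
  open IntegerSolver K

  Σwords : ℕ → (Word → Carrier) → Carrier
  Σwords zero    f = f []
  Σwords (suc n) f = Σwords n (λ w → f (𝐀 ∷ w)) + Σwords n (λ w → f (𝐁 ∷ w))

  Σwords-cong : ∀ n {f g} → (∀ w → f w ≈ g w) → Σwords n f ≈ Σwords n g
  Σwords-cong zero    p = p []
  Σwords-cong (suc n) p = +-cong (Σwords-cong n (λ w → p (𝐀 ∷ w))) (Σwords-cong n (λ w → p (𝐁 ∷ w)))

  Σwords-+ : ∀ n f g → Σwords n (λ w → f w + g w) ≈ Σwords n f + Σwords n g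
  Σwords-+ zero    f g = refl
  Σwords-+ (suc n) f g = trans (+-cong (Σwords-+ n _ _) (Σwords-+ n _ _))
    (solve 4 (λ a b c d → (a :+ b) :+ (c :+ d) := (a :+ c) :+ (b :+ d)) refl _ _ _ _)

  Σwords-* : ∀ n c f → Σwords n (λ w → c * f w) ≈ c * Σwords n f
  Σwords-* zero    c f = refl
  Σwords-* (suc n) c f = trans (+-cong (Σwords-* n c _) (Σwords-* n c _)) (sym (distribˡ _ _ _))

-- Writing M = Σ zⁿ(𝐀+𝐁)ⁿ, the relation gives (1 - s𝐁)(1 - s𝐀) = c (1 - z(𝐀+𝐁)) with
-- c = 1 + s²y as soon as s = z + y(z+1)s², so M(1 - s𝐁)(1 - s𝐀) = c.
module WordSeries (K : CommutativeRing 0ℓ 0ℓ) (F : Filtration K)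
                  (x y z s : CommutativeRing.Carrier K) where

  open CommutativeRing K hiding (zero)
  open Relation.Binary.Reasoning.Setoid setoid
  open IntegerSolver K
  open Filtration F
  open Adic K F
  open Canonical K x y
  open WordSums K

  total : ℕ → Word → Carrier
  total n u = Σwords n (λ w → κ (u ++ w))

  module _ (f : Word → Carrier) (isSum : ∀ u → IsSum (f u) (λ n → power z n * total n u))
           (z₁ : Div 1 z) (s₁ : Div 1 s) (s-equation : s ≈ z + y * (z + 1#) * (s * s)) where

    private
      snoc : ∀ (u : Word) l w → u ++ l ∷ w ≡ (u ++ l ∷ []) ++ w
      snoc u l w = ≡.sym (Listₚ.++-assoc u (l ∷ []) w)

      total-suc : ∀ n u → total (suc n) u ≈ total n (u ++ 𝐀 ∷ []) + total n (u ++ 𝐁 ∷ [])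
      total-suc n u = +-cong (Σwords-cong n (λ w → reflexive (≡.cong κ (snoc u 𝐀 w))))
                             (Σwords-cong n (λ w → reflexive (≡.cong κ (snoc u 𝐁 w))))

      total-pull : ∀ n u → total n (u ++ 𝐁 ∷ 𝐀 ∷ []) ≈ y * (total n (u ++ 𝐁 ∷ []) + total n (u ++ 𝐀 ∷ []) + total n u)
      total-pull n u = begin
        total n (u ++ 𝐁 ∷ 𝐀 ∷ [])
          ≈⟨ Σwords-cong n (λ w → trans (reflexive (≡.cong κ (Listₚ.++-assoc u (𝐁 ∷ 𝐀 ∷ []) w)))
               (trans (Straight.pull κ-straight u w)
                 (reflexive (≡.cong₂ (λ a b → y * (κ a + κ b + κ (u ++ w))) (snoc u 𝐁 w) (snoc u 𝐀 w))))) ⟩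
        Σwords n (λ w → y * (κ ((u ++ 𝐁 ∷ []) ++ w) + κ ((u ++ 𝐀 ∷ []) ++ w) + κ (u ++ w)))
          ≈⟨ trans (Σwords-* n y _) (*-congˡ (trans (Σwords-+ n _ _) (+-congʳ (Σwords-+ n _ _)))) ⟩
        _ ∎

      f-step : ∀ u → f u ≈ κ u + z * (f (u ++ 𝐀 ∷ []) + f (u ++ 𝐁 ∷ []))
      f-step u = agree go
        where
        uA = u ++ 𝐀 ∷ []
        uB = u ++ 𝐁 ∷ []
        G : Word → ℕ → Carrier
        G v n = power z n * total n v
        expand : ∀ N → partial (G u) (suc N) ≈ κ u + z * (partial (G uA) N + partial (G uB) N)
        expand N = begin
          partial (G u) (suc N)
            ≈⟨ partial-suc (G u) N ⟩
          1# * κ (u ++ []) + partial (λ n → G u (suc n)) N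
            ≈⟨ +-cong (trans (*-identityˡ _) (reflexive (≡.cong κ (Listₚ.++-identityʳ u))))
                 (trans (partial-cong (λ n → trans (*-congˡ (total-suc n u))
                     (solve 4 (λ z p a b → z :* p :* (a :+ b) := z :* (p :* a :+ p :* b)) refl z _ _ _)) N)
                   (trans (partial-* z _ N) (*-congˡ (partial-+ _ _ N)))) ⟩
          κ u + z * (partial (G uA) N + partial (G uB) N) ∎
        go : ∀ N → Div N (f u - (κ u + z * (f uA + f uB)))
        go zero    = div-zero
        go (suc N) = div-resp (begin
          (f u - partial (G u) (suc N)) - z * ((f uA - partial (G uA) N) + (f uB - partial (G uB) N))
            ≈⟨ +-congʳ (+-congˡ (-‿cong (expand N))) ⟩
          _ ≈⟨ solve 7 (λ f k z a b p q → (f :- (k :+ z :* (p :+ q))) :- z :* ((a :- p) :+ (b :- q)) := f :- (k :+ z :* (a :+ b))) refl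
                 (f u) (κ u) z (f uA) (f uB) (partial (G uA) N) (partial (G uB) N) ⟩
          _ ∎)
          (div-+ (isSum u (suc N)) (div-neg (div-suc z₁ (div-+ (isSum uA N) (isSum uB N)))))

      f-pull : ∀ u → f (u ++ 𝐁 ∷ 𝐀 ∷ []) ≈ y * (f (u ++ 𝐁 ∷ []) + f (u ++ 𝐀 ∷ []) + f u)
      f-pull u = agree λ N → div-resp (begin
          (f uBA - partial (G uBA) N) - y * ((f uB - partial (G uB) N) + (f uA - partial (G uA) N) + (f u - partial (G u) N))
            ≈⟨ +-congʳ (+-congˡ (-‿cong (expand N))) ⟩
          _ ≈⟨ solve 8 (λ e y b a k p q r → (e :- y :* (p :+ q :+ r)) :- y :* ((b :- p) :+ (a :- q) :+ (k :- r)) := e :- y :* (b :+ a :+ k)) refl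
                 (f uBA) y (f uB) (f uA) (f u) (partial (G uB) N) (partial (G uA) N) (partial (G u) N) ⟩
          _ ∎)
          (div-+ (isSum uBA N) (div-neg (div-* y (div-+ (div-+ (isSum uB N) (isSum uA N)) (isSum u N)))))
        where
        uA = u ++ 𝐀 ∷ []
        uB = u ++ 𝐁 ∷ []
        uBA = u ++ 𝐁 ∷ 𝐀 ∷ []
        G : Word → ℕ → Carrier
        G v n = power z n * total n v
        expand : ∀ N → partial (G uBA) N ≈ y * (partial (G uB) N + partial (G uA) N + partial (G u) N)
        expand N = trans (partial-cong (λ n → trans (*-congˡ (total-pull n u))
            (solve 5 (λ p y a b c → p :* (y :* (a :+ b :+ c)) := y :* (p :* a :+ p :* b :+ p :* c)) refl _ y _ _ _)) N)
          (trans (partial-* y _ N) (*-congˡ (trans (partial-+ _ _ N) (+-congʳ (partial-+ _ _ N)))))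

      c : Carrier
      c = 1# + s * s * y

      normal : ℕ → ℕ → Word
      normal p q = 𝐀^ p ++ 𝐁^ q

      -- The value of `κ` at 𝐀^p 𝐁^q (1 - s𝐀) M.
      φ : ℕ → ℕ → Carrier
      φ p q = f (normal p q) - s * f (normal p q ++ 𝐀 ∷ [])

      normal-𝐁 : ∀ p q → normal p q ++ 𝐁 ∷ [] ≡ normal p (suc q)
      normal-𝐁 p q = ≡.trans (Listₚ.++-assoc (𝐀^ p) (𝐁^ q) _)
        (≡.cong (𝐀^ p ++_) (≡.trans (replicate-shift q 𝐁 []) (≡.cong (𝐁 ∷_) (Listₚ.++-identityʳ _))))

      normal-𝐀 : ∀ p → normal p 0 ++ 𝐀 ∷ [] ≡ normal (suc p) 0
      normal-𝐀 p = ≡.trans (Listₚ.++-assoc (𝐀^ p) [] _) (replicate-shift p 𝐀 [])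

      -- This is X (1 - s𝐁)(1 - s𝐀) M = c X for X = 𝐀^p 𝐁^q. Iterated, it says that φ p q is c times
      -- the sum of s^j D p (q+j) over j.
      φ-step : ∀ p q → φ p q ≈ c * D p q + s * φ p (suc q)
      φ-step p q = modulo (- (fA + fB)) s-equation (begin
        f X - s * fA
          ≈⟨ +-congʳ (f-step X) ⟩
        (κ X + z * (fA + fB)) - s * fA
          ≈⟨ solve 7 (λ k z a b s y x →
               (k :+ z :* (a :+ b)) :- s :* a
               := (𝟙 :+ s :* s :* y) :* k :+ s :* (b :- s :* (y :* (b :+ a :+ (k :+ z :* (a :+ b)))))
                  :+ (:- (a :+ b)) :* (s :- (z :+ y :* (z :+ 𝟙) :* (s :* s)))) refl
               (κ X) z fA fB s y x ⟩
        c * κ X + s * (fB - s * (y * (fB + fA + (κ X + z * (fA + fB))))) + (- (fA + fB)) * (s - (z + y * (z + 1#) * (s * s)))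
          ≈⟨ +-congʳ (+-cong (*-congˡ (reflexive (κ-𝐀^𝐁^ p q))) (*-congˡ (+-cong (reflexive (≡.cong f (normal-𝐁 p q)))
               (-‿cong (*-congˡ (trans (*-congˡ (+-congˡ (sym (f-step X)))) (trans (sym (f-pull X)) (reflexive (≡.cong f eq)))))))) ) ⟩
        _ ∎)
        where
        X = normal p q
        fA = f (X ++ 𝐀 ∷ [])
        fB = f (X ++ 𝐁 ∷ [])
        eq : X ++ 𝐁 ∷ 𝐀 ∷ [] ≡ normal p (suc q) ++ 𝐀 ∷ []
        eq = ≡.trans (snoc X 𝐁 _) (≡.cong (_++ 𝐀 ∷ []) (normal-𝐁 p q))

      -- The recursion of `D` passes to these sums: by `φ-step` the defect at q is s times the
      -- defect at q + 1.
      φ-outer : ∀ p → φ (suc p) 1 ≈ x * (φ p 1 + φ (suc p) 0 + φ p 0)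
      φ-outer p = difference⇒≈ (iterate-zero d s₁ step 0)
        where
        d : ℕ → Carrier
        d q = φ (suc p) (suc q) - x * (φ p (suc q) + φ (suc p) q + φ p q)
        step : ∀ q → d q ≈ s * d (suc q)
        step q = begin
          d q ≈⟨ +-cong (φ-step (suc p) (suc q)) (-‿cong (*-congˡ (+-cong (+-cong (φ-step p (suc q)) (φ-step (suc p) q)) (φ-step p q)))) ⟩
          _ ≈⟨ solve 10 (λ c d1 d2 d3 s x a1 a2 a3 a4 →
                 (c :* (x :* (d1 :+ d2 :+ d3)) :+ s :* a1) :- x :* ((c :* d1 :+ s :* a2) :+ (c :* d2 :+ s :* a3) :+ (c :* d3 :+ s :* a4))
                 := s :* (a1 :- x :* (a2 :+ a3 :+ a4))) refl
                 c (D p (suc q)) (D (suc p) q) (D p q) s x (φ (suc p) (2 ℕ.+ q)) (φ p (2 ℕ.+ q)) (φ (suc p) (suc q)) (φ p (suc q)) ⟩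
          _ ∎

      φ-0-suc : ∀ q → φ 0 (suc q) ≈ 0#
      φ-0-suc = iterate-zero (λ q → φ 0 (suc q)) s₁ (λ q → trans (φ-step 0 (suc q)) (trans (+-congʳ (zeroʳ c)) (+-identityˡ _)))

      φ-00 : φ 0 0 ≈ c
      φ-00 = begin
        φ 0 0                ≈⟨ φ-step 0 0 ⟩
        c * 1# + s * φ 0 1   ≈⟨ +-cong (*-identityʳ c) (trans (*-congˡ (φ-0-suc 0)) (zeroʳ s)) ⟩
        c + 0#               ≈⟨ +-identityʳ c ⟩
        c                    ∎

      φ-suc : ∀ p → φ (suc p) 0 ≈ x * ((φ p 0 - c * D p 0) + s * φ (suc p) 0 + s * φ p 0)
      φ-suc p = begin
        φ (suc p) 0
          ≈⟨ trans (φ-step (suc p) 0) (trans (+-congʳ (zeroʳ c)) (+-identityˡ _)) ⟩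
        s * φ (suc p) 1
          ≈⟨ *-congˡ (φ-outer p) ⟩
        s * (x * (φ p 1 + φ (suc p) 0 + φ p 0))
          ≈⟨ solve 6 (λ s x a b e k → s :* (x :* (a :+ b :+ e)) := x :* (((k :+ s :* a) :- k) :+ s :* b :+ s :* e)) refl
               s x (φ p 1) (φ (suc p) 0) (φ p 0) (c * D p 0) ⟩
        x * (((c * D p 0 + s * φ p 1) - c * D p 0) + s * φ (suc p) 0 + s * φ p 0)
          ≈⟨ *-congˡ (+-congʳ (+-congʳ (+-congʳ (φ-step p 0)))) ⟨
        _ ∎

      f-φ : ∀ p → f (𝐀^ p) ≈ φ p 0 + s * f (𝐀^ suc p)
      f-φ p = ≡.subst₂ (λ u v → f u ≈ φ p 0 + s * f v) (Listₚ.++-identityʳ _)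
        (≡.trans (normal-𝐀 p) (Listₚ.++-identityʳ _))
        (solve 3 (λ a b s → a := (a :- s :* b) :+ s :* b) refl (f (normal p 0)) (f (normal p 0 ++ 𝐀 ∷ [])) s)

      -- By `f-φ`, f(𝐀^p) is c times the sum of s^(i+j) D (p+i) j over i and j. Summing the
      -- recursion of `D` in the same way leaves as defect `h p` only the terms D (p+i) 0, and these
      -- vanish except for p = i = 0.
      h : ℕ → Carrier
      h p = f (𝐀^ suc p) - x * (s * f (𝐀^ suc p) + f (𝐀^ p) + s * f (𝐀^ p))

      h-step : ∀ p → h p ≈ s * h (suc p) - x * c * D p 0
      h-step p = begin
        h p
          ≈⟨ +-cong (f-φ (suc p)) (-‿cong (*-congˡ (+-cong (+-cong (*-congˡ (f-φ (suc p))) (f-φ p)) (*-congˡ (f-φ p))))) ⟩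
        _ ≈⟨ +-congʳ (+-congʳ (φ-suc p)) ⟩
        _ ≈⟨ solve 7 (λ x s a b k f1 f2 →
               (x :* ((a :- k) :+ s :* b :+ s :* a) :+ s :* f2) :- x :* (s :* (b :+ s :* f2) :+ (a :+ s :* f1) :+ s :* (a :+ s :* f1))
               := s :* (f2 :- x :* (s :* f2 :+ f1 :+ s :* f1)) :- x :* k) refl
               x s (φ p 0) (φ (suc p) 0) (c * D p 0) (f (𝐀^ suc p)) (f (𝐀^ suc (suc p))) ⟩
        s * h (suc p) - x * (c * D p 0)
          ≈⟨ +-congˡ (-‿cong (*-assoc _ _ _)) ⟨
        _ ∎

      h-suc : ∀ p → h (suc p) ≈ 0#
      h-suc = iterate-zero (λ p → h (suc p)) s₁ (λ p → trans (h-step (suc p))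
        (solve 2 (λ a k → a :- k :* 𝟘 := a) refl _ (x * c)))

      h-zero : h 0 ≈ - (x * c)
      h-zero = begin
        h 0                          ≈⟨ h-step 0 ⟩
        s * h 1 - x * c * 1#         ≈⟨ +-congʳ (*-congˡ (h-suc 0)) ⟩
        s * 0# - x * c * 1#          ≈⟨ solve 2 (λ s k → s :* 𝟘 :- k :* 𝟙 := :- k) refl s (x * c) ⟩
        - (x * c)                    ∎

    -- Eliminate f(𝐀) from f [] = c + s f(𝐀) and h 0 = -xc. In other words f [] is c times the
    -- generating function of `D` at a = b = s.
    word-series : f [] * (1# - ((1# + 1#) * x * s + x * (s * s))) ≈ (1# + s * s * y) * (1# - (1# + 1#) * x * s)
    word-series = modulo s h-zero (modulo (1# - x * s) (trans (f-φ 0) (+-congʳ φ-00))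
      (solve 5 (λ f0 f1 x s c →
        f0 :* (𝟙 :- ((𝟙 :+ 𝟙) :* x :* s :+ x :* (s :* s)))
        := c :* (𝟙 :- (𝟙 :+ 𝟙) :* x :* s) :+ s :* ((f1 :- x :* (s :* f1 :+ f0 :+ s :* f0)) :- (:- (x :* c)))
           :+ (𝟙 :- x :* s) :* (f0 :- (c :+ s :* f1))) refl
        (f []) (f (𝐀 ∷ [])) x s c))

-- Ballot numbers, binomial coefficients and Catalan numbers.

module _ where

  open import Data.Nat.Combinatorics using (_C_; nCk+nC[k+1]≡[n+1]C[k+1]; k>n⇒nCk≡0; nCk≡nC[n∸k])
  open import Data.Nat.Base using (_+_; _*_)
  open ≡ using (module ≡-Reasoning)

  private
    pascal : ∀ n k → suc n C suc k ≡ n C k + n C suc k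
    pascal n k = ≡.sym (nCk+nC[k+1]≡[n+1]C[k+1] n k)

  -- A form without subtraction of (k+1) C(n,k+1) = (n-k) C(n,k).
  absorption : ∀ n k → suc k * (n C suc k) + k * (n C k) ≡ n * (n C k)
  absorption zero    zero    = ≡.refl
  absorption zero    (suc k) rewrite k>n⇒nCk≡0 {0} {suc (suc k)} (s≤s z≤n) | k>n⇒nCk≡0 {0} {suc k} (s≤s z≤n)
    | ℕₚ.*-zeroʳ k = ≡.refl
  absorption (suc n) zero    = begin
    1 * (suc n C 1) + 0        ≡⟨ ≡.cong (λ t → 1 * t + 0) (pascal n 0) ⟩
    1 * (1 + (n C 1)) + 0      ≡⟨ lemma (n C 1) ⟩
    1 + (1 * (n C 1) + 0)      ≡⟨ ≡.cong suc (absorption n 0) ⟩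
    suc n * 1                  ∎
    where
    open ≡-Reasoning
    lemma : ∀ t → 1 * (1 + t) + 0 ≡ 1 + (1 * t + 0)
    lemma = solve-∀
  absorption (suc n) (suc k) = begin
    suc (suc k) * (suc n C suc (suc k)) + suc k * (suc n C suc k)
      ≡⟨ ≡.cong₂ (λ s t → suc (suc k) * s + suc k * t) (pascal n (suc k)) (pascal n k) ⟩
    suc (suc k) * (b + c) + suc k * (a + b)
      ≡⟨ lemma₁ k a b c ⟩
    (suc (suc k) * c + suc k * b) + (suc k * b + k * a) + (a + b)
      ≡⟨ ≡.cong₂ (λ s t → s + t + (a + b)) (absorption n (suc k)) (absorption n k) ⟩
    n * b + n * a + (a + b)
      ≡⟨ lemma₂ n a b ⟩
    suc n * (a + b)
      ≡⟨ ≡.cong (suc n *_) (pascal n k) ⟨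
    suc n * (suc n C suc k) ∎
    where
    open ≡-Reasoning
    a = n C k
    b = n C suc k
    c = n C suc (suc k)
    lemma₁ : ∀ k a b c → suc (suc k) * (b + c) + suc k * (a + b) ≡ (suc (suc k) * c + suc k * b) + (suc k * b + k * a) + (a + b)
    lemma₁ = solve-∀
    lemma₂ : ∀ n a b → n * b + n * a + (a + b) ≡ suc n * (a + b)
    lemma₂ = solve-∀

  private
    -- The number 2m + j, written so that Pascal's rule can be applied after each step of the ballot
    -- recursion.
    twice : ℕ → ℕ → ℕ
    twice zero    j = j
    twice (suc m) j = suc (suc (twice m j))

    twice-suc : ∀ m j → twice m (suc j) ≡ suc (twice m j)
    twice-suc zero    j = ≡.refl
    twice-suc (suc m) j = ≡.cong (λ k → suc (suc k)) (twice-suc m j)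

    twice-zero : ∀ m → twice m 0 ≡ m + m
    twice-zero zero    = ≡.refl
    twice-zero (suc m) = ≡.cong suc (≡.trans (≡.cong suc (twice-zero m)) (≡.sym (ℕₚ.+-suc m m)))

    central : ∀ m → suc (m + m) C suc m ≡ suc (m + m) C m
    central m = ≡.trans (nCk≡nC[n∸k] (s≤s (ℕₚ.m≤m+n m m))) (≡.cong (suc (m + m) C_) (ℕₚ.m+n∸m≡n m m))

    -- The reflection principle: a ballot number is a difference of two neighbouring
    -- binomial coefficients in row 2m + 2 + j.
    ballot-closed : ∀ m j → ballot (suc m) (suc j) + (twice (suc m) j C m) ≡ twice (suc m) j C suc m
    ballot-closed zero    zero    = ≡.refl
    ballot-closed zero    (suc j) = begin
      (ballot 1 (suc j) + 1) + 1   ≡⟨ ≡.cong (_+ 1) (ballot-closed 0 j) ⟩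
      (twice 1 j C 1) + 1          ≡⟨ ℕₚ.+-comm _ 1 ⟩
      1 + (twice 1 j C 1)          ≡⟨ pascal (twice 1 j) 0 ⟨
      suc (twice 1 j) C 1          ∎
      where open ≡-Reasoning
    ballot-closed (suc m) zero    = begin
      b + (suc (suc (twice (suc m) 0)) C suc m)    ≡⟨ ≡.cong (λ k → b + k) (pascal M m) ⟩
      b + ((M C m) + (M C suc m))                  ≡⟨ ℕₚ.+-assoc b _ _ ⟨
      b + (M C m) + (M C suc m)                    ≡⟨ ≡.cong (_+ (M C suc m)) (≡.subst (λ k → b + (k C m) ≡ k C suc m) (twice-suc (suc m) 0) (ballot-closed m 1)) ⟩
      (M C suc m) + (M C suc m)                    ≡⟨ ≡.cong (λ k → (M C suc m) + k) (≡.sym (≡.subst (λ k → suc k C suc (suc m) ≡ suc k C suc m) (≡.sym (twice-zero (suc m))) (central (suc m)))) ⟩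
      (M C suc m) + (M C suc (suc m))              ≡⟨ pascal M (suc m) ⟨
      suc M C suc (suc m)                          ∎
      where
      open ≡-Reasoning
      b = ballot (suc m) 2
      M = suc (twice (suc m) 0)
    ballot-closed (suc m) (suc j) = begin
      b₁ + b₂ + (twice (suc (suc m)) (suc j) C suc m)   ≡⟨ ≡.cong (λ k → b₁ + b₂ + (k C suc m)) (twice-suc (suc (suc m)) j) ⟩
      b₁ + b₂ + (suc M C suc m)                         ≡⟨ ≡.cong (λ k → b₁ + b₂ + k) (pascal M m) ⟩
      b₁ + b₂ + ((M C m) + (M C suc m))                 ≡⟨ rearrange b₁ b₂ (M C m) (M C suc m) ⟩
      (b₂ + (M C m)) + (b₁ + (M C suc m))               ≡⟨ ≡.cong₂ _+_ (≡.subst (λ k → b₂ + (k C m) ≡ k C suc m)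
                                                             (≡.trans (twice-suc (suc m) (suc j)) (≡.cong suc (twice-suc (suc m) j))) (ballot-closed m (suc (suc j))))
                                                             (ballot-closed (suc m) j) ⟩
      (M C suc m) + (M C suc (suc m))                   ≡⟨ pascal M (suc m) ⟨
      suc M C suc (suc m)                               ≡⟨ ≡.cong (_C suc (suc m)) (twice-suc (suc (suc m)) j) ⟨
      twice (suc (suc m)) (suc j) C suc (suc m)         ∎
      where
      open ≡-Reasoning
      b₁ = ballot (suc (suc m)) (suc j)
      b₂ = ballot (suc m) (suc (suc (suc j)))
      M = twice (suc (suc m)) j
      rearrange : ∀ a b c d → a + b + (c + d) ≡ (b + c) + (a + d)
      rearrange = solve-∀

  -- For N = 2m + 2 the ballot number is C(N,m+1) - C(N,m). Multiplied by m + 2 it becomes C(N,m+1)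
  -- by absorption, so the division in `catalan` is exact.
  ballot-catalan : ∀ n → ballot n 1 ≡ catalan n
  ballot-catalan zero    = ≡.refl
  ballot-catalan (suc m) = begin
    ballot (suc m) 1                                ≡⟨ m*n/n≡m (ballot (suc m) 1) (suc (suc m)) ⟨
    (ballot (suc m) 1 * suc (suc m)) / suc (suc m)  ≡⟨ ≡.cong (_/ suc (suc m)) (ℕₚ.+-cancelʳ-≡ (suc (suc m) * (N C m)) (ballot (suc m) 1 * suc (suc m)) (N C suc m) scaled) ⟩
    (N C suc m) / suc (suc m)                       ≡⟨ ≡.cong (λ k → (k C suc m) / suc (suc m)) N≡ ⟩
    catalan (suc m)                                 ∎
    where
    open ≡-Reasoning
    N = twice (suc m) 0
    N≡ : N ≡ 2 * suc m
    N≡ = ≡.trans (twice-zero (suc m)) (≡.cong (λ k → suc m + k) (≡.sym (ℕₚ.+-identityʳ (suc m))))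
    factor : ∀ b m c → b * suc (suc m) + suc (suc m) * c ≡ (b + c) * suc (suc m)
    factor = solve-∀
    split : ∀ m c → c * suc (suc m) ≡ c + suc m * c
    split = solve-∀
    double : ∀ m t → 2 * suc m * t ≡ suc (suc m) * t + m * t
    double = solve-∀
    absorbed : suc m * (N C suc m) ≡ suc (suc m) * (N C m)
    absorbed = ℕₚ.+-cancelʳ-≡ (m * (N C m)) _ _ (≡.trans (absorption N m)
      (≡.trans (≡.cong (_* (N C m)) N≡) (double m (N C m))))
    scaled : ballot (suc m) 1 * suc (suc m) + suc (suc m) * (N C m) ≡ (N C suc m) + suc (suc m) * (N C m)
    scaled = begin
      ballot (suc m) 1 * suc (suc m) + suc (suc m) * (N C m)   ≡⟨ factor (ballot (suc m) 1) m (N C m) ⟩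
      (ballot (suc m) 1 + (N C m)) * suc (suc m)               ≡⟨ ≡.cong (_* suc (suc m)) (ballot-closed m 0) ⟩
      (N C suc m) * suc (suc m)                                ≡⟨ split m (N C suc m) ⟩
      (N C suc m) + suc m * (N C suc m)                        ≡⟨ ≡.cong (λ k → (N C suc m) + k) absorbed ⟩
      (N C suc m) + suc (suc m) * (N C m)                      ∎

-- The rational form of the series and the z-adic filtration.

module _ where

  module RationalForm (K : CommutativeRing 0ℓ 0ℓ) where

    open CommutativeRing K hiding (zero)
    open Relation.Binary.Reasoning.Setoid setoid
    open IntegerSolver K
    open Canonical K 0# 0# using (modulo)

    -- Here f is the series over words. A word has one letter more than the index of its complex,
    -- whence the factor z. Words of length 0 and 1 have totals 1 and 0, while the desired series
    -- begins with 1 at n = 0; the summands `1#` and `z` account for this.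
    rational-form : ∀ {x y z C I G f} →
      C ≈ 1# + y * z * (z + 1#) * (C * C) →
      I * (1# - - z) ≈ 1# →
      G * (1# - ((1# + 1#) * C * x * z + C * (C * 1#) * x * (z * (z * 1#)))) ≈ 1# →
      f * (1# - ((1# + 1#) * x * (z * C) + x * (z * C * (z * C)))) ≈ (1# + z * C * (z * C) * y) * (1# - (1# + 1#) * x * (z * C)) →
      z * ((C + z) * I + x * z * (1# + z * C) * (C * (C * 1#)) * I * G) + 1# ≈ f + z
    rational-form {x} {y} {z} {C} {I} {G} {f} C-eq I-eq G-eq f-eq = begin
      z * ((C + z) * I + x * z * (1# + z * C) * (C * (C * 1#)) * I * G) + 1#
        ≈⟨ modulo (z - 1#) I-eq (solve 5 (λ x z C I G →
             z :* ((C :+ z) :* I :+ x :* z :* (𝟙 :+ z :* C) :* (C :* (C :* 𝟙)) :* I :* G) :+ 𝟙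
             := (𝟙 :+ z :* C) :* I :+ z :+ x :* (z :* C :* (z :* C)) :* ((𝟙 :+ z :* C) :* I) :* G
                :+ (z :- 𝟙) :* (I :* (𝟙 :- (:- z)) :- 𝟙)) refl x z C I G) ⟩
      (1# + z * C) * I + z + x * (z * C * (z * C)) * ((1# + z * C) * I) * G
        ≈⟨ +-cong (+-congʳ c-eq) (*-congʳ (*-congˡ c-eq)) ⟨
      c + z + x * (z * C * (z * C)) * c * G
        ≈⟨ modulo (- c) G-eq (solve 5 (λ x z C c G →
             c :+ z :+ x :* (z :* C :* (z :* C)) :* c :* G
             := c :* (𝟙 :- (𝟙 :+ 𝟙) :* x :* (z :* C)) :* G :+ z
                :+ (:- c) :* (G :* (𝟙 :- ((𝟙 :+ 𝟙) :* C :* x :* z :+ C :* (C :* 𝟙) :* x :* (z :* (z :* 𝟙)))) :- 𝟙)) refl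
             x z C c G) ⟩
      c * (1# - (1# + 1#) * x * (z * C)) * G + z
        ≈⟨ +-congʳ (*-congʳ f-eq) ⟨
      f * (1# - ((1# + 1#) * x * (z * C) + x * (z * C * (z * C)))) * G + z
        ≈⟨ modulo f G-eq (solve 5 (λ x z C f G →
             f :* (𝟙 :- ((𝟙 :+ 𝟙) :* x :* (z :* C) :+ x :* (z :* C :* (z :* C)))) :* G :+ z
             := f :+ z :+ f :* (G :* (𝟙 :- ((𝟙 :+ 𝟙) :* C :* x :* z :+ C :* (C :* 𝟙) :* x :* (z :* (z :* 𝟙)))) :- 𝟙)) refl
             x z C f G) ⟩
      f + z ∎
      where
      c : Carrier
      c = 1# + z * C * (z * C) * y
      -- For s = zC the equation s = z + y(z+1)s² says (1 + z)(1 + s²y) = 1 + s.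
      c-eq : c ≈ (1# + z * C) * I
      c-eq = sym (modulo (z * I) C-eq (modulo c I-eq (solve 4 (λ y z C I →
        (𝟙 :+ z :* C) :* I
        := (𝟙 :+ z :* C :* (z :* C) :* y) :+ z :* I :* (C :- (𝟙 :+ y :* z :* (z :+ 𝟙) :* (C :* C)))
           :+ (𝟙 :+ z :* C :* (z :* C) :* y) :* (I :* (𝟙 :- (:- z)) :- 𝟙)) refl y z C I)))

    s-equation : ∀ {y z C} → C ≈ 1# + y * z * (z + 1#) * (C * C) → z * C ≈ z + y * (z + 1#) * (z * C * (z * C))
    s-equation {y} {z} {C} C-eq = modulo z C-eq (solve 3 (λ y z C →
      z :* C := z :+ y :* (z :+ 𝟙) :* (z :* C :* (z :* C)) :+ z :* (C :- (𝟙 :+ y :* z :* (z :+ 𝟙) :* (C :* C)))) refl y z C)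

  sumTo-zero : ∀ n {f : ℕ → ℤ} → (∀ i → i ≤ n → f i ≡ 0ℤ) → sumTo n f ≡ 0ℤ
  sumTo-zero zero    p = p 0 z≤n
  sumTo-zero (suc n) p = ≡.cong₂ ℤ._+_ (sumTo-zero n (λ i i≤n → p i (ℕₚ.m≤n⇒m≤1+n i≤n))) (p (suc n) ℕₚ.≤-refl)

  private
    product-zero : ∀ {u v : ℤ} → u ≡ 0ℤ → u ℤ.* v ≡ 0ℤ
    product-zero ≡.refl = ≡.refl
    product-zeroʳ : ∀ u {v : ℤ} → v ≡ 0ℤ → u ℤ.* v ≡ 0ℤ
    product-zeroʳ u ≡.refl = ℤₚ.*-zeroʳ u

  z-adic : Filtration seriesRing
  z-adic = record
    { Div       = λ N f → ∀ a b n → n < N → f a b n ≡ 0ℤ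
    ; div-resp  = λ f≈g p a b n n<N → ≡.trans (≡.sym (f≈g a b n)) (p a b n n<N)
    ; div-zero  = λ a b n ()
    ; div-+     = λ p q a b n n<N → ≡.cong₂ ℤ._+_ (p a b n n<N) (q a b n n<N)
    ; div-neg   = λ p a b n n<N → ≡.cong ℤ.-_ (p a b n n<N)
    ; div-*     = λ g p a b n n<N → sumTo-zero a λ i _ → sumTo-zero b λ j _ → sumTo-zero n λ k _ →
                    product-zeroʳ (g i j k) (p (a ∸ i) (b ∸ j) (n ∸ k) (ℕₚ.≤-<-trans (ℕₚ.m∸n≤m n k) n<N))
    -- In the convolution the term k = 0 vanishes through u, and for k > 0 the other factor is taken
    -- in a degree below N.
    ; div-suc   = λ {_} {u} p q a b n n<1+N → sumTo-zero a λ i _ → sumTo-zero b λ j _ → sumTo-zero n λ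
                    { zero    _   → product-zero (p i j 0 (s≤s z≤n))
                    ; (suc k) k<n → product-zeroʳ (u i j (suc k)) (q (a ∸ i) (b ∸ j) (n ∸ suc k)
                        (ℕₚ.<-≤-trans (ℕₚ.∸-monoʳ-< (s≤s z≤n) k<n) (ℕₚ.≤-pred n<1+N))) }
    ; separated = λ p a b n → p (suc n) a b n ℕₚ.≤-refl
    }

  open CommutativeRing seriesRing using (refl; sym; trans; reflexive; *-comm)
  open Filtration z-adic
  open Adic seriesRing z-adic
  open CatalanEquation seriesRing z-adic

  zSum-isSum : ∀ {G} → (∀ k → Div k (G k)) → IsSum (zSum G) G
  zSum-isSum {G} div N a b n n<N = ≡.trans (≡.cong (λ t → sumTo n (λ k → G k a b n) ℤ.- t) truncate) (ℤₚ.+-inverseʳ (sumTo n (λ k → G k a b n)))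
    where
    exact : ∀ m → partial G (suc m) a b n ≡ sumTo m (λ k → G k a b n)
    exact zero    = ℤₚ.+-identityˡ _
    exact (suc m) = ≡.cong (ℤ._+ G (suc m) a b n) (exact m)
    beyond : ∀ j → partial G (j ℕ.+ suc n) a b n ≡ sumTo n (λ k → G k a b n)
    beyond zero    = exact n
    beyond (suc j) = ≡.trans (≡.cong₂ ℤ._+_ (beyond j) (div (j ℕ.+ suc n) a b n (ℕₚ.m≤n+m (suc n) j))) (ℤₚ.+-identityʳ _)
    truncate : partial G N a b n ≡ sumTo n (λ k → G k a b n)
    truncate = ≡.subst (λ M → partial G M a b n ≡ sumTo n (λ k → G k a b n)) (ℕₚ.m∸n+n≡m n<N) (beyond (N ∸ suc n))

  div-comm : ∀ {N f} g → Div N f → Div N (f *S g)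
  div-comm {N} {f} g p = div-resp {N} {g *S f} (*-comm g f) (div-* {N} {f} g p)

  power≡^S : ∀ g k → power g k ≡ g ^S k
  power≡^S g zero    = ≡.refl
  power≡^S g (suc k) = ≡.cong (g *S_) (power≡^S g k)

  div-power : ∀ {g} → Div 1 g → ∀ k → Div k (power g k)
  div-power {g} g₁ zero    = div-zero {f = oneS}
  div-power {g} g₁ (suc k) = div-suc {k} {g} {power g k} g₁ (div-power g₁ k)

  IsSum-resp : ∀ {S G H} → (∀ k → G k ≈S H k) → IsSum S G → IsSum S H
  IsSum-resp {S} {G} {H} p s N = div-resp {N} {S +S (-S partial G N)} (λ a b n → ≡.cong (λ t → S a b n ℤ.- t) (partial-cong {G} {H} p N a b n)) (s N)

  geomS-isSum : ∀ {g} → Div 1 g → IsSum (geomS g) (power g)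
  geomS-isSum {g} g₁ = IsSum-resp {geomS g} {g ^S_} {power g} (λ k → reflexive (≡.sym (power≡^S g k)))
    (zSum-isSum {g ^S_} (λ k → ≡.subst (Div k) (power≡^S g k) (div-power {g} g₁ k)))

  geomS-inverse : ∀ {g} → Div 1 g → (geomS g *S (oneS +S (-S g))) ≈S oneS
  geomS-inverse {g} g₁ = inverse-of-geometric {g} {geomS g} (geomS-isSum {g} g₁) g₁

  CatS-equation : ∀ {u} → Div 1 u → CatS u ≈S (oneS +S u *S (CatS u *S CatS u))
  CatS-equation {u} u₁ = catalan-equation (λ m → constS (+ m)) const-0 const-1 const-+ {u} u₁ P isSum
    where
    -- Index 1 is singled out so that `P 1` is the series with the coefficients `catalan`;
    -- `ballot-catalan` turns these into ballot numbers.
    P : ℕ → Series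
    P zero          = zSum (λ n → constS (+ ballot n 0) *S (u ^S n))
    P (suc zero)    = CatS u
    P (suc (suc k)) = zSum (λ n → constS (+ ballot n (suc (suc k))) *S (u ^S n))
    const-0 : constS (+ 0) ≈S zeroS
    const-0 zero    zero    zero    = ≡.refl
    const-0 zero    zero    (suc n) = ≡.refl
    const-0 zero    (suc b) n       = ≡.refl
    const-0 (suc a) b       n       = ≡.refl
    const-1 : constS (+ 1) ≈S oneS
    const-1 a b n = ≡.refl
    const-+ : ∀ i j → constS (+ (i ℕ.+ j)) ≈S (constS (+ i) +S constS (+ j))
    const-+ i j zero    zero    zero    = ≡.refl
    const-+ i j zero    zero    (suc n) = ≡.refl
    const-+ i j zero    (suc b) n       = ≡.refl
    const-+ i j (suc a) b       n       = ≡.refl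
    general : ∀ c → (S : Series) → S ≡ zSum (λ n → constS (+ c n) *S (u ^S n)) → IsSum S (λ n → constS (+ c n) *S power u n)
    general c S ≡.refl = IsSum-resp {S} {λ n → constS (+ c n) *S (u ^S n)} {λ n → constS (+ c n) *S power u n}
      (λ n → reflexive (≡.cong (constS (+ c n) *S_) (≡.sym (power≡^S u n))))
      (zSum-isSum {λ n → constS (+ c n) *S (u ^S n)} (λ k → div-* {k} {u ^S k} (constS (+ c k))
        (≡.subst (Div k) (power≡^S u k) (div-power {u} u₁ k))))
    isSum : ∀ k → IsSum (P k) (λ n → constS (+ ballot n k) *S power u n)
    isSum zero          = general (λ n → ballot n 0) (P 0) ≡.refl
    isSum (suc zero)    = IsSum-resp {CatS u} {λ n → constS (+ catalan n) *S power u n} {λ n → constS (+ ballot n 1) *S power u n}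
      (λ n → reflexive (≡.cong (λ t → constS (+ t) *S power u n) (≡.sym (ballot-catalan n)))) (general catalan (CatS u) ≡.refl)
    isSum (suc (suc k)) = general (λ n → ballot n (suc (suc k))) (P (suc (suc k))) ≡.refl

-- Comparison of coefficients: from word sums to the formula.

module _ where

  open CommutativeRing seriesRing using (refl; sym; trans; *-congˡ; *-congʳ; +-congʳ; *-assoc; *-identityˡ)
  open Filtration z-adic
  open Adic seriesRing z-adic using (IsSum; power)

  -- Series free of z. The values of `κ` are such, hence the z^n-coefficient of the series over
  -- words is exactly the total over words of length n.
  Pure : Series → Set
  Pure h = ∀ a b n → h a b (suc n) ≡ 0ℤ

  sumTo-last : ∀ n {f : ℕ → ℤ} → (∀ i → i < n → f i ≡ 0ℤ) → sumTo n f ≡ f n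
  sumTo-last zero    p = ≡.refl
  sumTo-last (suc n) {f} p = ≡.trans (≡.cong (ℤ._+ f (suc n)) (sumTo-zero n (λ i i≤n → p i (s≤s i≤n)))) (ℤₚ.+-identityˡ _)

  power-Zs-* : ∀ k h a b n → (power Zs k *S h) a b (k ℕ.+ n) ≡ h a b n
  power-Zs-* zero    h a b n = *-identityˡ h a b n
  power-Zs-* (suc k) h a b n = ≡.trans (*-assoc Zs (power Zs k) h a b (suc (k ℕ.+ n)))
    (≡.trans (Zs-*-suc (power Zs k *S h) a b (k ℕ.+ n)) (power-Zs-* k h a b n))

  pure-Xs : ∀ {h} → Pure h → Pure (Xs *S h)
  pure-Xs {h} p zero    b n = Xs-*-zero h b (suc n)
  pure-Xs {h} p (suc a) b n = ≡.trans (Xs-*-suc h a b (suc n)) (p a b n)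

  pure-Ys : ∀ {h} → Pure h → Pure (Ys *S h)
  pure-Ys {h} p a zero    n = Ys-*-zero h a (suc n)
  pure-Ys {h} p a (suc b) n = ≡.trans (Ys-*-suc h a b (suc n)) (p a b n)

  zS-div : Div 1 Zs
  zS-div zero    zero    zero    _ = ≡.refl
  zS-div zero    (suc b) zero    _ = ≡.refl
  zS-div (suc a) b       zero    _ = ≡.refl
  zS-div a       b       (suc n) (s≤s ())

  module SeriesFormula (x y : Series) (pure-x : ∀ {h} → Pure h → Pure (x *S h)) (pure-y : ∀ {h} → Pure h → Pure (y *S h)) where

    open Canonical seriesRing x y
    open WordSums seriesRing
    private
      u Cu s : Series
      u = y *S Zs *S (Zs +S oneS)
      Cu = CatS u
      s = Zs *S Cu
    open WordSeries seriesRing z-adic x y Zs s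

    private
      pure-+ : ∀ {f g} → Pure f → Pure g → Pure (f +S g)
      pure-+ p q a b n = ≡.cong₂ ℤ._+_ (p a b n) (q a b n)

      pure-D : ∀ p q → Pure (D p q)
      pure-D zero    zero    zero    zero    n = ≡.refl
      pure-D zero    zero    zero    (suc b) n = ≡.refl
      pure-D zero    zero    (suc a) b       n = ≡.refl
      pure-D zero    (suc q) a b n = ≡.refl
      pure-D (suc p) zero    a b n = ≡.refl
      pure-D (suc p) (suc q) = pure-x {D p (suc q) +S D (suc p) q +S D p q}
        (pure-+ {D p (suc q) +S D (suc p) q} {D p q} (pure-+ {D p (suc q)} {D (suc p) q} (pure-D p (suc q)) (pure-D (suc p) q)) (pure-D p q))

      pure-e : ∀ p q w → Pure (e p q w)
      pure-e p q       []      = pure-D p q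
      pure-e p q       (𝐁 ∷ w) = pure-e p (suc q) w
      pure-e p zero    (𝐀 ∷ w) = pure-e (suc p) zero w
      pure-e p (suc q) (𝐀 ∷ w) = pure-y {e p (suc q) w +S e p q (𝐀 ∷ w) +S e p q w}
        (pure-+ {e p (suc q) w +S e p q (𝐀 ∷ w)} {e p q w} (pure-+ {e p (suc q) w} {e p q (𝐀 ∷ w)} (pure-e p (suc q) w) (pure-e p q (𝐀 ∷ w))) (pure-e p q w))

      pure-Σwords : ∀ n {f} → (∀ w → Pure (f w)) → Pure (Σwords n f)
      pure-Σwords zero    p = p []
      pure-Σwords (suc n) {f} p = pure-+ {Σwords n (λ w → f (𝐀 ∷ w))} {Σwords n (λ w → f (𝐁 ∷ w))}
        (pure-Σwords n (λ w → p (𝐀 ∷ w))) (pure-Σwords n (λ w → p (𝐁 ∷ w)))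

      f : Word → Series
      f w = zSum (λ n → power Zs n *S total n w)

      f-isSum : ∀ w → IsSum (f w) (λ n → power Zs n *S total n w)
      f-isSum w = zSum-isSum {λ n → power Zs n *S total n w} (λ k → div-comm {k} {power Zs k} (total k w) (div-power {Zs} zS-div k))

      f-coefficient : ∀ a b n → f [] a b n ≡ Σwords n κ a b 0
      f-coefficient a b n = ≡.trans (sumTo-last n early) (≡.trans (≡.cong ((power Zs n *S total n []) a b) (≡.sym (ℕₚ.+-identityʳ n))) (power-Zs-* n (total n []) a b 0))
        where
        early : ∀ k → k < n → (power Zs k *S total k []) a b n ≡ 0ℤ
        early k k<n = ≡.subst (λ m → (power Zs k *S total k []) a b m ≡ 0ℤ)
          (≡.trans (ℕₚ.+-suc k _) (ℕₚ.m+[n∸m]≡n k<n))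
          (≡.trans (power-Zs-* k (total k []) a b (suc (n ∸ suc k))) (pure-Σwords k {κ} (pure-e 0 0) a b (n ∸ suc k)))

      Cu-equation : Cu ≈S (oneS +S u *S (Cu *S Cu))
      Cu-equation = CatS-equation {u} (div-comm {1} {y *S Zs} (Zs +S oneS) (div-* {1} {Zs} y zS-div))

      two : constS (+ 2) ≈S (oneS +S oneS)
      two zero    zero    zero    = ≡.refl
      two zero    zero    (suc n) = ≡.refl
      two zero    (suc b) n       = ≡.refl
      two (suc a) b       n       = ≡.refl

      g g′ : Series
      g  = constS (+ 2) *S Cu *S x *S Zs +S (Cu ^S 2) *S x *S (Zs ^S 2)
      g′ = (oneS +S oneS) *S Cu *S x *S Zs +S (Cu ^S 2) *S x *S (Zs ^S 2)

      g≈g′ : g ≈S g′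
      g≈g′ = +-congʳ {(Cu ^S 2) *S x *S (Zs ^S 2)} {constS (+ 2) *S Cu *S x *S Zs} {(oneS +S oneS) *S Cu *S x *S Zs}
        (*-congʳ {Zs} {constS (+ 2) *S Cu *S x} {(oneS +S oneS) *S Cu *S x}
          (*-congʳ {x} {constS (+ 2) *S Cu} {(oneS +S oneS) *S Cu} (*-congʳ {Cu} {constS (+ 2)} {oneS +S oneS} two)))

      g₁ : Div 1 g
      g₁ = div-+ {1} {constS (+ 2) *S Cu *S x *S Zs} {(Cu ^S 2) *S x *S (Zs ^S 2)}
        (div-* {1} {Zs} (constS (+ 2) *S Cu *S x) zS-div)
        (div-* {1} {Zs ^S 2} ((Cu ^S 2) *S x) (div-comm {1} {Zs} (Zs ^S 1) zS-div))

      G-inverse : (geomS g *S (oneS +S (-S g′))) ≈S oneS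
      G-inverse = trans {geomS g *S (oneS +S (-S g′))} {geomS g *S (oneS +S (-S g))} {oneS}
        (*-congˡ {geomS g} {oneS +S (-S g′)} {oneS +S (-S g)} (λ a b n → ≡.cong (λ t → oneS a b n ℤ.- t) (≡.sym (g≈g′ a b n))))
        (geomS-inverse {g} g₁)

    series-formula : ∀ F → (∀ a b → F a b 0 ≡ oneS a b 0) → (∀ a b n → F a b (suc n) ≡ Σwords (suc (suc n)) κ a b 0) → F ≈S rhs y x
    series-formula F F0 F+ a b n = begin
      F a b n                                  ≡⟨ Zs-*-suc F a b n ⟨
      (Zs *S F) a b (suc n)                    ≡⟨ ℤₚ.+-identityʳ _ ⟨
      (Zs *S F) a b (suc n) ℤ.+ 0ℤ             ≡⟨ ≡.cong (λ t → (Zs *S F) a b (suc n) ℤ.+ t) (pure-D 0 0 a b n) ⟨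
      (Zs *S F +S oneS) a b (suc n)            ≡⟨ both a b n ⟩
      (f [] +S Zs) a b (suc n)                 ≡⟨ form a b (suc n) ⟨
      (Zs *S rhs y x +S oneS) a b (suc n)      ≡⟨ ≡.cong (λ t → (Zs *S rhs y x) a b (suc n) ℤ.+ t) (pure-D 0 0 a b n) ⟩
      (Zs *S rhs y x) a b (suc n) ℤ.+ 0ℤ       ≡⟨ ℤₚ.+-identityʳ _ ⟩
      (Zs *S rhs y x) a b (suc n)              ≡⟨ Zs-*-suc (rhs y x) a b n ⟩
      rhs y x a b n                            ∎
      where
      open ≡.≡-Reasoning
      form : (Zs *S rhs y x +S oneS) ≈S (f [] +S Zs)
      form = RationalForm.rational-form seriesRing {x} {y} {Zs} {Cu} {geomS (-S Zs)} {geomS g} {f []}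
        Cu-equation (geomS-inverse { -S Zs} (div-neg {1} {Zs} zS-div)) G-inverse
        (word-series f f-isSum zS-div (div-comm {1} {Zs} Cu zS-div) (RationalForm.s-equation seriesRing {y} {Zs} {Cu} Cu-equation))
      Zs-one : ∀ a b → Zs a b 1 ≡ oneS a b 0
      Zs-one zero    zero    = ≡.refl
      Zs-one zero    (suc b) = ≡.refl
      Zs-one (suc a) b       = ≡.refl
      Zs-two : ∀ a b n → Zs a b (suc (suc n)) ≡ 0ℤ
      Zs-two zero    zero    n = ≡.refl
      Zs-two zero    (suc b) n = ≡.refl
      Zs-two (suc a) b       n = ≡.refl
      both : ∀ a b n → (Zs *S F +S oneS) a b (suc n) ≡ (f [] +S Zs) a b (suc n)
      -- Neither one-letter word carries a face, so the total for length 1 is 0, and `Zs` supplies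
      -- the coefficient 1 of the empty face at n = 0.
      both a b zero = begin
        (Zs *S F) a b 1 ℤ.+ oneS a b 1         ≡⟨ ≡.cong₂ ℤ._+_ (Zs-*-suc F a b 0) (pure-D 0 0 a b 0) ⟩
        F a b 0 ℤ.+ 0ℤ                         ≡⟨ ≡.trans (ℤₚ.+-identityʳ _) (F0 a b) ⟩
        oneS a b 0                             ≡⟨ ≡.trans (ℤₚ.+-identityˡ _) (Zs-one a b) ⟨
        0ℤ ℤ.+ Zs a b 1                        ≡⟨ ≡.cong (ℤ._+ Zs a b 1) (f-coefficient a b 1) ⟨
        f [] a b 1 ℤ.+ Zs a b 1                ∎
      both a b (suc n) = begin
        (Zs *S F) a b (suc (suc n)) ℤ.+ oneS a b (suc (suc n))   ≡⟨ ≡.cong₂ ℤ._+_ (Zs-*-suc F a b (suc n)) (pure-D 0 0 a b (suc n)) ⟩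
        F a b (suc n) ℤ.+ 0ℤ                                     ≡⟨ ≡.cong₂ ℤ._+_ (F+ a b n) (≡.sym (Zs-two a b n)) ⟩
        Σwords (suc (suc n)) κ a b 0 ℤ.+ Zs a b (suc (suc n))    ≡⟨ ≡.cong (ℤ._+ Zs a b (suc (suc n))) (f-coefficient a b (suc (suc n))) ⟨
        f [] a b (suc (suc n)) ℤ.+ Zs a b (suc (suc n))          ∎

-- Patterns and the compatibility of arcs.

-- A rule set after exchanging tails and heads if necessary: an arc is written as
-- (position of its 𝐀-end , position of its 𝐁-end), 𝐀𝐁𝐀𝐁 always nests and 𝐁𝐀𝐁𝐀 never does.
record Pattern : Set where
  constructor pattern′
  field
    abba-crosses baab-crosses aabb-nests bbaa-nests : Bool

Arc : Set
Arc = ℕ × ℕ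

T⇒≡true : ∀ {b} → T b → b ≡ true
T⇒≡true {true} _ = ≡.refl

<⇒<ᵇ≡true : ∀ {m n} → m < n → (m <ᵇ n) ≡ true
<⇒<ᵇ≡true m<n = T⇒≡true (ℕₚ.<⇒<ᵇ m<n)

≤⇒<ᵇ≡false : ∀ {m n} → n ≤ m → (m <ᵇ n) ≡ false
≤⇒<ᵇ≡false {m} {n} n≤m with m <ᵇ n in eq
... | false = ≡.refl
... | true  = ⊥-elim (ℕₚ.<⇒≱ (ℕₚ.<ᵇ⇒< m n (≡.subst T (≡.sym eq) _)) n≤m)

>⇒<ᵇ≡false : ∀ {m n} → n < m → (m <ᵇ n) ≡ false
>⇒<ᵇ≡false n<m = ≤⇒<ᵇ≡false (ℕₚ.<⇒≤ n<m)

≡ᵇ-refl : ∀ n → (n ≡ᵇ n) ≡ true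
≡ᵇ-refl n = T⇒≡true (ℕₚ.≡⇒≡ᵇ n n ≡.refl)

≢⇒≡ᵇ≡false : ∀ {m n} → m ≢ n → (m ≡ᵇ n) ≡ false
≢⇒≡ᵇ≡false {m} {n} m≢n with m ≡ᵇ n in eq
... | false = ≡.refl
... | true  = ⊥-elim (m≢n (ℕₚ.≡ᵇ⇒≡ m n (≡.subst T (≡.sym eq) _)))

module Compatibility (ρ : Pattern) where

  open Pattern ρ

  -- For 𝐀-ends a < a′ and 𝐁-ends b < b′: does the rule choose {(a , b′), (a′ , b)}?
  inverse : ℕ → ℕ → ℕ → ℕ → Bool
  inverse a a′ b b′ =
    if a <ᵇ b
    then (if a′ <ᵇ b then aabb-nests else if a′ <ᵇ b′ then true else abba-crosses)
    else (if b′ <ᵇ a then bbaa-nests else if b′ <ᵇ a′ then false else baab-crosses)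

  compatible : Arc → Arc → Bool
  compatible (a , b) (c , d) =
    if (a ≡ᵇ c) ∨ (b ≡ᵇ d) then true
    else if a <ᵇ c
    then (if b <ᵇ d then not (inverse a c b d) else inverse a c d b)
    else (if d <ᵇ b then not (inverse c a d b) else inverse c a b d)

  compatible-≡ˡ : ∀ a b d → compatible (a , b) (a , d) ≡ true
  compatible-≡ˡ a b d rewrite ≡ᵇ-refl a = ≡.refl

  compatible-≡ʳ : ∀ a c b → compatible (a , b) (c , b) ≡ true
  compatible-≡ʳ a c b rewrite ≡ᵇ-refl b | Boolₚ.∨-zeroʳ (a ≡ᵇ c) = ≡.refl

  compatible-< : ∀ {a b c d} → a < c → b < d → compatible (a , b) (c , d) ≡ not (inverse a c b d)
  compatible-< a<c b<d rewrite ≢⇒≡ᵇ≡false (ℕₚ.<⇒≢ a<c) | ≢⇒≡ᵇ≡false (ℕₚ.<⇒≢ b<d)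
    | <⇒<ᵇ≡true a<c | <⇒<ᵇ≡true b<d = ≡.refl

  compatible-> : ∀ {a b c d} → a < c → d < b → compatible (a , b) (c , d) ≡ inverse a c d b
  compatible-> a<c d<b rewrite ≢⇒≡ᵇ≡false (ℕₚ.<⇒≢ a<c) | ≢⇒≡ᵇ≡false (ℕₚ.>⇒≢ d<b)
    | <⇒<ᵇ≡true a<c | >⇒<ᵇ≡false d<b = ≡.refl

  private
    compatible->> : ∀ {a b c d} → c < a → d < b → compatible (a , b) (c , d) ≡ not (inverse c a d b)
    compatible->> c<a d<b rewrite ≢⇒≡ᵇ≡false (ℕₚ.>⇒≢ c<a) | ≢⇒≡ᵇ≡false (ℕₚ.>⇒≢ d<b)
      | >⇒<ᵇ≡false c<a | <⇒<ᵇ≡true d<b = ≡.refl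

    compatible-<> : ∀ {a b c d} → c < a → b < d → compatible (a , b) (c , d) ≡ inverse c a b d
    compatible-<> c<a b<d rewrite ≢⇒≡ᵇ≡false (ℕₚ.>⇒≢ c<a) | ≢⇒≡ᵇ≡false (ℕₚ.<⇒≢ b<d)
      | >⇒<ᵇ≡false c<a | >⇒<ᵇ≡false b<d = ≡.refl

  compatible-sym : ∀ α β → compatible α β ≡ compatible β α
  compatible-sym (a , b) (c , d) with ℕₚ.<-cmp a c | ℕₚ.<-cmp b d
  ... | tri≈ _ ≡.refl _ | _             = ≡.trans (compatible-≡ˡ a b d) (≡.sym (compatible-≡ˡ a d b))
  ... | tri< _ _ _    | tri≈ _ ≡.refl _ = ≡.trans (compatible-≡ʳ a c b) (≡.sym (compatible-≡ʳ c a b))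
  ... | tri> _ _ _    | tri≈ _ ≡.refl _ = ≡.trans (compatible-≡ʳ a c b) (≡.sym (compatible-≡ʳ c a b))
  ... | tri< a<c _ _  | tri< b<d _ _  = ≡.trans (compatible-< a<c b<d) (≡.sym (compatible->> a<c b<d))
  ... | tri< a<c _ _  | tri> _ _ d<b  = ≡.trans (compatible-> a<c d<b) (≡.sym (compatible-<> a<c d<b))
  ... | tri> _ _ c<a  | tri< b<d _ _  = ≡.trans (compatible-<> c<a b<d) (≡.sym (compatible-> c<a b<d))
  ... | tri> _ _ c<a  | tri> _ _ d<b  = ≡.trans (compatible->> c<a d<b) (≡.sym (compatible-< c<a d<b))

  compatible-refl : ∀ α → compatible α α ≡ true
  compatible-refl (a , b) = compatible-≡ˡ a b b

  -- The rule picks one of two matchings, so swapping the 𝐁-ends negates the answer. This is what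
  -- forces a preferred arc into every face.
  compatible-exchange : ∀ {a b c d} → a ≢ c → b ≢ d → compatible (a , d) (c , b) ≡ not (compatible (a , b) (c , d))
  compatible-exchange {a} {b} {c} {d} a≢c b≢d with ℕₚ.<-cmp a c | ℕₚ.<-cmp b d
  ... | tri≈ _ a≡c _  | _             = ⊥-elim (a≢c a≡c)
  ... | tri< _ _ _    | tri≈ _ b≡d _  = ⊥-elim (b≢d b≡d)
  ... | tri> _ _ _    | tri≈ _ b≡d _  = ⊥-elim (b≢d b≡d)
  ... | tri< a<c _ _  | tri< b<d _ _  = ≡.trans (compatible-> a<c b<d) (≡.trans (≡.sym (Boolₚ.not-involutive _)) (≡.cong not (≡.sym (compatible-< a<c b<d))))
  ... | tri< a<c _ _  | tri> _ _ d<b  = ≡.trans (compatible-< a<c d<b) (≡.cong not (≡.sym (compatible-> a<c d<b)))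
  ... | tri> _ _ c<a  | tri< b<d _ _  = ≡.trans (compatible->> c<a b<d) (≡.cong not (≡.sym (compatible-<> c<a b<d)))
  ... | tri> _ _ c<a  | tri> _ _ d<b  = ≡.trans (compatible-<> c<a d<b) (≡.trans (≡.sym (Boolₚ.not-involutive _)) (≡.cong not (≡.sym (compatible->> c<a d<b))))

  inverse-aabb : ∀ {a a′ b b′} → a < b → a′ < b → inverse a a′ b b′ ≡ aabb-nests
  inverse-aabb {a} {a′} {b} {b′} a<b a′<b rewrite <⇒<ᵇ≡true a<b | <⇒<ᵇ≡true a′<b = ≡.refl

  inverse-abab : ∀ {a a′ b b′} → a < b → b < a′ → a′ < b′ → inverse a a′ b b′ ≡ true
  inverse-abab {a} {a′} {b} {b′} a<b b<a′ a′<b′ rewrite <⇒<ᵇ≡true a<b | >⇒<ᵇ≡false b<a′ | <⇒<ᵇ≡true a′<b′ = ≡.refl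

  inverse-abba : ∀ {a a′ b b′} → a < b → b < b′ → b′ < a′ → inverse a a′ b b′ ≡ abba-crosses
  inverse-abba {a} {a′} {b} {b′} a<b b<b′ b′<a′ rewrite <⇒<ᵇ≡true a<b | >⇒<ᵇ≡false (ℕₚ.<-trans b<b′ b′<a′) | >⇒<ᵇ≡false b′<a′ = ≡.refl

  inverse-bbaa : ∀ {a a′ b b′} → b < a → b′ < a → inverse a a′ b b′ ≡ bbaa-nests
  inverse-bbaa {a} {a′} {b} {b′} b<a b′<a rewrite >⇒<ᵇ≡false b<a | <⇒<ᵇ≡true b′<a = ≡.refl

  inverse-baba : ∀ {a a′ b b′} → b < a → a < b′ → b′ < a′ → inverse a a′ b b′ ≡ false
  inverse-baba {a} {a′} {b} {b′} b<a a<b′ b′<a′ rewrite >⇒<ᵇ≡false b<a | >⇒<ᵇ≡false a<b′ | <⇒<ᵇ≡true b′<a′ = ≡.refl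

  inverse-baab : ∀ {a a′ b b′} → b < a → a < a′ → a′ < b′ → inverse a a′ b b′ ≡ baab-crosses
  inverse-baab {a} {a′} {b} {b′} b<a a<a′ a′<b′ rewrite >⇒<ᵇ≡false b<a | >⇒<ᵇ≡false (ℕₚ.<-trans a<a′ a′<b′) | >⇒<ᵇ≡false a′<b′ = ≡.refl

-- Sums over the subsets of a list.

module SubsetSums (K : CommutativeRing 0ℓ 0ℓ) where

  open CommutativeRing K hiding (zero)
  open IntegerSolver K

  Σ⊆ : {X : Set} → List X → (List X → Carrier) → Carrier
  Σ⊆ []      f = f []
  Σ⊆ (a ∷ L) f = Σ⊆ L f + Σ⊆ L (f ∘ (a ∷_))

  module _ {X : Set} where

    Σ⊆-cong-All : ∀ {P : X → Set} {L f g} → All P L → (∀ σ → All P σ → f σ ≈ g σ) → Σ⊆ L f ≈ Σ⊆ L g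
    Σ⊆-cong-All []       eq = eq [] []
    Σ⊆-cong-All (p ∷ ps) eq = +-cong (Σ⊆-cong-All ps eq) (Σ⊆-cong-All ps (λ σ qs → eq _ (p ∷ qs)))

    Σ⊆-cong : ∀ L {f g : List X → Carrier} → (∀ σ → f σ ≈ g σ) → Σ⊆ L f ≈ Σ⊆ L g
    Σ⊆-cong []      eq = eq []
    Σ⊆-cong (a ∷ L) eq = +-cong (Σ⊆-cong L eq) (Σ⊆-cong L (λ σ → eq (a ∷ σ)))

    Σ⊆-+ : ∀ (L : List X) f g → Σ⊆ L (λ σ → f σ + g σ) ≈ Σ⊆ L f + Σ⊆ L g
    Σ⊆-+ []      f g = refl
    Σ⊆-+ (a ∷ L) f g = trans (+-cong (Σ⊆-+ L f g) (Σ⊆-+ L (f ∘ (a ∷_)) (g ∘ (a ∷_))))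
      (solve 4 (λ a b c d → (a :+ b) :+ (c :+ d) := (a :+ c) :+ (b :+ d)) refl _ _ _ _)

    Σ⊆-* : ∀ (L : List X) c f → Σ⊆ L (λ σ → c * f σ) ≈ c * Σ⊆ L f
    Σ⊆-* []      c f = refl
    Σ⊆-* (a ∷ L) c f = trans (+-cong (Σ⊆-* L c f) (Σ⊆-* L c (f ∘ (a ∷_)))) (sym (distribˡ _ _ _))

    Σ⊆-zero : ∀ {P : X → Set} {L f} → All P L → (∀ σ → All P σ → f σ ≈ 0#) → Σ⊆ L f ≈ 0#
    Σ⊆-zero []       eq = eq [] []
    Σ⊆-zero (p ∷ ps) eq = trans (+-cong (Σ⊆-zero ps eq) (Σ⊆-zero ps (λ σ qs → eq _ (p ∷ qs)))) (+-identityˡ 0#)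

    Σ⊆-0 : ∀ L {f : List X → Carrier} → (∀ σ → f σ ≈ 0#) → Σ⊆ L f ≈ 0#
    Σ⊆-0 []      eq = eq []
    Σ⊆-0 (a ∷ L) eq = trans (+-cong (Σ⊆-0 L eq) (Σ⊆-0 L (λ σ → eq (a ∷ σ)))) (+-identityˡ 0#)

    Σ⊆-↭ : ∀ {L L′ : List X} {f} → (∀ {σ τ} → σ ↭ τ → f σ ≈ f τ) → L ↭ L′ → Σ⊆ L f ≈ Σ⊆ L′ f
    Σ⊆-↭ inv Perm.refl = refl
    Σ⊆-↭ inv (prep a p) = +-cong (Σ⊆-↭ inv p) (Σ⊆-↭ (inv ∘ prep a) p)
    Σ⊆-↭ {f = f} inv (swap {xs} {ys} a b p) = trans
      (+-cong (+-cong (Σ⊆-↭ inv p) (Σ⊆-↭ (inv ∘ prep b) p))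
              (+-cong (Σ⊆-↭ (inv ∘ prep a) p) (trans (Σ⊆-cong xs (λ σ → inv (swap a b ↭-refl))) (Σ⊆-↭ (inv ∘ prep b ∘ prep a) p))))
      (solve 4 (λ a b c d → (a :+ b) :+ (c :+ d) := (a :+ c) :+ (b :+ d)) refl _ _ _ _)
    Σ⊆-↭ inv (Perm.trans p q) = trans (Σ⊆-↭ inv p) (Σ⊆-↭ inv q)

    Σ⊆-++ : ∀ (L M : List X) f → Σ⊆ (L ++ M) f ≈ Σ⊆ L (λ σ → Σ⊆ M (λ τ → f (σ ++ τ)))
    Σ⊆-++ []      M f = refl
    Σ⊆-++ (a ∷ L) M f = +-cong (Σ⊆-++ L M f) (Σ⊆-++ L M (f ∘ (a ∷_)))

  only₁ : ∀ {v a b c d} → v ≈ a → b ≈ 0# → c ≈ 0# → d ≈ 0# → v ≈ a + b + c + d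
  only₁ p q r s = trans p (sym (trans (+-cong (trans (+-cong (trans (+-congˡ q) (+-identityʳ _)) r) (+-identityʳ _)) s) (+-identityʳ _)))

  only₂ : ∀ {v a b c d} → v ≈ b → a ≈ 0# → c ≈ 0# → d ≈ 0# → v ≈ a + b + c + d
  only₂ p q r s = trans (only₁ p q r s) (+-congʳ (+-congʳ (+-comm _ _)))

  only₃ : ∀ {v a b c d} → v ≈ c → a ≈ 0# → b ≈ 0# → d ≈ 0# → v ≈ a + b + c + d
  only₃ p q r s = trans (only₁ p q r s) (+-congʳ (trans (+-assoc _ _ _) (+-comm _ _)))

  only₄ : ∀ {v a b c d} → v ≈ d → a ≈ 0# → b ≈ 0# → c ≈ 0# → v ≈ a + b + c + d
  only₄ p q r s = trans (only₁ p q r s) (trans (trans (+-congʳ (+-assoc _ _ _)) (+-assoc _ _ _)) (+-comm _ _))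

  abstract
    ind : {P : Set} → Dec P → Carrier
    ind d = if does d then 1# else 0#

    ind-⇔ : ∀ {P Q : Set} → (P → Q) → (Q → P) → (p? : Dec P) (q? : Dec Q) → ind p? ≈ ind q?
    ind-⇔ f g p? q? = reflexive (≡.cong (λ b → if b then 1# else 0#) (does-⇔ (mk⇔ f g) p? q?))

    ind-no : ∀ {P : Set} (p? : Dec P) → ¬ P → ind p? ≈ 0#
    ind-no (yes p) ¬p = ⊥-elim (¬p p)
    ind-no (no _)  ¬p = refl

    ind-yes : ∀ {P : Set} (p? : Dec P) → P → ind p? ≈ 1#
    ind-yes (yes _) p = refl
    ind-yes (no ¬p) p = ⊥-elim (¬p p)

-- Nodes, arcs and the faces on a set of nodes.

Node : Set
Node = Letter × ℕ

_≟ₗ_ : DecidableEquality Letter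
𝐀 ≟ₗ 𝐀 = yes ≡.refl
𝐀 ≟ₗ 𝐁 = no λ ()
𝐁 ≟ₗ 𝐀 = no λ ()
𝐁 ≟ₗ 𝐁 = yes ≡.refl

_≟ₙ_ : DecidableEquality Node
_≟ₙ_ = Productₚ.≡-dec _≟ₗ_ ℕₚ._≟_

open DecMembership _≟ₙ_ using () renaming (_∈?_ to _∈ₙ?_)

Incident : Node → Arc → Set
Incident (𝐀 , i) (a , b) = a ≡ i
Incident (𝐁 , i) (a , b) = b ≡ i

incident? : ∀ n α → Dec (Incident n α)
incident? (𝐀 , i) (a , b) = a ℕₚ.≟ i
incident? (𝐁 , i) (a , b) = b ℕₚ.≟ i

Inside : List Node → Arc → Set
Inside ns (a , b) = (𝐀 , a) ∈ ns × (𝐁 , b) ∈ ns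

inside? : ∀ ns α → Dec (Inside ns α)
inside? ns (a , b) = ((𝐀 , a) ∈ₙ? ns) ×-dec ((𝐁 , b) ∈ₙ? ns)

Covered : Node → List Arc → Set
Covered n σ = Any (Incident n) σ

extract : ∀ {X : Set} {z : X} {L} → z ∈ L → ∃ λ L′ → L ↭ z ∷ L′
extract z∈ with Membershipₚ.∈-∃++ z∈
... | us , vs , ≡.refl = us ++ vs , Permₚ.shift _ us vs

covered? : ∀ n σ → Dec (Covered n σ)
covered? n = Any.any? (incident? n)

inside-node : ∀ {ns} n {α} → Inside ns α → Incident n α → n ∈ ns
inside-node (𝐀 , i) (a∈ , b∈) ≡.refl = a∈
inside-node (𝐁 , i) (a∈ , b∈) ≡.refl = b∈

inside-weaken : ∀ {ns ms} → (∀ {n} → n ∈ ns → n ∈ ms) → ∀ {α} → Inside ns α → Inside ms α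
inside-weaken f (a∈ , b∈) = f a∈ , f b∈

private
  module PermSetoidₚ = PermutationSetoidProperties (≡.setoid Arc)

module Validity (ρ : Pattern) where

  open Compatibility ρ

  -- An arc is paired with itself too, which `compatible-refl` makes harmless; quantifying over all
  -- pairs makes the notion independent of the order of the list.
  record Valid (ns : List Node) (σ : List Arc) : Set where
    constructor valid
    field
      inside : ∀ {α} → α ∈ σ → Inside ns α
      clique : ∀ {α β} → α ∈ σ → β ∈ σ → compatible α β ≡ true
      covers : ∀ {n} → n ∈ ns → Covered n σ
  open Valid public

  abstract
   valid? : ∀ ns σ → Dec (Valid ns σ)
   valid? ns σ = map′
    (λ { (i , c , v) → valid (All.lookup i) (λ α∈ → All.lookup (All.lookup c α∈)) (All.lookup v) })
    (λ v → All.tabulate (inside v) , All.tabulate (λ α∈ → All.tabulate (clique v α∈)) , All.tabulate (covers v))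
    (All.all? (inside? ns) σ ×-dec All.all? (λ α → All.all? (λ β → compatible α β Boolₚ.≟ true) σ) σ ×-dec All.all? (λ n → covered? n σ) ns)

  valid-↭ : ∀ {ns σ τ} → σ ↭ τ → Valid ns σ → Valid ns τ
  valid-↭ {σ = σ} {τ} p v = valid (λ α∈ → inside v (back α∈)) (λ α∈ β∈ → clique v (back α∈) (back β∈))
                      (λ n∈ → Permₚ.Any-resp-↭ p (covers v n∈))
    where
    back : ∀ {α} → α ∈ τ → α ∈ σ
    back = Permₚ.∈-resp-↭ (↭-sym p)

  valid-nodes : ∀ {ns ms σ} → (∀ {n} → n ∈ ns → n ∈ ms) → (∀ {n} → n ∈ ms → n ∈ ns) → Valid ns σ → Valid ms σ
  valid-nodes f g v = valid (λ α∈ → inside-weaken f (inside v α∈)) (clique v) (λ n∈ → covers v (g n∈))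

  CompatibleWith : Arc → List Arc → Set
  CompatibleWith α σ = All (λ β → compatible α β ≡ true) σ

  compatibleWith? : ∀ α σ → Dec (CompatibleWith α σ)
  compatibleWith? α = All.all? (λ β → compatible α β Boolₚ.≟ true)

-- Weighted counts of faces and the removal of an arc.

module Weights (K : CommutativeRing 0ℓ 0ℓ) (x y : CommutativeRing.Carrier K) where

  open CommutativeRing K hiding (zero)
  open IntegerSolver K

  weight : Arc → Carrier
  weight (a , b) = if a <ᵇ b then x else y

  wt : List Arc → Carrier
  wt []      = 1#
  wt (α ∷ σ) = weight α * wt σ

  wt-↭ : ∀ {σ τ} → σ ↭ τ → wt σ ≈ wt τ
  wt-↭ Perm.refl         = refl
  wt-↭ (prep α p)        = *-congˡ (wt-↭ p)
  wt-↭ (swap α β p)      = trans (*-congˡ (*-congˡ (wt-↭ p))) (solve 3 (λ a b c → a :* (b :* c) := b :* (a :* c)) refl _ _ _)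
  wt-↭ (Perm.trans p q)  = trans (wt-↭ p) (wt-↭ q)

module Faces (K : CommutativeRing 0ℓ 0ℓ) (x y : CommutativeRing.Carrier K) (ρ : Pattern) where

  open CommutativeRing K hiding (zero)
  open Relation.Binary.Reasoning.Setoid setoid
  open IntegerSolver K
  open SubsetSums K
  open Compatibility ρ
  open Validity ρ public
  open Weights K x y public

  face : List Node → List Arc → Carrier
  face ns σ = ind (valid? ns σ) * wt σ

  face-↭ : ∀ ns {σ τ} → σ ↭ τ → face ns σ ≈ face ns τ
  face-↭ ns p = *-cong (ind-⇔ (valid-↭ p) (valid-↭ (↭-sym p)) (valid? ns _) (valid? ns _)) (wt-↭ p)

  face-no : ∀ {ns σ} → ¬ Valid ns σ → face ns σ ≈ 0#
  face-no {ns} {σ} ¬v = trans (*-congʳ (ind-no (valid? ns σ) ¬v)) (zeroˡ _)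

  module Universe (U : List Arc) (U! : Unique U) where

    -- The subsets are taken from one fixed list of arcs and validity confines them to `ns`.
    -- Deleting nodes thus changes the summand but not the range, and counts can be compared term by
    -- term.
    Sum : List Node → Carrier
    Sum ns = Σ⊆ U (face ns)

    Sum-nodes : ∀ {ns ms} → (∀ {n} → n ∈ ns → n ∈ ms) → (∀ {n} → n ∈ ms → n ∈ ns) → Sum ns ≈ Sum ms
    Sum-nodes f g = Σ⊆-cong U (λ σ → *-congʳ (ind-⇔ (valid-nodes f g) (valid-nodes g f) (valid? _ σ) (valid? _ σ)))

    Sum-↭ : ∀ {ns ms} → ns ↭ ms → Sum ns ≈ Sum ms
    Sum-↭ p = Sum-nodes (Permₚ.∈-resp-↭ p) (Permₚ.∈-resp-↭ (↭-sym p))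

    Sum-no : ∀ {ns} → (∀ σ → ¬ Valid ns σ) → Sum ns ≈ 0#
    Sum-no no-face = Σ⊆-0 U (λ σ → face-no (no-face σ))

    module Split {a b : ℕ} {U′ : List Arc} (U↭ : U ↭ (a , b) ∷ U′) where

      α : Arc
      α = a , b

      n₁ n₂ : Node
      n₁ = 𝐀 , a
      n₂ = 𝐁 , b

      fresh : All (_≢ α) U′
      fresh with PermSetoidₚ.Unique-resp-↭ (Perm.↭⇒↭ₛ U↭) U!
      ... | α≢ ∷ _ = All.map (λ p q → p (≡.sym q)) α≢

      Sum-split : ∀ ns → Sum ns ≈ Σ⊆ U′ (face ns) + Σ⊆ U′ (λ σ → face ns (α ∷ σ))
      Sum-split ns = Σ⊆-↭ (face-↭ ns) U↭

      -- The faces on `ns` that avoid α, since the sum runs over `U′`, and whose arcs are all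
      -- compatible with α.
      star : List Node → Carrier
      star ns = Σ⊆ U′ (λ σ → ind (valid? ns σ ×-dec compatibleWith? α σ) * wt σ)

      Sum-outside : ∀ {ns} → ¬ Inside ns α → Sum ns ≈ Σ⊆ U′ (face ns)
      Sum-outside {ns} ¬in = trans (Sum-split ns) (trans
        (+-congˡ (Σ⊆-zero fresh (λ σ _ → face-no (λ v → ¬in (inside v (here ≡.refl))))))
        (+-identityʳ _))

      incident-α : ∀ {n} → Incident n α → n ≡ n₁ ⊎ n ≡ n₂
      incident-α {𝐀 , i} ≡.refl = inj₁ ≡.refl
      incident-α {𝐁 , i} ≡.refl = inj₂ ≡.refl

      module _ {ms : List Node} (n₁∉ : n₁ ∉ ms) (n₂∉ : n₂ ∉ ms) where

        private
          ns : List Node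
          ns = n₁ ∷ n₂ ∷ ms

          same : ∀ {ks σ} → (∀ {n} → n ∈ ks → n ∈ ns) →
                 (∀ {n} → n ∈ ns → n ∈ ks ⊎ ((n ≡ n₁ ⊎ n ≡ n₂) × ¬ Covered n σ)) →
                 (∀ {n} → n ∈ ks → n ∈ ms ⊎ Covered n σ) →
                 ind (valid? ns (α ∷ σ)) ≈ ind (valid? ks σ ×-dec compatibleWith? α σ)
          same {ks} {σ} sub sup cov = ind-⇔ to from (valid? ns (α ∷ σ)) (valid? ks σ ×-dec compatibleWith? α σ)
            where
            kept : ∀ {n β} → β ∈ σ → Incident n β → n ∈ ns → n ∈ ks
            kept β∈ inc n∈ with sup n∈
            ... | inj₁ n∈ks     = n∈ks
            ... | inj₂ (_ , ¬c) = ⊥-elim (¬c (lose β∈ inc))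
            cover : Valid ns (α ∷ σ) → ∀ {n} → n ∈ ks → Covered n σ
            cover v n∈ with cov n∈
            ... | inj₂ c = c
            ... | inj₁ n∈ms with covers v (there (there n∈ms))
            ...   | there c = c
            ...   | here inc with incident-α inc
            ...     | inj₁ ≡.refl = ⊥-elim (n₁∉ n∈ms)
            ...     | inj₂ ≡.refl = ⊥-elim (n₂∉ n∈ms)
            to : Valid ns (α ∷ σ) → Valid ks σ × CompatibleWith α σ
            to v = valid (λ {β} β∈ → kept β∈ ≡.refl (proj₁ (inside v (there β∈))) , kept β∈ ≡.refl (proj₂ (inside v (there β∈))))
                         (λ β∈ γ∈ → clique v (there β∈) (there γ∈)) (cover v)
                 , All.tabulate (λ β∈ → clique v (here ≡.refl) (there β∈))
            from : Valid ks σ × CompatibleWith α σ → Valid ns (α ∷ σ)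
            from (v , c) = valid
              (λ { (here ≡.refl) → here ≡.refl , there (here ≡.refl) ; (there β∈) → inside-weaken sub (inside v β∈) })
              (λ { (here ≡.refl) (here ≡.refl) → compatible-refl α
                 ; (here ≡.refl) (there β∈) → All.lookup c β∈
                 ; {β = β} (there β∈) (here ≡.refl) → ≡.trans (compatible-sym _ α) (All.lookup c β∈)
                 ; (there β∈) (there γ∈) → clique v β∈ γ∈ })
              λ n∈ → cov′ (sup n∈)
              where
              cov′ : ∀ {n} → n ∈ ks ⊎ ((n ≡ n₁ ⊎ n ≡ n₂) × ¬ Covered n σ) → Covered n (α ∷ σ)
              cov′ (inj₁ n∈ks)              = there (covers v n∈ks)
              cov′ (inj₂ (inj₁ ≡.refl , _)) = here ≡.refl
              cov′ (inj₂ (inj₂ ≡.refl , _)) = here ≡.refl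

          missing : ∀ {n ks σ} → n ∉ ks → Covered n σ → ind (valid? ks σ ×-dec compatibleWith? α σ) ≈ 0#
          missing {n} {ks} {σ} n∉ c = ind-no (valid? ks σ ×-dec compatibleWith? α σ) λ (v , _) →
            let β , β∈ , inc = find c in n∉ (inside-node n (inside v β∈) inc)

          uncovered : ∀ {n ks σ} → n ∈ ks → ¬ Covered n σ → ind (valid? ks σ ×-dec compatibleWith? α σ) ≈ 0#
          uncovered {n} {ks} {σ} n∈ ¬c = ind-no (valid? ks σ ×-dec compatibleWith? α σ) (λ (v , _) → ¬c (covers v n∈))

          n₁∉′ : n₁ ∉ n₂ ∷ ms
          n₁∉′ (there p) = n₁∉ p

          n₂∉′ : n₂ ∉ n₁ ∷ ms
          n₂∉′ (there p) = n₂∉ p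

          indicator : List Node → List Arc → Carrier
          indicator ks σ = ind (valid? ks σ ×-dec compatibleWith? α σ)

          -- Without α, the remaining arcs cover both ends of α, one of them or none, and they can
          -- be a face only on the node list with precisely the ends they cover. The other three
          -- indicators are zero.
          four : ∀ σ → ind (valid? ns (α ∷ σ)) ≈ indicator ms σ + indicator (n₁ ∷ ms) σ + indicator (n₂ ∷ ms) σ + indicator ns σ
          four σ = cases (covered? n₁ σ) (covered? n₂ σ)
           where
           cases : Dec (Covered n₁ σ) → Dec (Covered n₂ σ) →
                   ind (valid? ns (α ∷ σ)) ≈ indicator ms σ + indicator (n₁ ∷ ms) σ + indicator (n₂ ∷ ms) σ + indicator ns σ
           cases (no ¬c₁) (no ¬c₂) = only₁
             (same {ms} {σ} (there ∘ there)
               (λ { (here ≡.refl) → inj₂ (inj₁ ≡.refl , ¬c₁) ; (there (here ≡.refl)) → inj₂ (inj₂ ≡.refl , ¬c₂) ; (there (there p)) → inj₁ p }) inj₁)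
             (uncovered (here ≡.refl) ¬c₁) (uncovered (here ≡.refl) ¬c₂) (uncovered (here ≡.refl) ¬c₁)
           cases (yes c₁) (no ¬c₂) = only₂
             (same {n₁ ∷ ms} {σ} (λ { (here p) → here p ; (there p) → there (there p) })
               (λ { (here ≡.refl) → inj₁ (here ≡.refl) ; (there (here ≡.refl)) → inj₂ (inj₂ ≡.refl , ¬c₂) ; (there (there p)) → inj₁ (there p) })
               (λ { (here ≡.refl) → inj₂ c₁ ; (there p) → inj₁ p }))
             (missing n₁∉ c₁) (uncovered (here ≡.refl) ¬c₂) (uncovered (there (here ≡.refl)) ¬c₂)
           cases (no ¬c₁) (yes c₂) = only₃
             (same {n₂ ∷ ms} {σ} there
               (λ { (here ≡.refl) → inj₂ (inj₁ ≡.refl , ¬c₁) ; (there p) → inj₁ p })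
               (λ { (here ≡.refl) → inj₂ c₂ ; (there p) → inj₁ p }))
             (missing n₂∉ c₂) (uncovered (here ≡.refl) ¬c₁) (uncovered (here ≡.refl) ¬c₁)
           cases (yes c₁) (yes c₂) = only₄
             (same {ns} {σ} id inj₁
               (λ { (here ≡.refl) → inj₂ c₁ ; (there (here ≡.refl)) → inj₂ c₂ ; (there (there p)) → inj₁ p }))
             (missing n₁∉ c₁) (missing n₂∉′ c₂) (missing n₁∉′ c₁)

        cone-sum : Σ⊆ U′ (λ σ → face ns (α ∷ σ)) ≈ weight α * (star ms + star (n₁ ∷ ms) + star (n₂ ∷ ms) + star ns)
        cone-sum = begin
          Σ⊆ U′ (λ σ → face ns (α ∷ σ))
            ≈⟨ Σ⊆-cong U′ (λ σ → trans (*-congʳ (four σ))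
                 (solve 6 (λ a b c d w t → (a :+ b :+ c :+ d) :* (w :* t) := w :* (a :* t :+ b :* t :+ c :* t :+ d :* t)) refl _ _ _ _ _ _)) ⟩
          Σ⊆ U′ (λ σ → weight α * (indicator ms σ * wt σ + indicator (n₁ ∷ ms) σ * wt σ + indicator (n₂ ∷ ms) σ * wt σ + indicator ns σ * wt σ))
            ≈⟨ trans (Σ⊆-* U′ _ _) (*-congˡ (trans (Σ⊆-+ U′ _ _) (+-congʳ (trans (Σ⊆-+ U′ _ _) (+-congʳ (Σ⊆-+ U′ _ _)))))) ⟩
          weight α * (star ms + star (n₁ ∷ ms) + star (n₂ ∷ ms) + star ns) ∎

        -- If the rule prefers α in every pair of disjoint arcs on α's endpoints and two other
        -- nodes, then α lies in every face and one of its endpoints has degree one.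
        module GoodPair (good : ∀ {c d} → (𝐀 , c) ∈ ms → (𝐁 , d) ∈ ms → compatible α (c , d) ≡ true) where

          private
            -- In a face without α the ends of α would lie on arcs (a , d) and (c , b). These form
            -- the matching that competes with α and (c , d), and `good` rejects it.
            exclusive : ∀ σ → All (_≢ α) σ → ¬ Valid ns σ
            exclusive σ α∉ v with find (covers v {n₁} (here ≡.refl)) | find (covers v {n₂} (there (here ≡.refl)))
            ... | (_ , d) , β∈ , ≡.refl | (c , _) , γ∈ , ≡.refl = contra
              where
              d≢b : b ≢ d
              d≢b ≡.refl = All.lookup α∉ β∈ ≡.refl
              c≢a : a ≢ c
              c≢a ≡.refl = All.lookup α∉ γ∈ ≡.refl
              d∈ : (𝐁 , d) ∈ ms
              d∈ with proj₂ (inside v β∈)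
              ... | there (here ≡.refl) = ⊥-elim (d≢b ≡.refl)
              ... | there (there p)     = p
              c∈ : (𝐀 , c) ∈ ms
              c∈ with proj₁ (inside v γ∈)
              ... | here ≡.refl       = ⊥-elim (c≢a ≡.refl)
              ... | there (there p)   = p
              contra : ⊥
              contra with ≡.trans (≡.sym (clique v β∈ γ∈)) (≡.trans (compatible-exchange c≢a d≢b) (≡.cong not (good c∈ d∈)))
              ... | ()

            prefers : ∀ {c d} → Inside ns (c , d) → compatible α (c , d) ≡ true
            prefers (here ≡.refl , _)                             = compatible-≡ˡ a b _
            prefers (there (there c∈) , there (here ≡.refl))      = compatible-≡ʳ a _ b
            prefers (there (there c∈) , there (there d∈))         = good c∈ d∈

            star-Sum : ∀ ks → (∀ {n} → n ∈ ks → n ∈ ns) → ¬ Inside ks α → star ks ≈ Sum ks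
            star-Sum ks sub ¬in = trans
              (Σ⊆-cong U′ (λ σ → *-congʳ (ind-⇔ proj₁ (λ v → v , All.tabulate (λ β∈ → prefers (inside-weaken sub (inside v β∈))))
                 (valid? ks σ ×-dec compatibleWith? α σ) (valid? ks σ))))
              (sym (Sum-outside ¬in))

          -- Of the four stars in `cone-sum` the last is empty, as its faces would cover both ends
          -- without α. In the other three, compatibility with α is automatic, so they are full
          -- counts.
          good-pair : Sum ns ≈ weight α * (Sum ms + Sum (n₁ ∷ ms) + Sum (n₂ ∷ ms))
          good-pair = begin
            Sum ns
              ≈⟨ Sum-split ns ⟩
            Σ⊆ U′ (face ns) + Σ⊆ U′ (λ σ → face ns (α ∷ σ))
              ≈⟨ +-cong (Σ⊆-zero fresh (λ σ α∉ → face-no (exclusive σ α∉))) cone-sum ⟩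
            0# + weight α * (star ms + star (n₁ ∷ ms) + star (n₂ ∷ ms) + star ns)
              ≈⟨ trans (+-identityˡ _) (*-congˡ (+-cong (+-cong (+-cong
                   (star-Sum ms (there ∘ there) (λ p → n₁∉ (proj₁ p)))
                   (star-Sum (n₁ ∷ ms) (λ { (here p) → here p ; (there p) → there (there p) }) (λ p → n₂∉′ (proj₂ p))))
                   (star-Sum (n₂ ∷ ms) there (λ p → n₁∉′ (proj₁ p))))
                   (Σ⊆-zero fresh (λ σ α∉ → trans (*-congʳ (ind-no (valid? ns σ ×-dec compatibleWith? α σ) (λ p → exclusive σ α∉ (proj₁ p)))) (zeroˡ _))))) ⟩
            weight α * (Sum ms + Sum (n₁ ∷ ms) + Sum (n₂ ∷ ms) + 0#)
              ≈⟨ *-congˡ (+-identityʳ _) ⟩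
            weight α * (Sum ms + Sum (n₁ ∷ ms) + Sum (n₂ ∷ ms)) ∎

-- Sorted lists of nodes.

position : Node → ℕ
position = proj₂

letters : List Node → Word
letters = map proj₁

_≺_ : Node → Node → Set
m ≺ n = position m < position n

Sorted : List Node → Set
Sorted = AllPairs _≺_

Is : Letter → Node → Set
Is l n = proj₁ n ≡ l

sorted-⊆ : ∀ {ms ns} → ms ⊆ ns → Sorted ns → Sorted ms
sorted-⊆ Sublist.[]         []       = []
sorted-⊆ (skip n p)         (_ ∷ s)  = sorted-⊆ p s
sorted-⊆ (keep ≡.refl p)    (a ∷ s)  = Sublistₚ.All-resp-⊆ p a ∷ sorted-⊆ p s

sorted-before : ∀ us {n vs} → Sorted (us ++ n ∷ vs) → All (_≺ n) us
sorted-before []       s       = []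
sorted-before (u ∷ us) (a ∷ s) = All.lookup a (Membershipₚ.∈-++⁺ʳ us (here ≡.refl)) ∷ sorted-before us s

sorted-after : ∀ us {n vs} → Sorted (us ++ n ∷ vs) → All (n ≺_) vs
sorted-after []       (a ∷ s) = a
sorted-after (u ∷ us) (a ∷ s) = sorted-after us s

sorted-unique : ∀ {ns} → Sorted ns → Unique ns
sorted-unique = AllPairs.map (λ { lt ≡.refl → ℕₚ.<-irrefl ≡.refl lt })

letters-all : ∀ {l ns} → All (Is l) ns → letters ns ≡ replicate (length ns) l
letters-all []            = ≡.refl
letters-all (≡.refl ∷ ps) = ≡.cong (_ ∷_) (letters-all ps)

first𝐀 : ∀ ns → All (Is 𝐁) ns ⊎ ∃ λ bs → ∃ λ a → ∃ λ vs → ns ≡ bs ++ (𝐀 , a) ∷ vs × All (Is 𝐁) bs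
first𝐀 []             = inj₁ []
first𝐀 ((𝐀 , a) ∷ ns) = inj₂ ([] , a , ns , ≡.refl , [])
first𝐀 ((𝐁 , b) ∷ ns) with first𝐀 ns
... | inj₁ all                         = inj₁ (≡.refl ∷ all)
... | inj₂ (bs , a , vs , ≡.refl , all) = inj₂ ((𝐁 , b) ∷ bs , a , vs , ≡.refl , ≡.refl ∷ all)

last𝐁 : ∀ ns → All (Is 𝐀) ns ⊎ ∃ λ us → ∃ λ b → ∃ λ as → ns ≡ us ++ (𝐁 , b) ∷ as × All (Is 𝐀) as
last𝐁 []       = inj₁ []
last𝐁 (n ∷ ns) with last𝐁 ns
... | inj₂ (us , b , as , ≡.refl , all) = inj₂ (n ∷ us , b , as , ≡.refl , all)
last𝐁 ((𝐀 , a) ∷ ns) | inj₁ all = inj₁ (≡.refl ∷ all)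
last𝐁 ((𝐁 , b) ∷ ns) | inj₁ all = inj₂ ([] , b , ns , ≡.refl , all)

not-𝐀 : ∀ {bs c} → All (Is 𝐁) bs → (𝐀 , c) ∉ bs
not-𝐀 all c∈ with All.lookup all c∈
... | ()

not-𝐁 : ∀ {as d} → All (Is 𝐀) as → (𝐁 , d) ∉ as
not-𝐁 all d∈ with All.lookup all d∈
... | ()

split-∈ : ∀ {n : Node} us {vs} → n ∈ us ++ vs → n ∈ us ⊎ n ∈ vs
split-∈ us = Membershipₚ.∈-++⁻ us

private
  module NodeSetoidₚ = PermutationSetoidProperties (≡.setoid Node)

-- Correctness of a count and the removal of a preferred pair of nodes.

module Counting (K : CommutativeRing 0ℓ 0ℓ) (x y : CommutativeRing.Carrier K) (ρ : Pattern)
                (U : List Arc) (U! : Unique U) where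

  open CommutativeRing K hiding (zero)
  open Relation.Binary.Reasoning.Setoid setoid
  open SubsetSums K
  open Canonical K x y
  open Compatibility ρ
  open Pattern ρ
  open Faces K x y ρ
  open Universe U U!

  Complete : List Node → Set
  Complete ns = ∀ {a b} → (𝐀 , a) ∈ ns → (𝐁 , b) ∈ ns → (a , b) ∈ U

  Correct : List Node → Set
  Correct ns = Sum ns ≈ κ (letters ns)

  CorrectBelow : List Node → Set
  CorrectBelow ns = ∀ {ms} → length ms < length ns → Sorted ms → Complete ms → Correct ms

  complete-⊆ : ∀ {ms ns} → ms ⊆ ns → Complete ns → Complete ms
  complete-⊆ p c a∈ b∈ = c (Sublist.lookup p a∈) (Sublist.lookup p b∈)

  weight-< : ∀ {a b} → a < b → weight (a , b) ≡ x
  weight-< a<b rewrite <⇒<ᵇ≡true a<b = ≡.refl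

  weight-> : ∀ {a b} → b < a → weight (a , b) ≡ y
  weight-> b<a rewrite >⇒<ᵇ≡false b<a = ≡.refl

  fresh-nodes : ∀ {a b ns ms} → Sorted ns → ns ↭ (𝐀 , a) ∷ (𝐁 , b) ∷ ms → ((𝐀 , a) ∉ ms) × ((𝐁 , b) ∉ ms)
  fresh-nodes {a} {b} {ns} {ms} s p with NodeSetoidₚ.Unique-resp-↭ (Perm.↭⇒↭ₛ p) (sorted-unique s)
  ... | (_ ∷ n₁∉) ∷ n₂∉ ∷ _ = Allₚ.All¬⇒¬Any n₁∉ , Allₚ.All¬⇒¬Any n₂∉

  -- The reduced lists are given up to permutation, which suffices for counting, and also as
  -- sublists, because their words depend on the order.
  remove-pair : ∀ {a b ns ms m₁ m₂} →
    ns ↭ (𝐀 , a) ∷ (𝐁 , b) ∷ ms → m₁ ↭ (𝐀 , a) ∷ ms → m₂ ↭ (𝐁 , b) ∷ ms → ms ⊆ ns → m₁ ⊆ ns → m₂ ⊆ ns →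
    Sorted ns → Complete ns → CorrectBelow ns →
    (∀ {c d} → (𝐀 , c) ∈ ms → (𝐁 , d) ∈ ms → compatible (a , b) (c , d) ≡ true) →
    Sum ns ≈ weight (a , b) * (κ (letters ms) + κ (letters m₁) + κ (letters m₂))
  remove-pair {a} {b} {ns} {ms} {m₁} {m₂} p p₁ p₂ q q₁ q₂ s c ih good = begin
    Sum ns
      ≈⟨ Sum-↭ p ⟩
    Sum ((𝐀 , a) ∷ (𝐁 , b) ∷ ms)
      ≈⟨ GoodPair.good-pair (proj₁ fr) (proj₂ fr) good ⟩
    weight (a , b) * (Sum ms + Sum ((𝐀 , a) ∷ ms) + Sum ((𝐁 , b) ∷ ms))
      ≈⟨ *-congˡ (+-cong (+-cong (ih (≡.subst (length ms <_) (≡.sym len) (ℕₚ.m≤n⇒m≤1+n ℕₚ.≤-refl)) (sorted-⊆ q s) (complete-⊆ q c))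
           (trans (Sum-↭ (↭-sym p₁)) (ih (shorter p₁) (sorted-⊆ q₁ s) (complete-⊆ q₁ c))))
           (trans (Sum-↭ (↭-sym p₂)) (ih (shorter p₂) (sorted-⊆ q₂ s) (complete-⊆ q₂ c)))) ⟩
    _ ∎
    where
    fr = fresh-nodes s p
    mem : (a , b) ∈ U
    mem = c (Permₚ.∈-resp-↭ (↭-sym p) (here ≡.refl)) (Permₚ.∈-resp-↭ (↭-sym p) (there (here ≡.refl)))
    open Split (proj₂ (extract mem))
    len : length ns ≡ suc (suc (length ms))
    len = Permₚ.↭-length p
    shorter : ∀ {m n} → m ↭ n ∷ ms → length m < length ns
    shorter p′ = ≡.subst₂ _<_ (≡.sym (Permₚ.↭-length p′)) (≡.sym len) ℕₚ.≤-refl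

  Sum-[] : Sum [] ≈ 1#
  Sum-[] = go U
    where
    go : ∀ L → Σ⊆ L (face []) ≈ 1#
    go []      = trans (*-congʳ (ind-yes (valid? [] []) (valid (λ ()) (λ ()) (λ ())))) (*-identityˡ 1#)
    go (α ∷ L) = trans (+-cong (go L) (Σ⊆-0 L (λ σ → face-no (λ v → outside {α} (inside v (here ≡.refl))))))
                       (+-identityʳ 1#)
      where
      outside : ∀ {α} → ¬ Inside [] α
      outside (() , _)

  Sum-all𝐁 : ∀ {n ns} → All (Is 𝐁) (n ∷ ns) → Sum (n ∷ ns) ≈ 0#
  Sum-all𝐁 {n} all = Sum-no (λ σ v → not-𝐀 all (proj₁ (inside v (proj₁ (proj₂ (find (covers v {n} (here ≡.refl))))))))

  Sum-all𝐀 : ∀ {n ns} → All (Is 𝐀) (n ∷ ns) → Sum (n ∷ ns) ≈ 0#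
  Sum-all𝐀 {n} all = Sum-no (λ σ v → not-𝐁 all (proj₂ (inside v (proj₁ (proj₂ (find (covers v {n} (here ≡.refl))))))))

  private
    module _ {bs : List Node} {a : ℕ} {ws : List Node} {b : ℕ} {as : List Node}
             (s : Sorted (bs ++ (𝐀 , a) ∷ ws ++ (𝐁 , b) ∷ as)) where

      middle-sorted : Sorted (ws ++ (𝐁 , b) ∷ as)
      middle-sorted = sorted-⊆ (Sublistₚ.++⁺ˡ bs (skip _ ⊆-refl)) s

      bs<a : ∀ {n} → n ∈ bs → position n < a
      bs<a = All.lookup (sorted-before bs s)

      a<ws : ∀ {n} → n ∈ ws → a < position n
      a<ws n∈ = All.lookup (sorted-after bs s) (Membershipₚ.∈-++⁺ˡ n∈)

      a<as : ∀ {n} → n ∈ as → a < position n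
      a<as n∈ = All.lookup (sorted-after bs s) (Membershipₚ.∈-++⁺ʳ ws (there n∈))

      a<b : a < b
      a<b = All.lookup (sorted-after bs s) (Membershipₚ.∈-++⁺ʳ ws (here ≡.refl))

      ws<b : ∀ {n} → n ∈ ws → position n < b
      ws<b = All.lookup (sorted-before ws middle-sorted)

      b<as : ∀ {n} → n ∈ as → b < position n
      b<as = All.lookup (sorted-after ws middle-sorted)

  Distinct : List Node → Set
  Distinct ns = ∀ {c} → (𝐀 , c) ∈ ns → (𝐁 , c) ∉ ns

  sorted-distinct : ∀ {ns} → Sorted ns → Distinct ns
  sorted-distinct (a ∷ s) (here ≡.refl) (there d∈)    = ℕₚ.<-irrefl ≡.refl (All.lookup a d∈)
  sorted-distinct (a ∷ s) (there c∈)    (here ≡.refl) = ℕₚ.<-irrefl ≡.refl (All.lookup a c∈)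
  sorted-distinct (a ∷ s) (there c∈)    (there d∈)    = sorted-distinct s c∈ d∈

  -- Every other 𝐀 lies right of a and every other 𝐁 left of b. The arc is chosen in 𝐀𝐁𝐀𝐁 and, by
  -- assumption, in 𝐀𝐀𝐁𝐁. A 𝐁 before a brings in 𝐁𝐀𝐀𝐁 and an 𝐀 after b brings in 𝐀𝐁𝐁𝐀, whence the
  -- crossing conditions; both together would give 𝐁𝐀𝐁𝐀, where the arc is rejected.
  forward-pair : ∀ bs {a} ws {b} as → let ns = bs ++ (𝐀 , a) ∷ ws ++ (𝐁 , b) ∷ as in
    aabb-nests ≡ true → All (Is 𝐁) bs → All (Is 𝐀) as →
    bs ≡ [] ⊎ baab-crosses ≡ true → as ≡ [] ⊎ abba-crosses ≡ true → bs ≡ [] ⊎ as ≡ [] →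
    Sorted ns → Complete ns → CorrectBelow ns →
    Sum ns ≈ x * (κ (letters (bs ++ ws ++ as)) + κ (letters (bs ++ (𝐀 , a) ∷ ws ++ as)) + κ (letters (bs ++ ws ++ (𝐁 , b) ∷ as)))
  forward-pair bs {a} ws {b} as r all𝐁 all𝐀 bs? as? one? s c ih =
    trans (remove-pair (↭-trans (Permₚ.shift _ bs _) (prep _ p₂)) (Permₚ.shift _ bs _) p₂
            (Sublistₚ.++⁺ ⊆-refl (skip _ (Sublistₚ.++⁺ ⊆-refl (skip _ ⊆-refl))))
            (Sublistₚ.++⁺ ⊆-refl (keep ≡.refl (Sublistₚ.++⁺ ⊆-refl (skip _ ⊆-refl))))
            (Sublistₚ.++⁺ ⊆-refl (skip _ ⊆-refl)) s c ih good)
          (*-congʳ (reflexive (weight-< (a<b {bs} s))))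
    where
    p₂ : bs ++ ws ++ (𝐁 , b) ∷ as ↭ (𝐁 , b) ∷ bs ++ ws ++ as
    p₂ = ↭-trans (Permₚ.++⁺ˡ bs (Permₚ.shift _ ws as)) (Permₚ.shift _ bs (ws ++ as))
    nonempty : ∀ {n : Node} {us} {P : Set} → n ∈ us → us ≡ [] ⊎ P → P
    nonempty () (inj₁ ≡.refl)
    nonempty n∈ (inj₂ p) = p
    a<b′ : a < b
    a<b′ = a<b {bs} s
    below : ∀ {d} → (𝐁 , d) ∈ bs ⊎ (𝐁 , d) ∈ ws → d < b
    below (inj₁ d∈) = ℕₚ.<-trans (bs<a {bs} s d∈) a<b′
    below (inj₂ d∈) = ws<b {bs} s d∈
    above : ∀ {c} → (𝐀 , c) ∈ ws ⊎ (𝐀 , c) ∈ as → a < c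
    above (inj₁ c∈) = a<ws {bs} s c∈
    above (inj₂ c∈) = a<as {bs} s c∈
    value : ∀ {c d} → (𝐀 , c) ∈ ws ⊎ (𝐀 , c) ∈ as → (𝐁 , d) ∈ bs ⊎ (𝐁 , d) ∈ ws → c ≢ d → inverse a c d b ≡ true
    value {c} {d} c∈ d∈ c≢d with ℕₚ.<-cmp c d
    ... | tri< c<d _ _ = ≡.trans (inverse-aabb (ℕₚ.<-trans (above c∈) c<d) c<d) r
    ... | tri≈ _ c≡d _ = ⊥-elim (c≢d c≡d)
    value (inj₁ c∈) (inj₁ d∈) _ | tri> _ _ d<c = ≡.trans (inverse-baab (bs<a {bs} s d∈) (a<ws {bs} s c∈) (ws<b {bs} s c∈)) (nonempty d∈ bs?)
    value (inj₁ c∈) (inj₂ d∈) _ | tri> _ _ d<c = inverse-abab (a<ws {bs} s d∈) d<c (ws<b {bs} s c∈)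
    value (inj₂ c∈) (inj₁ d∈) _ | tri> _ _ d<c with nonempty c∈ ([ inj₂ , inj₁ ]′ one?)
    value (inj₂ c∈) (inj₁ ()) _ | tri> _ _ d<c | ≡.refl
    value (inj₂ c∈) (inj₂ d∈) _ | tri> _ _ d<c = ≡.trans (inverse-abba (a<ws {bs} s d∈) (ws<b {bs} s d∈) (b<as {bs} s c∈)) (nonempty c∈ as?)
    locate𝐀 : ∀ {c} → (𝐀 , c) ∈ bs ++ ws ++ as → (𝐀 , c) ∈ ws ⊎ (𝐀 , c) ∈ as
    locate𝐀 c∈ = [ (λ p → ⊥-elim (not-𝐀 all𝐁 p)) , split-∈ ws ]′ (split-∈ bs c∈)
    locate𝐁 : ∀ {d} → (𝐁 , d) ∈ bs ++ ws ++ as → (𝐁 , d) ∈ bs ⊎ (𝐁 , d) ∈ ws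
    locate𝐁 d∈ = [ inj₁ , (λ p → [ inj₂ , (λ q → ⊥-elim (not-𝐁 all𝐀 q)) ]′ (split-∈ ws p)) ]′ (split-∈ bs d∈)
    good : ∀ {c d} → (𝐀 , c) ∈ bs ++ ws ++ as → (𝐁 , d) ∈ bs ++ ws ++ as → compatible (a , b) (c , d) ≡ true
    good c∈ d∈ = ≡.trans (compatible-> (above (locate𝐀 c∈)) (below (locate𝐁 d∈)))
      (value (locate𝐀 c∈) (locate𝐁 d∈) (λ { ≡.refl → sorted-distinct (sorted-⊆ (Sublistₚ.++⁺ {as = bs} ⊆-refl (skip _ (Sublistₚ.++⁺ {as = ws} ⊆-refl (skip _ ⊆-refl)))) s) c∈ d∈ }))

  backward-pair : ∀ us {b} mid {a} vs → let ns = us ++ (𝐁 , b) ∷ mid ++ (𝐀 , a) ∷ vs in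
    Sorted ns → Complete ns → CorrectBelow ns →
    (∀ {c d} → (𝐀 , c) ∈ us ++ mid ++ vs → (𝐁 , d) ∈ us ++ mid ++ vs → compatible (a , b) (c , d) ≡ true) →
    Sum ns ≈ y * (κ (letters (us ++ mid ++ vs)) + κ (letters (us ++ mid ++ (𝐀 , a) ∷ vs)) + κ (letters (us ++ (𝐁 , b) ∷ mid ++ vs)))
  backward-pair us {b} mid {a} vs s c ih good =
    trans (remove-pair (↭-trans (Permₚ.++⁺ˡ us (prep _ (Permₚ.shift _ mid vs))) (↭-trans (Permₚ.++⁺ˡ us (Perm.swap _ _ ↭-refl))
              (↭-trans (Permₚ.shift _ us _) (prep _ (Permₚ.shift _ us (mid ++ vs))))))
            (↭-trans (Permₚ.++⁺ˡ us (Permₚ.shift _ mid vs)) (Permₚ.shift _ us (mid ++ vs)))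
            (Permₚ.shift _ us (mid ++ vs))
            (Sublistₚ.++⁺ ⊆-refl (skip _ (Sublistₚ.++⁺ ⊆-refl (skip _ ⊆-refl))))
            (Sublistₚ.++⁺ ⊆-refl (skip _ ⊆-refl))
            (Sublistₚ.++⁺ ⊆-refl (keep ≡.refl (Sublistₚ.++⁺ ⊆-refl (skip _ ⊆-refl)))) s c ih good)
          (*-congʳ (reflexive (weight-> (All.lookup (sorted-after us s) (Membershipₚ.∈-++⁺ʳ mid (here ≡.refl))))))

decide : ∀ b → b ≡ true ⊎ b ≡ false
decide true  = inj₁ ≡.refl
decide false = inj₂ ≡.refl

-- Backward arcs that can be removed.

module Reduction (K : CommutativeRing 0ℓ 0ℓ) (x y : CommutativeRing.Carrier K) (ρ : Pattern)
                 (U : List Arc) (U! : Unique U) where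

  open CommutativeRing K hiding (zero)
  open Relation.Binary.Reasoning.Setoid setoid
  open IntegerSolver K
  open Canonical K x y
  open Compatibility ρ
  open Pattern ρ
  open Faces K x y ρ
  open Universe U U!
  open Counting K x y ρ U U!

  letters-++ : ∀ us vs → letters (us ++ vs) ≡ letters us ++ letters vs
  letters-++ = Listₚ.map-++ proj₁

  letters-𝐁^ : ∀ {bs} vs → All (Is 𝐁) bs → letters (bs ++ vs) ≡ 𝐁^ (length bs) ++ letters vs
  letters-𝐁^ {bs} vs all = ≡.trans (letters-++ bs vs) (≡.cong (_++ letters vs) (letters-all all))

  private
    reorder : ∀ a b c → a + b + c ≈ c + b + a
    reorder = solve 3 (λ a b c → a :+ b :+ c := c :+ b :+ a) refl

    exclude : ∀ {A B : Set} → A ⊎ B → ¬ A → B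
    exclude (inj₁ a) ¬a = ⊥-elim (¬a a)
    exclude (inj₂ b) ¬a = b

    not-false : ∀ {b} → b ≡ false → not b ≡ true
    not-false ≡.refl = ≡.refl

  -- No node lies between b and a. Two other nodes on different sides give 𝐀𝐁𝐀𝐁 or 𝐁𝐁𝐀𝐀, where
  -- nesting selects the inner arc. Two on the same side give 𝐁𝐀𝐁𝐀 or a mixed type, where the serial
  -- matching selects it; a mixed type occurs only on a side with both letters in the unfavourable
  -- order.
  adjacent-correct : ∀ us {b a} vs → let ns = us ++ (𝐁 , b) ∷ (𝐀 , a) ∷ vs in
    bbaa-nests ≡ true → All (Is 𝐁) us ⊎ abba-crosses ≡ false → All (Is 𝐀) vs ⊎ baab-crosses ≡ false →
    Sorted ns → Complete ns → CorrectBelow ns → Correct ns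
  adjacent-correct us {b} {a} vs nests us? vs? s c ih = begin
    Sum (us ++ (𝐁 , b) ∷ (𝐀 , a) ∷ vs)
      ≈⟨ backward-pair us [] vs s c ih (λ c∈ d∈ → good (split-∈ us c∈) (split-∈ us d∈) (λ { ≡.refl → sorted-distinct ms-sorted c∈ d∈ })) ⟩
    y * (κ (letters (us ++ vs)) + κ (letters (us ++ (𝐀 , a) ∷ vs)) + κ (letters (us ++ (𝐁 , b) ∷ vs)))
      ≡⟨ ≡.cong₂ (λ s t → y * (κ s + κ t + κ (letters (us ++ (𝐁 , b) ∷ vs)))) (letters-++ us vs) (letters-++ us _) ⟩
    y * (κ (w ++ v) + κ (w ++ 𝐀 ∷ v) + κ (letters (us ++ (𝐁 , b) ∷ vs)))
      ≡⟨ ≡.cong (λ s → y * (κ (w ++ v) + κ (w ++ 𝐀 ∷ v) + κ s)) (letters-++ us _) ⟩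
    y * (κ (w ++ v) + κ (w ++ 𝐀 ∷ v) + κ (w ++ 𝐁 ∷ v))
      ≈⟨ *-congˡ (reorder _ _ _) ⟩
    y * (κ (w ++ 𝐁 ∷ v) + κ (w ++ 𝐀 ∷ v) + κ (w ++ v))
      ≈⟨ Straight.pull κ-straight w v ⟨
    κ (w ++ 𝐁 ∷ 𝐀 ∷ v)
      ≡⟨ ≡.cong κ (letters-++ us _) ⟨
    κ (letters (us ++ (𝐁 , b) ∷ (𝐀 , a) ∷ vs)) ∎
    where
    w v : Word
    w = letters us
    v = letters vs
    ms-sorted : Sorted (us ++ vs)
    ms-sorted = sorted-⊆ (Sublistₚ.++⁺ {as = us} ⊆-refl (skip _ (skip _ ⊆-refl))) s
    tail-sorted : Sorted ((𝐁 , b) ∷ (𝐀 , a) ∷ vs)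
    tail-sorted = sorted-⊆ (Sublistₚ.++⁺ˡ us ⊆-refl) s
    us<b : ∀ {n} → n ∈ us → position n < b
    us<b = All.lookup (sorted-before us s)
    a<vs : ∀ {n} → n ∈ vs → a < position n
    a<vs = All.lookup (sorted-after ((𝐁 , b) ∷ []) tail-sorted)
    b<a : b < a
    b<a = All.lookup (sorted-after [] tail-sorted) (here ≡.refl)
    good : ∀ {c d} → (𝐀 , c) ∈ us ⊎ (𝐀 , c) ∈ vs → (𝐁 , d) ∈ us ⊎ (𝐁 , d) ∈ vs → c ≢ d → compatible (a , b) (c , d) ≡ true
    good {c} {d} (inj₁ c∈) (inj₁ d∈) c≢d = ≡.trans (compatible-sym (a , b) (c , d))
      (≡.trans (compatible-< (ℕₚ.<-trans (us<b c∈) b<a) (us<b d∈)) (not-false (value (ℕₚ.<-cmp c d))))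
      where
      value : _ → inverse c a d b ≡ false
      value (tri< c<d _ _) = ≡.trans (inverse-abba c<d (us<b d∈) b<a) (exclude us? (λ all → not-𝐀 all c∈))
      value (tri≈ _ c≡d _) = ⊥-elim (c≢d c≡d)
      value (tri> _ _ d<c) = inverse-baba d<c (us<b c∈) b<a
    good {c} {d} (inj₁ c∈) (inj₂ d∈) _ = ≡.trans (compatible-sym (a , b) (c , d))
      (≡.trans (compatible-> (ℕₚ.<-trans (us<b c∈) b<a) (ℕₚ.<-trans b<a (a<vs d∈))) (inverse-abab (us<b c∈) b<a (a<vs d∈)))
    good (inj₂ c∈) (inj₁ d∈) _ = ≡.trans (compatible-> (a<vs c∈) (us<b d∈)) (≡.trans (inverse-bbaa (ℕₚ.<-trans (us<b d∈) b<a) b<a) nests)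
    good {c} {d} (inj₂ c∈) (inj₂ d∈) c≢d =
      ≡.trans (compatible-< (a<vs c∈) (ℕₚ.<-trans b<a (a<vs d∈))) (not-false (value (ℕₚ.<-cmp c d)))
      where
      value : _ → inverse a c b d ≡ false
      value (tri< c<d _ _) = ≡.trans (inverse-baab b<a (a<vs c∈) c<d) (exclude vs? (λ all → not-𝐁 all d∈))
      value (tri≈ _ c≡d _) = ⊥-elim (c≢d c≡d)
      value (tri> _ _ d<c) = inverse-baba b<a (a<vs d∈) d<c

  -- If 𝐁𝐁𝐀𝐀 crosses, the first 𝐁 goes with the first 𝐀. All other 𝐀s lie right of a, so the only
  -- further types are 𝐁𝐀𝐀𝐁 and 𝐁𝐀𝐁𝐀.
  first-crossing : ∀ {b} bs {a} vs → let ns = (𝐁 , b) ∷ bs ++ (𝐀 , a) ∷ vs in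
    bbaa-nests ≡ false → All (Is 𝐁) bs → All (Is 𝐀) vs ⊎ baab-crosses ≡ false →
    Sorted ns → Complete ns → CorrectBelow ns → Correct ns
  first-crossing {b} bs {a} vs crosses all𝐁 vs? s c ih = begin
    Sum ((𝐁 , b) ∷ bs ++ (𝐀 , a) ∷ vs)
      ≈⟨ backward-pair [] bs vs s c ih (λ c∈ d∈ → good (exclude (split-∈ bs c∈) (not-𝐀 all𝐁)) (split-∈ bs d∈) (λ { ≡.refl → sorted-distinct ms-sorted c∈ d∈ })) ⟩
    y * (κ (letters (bs ++ vs)) + κ (letters (bs ++ (𝐀 , a) ∷ vs)) + κ (𝐁 ∷ letters (bs ++ vs)))
      ≡⟨ ≡.cong₂ (λ s t → y * (κ s + κ t + κ (𝐁 ∷ s))) (letters-𝐁^ vs all𝐁) (letters-𝐁^ _ all𝐁) ⟩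
    y * (κ (𝐁^ k ++ v) + κ (𝐁^ k ++ 𝐀 ∷ v) + κ (𝐁 ∷ 𝐁^ k ++ v))
      ≡⟨ ≡.cong (λ t → y * (κ (𝐁^ k ++ v) + κ (𝐁^ k ++ 𝐀 ∷ v) + κ t)) (replicate-shift k 𝐁 v) ⟨
    y * (κ (𝐁^ k ++ v) + κ (𝐁^ k ++ 𝐀 ∷ v) + κ (𝐁^ k ++ 𝐁 ∷ v))
      ≈⟨ *-congˡ (reorder _ _ _) ⟩
    y * (κ (𝐁^ k ++ 𝐁 ∷ v) + κ (𝐁^ k ++ 𝐀 ∷ v) + κ (𝐁^ k ++ v))
      ≈⟨ Straight.pull κ-straight (𝐁^ k) v ⟨
    κ (𝐁^ k ++ 𝐁 ∷ 𝐀 ∷ v)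
      ≡⟨ ≡.cong κ (≡.trans (replicate-shift k 𝐁 (𝐀 ∷ v)) (≡.cong (𝐁 ∷_) (≡.sym (letters-𝐁^ ((𝐀 , a) ∷ vs) all𝐁)))) ⟩
    κ (letters ((𝐁 , b) ∷ bs ++ (𝐀 , a) ∷ vs)) ∎
    where
    k : ℕ
    k = length bs
    v : Word
    v = letters vs
    ms-sorted : Sorted (bs ++ vs)
    ms-sorted = sorted-⊆ (skip _ (Sublistₚ.++⁺ {as = bs} ⊆-refl (skip _ ⊆-refl))) s
    bs<a : ∀ {n} → n ∈ bs → position n < a
    bs<a n∈ = All.lookup (sorted-before ((𝐁 , b) ∷ bs) s) (there n∈)
    b<bs : ∀ {n} → n ∈ bs → b < position n
    b<bs n∈ = All.lookup (sorted-after [] s) (Membershipₚ.∈-++⁺ˡ n∈)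
    b<a : b < a
    b<a = All.lookup (sorted-before ((𝐁 , b) ∷ bs) s) (here ≡.refl)
    a<vs : ∀ {n} → n ∈ vs → a < position n
    a<vs = All.lookup (sorted-after ((𝐁 , b) ∷ bs) s)
    good : ∀ {c d} → (𝐀 , c) ∈ vs → (𝐁 , d) ∈ bs ⊎ (𝐁 , d) ∈ vs → c ≢ d → compatible (a , b) (c , d) ≡ true
    good c∈ (inj₁ d∈) _ = ≡.trans (compatible-< (a<vs c∈) (b<bs d∈)) (not-false (≡.trans (inverse-bbaa b<a (bs<a d∈)) crosses))
    good {c} {d} c∈ (inj₂ d∈) c≢d = ≡.trans (compatible-< (a<vs c∈) (ℕₚ.<-trans b<a (a<vs d∈))) (not-false (value (ℕₚ.<-cmp c d)))
      where
      value : _ → inverse a c b d ≡ false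
      value (tri< c<d _ _) = ≡.trans (inverse-baab b<a (a<vs c∈) c<d) (exclude vs? (λ all → not-𝐁 all d∈))
      value (tri≈ _ c≡d _) = ⊥-elim (c≢d c≡d)
      value (tri> _ _ d<c) = inverse-baba b<a (a<vs d∈) d<c

  -- The mirror situation: the last 𝐁 goes with the last 𝐀, and every other 𝐁 lies left of b.
  last-crossing : ∀ us {b} as {a} → let ns = us ++ (𝐁 , b) ∷ as ++ (𝐀 , a) ∷ [] in
    bbaa-nests ≡ false → All (Is 𝐀) as → abba-crosses ≡ false →
    Sorted ns → Complete ns → CorrectBelow ns → Correct ns
  last-crossing us {b} as {a} crosses all𝐀 uncrossed s c ih = begin
    Sum (us ++ (𝐁 , b) ∷ as ++ (𝐀 , a) ∷ [])
      ≈⟨ backward-pair us as [] s c ih (λ c∈ d∈ → good (split c∈) (exclude′ (split d∈) (not-𝐁 all𝐀)) (λ { ≡.refl → sorted-distinct ms-sorted c∈ d∈ })) ⟩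
    y * (κ (letters (us ++ as ++ [])) + κ (letters (us ++ as ++ (𝐀 , a) ∷ [])) + κ (letters (us ++ (𝐁 , b) ∷ as ++ [])))
      ≡⟨ ≡.cong₂ (λ s t → y * (κ s + κ (letters (us ++ as ++ (𝐀 , a) ∷ [])) + κ t)) (word _ (≡.trans (≡.cong letters (Listₚ.++-identityʳ as)) (letters-all all𝐀)))
           (word ((𝐁 , b) ∷ as ++ []) (≡.cong (𝐁 ∷_) (≡.trans (≡.cong letters (Listₚ.++-identityʳ as)) (letters-all all𝐀)))) ⟩
    y * (κ (w ++ 𝐀^ k) + κ (letters (us ++ as ++ (𝐀 , a) ∷ [])) + κ (w ++ 𝐁 ∷ 𝐀^ k))
      ≡⟨ ≡.cong (λ t → y * (κ (w ++ 𝐀^ k) + κ t + κ (w ++ 𝐁 ∷ 𝐀^ k))) (word _ as-a) ⟩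
    y * (κ (w ++ 𝐀^ k) + κ (w ++ 𝐀 ∷ 𝐀^ k) + κ (w ++ 𝐁 ∷ 𝐀^ k))
      ≈⟨ *-congˡ (reorder _ _ _) ⟩
    y * (κ (w ++ 𝐁 ∷ 𝐀^ k) + κ (w ++ 𝐀 ∷ 𝐀^ k) + κ (w ++ 𝐀^ k))
      ≈⟨ Straight.pull κ-straight w (𝐀^ k) ⟨
    κ (w ++ 𝐁 ∷ 𝐀 ∷ 𝐀^ k)
      ≡⟨ ≡.cong κ (word ((𝐁 , b) ∷ as ++ (𝐀 , a) ∷ []) (≡.cong (𝐁 ∷_) as-a)) ⟨
    κ (letters (us ++ (𝐁 , b) ∷ as ++ (𝐀 , a) ∷ [])) ∎
    where
    k : ℕ
    k = length as
    w : Word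
    w = letters us
    word : ∀ vs {v} → letters vs ≡ v → letters (us ++ vs) ≡ w ++ v
    word vs ≡.refl = letters-++ us vs
    as-a : letters (as ++ (𝐀 , a) ∷ []) ≡ 𝐀 ∷ 𝐀^ k
    as-a = ≡.trans (letters-++ as _) (≡.trans (≡.cong (_++ 𝐀 ∷ []) (letters-all all𝐀))
      (≡.trans (replicate-shift k 𝐀 []) (≡.cong (𝐀 ∷_) (Listₚ.++-identityʳ _))))
    split : ∀ {n : Node} → n ∈ us ++ as ++ [] → n ∈ us ⊎ n ∈ as
    split n∈ = [ inj₁ , (λ p → inj₂ (≡.subst (_ ∈_) (Listₚ.++-identityʳ as) p)) ]′ (split-∈ us n∈)
    exclude′ : ∀ {A B : Set} → A ⊎ B → ¬ B → A
    exclude′ (inj₁ a) ¬b = a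
    exclude′ (inj₂ b) ¬b = ⊥-elim (¬b b)
    ms-sorted : Sorted (us ++ as ++ [])
    ms-sorted = sorted-⊆ (Sublistₚ.++⁺ {as = us} ⊆-refl (skip _ (Sublistₚ.++⁺ {as = as} ⊆-refl (skip _ ⊆-refl)))) s
    tail-sorted : Sorted ((𝐁 , b) ∷ as ++ (𝐀 , a) ∷ [])
    tail-sorted = sorted-⊆ (Sublistₚ.++⁺ˡ us ⊆-refl) s
    us<b : ∀ {n} → n ∈ us → position n < b
    us<b = All.lookup (sorted-before us s)
    b<as : ∀ {n} → n ∈ as → b < position n
    b<as n∈ = All.lookup (sorted-after us s) (Membershipₚ.∈-++⁺ˡ n∈)
    as<a : ∀ {n} → n ∈ as → position n < a
    as<a n∈ = All.lookup (sorted-before ((𝐁 , b) ∷ as) tail-sorted) (there n∈)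
    b<a : b < a
    b<a = All.lookup (sorted-after us s) (Membershipₚ.∈-++⁺ʳ as (here ≡.refl))
    good : ∀ {c d} → (𝐀 , c) ∈ us ⊎ (𝐀 , c) ∈ as → (𝐁 , d) ∈ us → c ≢ d → compatible (a , b) (c , d) ≡ true
    good {c} {d} (inj₂ c∈) d∈ _ = ≡.trans (compatible-sym (a , b) (c , d)) (≡.trans (compatible-< (as<a c∈) (us<b d∈))
      (not-false (≡.trans (inverse-bbaa (ℕₚ.<-trans (us<b d∈) (b<as c∈)) (b<as c∈)) crosses)))
    good {c} {d} (inj₁ c∈) d∈ c≢d = ≡.trans (compatible-sym (a , b) (c , d)) (≡.trans (compatible-< (ℕₚ.<-trans (us<b c∈) b<a) (us<b d∈)) (not-false (value (ℕₚ.<-cmp c d))))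
      where
      value : _ → inverse c a d b ≡ false
      value (tri< c<d _ _) = ≡.trans (inverse-abba c<d (us<b d∈) b<a) uncrossed
      value (tri≈ _ c≡d _) = ⊥-elim (c≢d c≡d)
      value (tri> _ _ d<c) = inverse-baba d<c (us<b c∈) b<a

  first-correct : ∀ {n} bs {a} vs → let ns = n ∷ bs ++ (𝐀 , a) ∷ vs in
    All (Is 𝐁) (n ∷ bs) → All (Is 𝐀) vs ⊎ baab-crosses ≡ false → Sorted ns → Complete ns → CorrectBelow ns → Correct ns
  first-correct {n} bs {a} vs all𝐁 vs? = [ nested (initLast (n ∷ bs)) (λ ()) all𝐁 , crossed all𝐁 ]′ (decide bbaa-nests)
    where
    Goal : List Node → Set
    Goal ns = Sorted ns → Complete ns → CorrectBelow ns → Correct ns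
    nested : ∀ {bs} → InitLast bs → bs ≢ [] → All (Is 𝐁) bs → bbaa-nests ≡ true → Goal (bs ++ (𝐀 , a) ∷ vs)
    nested []               ne all t = ⊥-elim (ne ≡.refl)
    nested (bs ∷ʳ′ (𝐁 , b)) ne all t = ≡.subst Goal (≡.sym (Listₚ.++-assoc bs _ _)) (adjacent-correct bs vs t (inj₁ (Allₚ.++⁻ˡ bs all)) vs?)
    nested (bs ∷ʳ′ (𝐀 , b)) ne all t = ⊥-elim (not-𝐀 all (Membershipₚ.∈-++⁺ʳ bs (here ≡.refl)))
    crossed : All (Is 𝐁) (n ∷ bs) → bbaa-nests ≡ false → Goal (n ∷ bs ++ (𝐀 , a) ∷ vs)
    crossed (≡.refl ∷ all) f = first-crossing bs vs f all vs?

  last-correct : ∀ us {b} n as → let ns = us ++ (𝐁 , b) ∷ n ∷ as in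
    All (Is 𝐀) (n ∷ as) → abba-crosses ≡ false →
    Sorted ns → Complete ns → CorrectBelow ns → Correct ns
  last-correct us {b} n as all𝐀 uncrossed = [ nested all𝐀 , crossed (initLast (n ∷ as)) (λ ()) all𝐀 ]′ (decide bbaa-nests)
    where
    Goal : List Node → Set
    Goal ns = Sorted ns → Complete ns → CorrectBelow ns → Correct ns
    nested : All (Is 𝐀) (n ∷ as) → bbaa-nests ≡ true → Goal (us ++ (𝐁 , b) ∷ n ∷ as)
    nested (≡.refl ∷ all) t = adjacent-correct us as t (inj₂ uncrossed) (inj₁ all)
    crossed : ∀ {as} → InitLast as → as ≢ [] → All (Is 𝐀) as → bbaa-nests ≡ false → Goal (us ++ (𝐁 , b) ∷ as)
    crossed []               ne all f = ⊥-elim (ne ≡.refl)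
    crossed (as ∷ʳ′ (𝐀 , a)) ne all f = last-crossing us as f (Allₚ.++⁻ˡ as all) uncrossed
    crossed (as ∷ʳ′ (𝐁 , a)) ne all f = ⊥-elim (not-𝐁 all (Membershipₚ.∈-++⁺ʳ as (here ≡.refl)))

-- The recursion when 𝐀𝐀𝐁𝐁 nests.

module NestingForward (K : CommutativeRing 0ℓ 0ℓ) (x y : CommutativeRing.Carrier K) (ρ : Pattern)
                      (U : List Arc) (U! : Unique U) where

  open CommutativeRing K hiding (zero)
  open Relation.Binary.Reasoning.Setoid setoid
  open IntegerSolver K
  open Canonical K x y
  open Pattern ρ
  open Faces K x y ρ
  open Universe U U!
  open Counting K x y ρ U U!
  open Reduction K x y ρ U U!

  private
    permute : ∀ a b c → a + b + c ≈ c + b + a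
    permute = solve 3 (λ a b c → a :+ b :+ c := c :+ b :+ a) refl

  front-correct : ∀ bs {a} ws {b} → let ns = bs ++ (𝐀 , a) ∷ ws ++ (𝐁 , b) ∷ [] in
    aabb-nests ≡ true → All (Is 𝐁) bs → bs ≡ [] ⊎ baab-crosses ≡ true →
    Sorted ns → Complete ns → CorrectBelow ns → Correct ns
  front-correct bs {a} ws {b} r all𝐁 bs? s c ih = begin
    Sum (bs ++ (𝐀 , a) ∷ ws ++ (𝐁 , b) ∷ [])
      ≈⟨ forward-pair bs ws [] r all𝐁 [] bs? (inj₁ ≡.refl) (inj₂ ≡.refl) s c ih ⟩
    x * (κ (letters (bs ++ ws ++ [])) + κ (letters (bs ++ (𝐀 , a) ∷ ws ++ [])) + κ (letters (bs ++ ws ++ (𝐁 , b) ∷ [])))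
      ≡⟨ ≡.cong (λ z → x * (κ (letters (bs ++ z)) + κ (letters (bs ++ (𝐀 , a) ∷ z)) + κ (letters (bs ++ ws ++ (𝐁 , b) ∷ [])))) (Listₚ.++-identityʳ ws) ⟩
    x * (κ (letters (bs ++ ws)) + κ (letters (bs ++ (𝐀 , a) ∷ ws)) + κ (letters (bs ++ ws ++ (𝐁 , b) ∷ [])))
      ≡⟨ ≡.cong₂ (λ s t → x * (κ s + κ t + κ (letters (bs ++ ws ++ (𝐁 , b) ∷ [])))) (letters-𝐁^ ws all𝐁) (letters-𝐁^ ((𝐀 , a) ∷ ws) all𝐁) ⟩
    x * (κ (𝐁^ k ++ w) + κ (𝐁^ k ++ 𝐀 ∷ w) + κ (letters (bs ++ ws ++ (𝐁 , b) ∷ [])))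
      ≡⟨ ≡.cong (λ t → x * (κ (𝐁^ k ++ w) + κ (𝐁^ k ++ 𝐀 ∷ w) + κ t)) (≡.trans (letters-𝐁^ (ws ++ _) all𝐁) (≡.cong (𝐁^ k ++_) (letters-++ ws _))) ⟩
    x * (κ (𝐁^ k ++ w) + κ (𝐁^ k ++ 𝐀 ∷ w) + κ (𝐁^ k ++ w ++ 𝐁 ∷ []))
      ≈⟨ *-congˡ (permute _ _ _) ⟩
    x * (κ (𝐁^ k ++ w ++ 𝐁 ∷ []) + κ (𝐁^ k ++ 𝐀 ∷ w) + κ (𝐁^ k ++ w))
      ≈⟨ κ-first𝐀-last𝐁 k w ⟨
    κ (𝐁^ k ++ 𝐀 ∷ w ++ 𝐁 ∷ [])
      ≡⟨ ≡.cong κ (≡.trans (letters-𝐁^ _ all𝐁) (≡.cong (λ z → 𝐁^ k ++ 𝐀 ∷ z) (letters-++ ws _))) ⟨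
    κ (letters (bs ++ (𝐀 , a) ∷ ws ++ (𝐁 , b) ∷ [])) ∎
    where
    k : ℕ
    k = length bs
    w : Word
    w = letters ws

  back-correct : ∀ {a} ws {b} as → let ns = (𝐀 , a) ∷ ws ++ (𝐁 , b) ∷ as in
    aabb-nests ≡ true → All (Is 𝐀) as → abba-crosses ≡ true →
    Sorted ns → Complete ns → CorrectBelow ns → Correct ns
  back-correct {a} ws {b} as r all𝐀 p s c ih = begin
    Sum ((𝐀 , a) ∷ ws ++ (𝐁 , b) ∷ as)
      ≈⟨ forward-pair [] ws as r [] all𝐀 (inj₁ ≡.refl) (inj₂ p) (inj₁ ≡.refl) s c ih ⟩
    x * (κ (letters (ws ++ as)) + κ (𝐀 ∷ letters (ws ++ as)) + κ (letters (ws ++ (𝐁 , b) ∷ as)))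
      ≡⟨ ≡.cong₂ (λ s t → x * (κ s + κ (𝐀 ∷ s) + κ t)) (word as (letters-all all𝐀)) (word ((𝐁 , b) ∷ as) (≡.cong (𝐁 ∷_) (letters-all all𝐀))) ⟩
    x * (κ (w ++ 𝐀^ k) + κ (𝐀 ∷ w ++ 𝐀^ k) + κ (w ++ 𝐁 ∷ 𝐀^ k))
      ≈⟨ *-congˡ (permute _ _ _) ⟩
    x * (κ (w ++ 𝐁 ∷ 𝐀^ k) + κ (𝐀 ∷ w ++ 𝐀^ k) + κ (w ++ 𝐀^ k))
      ≈⟨ κ-first𝐀-last𝐁′ k w ⟨
    κ (𝐀 ∷ w ++ 𝐁 ∷ 𝐀^ k)
      ≡⟨ ≡.cong (λ z → κ (𝐀 ∷ z)) (word ((𝐁 , b) ∷ as) (≡.cong (𝐁 ∷_) (letters-all all𝐀))) ⟨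
    κ (letters ((𝐀 , a) ∷ ws ++ (𝐁 , b) ∷ as)) ∎
    where
    k : ℕ
    k = length as
    w : Word
    w = letters ws
    word : ∀ vs {v} → letters vs ≡ v → letters (ws ++ vs) ≡ w ++ v
    word vs ≡.refl = letters-++ ws vs

  -- The one configuration without a preferred arc, kept as a hypothesis: it is void unless both
  -- mixed types cross, and is supplied separately for the pattern in which they do.
  Crossing : Set
  Crossing = ∀ {n} bs {a} ws {b} {m} as → let ns = (n ∷ bs) ++ (𝐀 , a) ∷ ws ++ (𝐁 , b) ∷ m ∷ as in
    abba-crosses ≡ true → baab-crosses ≡ true → All (Is 𝐁) (n ∷ bs) → All (Is 𝐀) (m ∷ as) →
    Sorted ns → Complete ns → CorrectBelow ns → Correct ns

  κ-𝐀^ : ∀ p → κ (𝐀^ suc p) ≡ 0#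
  κ-𝐀^ p = ≡.trans (≡.cong κ (≡.sym (Listₚ.++-identityʳ (𝐀^ suc p)))) (κ-𝐀^𝐁^ (suc p) 0)

  all𝐁-correct : ∀ {ns} → All (Is 𝐁) ns → Correct ns
  all𝐁-correct {[]}     []  = Sum-[]
  all𝐁-correct {n ∷ ns} all = trans (Sum-all𝐁 all) (reflexive (≡.sym (≡.trans (≡.cong κ (letters-all all)) (κ-𝐁^ (length ns)))))

  all𝐀-correct : ∀ {n ns} → All (Is 𝐀) (n ∷ ns) → Correct (n ∷ ns)
  all𝐀-correct {n} {ns} all = trans (Sum-all𝐀 all) (reflexive (≡.sym (≡.trans (≡.cong κ (letters-all all)) (κ-𝐀^ (length ns)))))

  module _ (r : aabb-nests ≡ true) (crossing : Crossing) where

    private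
      Goal : List Node → Set
      Goal ns = Sorted ns → Complete ns → CorrectBelow ns → Correct ns

      -- An outer run of 𝐁s or 𝐀s either has a crossing mixed type and tolerates the arc from the
      -- first 𝐀 to the last 𝐁, or has a serial one and yields a removable backward arc at its
      -- border.
      mixed : ∀ bs {a} ws {b} as → All (Is 𝐁) bs → All (Is 𝐀) as → Goal (bs ++ (𝐀 , a) ∷ ws ++ (𝐁 , b) ∷ as)
      mixed []       ws []       all𝐁 all𝐀 = front-correct [] ws r all𝐁 (inj₁ ≡.refl)
      mixed (n ∷ bs) ws []       all𝐁 all𝐀 with decide baab-crosses
      ... | inj₁ q = front-correct (n ∷ bs) ws r all𝐁 (inj₂ q)
      ... | inj₂ q = first-correct bs _ all𝐁 (inj₂ q)
      mixed []       ws (m ∷ as) all𝐁 all𝐀 with decide abba-crosses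
      ... | inj₁ p = back-correct ws (m ∷ as) r all𝐀 p
      ... | inj₂ p = last-correct (_ ∷ ws) m as all𝐀 p
      mixed (n ∷ bs) ws (m ∷ as) all𝐁 all𝐀 with decide baab-crosses | decide abba-crosses
      ... | inj₂ q | _      = first-correct bs _ all𝐁 (inj₂ q)
      ... | inj₁ q | inj₁ p = crossing bs ws as p q all𝐁 all𝐀
      ... | inj₁ q | inj₂ p = ≡.subst Goal (Listₚ.++-assoc (n ∷ bs) (_ ∷ ws) _) (last-correct (n ∷ bs ++ _ ∷ ws) m as all𝐀 p)

      step : ∀ ns → Goal ns
      step ns with first𝐀 ns
      ... | inj₁ all𝐁 = λ _ _ _ → all𝐁-correct all𝐁
      ... | inj₂ (bs , a , vs , ≡.refl , all𝐁) with last𝐁 vs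
      ...   | inj₂ (ws , b , as , ≡.refl , all𝐀) = mixed bs ws as all𝐁 all𝐀
      step _ | inj₂ ([]     , a , vs , ≡.refl , all𝐁) | inj₁ all𝐀 = λ _ _ _ → all𝐀-correct (≡.refl ∷ all𝐀)
      step _ | inj₂ (n ∷ bs , a , vs , ≡.refl , all𝐁) | inj₁ all𝐀 = first-correct bs vs all𝐁 (inj₁ all𝐀)

    nesting-correct : ∀ {ns} → Sorted ns → Complete ns → Correct ns
    nesting-correct {ns} = go (suc (length ns)) ℕₚ.≤-refl
      where
      go : ∀ k {ns} → length ns < k → Sorted ns → Complete ns → Correct ns
      go (suc k) {ns} (s≤s le) s c = step ns s c (λ lt s′ c′ → go k (ℕₚ.<-≤-trans lt le) s′ c′)

-- Comparison of patterns on the arcs of nonzero weight.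

module WeightLemmas (K : CommutativeRing 0ℓ 0ℓ) where

  open CommutativeRing K hiding (zero)
  open SubsetSums K

  wt-zero : ∀ {x y} {P : Arc → Set} → (∀ {α} → P α → Weights.weight K x y α ≈ 0#) → ∀ {σ} → Any P σ → Weights.wt K x y σ ≈ 0#
  wt-zero z (here p)  = trans (*-congʳ (z p)) (zeroˡ _)
  wt-zero z (there p) = trans (*-congˡ (wt-zero z p)) (zeroʳ _)

  wt-cong : ∀ {x y x′ y′} {P : Arc → Set} → (∀ {α} → P α → Weights.weight K x y α ≈ Weights.weight K x′ y′ α) →
            ∀ {σ} → All P σ → Weights.wt K x y σ ≈ Weights.wt K x′ y′ σ
  wt-cong w []       = refl
  wt-cong w (p ∷ ps) = *-cong (w p) (wt-cong w ps)

  -- A set with an arc outside `P` has weight zero for either pattern, so only compatibility within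
  -- `P` matters.
  transfer : ∀ {x y} {P : Arc → Set} → (∀ α → Dec (P α)) → (∀ {α} → ¬ P α → Weights.weight K x y α ≈ 0#) →
    ∀ ρ ρ′ U (U! : Unique U) {ns} →
    (∀ {α β} → P α → P β → Inside ns α → Inside ns β → Compatibility.compatible ρ α β ≡ Compatibility.compatible ρ′ α β) →
    Faces.Universe.Sum K x y ρ U U! ns ≈ Faces.Universe.Sum K x y ρ′ U U! ns
  transfer {x} {y} {P} P? zero-weight ρ ρ′ U U! {ns} agree = Σ⊆-cong U pointwise
    where
    module V  = Validity ρ
    module V′ = Validity ρ′
    pointwise : ∀ σ → Faces.face K x y ρ ns σ ≈ Faces.face K x y ρ′ ns σ
    pointwise σ with All.all? P? σ
    ... | yes all = *-congʳ (ind-⇔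
      (λ v → V′.valid (V.inside v) (λ α∈ β∈ → ≡.trans (≡.sym (agree (All.lookup all α∈) (All.lookup all β∈) (V.inside v α∈) (V.inside v β∈))) (V.clique v α∈ β∈)) (V.covers v))
      (λ v → V.valid (V′.inside v) (λ α∈ β∈ → ≡.trans (agree (All.lookup all α∈) (All.lookup all β∈) (V′.inside v α∈) (V′.inside v β∈)) (V′.clique v α∈ β∈)) (V′.covers v))
      (V.valid? ns σ) (V′.valid? ns σ))
    ... | no ¬all = trans (trans (*-congˡ z) (zeroʳ _)) (sym (trans (*-congˡ z) (zeroʳ _)))
      where
      z : Weights.wt K x y σ ≈ 0#
      z = wt-zero zero-weight (Allₚ.¬All⇒Any¬ P? σ ¬all)

module Agreement (ρ ρ′ : Pattern) where

  private
    module C  = Compatibility ρ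
    module C′ = Compatibility ρ′

  -- The rule is read off the order-preserving matching, so `R` has to contain it whenever it
  -- contains the reversing one.
  agreement : (R : ℕ → ℕ → Set) →
    (∀ {a c b d} → a < c → d < b → R a b → R c d → R a d × R c b) →
    (∀ {a c b d} → a < c → b < d → R a b → R c d → C.inverse a c b d ≡ C′.inverse a c b d) →
    ∀ {a b c d} → R a b → R c d → C.compatible (a , b) (c , d) ≡ C′.compatible (a , b) (c , d)
  agreement R exch inv {a} {b} {c} {d} r₁ r₂ with ℕₚ.<-cmp a c | ℕₚ.<-cmp b d
  ... | tri≈ _ ≡.refl _ | _ = ≡.trans (C.compatible-≡ˡ a b d) (≡.sym (C′.compatible-≡ˡ a b d))
  ... | tri< _ _ _ | tri≈ _ ≡.refl _ = ≡.trans (C.compatible-≡ʳ a c b) (≡.sym (C′.compatible-≡ʳ a c b))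
  ... | tri> _ _ _ | tri≈ _ ≡.refl _ = ≡.trans (C.compatible-≡ʳ a c b) (≡.sym (C′.compatible-≡ʳ a c b))
  ... | tri< a<c _ _ | tri< b<d _ _ = ≡.trans (C.compatible-< a<c b<d) (≡.trans (≡.cong not (inv a<c b<d r₁ r₂)) (≡.sym (C′.compatible-< a<c b<d)))
  ... | tri< a<c _ _ | tri> _ _ d<b = let r , r′ = exch a<c d<b r₁ r₂ in
    ≡.trans (C.compatible-> a<c d<b) (≡.trans (inv a<c d<b r r′) (≡.sym (C′.compatible-> a<c d<b)))
  ... | tri> _ _ c<a | tri< b<d _ _ = let r , r′ = exch c<a b<d r₂ r₁ in
    ≡.trans (C.compatible-sym (a , b) (c , d)) (≡.trans (≡.trans (C.compatible-> c<a b<d) (≡.trans (inv c<a b<d r r′) (≡.sym (C′.compatible-> c<a b<d)))) (C′.compatible-sym (c , d) (a , b)))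
  ... | tri> _ _ c<a | tri> _ _ d<b =
    ≡.trans (C.compatible-sym (a , b) (c , d)) (≡.trans (≡.trans (C.compatible-< c<a d<b) (≡.trans (≡.cong not (inv c<a d<b r₂ r₁)) (≡.sym (C′.compatible-< c<a d<b)))) (C′.compatible-sym (c , d) (a , b)))

  -- The ends of two disjoint backward arcs form 𝐁𝐁𝐀𝐀 or 𝐁𝐀𝐁𝐀, and the latter has the same rule in
  -- every pattern.
  agreement-backward : Pattern.bbaa-nests ρ ≡ Pattern.bbaa-nests ρ′ → ∀ {a b c d} → b < a → d < c →
                       C.compatible (a , b) (c , d) ≡ C′.compatible (a , b) (c , d)
  agreement-backward eq = agreement (λ a b → b < a)
    (λ a<c d<b b<a d<c → ℕₚ.<-trans d<b b<a , ℕₚ.<-trans b<a a<c) inv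
    where
    inv : ∀ {a c b d} → a < c → b < d → b < a → d < c → C.inverse a c b d ≡ C′.inverse a c b d
    inv a<c b<d b<a d<c rewrite >⇒<ᵇ≡false b<a | <⇒<ᵇ≡true d<c | eq = ≡.refl

  agreement-forward : Pattern.aabb-nests ρ ≡ Pattern.aabb-nests ρ′ → ∀ {a b c d} → a < b → c < d →
                      C.compatible (a , b) (c , d) ≡ C′.compatible (a , b) (c , d)
  agreement-forward eq = agreement (λ a b → a < b)
    (λ a<c d<b a<b c<d → ℕₚ.<-trans a<c c<d , ℕₚ.<-trans c<d d<b) inv
    where
    inv : ∀ {a c b d} → a < c → b < d → a < b → c < d → C.inverse a c b d ≡ C′.inverse a c b d
    inv a<c b<d a<b c<d rewrite <⇒<ᵇ≡true a<b | <⇒<ᵇ≡true c<d | eq = ≡.refl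

-- The exceptional case: both mixed types cross and the word has the form 𝐁...𝐀.

Backward : Arc → Set
Backward (a , b) = b < a

backward? : ∀ α → Dec (Backward α)
backward? (a , b) = b ℕₚ.<? a

ρ₁ : Pattern
ρ₁ = pattern′ true true true true

-- Inside the box the first 𝐀 is a, the last 𝐁 is b, the first 𝐁 is h and the last 𝐀 is t.
module Box {a b h t : ℕ} (h<a : h < a) (a<b : a < b) (b<t : b < t) where

  open Compatibility ρ₁
  open Validity ρ₁

  -- The corners themselves may be absent, so that the lists left after deleting nodes satisfy the
  -- same bounds.
  Bounded : List Node → Set
  Bounded ns = (∀ {c} → (𝐀 , c) ∈ ns → a ≤ c × c ≤ t × c ≢ b) × (∀ {d} → (𝐁 , d) ∈ ns → h ≤ d × d ≤ b × d ≢ a) × Distinct ns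
    where
    Distinct : List Node → Set
    Distinct ns = ∀ {c} → (𝐀 , c) ∈ ns → (𝐁 , c) ∉ ns

  private

    clash : ∀ {b} → b ≡ true → b ≡ false → ⊥
    clash ≡.refl ()

    not-true : ∀ {b} → not b ≡ true → b ≡ false
    not-true {false} _ = ≡.refl

    ≤-case : ∀ {m n} → m ≤ n → m ≢ n → m < n
    ≤-case = ℕₚ.≤∧≢⇒<

  inner-outer : compatible (a , b) (t , h) ≡ false
  inner-outer = ≡.trans (compatible-> (ℕₚ.<-trans a<b b<t) (ℕₚ.<-trans h<a a<b)) (inverse-baba h<a a<b b<t)

  -- With all flags true, 𝐁𝐀𝐁𝐀 is the only type that rejects the arc (a , b); the order must be d,
  -- a, b, c.
  serial-ends : ∀ {c d} → a < c → d < b → c ≢ b → d ≢ a → c ≢ d → inverse a c d b ≡ false → d < a × b < c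
  serial-ends {c} {d} a<c d<b c≢b d≢a c≢d eq with ℕₚ.<-cmp c d | ℕₚ.<-cmp a d | ℕₚ.<-cmp c b
  ... | tri≈ _ c≡d _ | _            | _            = ⊥-elim (c≢d c≡d)
  ... | _            | tri≈ _ a≡d _ | _            = ⊥-elim (d≢a (≡.sym a≡d))
  ... | _            | _            | tri≈ _ c≡b _ = ⊥-elim (c≢b c≡b)
  ... | tri< c<d _ _ | _            | _            = ⊥-elim (clash (inverse-aabb (ℕₚ.<-trans a<c c<d) c<d) eq)
  ... | tri> _ _ d<c | tri< a<d _ _ | tri< c<b _ _ = ⊥-elim (clash (inverse-abab a<d d<c c<b) eq)
  ... | tri> _ _ d<c | tri< a<d _ _ | tri> _ _ b<c = ⊥-elim (clash (inverse-abba a<d d<b b<c) eq)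
  ... | tri> _ _ d<c | tri> _ _ d<a | tri< c<b _ _ = ⊥-elim (clash (inverse-baab d<a a<c c<b) eq)
  ... | tri> _ _ d<c | tri> _ _ d<a | tri> _ _ b<c = d<a , b<c

  module _ {ks : List Node} (bounded : Bounded ks) {σ : List Arc} (v : Valid ks σ) where

    private
      a≤ : ∀ {c d} → (c , d) ∈ σ → a ≤ c
      a≤ γ∈ = proj₁ (proj₁ bounded (proj₁ (inside v γ∈)))
      ≤t : ∀ {c d} → (c , d) ∈ σ → c ≤ t
      ≤t γ∈ = proj₁ (proj₂ (proj₁ bounded (proj₁ (inside v γ∈))))
      h≤ : ∀ {c d} → (c , d) ∈ σ → h ≤ d
      h≤ γ∈ = proj₁ (proj₁ (proj₂ bounded) (proj₂ (inside v γ∈)))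
      ≤b : ∀ {c d} → (c , d) ∈ σ → d ≤ b
      ≤b γ∈ = proj₁ (proj₂ (proj₁ (proj₂ bounded) (proj₂ (inside v γ∈))))
      ≢b : ∀ {c d} → (c , d) ∈ σ → c ≢ b
      ≢b γ∈ = proj₂ (proj₂ (proj₁ bounded (proj₁ (inside v γ∈))))
      ≢a : ∀ {c d} → (c , d) ∈ σ → d ≢ a
      ≢a γ∈ = proj₂ (proj₂ (proj₁ (proj₂ bounded) (proj₂ (inside v γ∈))))
      apart : ∀ {c d e f} → (c , d) ∈ σ → (e , f) ∈ σ → c ≢ f
      apart γ∈ δ∈ ≡.refl = proj₂ (proj₂ bounded) (proj₁ (inside v γ∈)) (proj₂ (inside v δ∈))

    -- If (a , b) is missing, its ends lie on arcs (a , d) and (c , b) with d < a and b < c. A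
    -- forward arc that starts after a would form a serial 𝐁𝐀𝐀𝐁 with the former, one that starts at
    -- a a serial 𝐀𝐁𝐁𝐀 with the latter.
    all-backward : (𝐀 , a) ∈ ks → (𝐁 , b) ∈ ks → (a , b) ∉ σ → All Backward σ
    all-backward a∈ b∈ β∉ with find (covers v a∈) | find (covers v b∈)
    ... | (_ , d) , ad∈ , ≡.refl | (c , _) , cb∈ , ≡.refl = All.tabulate is-backward
      where
      d<b : d < b
      d<b = ≤-case (≤b ad∈) (λ { ≡.refl → β∉ ad∈ })
      a<c : a < c
      a<c = ≤-case (a≤ cb∈) (λ { ≡.refl → β∉ cb∈ })
      ends : d < a × b < c
      ends = serial-ends a<c d<b (≢b cb∈) (≢a ad∈) (apart cb∈ ad∈)
        (not-true (≡.trans (≡.sym (compatible-< a<c d<b)) (clique v ad∈ cb∈)))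
      forward-absurd : ∀ {e f} → (e , f) ∈ σ → e < f → ⊥
      forward-absurd {e} {f} γ∈ e<f with ℕₚ.m≤n⇒m<n∨m≡n (a≤ γ∈) | ℕₚ.m≤n⇒m<n∨m≡n (≤b γ∈)
      ... | inj₁ a<e | _ = clash (inverse-baab {a} {e} {d} {f} (proj₁ ends) a<e e<f)
        (not-true (≡.trans (≡.sym (compatible-< a<e (ℕₚ.<-trans (proj₁ ends) (ℕₚ.<-trans a<e e<f)))) (clique v ad∈ γ∈)))
      ... | inj₂ ≡.refl | inj₁ f<b = clash (inverse-abba {a} {c} {f} {b} e<f f<b (proj₂ ends))
        (not-true (≡.trans (≡.sym (compatible-< a<c f<b)) (clique v γ∈ cb∈)))
      ... | inj₂ ≡.refl | inj₂ ≡.refl = β∉ γ∈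
      is-backward : ∀ {γ} → γ ∈ σ → Backward γ
      is-backward {e , f} γ∈ with ℕₚ.<-cmp e f
      ... | tri< e<f _ _ = ⊥-elim (forward-absurd γ∈ e<f)
      ... | tri≈ _ e≡f _ = ⊥-elim (apart γ∈ γ∈ e≡f)
      ... | tri> _ _ f<e = f<e

    -- A forward arc would lie under (t , h) and form a nested 𝐁𝐀𝐁𝐀 with it.
    outer-backward : (t , h) ∈ σ → All Backward σ
    outer-backward α∈ = All.tabulate is-backward
      where
      is-backward : ∀ {γ} → γ ∈ σ → Backward γ
      is-backward {e , f} γ∈ with ℕₚ.<-cmp e f
      ... | tri≈ _ e≡f _ = ⊥-elim (apart γ∈ γ∈ e≡f)
      ... | tri> _ _ f<e = f<e
      ... | tri< e<f _ _ = ⊥-elim (clash (clique v γ∈ α∈)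
        (≡.trans (compatible-> (ℕₚ.<-trans e<f (ℕₚ.≤-<-trans (≤b γ∈) b<t)) (ℕₚ.<-trans (ℕₚ.<-≤-trans h<a (a≤ γ∈)) e<f))
                 (inverse-baba (ℕₚ.<-≤-trans h<a (a≤ γ∈)) e<f (ℕₚ.≤-<-trans (≤b γ∈) b<t))))

    private
      -- An arc at h that ends before c would cross (c , d), against the nesting of 𝐁𝐁𝐀𝐀.
      reach-h : (𝐁 , h) ∈ ks → ∀ {c d} → (c , d) ∈ σ → d < a → ∃ λ c′ → c ≤ c′ × (c′ , h) ∈ σ
      reach-h h∈ {c} {d} γ∈ d<a with ℕₚ.m≤n⇒m<n∨m≡n (h≤ γ∈)
      ... | inj₂ ≡.refl = c , ℕₚ.≤-refl , γ∈
      ... | inj₁ h<d with find (covers v h∈)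
      ...   | (c′ , _) , c′h∈ , ≡.refl with ℕₚ.<-≤-connex c′ c
      ...     | inj₂ c≤c′ = c′ , c≤c′ , c′h∈
      ...     | inj₁ c′<c = ⊥-elim (clash (inverse-bbaa {c′} {c} {h} {d} (ℕₚ.<-≤-trans h<a (a≤ c′h∈)) (ℕₚ.<-≤-trans d<a (a≤ c′h∈)))
        (not-true (≡.trans (≡.sym (compatible-< c′<c h<d)) (clique v c′h∈ γ∈))))

      reach-t : (𝐀 , t) ∈ ks → ∀ {c d} → (c , d) ∈ σ → b < c → ∃ λ d′ → d′ ≤ d × (t , d′) ∈ σ
      reach-t t∈ {c} {d} γ∈ b<c with ℕₚ.m≤n⇒m<n∨m≡n (≤t γ∈)
      ... | inj₂ ≡.refl = d , ℕₚ.≤-refl , γ∈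
      ... | inj₁ c<t with find (covers v t∈)
      ...   | (_ , d′) , td′∈ , ≡.refl with ℕₚ.<-≤-connex d d′
      ...     | inj₂ d′≤d = d′ , d′≤d , td′∈
      ...     | inj₁ d<d′ = ⊥-elim (clash (inverse-bbaa {c} {t} {d} {d′} (ℕₚ.≤-<-trans (≤b γ∈) b<c) (ℕₚ.≤-<-trans (≤b td′∈) b<c))
        (not-true (≡.trans (≡.sym (compatible-< c<t d<d′)) (clique v γ∈ td′∈))))

    -- An arc that clashes with (a , b) encloses it from both sides. Then some arc leads from h to
    -- beyond b and some arc from t to before a; these two cross, unless (t , h) is in the face.
    inner-compatible : (𝐁 , h) ∈ ks → (𝐀 , t) ∈ ks → (t , h) ∉ σ → CompatibleWith (a , b) σ
    inner-compatible h∈ t∈ α∉ = All.tabulate good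
      where
      good : ∀ {γ} → γ ∈ σ → compatible (a , b) γ ≡ true
      good {c , d} γ∈ with ℕₚ.m≤n⇒m<n∨m≡n (a≤ γ∈) | ℕₚ.m≤n⇒m<n∨m≡n (≤b γ∈)
      ... | inj₂ ≡.refl | _           = compatible-≡ˡ a b d
      ... | inj₁ _      | inj₂ ≡.refl = compatible-≡ʳ a c b
      ... | inj₁ a<c    | inj₁ d<b    with decide (inverse a c d b)
      ...   | inj₁ eq = ≡.trans (compatible-> a<c d<b) eq
      ...   | inj₂ eq = ⊥-elim (absurd (reach-h h∈ γ∈ (proj₁ ends)) (reach-t t∈ γ∈ (proj₂ ends)))
        where
        ends : d < a × b < c
        ends = serial-ends a<c d<b (≢b γ∈) (≢a γ∈) (apart γ∈ γ∈) eq
        absurd : (∃ λ c′ → c ≤ c′ × (c′ , h) ∈ σ) → (∃ λ d′ → d′ ≤ d × (t , d′) ∈ σ) → ⊥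
        absurd (c′ , _ , c′h∈) (d′ , d′≤d , td′∈) = clash
          (inverse-bbaa {c′} {t} {h} {d′} (ℕₚ.<-≤-trans h<a (a≤ c′h∈)) (ℕₚ.≤-<-trans d′≤d (ℕₚ.<-≤-trans (proj₁ ends) (a≤ c′h∈))))
          (not-true (≡.trans (≡.sym (compatible-< (≤-case (≤t c′h∈) (λ { ≡.refl → α∉ c′h∈ })) (≤-case (h≤ td′∈) (λ { ≡.refl → α∉ td′∈ })))) (clique v c′h∈ td′∈)))

    outer-compatible : All Backward σ → CompatibleWith (t , h) σ
    outer-compatible back = All.tabulate good
      where
      good : ∀ {γ} → γ ∈ σ → compatible (t , h) γ ≡ true
      good {c , d} γ∈ with ℕₚ.m≤n⇒m<n∨m≡n (≤t γ∈) | ℕₚ.m≤n⇒m<n∨m≡n (h≤ γ∈)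
      ... | inj₂ ≡.refl | _           = compatible-≡ˡ t h d
      ... | inj₁ _      | inj₂ ≡.refl = compatible-≡ʳ t c h
      ... | inj₁ c<t    | inj₁ h<d    = ≡.trans (compatible-sym (t , h) (c , d)) (≡.trans (compatible-> c<t h<d)
        (inverse-bbaa {c} {t} {h} {d} (ℕₚ.<-≤-trans h<a (a≤ γ∈)) (All.lookup back γ∈)))

module CrossingStep (K : CommutativeRing 0ℓ 0ℓ) (x y : CommutativeRing.Carrier K) (U : List Arc) (U! : Unique U) where

  open CommutativeRing K hiding (zero)
  open Relation.Binary.Reasoning.Setoid setoid
  open IntegerSolver K
  open SubsetSums K
  open WeightLemmas K
  open Validity ρ₁
  open Faces K x y ρ₁ using (face; face-↭; weight; wt)
  module F₀ = Faces K 0# y ρ₁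
  open F₀ using () renaming (face to face₀)
  open Faces.Universe K x y ρ₁ U U! using (Sum)
  open F₀.Universe U U! using () renaming (Sum to Sum₀)

  weight-backward : ∀ {α} → Backward α → Weights.weight K x y α ≈ Weights.weight K 0# y α
  weight-backward {a , b} b<a rewrite >⇒<ᵇ≡false b<a = refl

  face-backward : ∀ {ns σ} → (Valid ns σ → All Backward σ) → face ns σ ≈ face₀ ns σ
  face-backward {ns} {σ} back with valid? ns σ in eq
  ... | yes v = *-congˡ (wt-cong weight-backward (back v))
  ... | no ¬v = trans (trans (*-congʳ (ind-no (no ¬v) ¬v)) (zeroˡ _)) (sym (trans (*-congʳ (ind-no (no ¬v) ¬v)) (zeroˡ _)))

  face₀-forward : ∀ {ns α} σ → ¬ Backward α → proj₁ α ≢ proj₂ α → face₀ ns (α ∷ σ) ≈ 0#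
  face₀-forward {ns} {a , b} σ ¬back a≢b = trans (*-congˡ (trans (*-congʳ (reflexive w)) (zeroˡ _))) (zeroʳ _)
    where
    w : Weights.weight K 0# y (a , b) ≡ 0#
    w with ℕₚ.<-cmp a b
    ... | tri< a<b _ _ rewrite <⇒<ᵇ≡true a<b = ≡.refl
    ... | tri≈ _ a≡b _ = ⊥-elim (a≢b a≡b)
    ... | tri> _ _ b<a = ⊥-elim (¬back b<a)

  module _ {a b h t : ℕ} (h<a : h < a) (a<b : a < b) (b<t : b < t) {U′ U″ : List Arc}
           (U↭ : U ↭ (a , b) ∷ U′) (U′↭ : U′ ↭ (t , h) ∷ U″) where

    open Box h<a a<b b<t

    private
      α β : Arc
      α = t , h
      β = a , b
      module S = Faces.Universe.Split K x y ρ₁ U U! U↭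
      U↭α : U ↭ α ∷ β ∷ U″
      U↭α = ↭-trans U↭ (↭-trans (prep β U′↭) (Perm.swap β α ↭-refl))
      module S₀β = F₀.Universe.Split U U! U↭
      module S₀ = F₀.Universe.Split U U! U↭α

      fresh-α : All (_≢ α) U″
      fresh-α with S₀.fresh
      ... | _ ∷ p = p

      forward-β : ¬ Backward β
      forward-β b<a = ℕₚ.<-asym a<b b<a

    -- The faces that contain the outermost arc, with their weight at x = 0; nothing is lost, as
    -- `outer-backward` shows.
    containing : List Node → Carrier
    containing ks = Σ⊆ U″ (λ σ → face₀ ks (α ∷ σ))

    -- A face that avoids β either contains α, which excludes compatibility with β, or avoids α,
    -- which enforces it.
    star+containing : ∀ {ks} → Bounded ks → (𝐁 , h) ∈ ks → (𝐀 , t) ∈ ks → S.star ks + containing ks ≈ Σ⊆ U′ (face ks)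
    star+containing {ks} bounded h∈ t∈ = begin
      S.star ks + containing ks
        ≈⟨ +-congʳ (Σ⊆-↭ g-↭ U′↭) ⟩
      Σ⊆ U″ g + Σ⊆ U″ (λ σ → g (α ∷ σ)) + containing ks
        ≈⟨ +-congʳ (trans (+-congˡ (Σ⊆-0 U″ (λ σ → trans (*-congʳ (ind-no _ (λ p → clash′ (proj₂ p)))) (zeroˡ _)))) (+-identityʳ _)) ⟩
      Σ⊆ U″ g + containing ks
        ≈⟨ +-cong (Σ⊆-cong-All fresh-α (λ σ α∉ → *-congʳ (ind-⇔ proj₁ (λ v → v , inner-compatible bounded v h∈ t∈ (λ α∈ → All.lookup α∉ α∈ ≡.refl)) _ _)))
             (sym (Σ⊆-cong U″ (λ σ → face-backward {ks} {α ∷ σ} (λ v → outer-backward bounded v (here ≡.refl))))) ⟩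
      Σ⊆ U″ (face ks) + Σ⊆ U″ (λ σ → face ks (α ∷ σ))
        ≈⟨ Σ⊆-↭ (face-↭ ks) U′↭ ⟨
      Σ⊆ U′ (face ks) ∎
      where
      g : List Arc → Carrier
      g σ = ind (valid? ks σ ×-dec compatibleWith? β σ) * wt σ
      g-↭ : ∀ {σ τ} → σ ↭ τ → g σ ≈ g τ
      g-↭ p = *-cong (ind-⇔ (λ (v , c) → valid-↭ p v , Permₚ.All-resp-↭ p c) (λ (v , c) → valid-↭ (↭-sym p) v , Permₚ.All-resp-↭ (↭-sym p) c) _ _)
                     (Faces.wt-↭ K x y ρ₁ p)
      clash′ : ∀ {σ} → CompatibleWith β (α ∷ σ) → ⊥
      clash′ (p ∷ _) with ≡.trans (≡.sym p) inner-outer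
      ... | ()

    -- The faces without β are purely backward, and at x = 0 the faces with β weigh nothing.
    avoiding : ∀ {ns} → Bounded ns → (𝐀 , a) ∈ ns → (𝐁 , b) ∈ ns → Σ⊆ U′ (face ns) ≈ Sum₀ ns
    avoiding {ns} bounded a∈ b∈ = begin
      Σ⊆ U′ (face ns)
        ≈⟨ Σ⊆-cong-All S.fresh (λ σ β∉ → face-backward {ns} {σ} (λ v → all-backward bounded v a∈ b∈ (λ β∈ → All.lookup β∉ β∈ ≡.refl))) ⟩
      Σ⊆ U′ (face₀ ns)
        ≈⟨ trans (+-congˡ (Σ⊆-0 U′ (λ σ → face₀-forward {ns} {β} σ forward-β (ℕₚ.<⇒≢ a<b)))) (+-identityʳ _) ⟨
      Σ⊆ U′ (face₀ ns) + Σ⊆ U′ (λ σ → face₀ ns (β ∷ σ))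
        ≈⟨ S₀β.Sum-split ns ⟨
      Sum₀ ns ∎

    -- At x = 0 only backward faces count, and α is compatible with all of them, so each star in
    -- `cone-sum` is the count of faces without α. On `ks` itself this is `Sum₀ ks` minus the
    -- unknown; collecting the unknown produces the factor 1 + y.
    containing-equation : ∀ {ks ks₀} → (𝐀 , t) ∉ ks₀ → (𝐁 , h) ∉ ks₀ → ks ↭ (𝐀 , t) ∷ (𝐁 , h) ∷ ks₀ → Bounded ks →
      (1# + y) * containing ks ≈ y * (Sum₀ ks₀ + Sum₀ ((𝐀 , t) ∷ ks₀) + Sum₀ ((𝐁 , h) ∷ ks₀) + Sum₀ ks)
    containing-equation {ks} {ks₀} t∉ h∉ p bounded = begin
      (1# + y) * N
        ≈⟨ solve 2 (λ y n → (𝟙 :+ y) :* n := n :+ y :* n) refl y N ⟩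
      N + y * N
        ≈⟨ +-congʳ equation ⟩
      y * (Sum₀ ks₀ + Sum₀ (n₁ ∷ ks₀) + Sum₀ (n₂ ∷ ks₀) + Σ⊆ (β ∷ U″) (face₀ ks)) + y * N
        ≈⟨ solve 6 (λ y a b c d n → y :* (a :+ b :+ c :+ d) :+ y :* n := y :* (a :+ b :+ c :+ (d :+ n))) refl
             y (Sum₀ ks₀) (Sum₀ (n₁ ∷ ks₀)) (Sum₀ (n₂ ∷ ks₀)) (Σ⊆ (β ∷ U″) (face₀ ks)) N ⟩
      y * (Sum₀ ks₀ + Sum₀ (n₁ ∷ ks₀) + Sum₀ (n₂ ∷ ks₀) + (Σ⊆ (β ∷ U″) (face₀ ks) + N))
        ≈⟨ *-congˡ (+-congˡ (trans (+-congˡ (sym with-β)) (sym (S₀.Sum-split ks)))) ⟩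
      y * (Sum₀ ks₀ + Sum₀ (n₁ ∷ ks₀) + Sum₀ (n₂ ∷ ks₀) + Sum₀ ks) ∎
      where
      n₁ n₂ : Node
      n₁ = 𝐀 , t
      n₂ = 𝐁 , h
      N : Carrier
      N = containing ks
      with-β : Σ⊆ (β ∷ U″) (λ σ → face₀ ks (α ∷ σ)) ≈ N
      with-β = trans (+-congˡ (Σ⊆-0 U″ (λ σ → trans (F₀.face-↭ ks (Perm.swap α β ↭-refl)) (face₀-forward {ks} {β} (α ∷ σ) forward-β (ℕₚ.<⇒≢ a<b))))) (+-identityʳ _)
      back : ∀ {n} → n ∈ n₁ ∷ n₂ ∷ ks₀ → n ∈ ks
      back = Permₚ.∈-resp-↭ (↭-sym p)
      star₀ : ∀ ks′ → (∀ {n} → n ∈ ks′ → n ∈ ks) → S₀.star ks′ ≈ Σ⊆ (β ∷ U″) (face₀ ks′)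
      star₀ ks′ sub = Σ⊆-cong (β ∷ U″) pointwise
        where
        bounded′ : Bounded ks′
        bounded′ = (λ c∈ → proj₁ bounded (sub c∈)) , (λ d∈ → proj₁ (proj₂ bounded) (sub d∈)) , (λ c∈ d∈ → proj₂ (proj₂ bounded) (sub c∈) (sub d∈))
        pointwise : ∀ σ → ind (valid? ks′ σ ×-dec compatibleWith? α σ) * F₀.wt σ ≈ face₀ ks′ σ
        pointwise σ with All.all? backward? σ
        ... | yes all = *-congʳ (ind-⇔ proj₁ (λ v → v , outer-compatible bounded′ v all) _ _)
        ... | no ¬all with valid? ks′ σ
        ...   | no ¬v = trans (trans (*-congʳ (ind-no _ (λ q → ¬v (proj₁ q)))) (zeroˡ _)) (sym (trans (*-congʳ (ind-no _ ¬v)) (zeroˡ _)))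
        ...   | yes v = trans (trans (*-congˡ z) (zeroʳ _)) (sym (trans (*-congˡ z) (zeroʳ _)))
          where
          is-forward : ∀ {γ} → ¬ Backward γ × Inside ks′ γ → Weights.weight K 0# y γ ≈ 0#
          is-forward {c , d} (¬back , in′) with ℕₚ.<-cmp c d
          ... | tri< c<d _ _ rewrite <⇒<ᵇ≡true c<d = refl
          ... | tri≈ _ ≡.refl _ = ⊥-elim (proj₂ (proj₂ bounded′) (proj₁ in′) (proj₂ in′))
          ... | tri> _ _ d<c = ⊥-elim (¬back d<c)
          z : F₀.wt σ ≈ 0#
          z = wt-zero is-forward (lift (Allₚ.¬All⇒Any¬ backward? σ ¬all))
            where
            lift : Any (λ γ → ¬ Backward γ) σ → Any (λ γ → ¬ Backward γ × Inside ks′ γ) σ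
            lift any with find any
            ... | γ , γ∈ , ¬back = lose γ∈ (¬back , inside v γ∈)
      n₁∉′ : n₁ ∉ n₂ ∷ ks₀
      n₁∉′ (there q) = t∉ q
      n₂∉′ : n₂ ∉ n₁ ∷ ks₀
      n₂∉′ (there q) = h∉ q
      equation : N ≈ y * (Sum₀ ks₀ + Sum₀ (n₁ ∷ ks₀) + Sum₀ (n₂ ∷ ks₀) + Σ⊆ (β ∷ U″) (face₀ ks))
      equation = begin
        N
          ≈⟨ with-β ⟨
        Σ⊆ (β ∷ U″) (λ σ → face₀ ks (α ∷ σ))
          ≈⟨ Σ⊆-cong (β ∷ U″) (λ σ → *-congʳ (ind-⇔ (valid-nodes (Permₚ.∈-resp-↭ p) back) (valid-nodes back (Permₚ.∈-resp-↭ p)) _ _)) ⟩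
        Σ⊆ (β ∷ U″) (λ σ → face₀ (n₁ ∷ n₂ ∷ ks₀) (α ∷ σ))
          ≈⟨ S₀.cone-sum t∉ h∉ ⟩
        F₀.weight α * (S₀.star ks₀ + S₀.star (n₁ ∷ ks₀) + S₀.star (n₂ ∷ ks₀) + S₀.star (n₁ ∷ n₂ ∷ ks₀))
          ≈⟨ *-cong (reflexive weight-α) (+-cong (+-cong (+-cong
               (trans (star₀ ks₀ (λ q → back (there (there q)))) (sym (S₀.Sum-outside (λ q → t∉ (proj₁ q)))))
               (trans (star₀ (n₁ ∷ ks₀) (λ { (here q) → back (here q) ; (there q) → back (there (there q)) })) (sym (S₀.Sum-outside (λ q → n₂∉′ (proj₂ q))))))
               (trans (star₀ (n₂ ∷ ks₀) (λ q → back (there q))) (sym (S₀.Sum-outside (λ q → n₁∉′ (proj₁ q))))))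
               (trans (star₀ (n₁ ∷ n₂ ∷ ks₀) back) (Σ⊆-cong (β ∷ U″) (λ σ → *-congʳ (ind-⇔ (valid-nodes back (Permₚ.∈-resp-↭ p)) (valid-nodes (Permₚ.∈-resp-↭ p) back) _ _))))) ⟩
        y * (Sum₀ ks₀ + Sum₀ (n₁ ∷ ks₀) + Sum₀ (n₂ ∷ ks₀) + Σ⊆ (β ∷ U″) (face₀ ks)) ∎
        where
        weight-α : F₀.weight α ≡ y
        weight-α rewrite >⇒<ᵇ≡false (ℕₚ.<-trans h<a (ℕₚ.<-trans a<b b<t)) = ≡.refl

module AllCrossing (K : CommutativeRing 0ℓ 0ℓ) (x y : CommutativeRing.Carrier K) (U : List Arc) (U! : Unique U) where

  open CommutativeRing K hiding (zero)
  open Relation.Binary.Reasoning.Setoid setoid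
  open IntegerSolver K
  open Canonical K x y using (κ; modulo)
  open CrossingIdentity K x y using (κ₀; κ₀-straight; κ-crossing)
  open WeightLemmas K
  open CrossingStep K x y U U!
  open Faces.Universe K x y ρ₁ U U! using (Sum; Sum-↭; module Split)
  open Faces.Universe K 0# y ρ₁ U U! using () renaming (Sum to Sum₀; Sum-↭ to Sum₀-↭)
  open Counting K x y ρ₁ U U! using (Complete; Correct; CorrectBelow; complete-⊆; sorted-distinct; weight-<; fresh-nodes)
  open NestingForward K x y ρ₁ U U! using (Crossing; nesting-correct)
  open Reduction K x y ρ₁ U U! using (letters-++)

  -- Backward arcs do not see the mixed types, so these may be declared serial, and the exceptional
  -- configuration disappears.
  Sum₀-correct : ∀ {ns} → Sorted ns → Complete ns → Sum₀ ns ≈ κ₀ (letters ns)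
  Sum₀-correct {ns} s c = trans
    (transfer Weak? weak-zero ρ₁ ρ₀ U U! agree)
    (NestingForward.nesting-correct K 0# y ρ₀ U U! ≡.refl (λ _ _ _ ()) s c)
    where
    ρ₀ : Pattern
    ρ₀ = pattern′ false false true true
    -- The non-strict inequality makes the complement exactly the set of arcs of weight x.
    Weak : Arc → Set
    Weak (a , b) = b ≤ a
    Weak? : ∀ α → Dec (Weak α)
    Weak? (a , b) = b ℕₚ.≤? a
    weak-zero : ∀ {α} → ¬ Weak α → Weights.weight K 0# y α ≈ 0#
    weak-zero {a , b} ¬w rewrite <⇒<ᵇ≡true (ℕₚ.≰⇒> ¬w) = refl
    strict : ∀ {a b} → b ≤ a → Inside ns (a , b) → b < a
    strict b≤a (a∈ , b∈) = ℕₚ.≤∧≢⇒< b≤a (λ { ≡.refl → sorted-distinct s a∈ b∈ })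
    agree : ∀ {α β} → Weak α → Weak β → Inside ns α → Inside ns β → Compatibility.compatible ρ₁ α β ≡ Compatibility.compatible ρ₀ α β
    agree w₁ w₂ in₁ in₂ = Agreement.agreement-backward ρ₁ ρ₀ ≡.refl (strict w₁ in₁) (strict w₂ in₂)

  opt : {X : Set} → Bool → X → List X
  opt true  z = z ∷ []
  opt false z = []

  opt-⊆ : ∀ e {n : Node} → opt e n ⊆ n ∷ []
  opt-⊆ true  = ⊆-refl
  opt-⊆ false = skip _ ⊆-refl

  letters-opt : ∀ e l {i} → letters (opt e (l , i)) ≡ opt e l
  letters-opt true  l = ≡.refl
  letters-opt false l = ≡.refl

  module _ (y-cancel : ∀ {f g} → y * f ≈ y * g → f ≈ g) (1+y-cancel : ∀ {f g} → (1# + y) * f ≈ (1# + y) * g → f ≈ g) where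

    module Step {h : ℕ} (bs : List Node) {a : ℕ} (ws : List Node) {b : ℕ} (as : List Node) {t : ℕ}
                (all𝐁 : All (Is 𝐁) bs) (all𝐀 : All (Is 𝐀) as) where

      core : Bool → Bool → List Node
      core e d = bs ++ opt e (𝐀 , a) ++ ws ++ opt d (𝐁 , b) ++ as

      -- The four flags keep or delete the nodes h, a, b, t, in this order.
      part : Bool → Bool → Bool → Bool → List Node
      part ε e d δ = opt ε (𝐁 , h) ++ core e d ++ opt δ (𝐀 , t)

      full : List Node
      full = part true true true true

      part-⊆ : ∀ ε e d δ → part ε e d δ ⊆ full
      part-⊆ ε e d δ = Sublistₚ.++⁺ (opt-⊆ ε) (Sublistₚ.++⁺ (Sublistₚ.++⁺ {as = bs} ⊆-refl
        (Sublistₚ.++⁺ (opt-⊆ e) (Sublistₚ.++⁺ {as = ws} ⊆-refl (Sublistₚ.++⁺ (opt-⊆ d) ⊆-refl)))) (opt-⊆ δ))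

      k j : ℕ
      k = length bs
      j = length as
      w : Word
      w = letters ws

      word : Bool → Bool → Bool → Bool → Word
      word ε e d δ = opt ε 𝐁 ++ 𝐁^ k ++ opt e 𝐀 ++ w ++ opt d 𝐁 ++ 𝐀^ j ++ opt δ 𝐀

      letters-part : ∀ ε e d δ → letters (part ε e d δ) ≡ word ε e d δ
      letters-part ε e d δ = ++-word (opt ε _) (letters-opt ε 𝐁) (≡.trans (≡.cong letters (assoc e d δ))
          (++-word bs (letters-all all𝐁) (++-word (opt e _) (letters-opt e 𝐀) (++-word ws ≡.refl
            (++-word (opt d _) (letters-opt d 𝐁) (++-word as (letters-all all𝐀) (letters-opt δ 𝐀)))))))
        where
        ++-word : ∀ us {vs u v} → letters us ≡ u → letters vs ≡ v → letters (us ++ vs) ≡ u ++ v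
        ++-word us {vs} ≡.refl ≡.refl = letters-++ us vs
        assoc : ∀ e d δ → core e d ++ opt δ (𝐀 , t) ≡ bs ++ opt e (𝐀 , a) ++ ws ++ opt d (𝐁 , b) ++ as ++ opt δ (𝐀 , t)
        assoc e d δ = ≡.trans (Listₚ.++-assoc bs _ _) (≡.cong (bs ++_) (≡.trans (Listₚ.++-assoc (opt e _) _ _) (≡.cong (opt e _ ++_)
          (≡.trans (Listₚ.++-assoc ws _ _) (≡.cong (ws ++_) (Listₚ.++-assoc (opt d _) _ _))))))

      v : Bool → Bool → Bool → Bool → Carrier
      v ε e d δ = κ₀ (word ε e d δ)

      v-left : ∀ d δ → v true true d δ ≈ y * (v true false d δ + v false true d δ + v false false d δ)
      v-left d δ = ≡.subst₂ (λ s u → κ₀ s ≈ y * (κ₀ u + κ₀ (𝐁^ k ++ 𝐀 ∷ z) + κ₀ (𝐁^ k ++ z)))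
        (replicate-shift k 𝐁 (𝐀 ∷ z)) (replicate-shift k 𝐁 z) (Canonical.Straight.pull κ₀-straight (𝐁^ k) z)
        where
        z : Word
        z = w ++ opt d 𝐁 ++ 𝐀^ j ++ opt δ 𝐀

      v-right : ∀ ε e → v ε e true true ≈ y * (v ε e true false + v ε e false true + v ε e false false)
      v-right ε e = ≡.subst₂ _≈_ (≡.cong κ₀ (at (𝐁 ∷ 𝐀 ∷ 𝐀^ j) (≡.cong (𝐁 ∷_) shift)))
        (≡.cong₂ (λ s u → y * (s + u)) (≡.cong₂ (λ s u → κ₀ s + κ₀ u) (at (𝐁 ∷ 𝐀^ j) (≡.cong (𝐁 ∷_) (≡.sym (Listₚ.++-identityʳ _)))) (at (𝐀 ∷ 𝐀^ j) shift))
          (≡.cong κ₀ (at (𝐀^ j) (≡.sym (Listₚ.++-identityʳ _)))))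
        (Canonical.Straight.pull κ₀-straight pre (𝐀^ j))
        where
        pre : Word
        pre = opt ε 𝐁 ++ 𝐁^ k ++ opt e 𝐀 ++ w
        shift : 𝐀 ∷ 𝐀^ j ≡ 𝐀^ j ++ 𝐀 ∷ []
        shift = ≡.sym (≡.trans (replicate-shift j 𝐀 []) (≡.cong (𝐀 ∷_) (Listₚ.++-identityʳ _)))
        at : ∀ z {z′} → z ≡ z′ → pre ++ z ≡ opt ε 𝐁 ++ 𝐁^ k ++ opt e 𝐀 ++ w ++ z′
        at z ≡.refl = ≡.trans (Listₚ.++-assoc (opt ε 𝐁) _ _) (≡.cong (opt ε 𝐁 ++_) (≡.trans (Listₚ.++-assoc (𝐁^ k) _ _)
          (≡.cong (𝐁^ k ++_) (Listₚ.++-assoc (opt e 𝐀) _ _))))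

      Σv : Bool → Bool → Carrier
      Σv e d = v false e d false + v false e d true + v true e d false + v true e d true

      -- The pull relation says y(v₁₀ + v₀₁ + v₀₀) = v₁₁ at the border of h and a, and likewise at
      -- that of b and t. Adding y v₁₁ gives a factor 1 + y for each of the two borders.
      v-total : y * (y * (Σv false false + Σv true false + Σv false true + Σv true true)) ≈ (1# + y) * ((1# + y) * v true true true true)
      v-total = begin
        y * (y * (Σv false false + Σv true false + Σv false true + Σv true true))
          ≈⟨ *-congˡ (trans
               (solve 17 (λ y a1 a2 a3 a4 b1 b2 b3 b4 c1 c2 c3 c4 d1 d2 d3 d4 →
                 y :* ((a1 :+ a2 :+ a3 :+ a4) :+ (b1 :+ b2 :+ b3 :+ b4) :+ (c1 :+ c2 :+ c3 :+ c4) :+ (d1 :+ d2 :+ d3 :+ d4))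
                 := (b3 :* y :+ y :* (a3 :+ b1 :+ a1)) :+ (b4 :* y :+ y :* (a4 :+ b2 :+ a2))
                    :+ (d3 :* y :+ y :* (c3 :+ d1 :+ c1)) :+ (d4 :* y :+ y :* (c4 :+ d2 :+ c2))) refl
                 y _ _ _ _ _ _ _ _ _ _ _ _ _ _ _ _)
               (+-cong (+-cong (+-cong (+-congˡ (sym (v-left false false))) (+-congˡ (sym (v-left false true))))
                 (+-congˡ (sym (v-left true false)))) (+-congˡ (sym (v-left true true))))) ⟩
        y * ((v true true false false * y + v true true false false) + (v true true false true * y + v true true false true)
             + (v true true true false * y + v true true true false) + (v true true true true * y + v true true true true))
          ≈⟨ solve 5 (λ y a b c d → y :* ((a :* y :+ a) :+ (b :* y :+ b) :+ (c :* y :+ c) :+ (d :* y :+ d))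
               := (𝟙 :+ y) :* (y :* d :+ y :* (c :+ b :+ a))) refl
               y (v true true false false) (v true true false true) (v true true true false) (v true true true true) ⟩
        (1# + y) * (y * v true true true true + y * (v true true true false + v true true false true + v true true false false))
          ≈⟨ *-congˡ (+-congˡ (sym (v-right true true))) ⟩
        (1# + y) * (y * v true true true true + v true true true true)
          ≈⟨ *-congˡ (solve 2 (λ y d → y :* d :+ d := (𝟙 :+ y) :* d) refl y _) ⟩
        (1# + y) * ((1# + y) * v true true true true) ∎

      core-ab : core true true ↭ (𝐀 , a) ∷ (𝐁 , b) ∷ core false false
      core-ab = ↭-trans (Permₚ.shift (𝐀 , a) bs _) (prep _ (↭-trans (Permₚ.++⁺ˡ bs (Permₚ.shift (𝐁 , b) ws as)) (Permₚ.shift (𝐁 , b) bs _)))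

      core-a : core true false ↭ (𝐀 , a) ∷ core false false
      core-a = Permₚ.shift (𝐀 , a) bs _

      core-b : core false true ↭ (𝐁 , b) ∷ core false false
      core-b = ↭-trans (Permₚ.++⁺ˡ bs (Permₚ.shift (𝐁 , b) ws as)) (Permₚ.shift (𝐁 , b) bs _)

      part-ab : full ↭ (𝐀 , a) ∷ (𝐁 , b) ∷ part true false false true
      part-ab = ↭-trans (prep _ (Permₚ.++⁺ʳ _ core-ab)) (↭-trans (Perm.swap _ _ ↭-refl) (prep _ (Perm.swap _ _ ↭-refl)))

      part-a : part true true false true ↭ (𝐀 , a) ∷ part true false false true
      part-a = ↭-trans (prep _ (Permₚ.++⁺ʳ _ core-a)) (Perm.swap _ _ ↭-refl)

      part-b : part true false true true ↭ (𝐁 , b) ∷ part true false false true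
      part-b = ↭-trans (prep _ (Permₚ.++⁺ʳ _ core-b)) (Perm.swap _ _ ↭-refl)

      part-t : ∀ e d → part false e d true ↭ (𝐀 , t) ∷ part false e d false
      part-t e d = Permₚ.shift (𝐀 , t) (core e d) []

      part-ht : ∀ e d → part true e d true ↭ (𝐀 , t) ∷ (𝐁 , h) ∷ part false e d false
      part-ht e d = ↭-trans (prep _ (part-t e d)) (Perm.swap _ _ ↭-refl)

      module _ (s : Sorted full) (c : Complete full) (ih : CorrectBelow full) where

        sorted-part : ∀ ε e d δ → Sorted (part ε e d δ)
        sorted-part ε e d δ = sorted-⊆ (part-⊆ ε e d δ) s

        complete-part : ∀ ε e d δ → Complete (part ε e d δ)
        complete-part ε e d δ = complete-⊆ (part-⊆ ε e d δ) c

        Sum₀-part : ∀ ε e d δ → Sum₀ (part ε e d δ) ≈ v ε e d δ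
        Sum₀-part ε e d δ = trans (Sum₀-correct (sorted-part ε e d δ) (complete-part ε e d δ)) (reflexive (≡.cong κ₀ (letters-part ε e d δ)))

        flat : full ≡ ((𝐁 , h) ∷ bs) ++ (𝐀 , a) ∷ ws ++ (𝐁 , b) ∷ as ++ (𝐀 , t) ∷ []
        flat = ≡.cong ((𝐁 , h) ∷_) (≡.trans (Listₚ.++-assoc bs _ _) (≡.cong (λ z → bs ++ (𝐀 , a) ∷ z) (Listₚ.++-assoc ws _ _)))

        flat-b : full ≡ ((𝐁 , h) ∷ bs ++ (𝐀 , a) ∷ ws) ++ (𝐁 , b) ∷ as ++ (𝐀 , t) ∷ []
        flat-b = ≡.trans flat (≡.sym (≡.cong ((𝐁 , h) ∷_) (Listₚ.++-assoc bs _ _)))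

        s′ : Sorted (((𝐁 , h) ∷ bs) ++ (𝐀 , a) ∷ ws ++ (𝐁 , b) ∷ as ++ (𝐀 , t) ∷ [])
        s′ = ≡.subst Sorted flat s

        s″ : Sorted (((𝐁 , h) ∷ bs ++ (𝐀 , a) ∷ ws) ++ (𝐁 , b) ∷ as ++ (𝐀 , t) ∷ [])
        s″ = ≡.subst Sorted flat-b s

        h<a : h < a
        h<a = All.lookup (sorted-before ((𝐁 , h) ∷ bs) s′) (here ≡.refl)

        a<b : a < b
        a<b = All.lookup (sorted-after ((𝐁 , h) ∷ bs) s′) (Membershipₚ.∈-++⁺ʳ ws (here ≡.refl))

        b<t : b < t
        b<t = All.lookup (sorted-after ((𝐁 , h) ∷ bs ++ (𝐀 , a) ∷ ws) s″) (Membershipₚ.∈-++⁺ʳ as (here ≡.refl))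

        open Box h<a a<b b<t using (Bounded)

        a∈ : (𝐀 , a) ∈ full
        a∈ = Permₚ.∈-resp-↭ (↭-sym part-ab) (here ≡.refl)

        b∈ : (𝐁 , b) ∈ full
        b∈ = Permₚ.∈-resp-↭ (↭-sym part-ab) (there (here ≡.refl))

        bounded : Bounded full
        bounded = (λ c∈ → after-a (split-∈ ((𝐁 , h) ∷ bs) (move flat c∈)) , before-t (split-∈ ((𝐁 , h) ∷ core true true) c∈)
                          , (λ { ≡.refl → sorted-distinct s c∈ b∈ }))
                , (λ d∈ → after-h d∈ , before-b (split-∈ ((𝐁 , h) ∷ bs ++ (𝐀 , a) ∷ ws) (move flat-b d∈))
                          , (λ { ≡.refl → sorted-distinct s a∈ d∈ }))
                , sorted-distinct s
          where
          move : ∀ {n us vs} → us ≡ vs → n ∈ us → n ∈ vs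
          move ≡.refl n∈ = n∈
          after-a : ∀ {n} → (𝐀 , n) ∈ (𝐁 , h) ∷ bs ⊎ (𝐀 , n) ∈ (𝐀 , a) ∷ ws ++ (𝐁 , b) ∷ as ++ (𝐀 , t) ∷ [] → a ≤ n
          after-a (inj₁ (there p))       = ⊥-elim (not-𝐀 all𝐁 p)
          after-a (inj₂ (here ≡.refl))   = ℕₚ.≤-refl
          after-a (inj₂ (there p))       = ℕₚ.<⇒≤ (All.lookup (sorted-after ((𝐁 , h) ∷ bs) s′) p)
          before-t : ∀ {n} → (𝐀 , n) ∈ (𝐁 , h) ∷ core true true ⊎ (𝐀 , n) ∈ (𝐀 , t) ∷ [] → n ≤ t
          before-t (inj₁ p)              = ℕₚ.<⇒≤ (All.lookup (sorted-before ((𝐁 , h) ∷ core true true) s) p)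
          before-t (inj₂ (here ≡.refl))  = ℕₚ.≤-refl
          after-h : ∀ {n} → (𝐁 , n) ∈ full → h ≤ n
          after-h (here ≡.refl)          = ℕₚ.≤-refl
          after-h (there p)              = ℕₚ.<⇒≤ (All.lookup (sorted-after [] s) p)
          before-b : ∀ {n} → (𝐁 , n) ∈ (𝐁 , h) ∷ bs ++ (𝐀 , a) ∷ ws ⊎ (𝐁 , n) ∈ (𝐁 , b) ∷ as ++ (𝐀 , t) ∷ [] → n ≤ b
          before-b (inj₁ p)              = ℕₚ.<⇒≤ (All.lookup (sorted-before ((𝐁 , h) ∷ bs ++ (𝐀 , a) ∷ ws) s″) p)
          before-b (inj₂ (here ≡.refl))  = ℕₚ.≤-refl
          before-b (inj₂ (there p))      = [ (λ q → ⊥-elim (not-𝐁 all𝐀 q)) , (λ { (here ()) }) ]′ (split-∈ as p)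

        U′∃ : ∃ λ U′ → U ↭ (a , b) ∷ U′
        U′∃ = extract (c a∈ b∈)

        U′ : List Arc
        U′ = proj₁ U′∃

        α∈U′ : (t , h) ∈ U′
        α∈U′ with Permₚ.∈-resp-↭ (proj₂ U′∃) (c (Permₚ.∈-resp-↭ (↭-sym (part-ht true true)) (here ≡.refl)) (here ≡.refl))
        ... | there p      = p
        ... | here ≡.refl  = ⊥-elim (ℕₚ.<-irrefl ≡.refl (ℕₚ.<-trans a<b b<t))

        U″∃ : ∃ λ U″ → U′ ↭ (t , h) ∷ U″
        U″∃ = extract α∈U′

        open Split (proj₂ U′∃) using (star; cone-sum; Sum-split; Sum-outside)

        N : List Node → Carrier
        N = containing h<a a<b b<t (proj₂ U′∃) (proj₂ U″∃)

        ms : List Node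
        ms = part true false false true

        bounded-part : ∀ {e d L} → part true e d true ↭ L → Bounded L
        bounded-part {e} {d} {L} p = (λ q → proj₁ bounded (up q)) , (λ q → proj₁ (proj₂ bounded) (up q)) , (λ q r → proj₂ (proj₂ bounded) (up q) (up r))
          where
          up : ∀ {n} → n ∈ L → n ∈ full
          up q = Sublist.lookup (part-⊆ true e d true) (Permₚ.∈-resp-↭ (↭-sym p) q)

        N-equation : ∀ e d {L} → part true e d true ↭ L → (1# + y) * N L ≈ y * Σv e d
        N-equation e d {L} p = begin
          (1# + y) * N L
            ≈⟨ containing-equation h<a a<b b<t (proj₂ U′∃) (proj₂ U″∃) (proj₁ fr) (proj₂ fr) (↭-trans (↭-sym p) (part-ht e d)) (bounded-part {e} {d} p) ⟩
          y * (Sum₀ (part false e d false) + Sum₀ ((𝐀 , t) ∷ part false e d false) + Sum₀ (part true e d false) + Sum₀ L)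
            ≈⟨ *-congˡ (+-cong (+-cong (+-cong (Sum₀-part false e d false)
                 (trans (Sum₀-↭ (↭-sym (part-t e d))) (Sum₀-part false e d true))) (Sum₀-part true e d false))
                 (trans (Sum₀-↭ (↭-sym p)) (Sum₀-part true e d true))) ⟩
          y * Σv e d ∎
          where
          fr : ((𝐀 , t) ∉ part false e d false) × ((𝐁 , h) ∉ part false e d false)
          fr = fresh-nodes (sorted-part true e d true) (part-ht e d)

        star-equation : ∀ e d {L} → part true e d true ↭ L → star L + N L ≈ SubsetSums.Σ⊆ K U′ (Faces.face K x y ρ₁ L)
        star-equation e d p = star+containing h<a a<b b<t (proj₂ U′∃) (proj₂ U″∃) (bounded-part {e} {d} p)
          (Permₚ.∈-resp-↭ p (here ≡.refl)) (Permₚ.∈-resp-↭ (↭-trans (↭-sym (part-ht e d)) p) (here ≡.refl))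

        smaller : ∀ e d {n} → full ↭ n ∷ part true e d true → Sum (part true e d true) ≈ κ (letters (part true e d true))
        smaller e d p = ih (≡.subst (length (part true e d true) <_) (≡.sym (Permₚ.↭-length p)) ℕₚ.≤-refl) (sorted-part true e d true) (complete-part true e d true)

        fresh-ab : ((𝐀 , a) ∉ ms) × ((𝐁 , b) ∉ ms)
        fresh-ab = fresh-nodes s part-ab

        K₀ K₁ K₂ F B S : Carrier
        K₀ = κ (letters ms)
        K₁ = κ (letters (part true true false true))
        K₂ = κ (letters (part true false true true))
        F  = κ (letters full)
        B  = v true true true true
        S  = Sum full

        L₁ L₂ L₃ : List Node
        L₁ = (𝐀 , a) ∷ ms
        L₂ = (𝐁 , b) ∷ ms
        L₃ = (𝐀 , a) ∷ (𝐁 , b) ∷ ms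

        star₀ : star ms + N ms ≈ K₀
        star₀ = trans (star-equation false false ↭-refl) (trans (sym (Sum-outside (λ q → proj₁ fresh-ab (proj₁ q))))
          (ih (≡.subst (length ms <_) (≡.sym (Permₚ.↭-length part-ab)) (ℕₚ.m≤n⇒m≤1+n ℕₚ.≤-refl)) (sorted-part true false false true) (complete-part true false false true)))

        star₁ : star L₁ + N L₁ ≈ K₁
        star₁ = trans (star-equation true false part-a) (trans (sym (Sum-outside (λ { (_ , there q) → proj₂ fresh-ab q })))
          (trans (Sum-↭ (↭-sym part-a)) (smaller true false (↭-trans part-ab (↭-trans (Perm.swap _ _ ↭-refl) (prep _ (↭-sym part-a)))))))

        star₂ : star L₂ + N L₂ ≈ K₂
        star₂ = trans (star-equation false true part-b) (trans (sym (Sum-outside (λ { (there q , _) → proj₁ fresh-ab q })))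
          (trans (Sum-↭ (↭-sym part-b)) (smaller false true (↭-trans part-ab (prep _ (↭-sym part-b))))))

        avoid : SubsetSums.Σ⊆ K U′ (Faces.face K x y ρ₁ L₃) ≈ B
        avoid = trans (avoiding h<a a<b b<t (proj₂ U′∃) (proj₂ U″∃) (bounded-part {true} {true} part-ab) (here ≡.refl) (there (here ≡.refl)))
          (trans (Sum₀-↭ (↭-sym part-ab)) (Sum₀-part true true true true))

        S-equation : S ≈ B + x * (star ms + star L₁ + star L₂ + star L₃)
        S-equation = begin
          Sum full
            ≈⟨ trans (Sum-↭ part-ab) (Sum-split L₃) ⟩
          SubsetSums.Σ⊆ K U′ (Faces.face K x y ρ₁ L₃) + SubsetSums.Σ⊆ K U′ (λ σ → Faces.face K x y ρ₁ L₃ ((a , b) ∷ σ))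
            ≈⟨ +-cong avoid (trans (cone-sum (proj₁ fresh-ab) (proj₂ fresh-ab)) (*-congʳ (reflexive (weight-< a<b)))) ⟩
          B + x * (star ms + star L₁ + star L₂ + star L₃) ∎

        star₃ : star L₃ + N L₃ ≈ B
        star₃ = trans (star-equation true true part-ab) avoid

        N-total : y * ((1# + y) * (N ms + N L₁ + N L₂ + N L₃)) ≈ (1# + y) * ((1# + y) * B)
        N-total = begin
          y * ((1# + y) * (N ms + N L₁ + N L₂ + N L₃))
            ≈⟨ *-congˡ (solve 5 (λ z a b c d → z :* (a :+ b :+ c :+ d) := z :* a :+ z :* b :+ z :* c :+ z :* d) refl (1# + y) (N ms) (N L₁) (N L₂) (N L₃)) ⟩
          y * ((1# + y) * N ms + (1# + y) * N L₁ + (1# + y) * N L₂ + (1# + y) * N L₃)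
            ≈⟨ *-congˡ (+-cong (+-cong (+-cong (N-equation false false ↭-refl) (N-equation true false part-a)) (N-equation false true part-b)) (N-equation true true part-ab)) ⟩
          y * (y * Σv false false + y * Σv true false + y * Σv false true + y * Σv true true)
            ≈⟨ *-congˡ (solve 5 (λ z a b c d → z :* a :+ z :* b :+ z :* c :+ z :* d := z :* (a :+ b :+ c :+ d)) refl y _ _ _ _) ⟩
          y * (y * (Σv false false + Σv true false + Σv false true + Σv true true))
            ≈⟨ v-total ⟩
          (1# + y) * ((1# + y) * B) ∎

        yN : y * (N ms + N L₁ + N L₂ + N L₃) ≈ (1# + y) * B
        yN = 1+y-cancel (trans (solve 3 (λ y z n → z :* (y :* n) := y :* (z :* n)) refl y (1# + y) (N ms + N L₁ + N L₂ + N L₃)) N-total)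

        crossing-identity : y * (F - x * (K₂ + K₁ + K₀)) ≈ (y - x) * B
        crossing-identity = ≡.subst₂ (λ f k → y * (f - x * k) ≈ (y - x) * B)
          (≡.cong κ (≡.trans (at 𝐀∷ʳ) (≡.sym (letters-part true true true true))))
          (≡.cong₂ _+_ (≡.cong₂ _+_ (≡.cong κ (≡.trans (≡.cong (λ z → 𝐁^ suc k ++ w ++ 𝐁 ∷ z) 𝐀∷ʳ) (≡.sym (letters-part true false true true))))
              (≡.cong κ (≡.trans (≡.cong (λ z → 𝐁^ suc k ++ 𝐀 ∷ w ++ z) 𝐀∷ʳ) (≡.sym (letters-part true true false true)))))
            (≡.cong κ (≡.trans (≡.cong (λ z → 𝐁^ suc k ++ w ++ z) 𝐀∷ʳ) (≡.sym (letters-part true false false true)))))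
          (trans (κ-crossing (suc k) (suc j) w) (*-congˡ (reflexive (≡.cong κ₀ (at 𝐀∷ʳ)))))
          where
          𝐀∷ʳ : 𝐀^ suc j ≡ 𝐀^ j ++ 𝐀 ∷ []
          𝐀∷ʳ = ≡.sym (≡.trans (replicate-shift j 𝐀 []) (≡.cong (𝐀 ∷_) (Listₚ.++-identityʳ _)))
          at : ∀ {z z′} → z ≡ z′ → 𝐁^ suc k ++ 𝐀 ∷ w ++ 𝐁 ∷ z ≡ 𝐁^ suc k ++ 𝐀 ∷ w ++ 𝐁 ∷ z′
          at ≡.refl = ≡.refl

        -- With n the sum of the four values of `N`, the equations give S = B + x(K₀ + K₁ + K₂ + B -
        -- n) and y n = (1 + y) B. Hence y(S - x(K₀ + K₁ + K₂)) = (y - x) B, which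
        -- `crossing-identity` asserts for F in place of S.
        full-correct : Correct full
        full-correct = y-cancel (modulo 1# (sym crossing-identity) (modulo (- x) yN (modulo y S-equation
          (modulo (x * y) star₀ (modulo (x * y) star₁ (modulo (x * y) star₂ (modulo (x * y) star₃
            (solve 16 (λ x y S F K₀ K₁ K₂ B s₀ s₁ s₂ s₃ n₀ n₁ n₂ n₃ →
              y :* S := y :* F
                :+ 𝟙 :* ((y :- x) :* B :- y :* (F :- x :* (K₂ :+ K₁ :+ K₀)))
                :+ (:- x) :* (y :* (n₀ :+ n₁ :+ n₂ :+ n₃) :- (𝟙 :+ y) :* B)
                :+ y :* (S :- (B :+ x :* (s₀ :+ s₁ :+ s₂ :+ s₃)))
                :+ (x :* y) :* (s₀ :+ n₀ :- K₀)
                :+ (x :* y) :* (s₁ :+ n₁ :- K₁)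
                :+ (x :* y) :* (s₂ :+ n₂ :- K₂)
                :+ (x :* y) :* (s₃ :+ n₃ :- B)) refl
              x y S F K₀ K₁ K₂ B (star ms) (star L₁) (star L₂) (star L₃) (N ms) (N L₁) (N L₂) (N L₃)))))))))

    crossing : Crossing
    crossing {n} bs {a} ws {b} {m} as _ _ (≡.refl ∷ all𝐁) all𝐀 = last (initLast (m ∷ as)) (λ ()) all𝐀
      where
      Goal : List Node → Set
      Goal ns = Sorted ns → Complete ns → CorrectBelow ns → Correct ns
      last : ∀ {as} → InitLast as → as ≢ [] → All (Is 𝐀) as → Goal ((n ∷ bs) ++ (𝐀 , a) ∷ ws ++ (𝐁 , b) ∷ as)
      last []               ne all = ⊥-elim (ne ≡.refl)
      last (as ∷ʳ′ (𝐁 , t)) ne all = ⊥-elim (not-𝐁 all (Membershipₚ.∈-++⁺ʳ as (here ≡.refl)))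
      last (as ∷ʳ′ (𝐀 , t)) ne all = ≡.subst Goal flat (Step.full-correct bs ws as all𝐁 (Allₚ.++⁻ˡ as all))
        where
        flat : n ∷ (bs ++ (𝐀 , a) ∷ ws ++ (𝐁 , b) ∷ as) ++ (𝐀 , t) ∷ [] ≡ (n ∷ bs) ++ (𝐀 , a) ∷ ws ++ (𝐁 , b) ∷ as ++ (𝐀 , t) ∷ []
        flat = ≡.cong (n ∷_) (≡.trans (Listₚ.++-assoc bs _ _) (≡.cong (λ z → bs ++ (𝐀 , a) ∷ z) (Listₚ.++-assoc ws _ _)))

    all-crossing-correct : ∀ {ns} → Sorted ns → Complete ns → Correct ns
    all-crossing-correct = nesting-correct ≡.refl crossing

-- Forward arcs alone: nesting and crossing of 𝐀𝐀𝐁𝐁 give equal counts.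

descent : ∀ ns → (∃ λ us → ∃ λ b → ∃ λ a → ∃ λ vs → ns ≡ us ++ (𝐁 , b) ∷ (𝐀 , a) ∷ vs)
               ⊎ (∃ λ as → ∃ λ bs → ns ≡ as ++ bs × All (Is 𝐀) as × All (Is 𝐁) bs)
descent [] = inj₂ ([] , [] , ≡.refl , [] , [])
descent (n ∷ ns) with descent ns
... | inj₁ (us , b , a , vs , ≡.refl) = inj₁ (n ∷ us , b , a , vs , ≡.refl)
descent ((𝐀 , a) ∷ ns) | inj₂ (as , bs , ≡.refl , all𝐀 , all𝐁) = inj₂ ((𝐀 , a) ∷ as , bs , ≡.refl , ≡.refl ∷ all𝐀 , all𝐁)
descent ((𝐁 , b) ∷ ns) | inj₂ ([] , bs , ≡.refl , all𝐀 , all𝐁) = inj₂ ([] , (𝐁 , b) ∷ bs , ≡.refl , [] , ≡.refl ∷ all𝐁)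
descent ((𝐁 , b) ∷ ns) | inj₂ ((𝐀 , a) ∷ as , bs , ≡.refl , all𝐀 , all𝐁) = inj₁ ([] , b , a , as ++ bs , ≡.refl)
descent ((𝐁 , b) ∷ ns) | inj₂ ((𝐁 , a) ∷ as , bs , ≡.refl , () ∷ all𝐀 , all𝐁)

module ForwardCrossing (K : CommutativeRing 0ℓ 0ℓ) (x y : CommutativeRing.Carrier K) (U : List Arc) (U! : Unique U) where

  -- With serial mixed types and nesting 𝐁𝐁𝐀𝐀 every adjacent 𝐁𝐀 is removable, so only the words 𝐀^p
  -- 𝐁^q feel the crossing of 𝐀𝐀𝐁𝐁.
  ρ₂ : Pattern
  ρ₂ = pattern′ false false false true

  open CommutativeRing K hiding (zero)
  open Relation.Binary.Reasoning.Setoid setoid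
  open IntegerSolver K
  open Canonical K x y
  open Compatibility ρ₂
  open Faces K x y ρ₂
  open Universe U U!
  open Counting K x y ρ₂ U U!
  open Reduction K x y ρ₂ U U!
  open NestingForward K x y ρ₂ U U! using (all𝐀-correct; all𝐁-correct)

  -- As 𝐀𝐀𝐁𝐁 crosses, the first 𝐀 goes with the first 𝐁; removing this arc gives the recursion of
  -- `D`.
  grid-correct : ∀ as bs → All (Is 𝐀) as → All (Is 𝐁) bs → Sorted (as ++ bs) → Complete (as ++ bs) → CorrectBelow (as ++ bs) → Correct (as ++ bs)
  grid-correct [] bs all𝐀 all𝐁 s c ih = all𝐁-correct all𝐁
  grid-correct (n ∷ as) [] all𝐀 all𝐁 s c ih = all𝐀-correct (Allₚ.++⁺ all𝐀 [])
  grid-correct ((𝐀 , a) ∷ as) ((𝐁 , b) ∷ bs) (_ ∷ all𝐀) (_ ∷ all𝐁) s c ih = begin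
    Sum ((𝐀 , a) ∷ as ++ (𝐁 , b) ∷ bs)
      ≈⟨ remove-pair (prep _ (Permₚ.shift _ as bs)) ↭-refl (Permₚ.shift _ as bs)
           (skip _ (Sublistₚ.++⁺ {as = as} ⊆-refl (skip _ ⊆-refl))) (keep ≡.refl (Sublistₚ.++⁺ {as = as} ⊆-refl (skip _ ⊆-refl))) (skip _ ⊆-refl)
           s c ih (λ c∈ d∈ → good ([ (λ p → p) , (λ q → ⊥-elim (not-𝐀 all𝐁 q)) ]′ (split-∈ as c∈))
                               ([ (λ q → ⊥-elim (not-𝐁 all𝐀 q)) , (λ p → p) ]′ (split-∈ as d∈))) ⟩
    weight (a , b) * (κ (letters (as ++ bs)) + κ (letters ((𝐀 , a) ∷ as ++ bs)) + κ (letters (as ++ (𝐁 , b) ∷ bs)))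
      ≡⟨ ≡.cong₂ _*_ (weight-< a<b) (≡.cong₂ _+_ (≡.cong₂ _+_ (value as bs all𝐀 all𝐁) (value ((𝐀 , a) ∷ as) bs (≡.refl ∷ all𝐀) all𝐁)) (value as ((𝐁 , b) ∷ bs) all𝐀 (≡.refl ∷ all𝐁))) ⟩
    x * (D p q + D (suc p) q + D p (suc q))
      ≈⟨ *-congˡ (solve 3 (λ a b c → a :+ b :+ c := c :+ b :+ a) refl _ _ _) ⟩
    D (suc p) (suc q)
      ≡⟨ value ((𝐀 , a) ∷ as) ((𝐁 , b) ∷ bs) (≡.refl ∷ all𝐀) (≡.refl ∷ all𝐁) ⟨
    κ (letters ((𝐀 , a) ∷ as ++ (𝐁 , b) ∷ bs)) ∎
    where
    p q : ℕ
    p = length as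
    q = length bs
    value : ∀ as bs → All (Is 𝐀) as → All (Is 𝐁) bs → κ (letters (as ++ bs)) ≡ D (length as) (length bs)
    value as bs all𝐀 all𝐁 = ≡.trans (≡.cong κ (≡.trans (letters-++ as bs) (≡.cong₂ _++_ (letters-all all𝐀) (letters-all all𝐁)))) (κ-𝐀^𝐁^ (length as) (length bs))
    a<b : a < b
    a<b = All.lookup (sorted-after [] s) (Membershipₚ.∈-++⁺ʳ as (here ≡.refl))
    good : ∀ {c d} → (𝐀 , c) ∈ as → (𝐁 , d) ∈ bs → compatible (a , b) (c , d) ≡ true
    good {c} {d} c∈ d∈ = ≡.trans (compatible-< (All.lookup (sorted-after [] s) (Membershipₚ.∈-++⁺ˡ c∈)) (All.lookup (sorted-after ((𝐀 , a) ∷ as) s) d∈))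
      (≡.cong not (inverse-aabb {a} {c} {b} {d} a<b (All.lookup (sorted-before ((𝐀 , a) ∷ as) s) (there c∈))))

  crossing-forward-correct : ∀ {ns} → Sorted ns → Complete ns → Correct ns
  crossing-forward-correct {ns} = go (suc (length ns)) ℕₚ.≤-refl
    where
    step : ∀ ns → Sorted ns → Complete ns → CorrectBelow ns → Correct ns
    step ns with descent ns
    ... | inj₁ (us , b , a , vs , ≡.refl) = adjacent-correct us vs ≡.refl (inj₂ ≡.refl) (inj₂ ≡.refl)
    ... | inj₂ (as , bs , ≡.refl , all𝐀 , all𝐁) = grid-correct as bs all𝐀 all𝐁
    go : ∀ k {ns} → length ns < k → Sorted ns → Complete ns → Correct ns
    go (suc k) {ns} (s≤s le) s c = step ns s c (λ lt s′ c′ → go k (ℕₚ.<-≤-trans lt le) s′ c′)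

Forward : Arc → Set
Forward (a , b) = a < b

forward? : ∀ α → Dec (Forward α)
forward? (a , b) = a ℕₚ.<? b

module ForwardCounts (K : CommutativeRing 0ℓ 0ℓ) (x : CommutativeRing.Carrier K) (U : List Arc) (U! : Unique U) where

  open CommutativeRing K hiding (zero)
  open WeightLemmas K

  forward-zero : ∀ {α} → ¬ Forward α → Weights.weight K x 0# α ≈ 0#
  forward-zero {a , b} ¬f rewrite ≤⇒<ᵇ≡false (ℕₚ.≮⇒≥ ¬f) = refl

  forward-transfer : ∀ ρ ρ′ → Pattern.aabb-nests ρ ≡ Pattern.aabb-nests ρ′ → ∀ {ns} →
    Faces.Universe.Sum K x 0# ρ U U! ns ≈ Faces.Universe.Sum K x 0# ρ′ U U! ns
  forward-transfer ρ ρ′ eq = transfer forward? forward-zero ρ ρ′ U U!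
    (λ f₁ f₂ _ _ → Agreement.agreement-forward ρ ρ′ eq f₁ f₂)

  -- At y = 0 only the rule for 𝐀𝐀𝐁𝐁 is seen, so the other flags may be replaced by those of two
  -- patterns for which the count is already known to be `κ`.
  forward-counts : ∀ p q s {ns} → Sorted ns → Counting.Complete K x 0# (pattern′ p q false s) U U! ns →
    Faces.Universe.Sum K x 0# (pattern′ p q false s) U U! ns ≈ Faces.Universe.Sum K x 0# (pattern′ p q true s) U U! ns
  forward-counts p q s srt c = trans (forward-transfer (pattern′ p q false s) (pattern′ false false false true) ≡.refl)
    (trans (ForwardCrossing.crossing-forward-correct K x 0# U U! srt c)
    (trans (sym (NestingForward.nesting-correct K x 0# (pattern′ false false true true) U U! ≡.refl (λ _ _ _ ()) srt c))
           (forward-transfer (pattern′ false false true true) (pattern′ p q true s) ≡.refl)))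

-- Replacing a crossing 𝐀𝐀𝐁𝐁 by a nesting one.

-- If not both mixed types cross, compatibility of a forward arc with a backward arc splits
-- into a condition on its 𝐀-end and a condition on its 𝐁-end.
admits𝐀 admits𝐁 : Bool → ℕ → Arc → Bool
admits𝐀 q e (c , d) = if q then not (c <ᵇ e) else not ((d <ᵇ e) ∧ (e <ᵇ c))
admits𝐁 p f (c , d) = if p then not (f <ᵇ d) else not ((d <ᵇ f) ∧ (f <ᵇ c))

separation : ∀ p q r s → p ≡ false ⊎ q ≡ false → ∀ {c d e f} → d < c → e < f → e ≢ d → f ≢ c →
  Compatibility.compatible (pattern′ p q r s) (c , d) (e , f) ≡ admits𝐀 q e (c , d) ∧ admits𝐁 p f (c , d)
separation p q r s ¬pq {c} {d} {e} {f} d<c e<f e≢d f≢c = cases (ℕₚ.<-cmp c e) (ℕₚ.<-cmp d f) (ℕₚ.<-cmp d e) (ℕₚ.<-cmp f c)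
  where
  open Compatibility (pattern′ p q r s)
  -- the values of the comparisons c<e, d<e, e<c, f<d, d<f, f<c
  ends : ∀ {v₁ v₂ v₃ v₄ v₅ v₆} → (c <ᵇ e) ≡ v₁ → (d <ᵇ e) ≡ v₂ → (e <ᵇ c) ≡ v₃ → (f <ᵇ d) ≡ v₄ → (d <ᵇ f) ≡ v₅ → (f <ᵇ c) ≡ v₆ →
    admits𝐀 q e (c , d) ∧ admits𝐁 p f (c , d) ≡ (if q then not v₁ else not (v₂ ∧ v₃)) ∧ (if p then not v₄ else not (v₅ ∧ v₆))
  ends ≡.refl ≡.refl ≡.refl ≡.refl ≡.refl ≡.refl = ≡.refl
  if-same : ∀ b → (if b then true else true) ≡ true
  if-same true  = ≡.refl
  if-same false = ≡.refl
  if-id : ∀ b → (if b then true else false) ≡ b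
  if-id true  = ≡.refl
  if-id false = ≡.refl
  if-not : ∀ b → (if b then false else true) ≡ not b
  if-not true  = ≡.refl
  if-not false = ≡.refl
  both : ∀ {u v u′ v′ w} → u ≡ u′ → v ≡ v′ → u′ ∧ v′ ≡ w → u ∧ v ≡ w
  both ≡.refl ≡.refl eq = eq
  neither : p ≡ false ⊎ q ≡ false → q ∧ p ≡ false
  neither (inj₁ ≡.refl) = Boolₚ.∧-zeroʳ q
  neither (inj₂ ≡.refl) = ≡.refl
  sym′ : ∀ {v} → compatible (e , f) (c , d) ≡ v → compatible (c , d) (e , f) ≡ v
  sym′ = ≡.trans (compatible-sym (c , d) (e , f))
  infixr 1 _⟨=⟩_
  _⟨=⟩_ : ∀ {u v w : Bool} → u ≡ w → v ≡ w → u ≡ v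
  p₁ ⟨=⟩ p₂ = ≡.trans p₁ (≡.sym p₂)
  t : ∀ {m n} → m < n → (m <ᵇ n) ≡ true
  t = <⇒<ᵇ≡true
  n : ∀ {m n} → n ≤ m → (m <ᵇ n) ≡ false
  n = ≤⇒<ᵇ≡false
  ≤ʳ : ∀ {m n} → m < n → m ≤ n
  ≤ʳ = ℕₚ.<⇒≤
  cases : _ → _ → _ → _ → compatible (c , d) (e , f) ≡ admits𝐀 q e (c , d) ∧ admits𝐁 p f (c , d)
  cases (tri≈ _ ≡.refl _) _ _ _ = compatible-≡ˡ c d f ⟨=⟩
    ≡.trans (ends (n {c} {c} ℕₚ.≤-refl) (t d<c) (n {c} {c} ℕₚ.≤-refl) (n (≤ʳ (ℕₚ.<-trans d<c e<f))) (t (ℕₚ.<-trans d<c e<f)) (n (≤ʳ e<f)))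
      (both (if-same q) (if-same p) ≡.refl)
  cases (tri< c<e _ _) _ _ _ = ≡.trans (compatible-< c<e (ℕₚ.<-trans d<c c<f)) (≡.cong not (inverse-baab {c} {e} {d} {f} d<c c<e e<f)) ⟨=⟩
    ≡.trans (ends (t c<e) (t (ℕₚ.<-trans d<c c<e)) (n (≤ʳ c<e)) (n (≤ʳ (ℕₚ.<-trans d<c c<f))) (t (ℕₚ.<-trans d<c c<f)) (n (≤ʳ c<f)))
      (both (if-not q) (if-same p) (Boolₚ.∧-identityʳ _))
    where
    c<f : c < f
    c<f = ℕₚ.<-trans c<e e<f
  cases (tri> _ _ e<c) (tri≈ _ ≡.refl _) _ _ = compatible-≡ʳ c e d ⟨=⟩
    ≡.trans (ends (n (≤ʳ e<c)) (n (≤ʳ e<f)) (t e<c) (n {d} {d} ℕₚ.≤-refl) (n {d} {d} ℕₚ.≤-refl) (t d<c))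
      (both (if-same q) (if-same p) ≡.refl)
  cases (tri> _ _ e<c) (tri> _ _ f<d) _ _ = sym′ (≡.trans (compatible-< e<c f<d) (≡.cong not (inverse-abba {e} {c} {f} {d} e<f f<d d<c))) ⟨=⟩
    ≡.trans (ends (n (≤ʳ e<c)) (n (≤ʳ (ℕₚ.<-trans e<f f<d))) (t e<c) (t f<d) (n (≤ʳ f<d)) (t (ℕₚ.<-trans f<d d<c)))
      (both (if-same q) (if-not p) ≡.refl)
  cases _ _ (tri≈ _ d≡e _) _ = ⊥-elim (e≢d (≡.sym d≡e))
  cases _ _ _ (tri≈ _ f≡c _) = ⊥-elim (f≢c f≡c)
  cases (tri> _ _ e<c) (tri< d<f _ _) (tri> _ _ e<d) (tri> _ _ c<f) = sym′ (≡.trans (compatible-> e<c d<f) (inverse-abab {e} {c} {d} {f} e<d d<c c<f)) ⟨=⟩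
    ≡.trans (ends (n (≤ʳ e<c)) (n (≤ʳ e<d)) (t e<c) (n (≤ʳ d<f)) (t d<f) (n (≤ʳ c<f)))
      (both (if-same q) (if-same p) ≡.refl)
  cases (tri> _ _ e<c) (tri< d<f _ _) (tri> _ _ e<d) (tri< f<c _ _) = sym′ (≡.trans (compatible-> e<c d<f) (inverse-abba {e} {c} {d} {f} e<d d<f f<c)) ⟨=⟩
    ≡.trans (ends (n (≤ʳ e<c)) (n (≤ʳ e<d)) (t e<c) (n (≤ʳ d<f)) (t d<f) (t f<c))
      (both (if-same q) (if-id p) ≡.refl)
  -- The forward arc lies under the backward one in a 𝐁𝐀𝐁𝐀 and must be rejected. The two end
  -- conditions are q and p here, and their conjunction is false because not both mixed types cross.
  cases (tri> _ _ e<c) (tri< d<f _ _) (tri< d<e _ _) (tri< f<c _ _) = sym′ (≡.trans (compatible-> e<c d<f) (inverse-baba {e} {c} {d} {f} d<e e<f f<c)) ⟨=⟩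
    ≡.trans (ends (n (≤ʳ e<c)) (t d<e) (t e<c) (n (≤ʳ d<f)) (t d<f) (t f<c))
      (both (if-id q) (if-id p) (neither ¬pq))
  cases (tri> _ _ e<c) (tri< d<f _ _) (tri< d<e _ _) (tri> _ _ c<f) = sym′ (≡.trans (compatible-> e<c d<f) (inverse-baab {e} {c} {d} {f} d<e e<c c<f)) ⟨=⟩
    ≡.trans (ends (n (≤ʳ e<c)) (t d<e) (t e<c) (n (≤ʳ d<f)) (t d<f) (n (≤ʳ c<f)))
      (both (if-id q) (if-same p) (Boolₚ.∧-identityʳ _))

filter-↭ : ∀ {X : Set} {P : X → Set} (P? : ∀ z → Dec (P z)) (L : List X) → L ↭ filter (λ z → ¬? (P? z)) L ++ filter P? L
filter-↭ P? [] = ↭-refl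
filter-↭ P? (z ∷ L) with P? z
... | yes _ = ↭-trans (prep z (filter-↭ P? L)) (↭-sym (Permₚ.shift z (filter (λ z → ¬? (P? z)) L) (filter P? L)))
... | no _  = prep z (filter-↭ P? L)

module Switch (K : CommutativeRing 0ℓ 0ℓ) (x y : CommutativeRing.Carrier K) (U : List Arc) (U! : Unique U)
              (p q s : Bool) (¬pq : p ≡ false ⊎ q ≡ false) where

  open CommutativeRing K hiding (zero)
  open Relation.Binary.Reasoning.Setoid setoid
  open IntegerSolver K
  open SubsetSums K
  open WeightLemmas K
  open Weights K x y
  open ForwardCounts K x U U!

  ρ : Bool → Pattern
  ρ r = pattern′ p q r s

  Complete : List Node → Set
  Complete = Counting.Complete K x y (ρ true) U U!

  forwards backwards : List Arc
  forwards  = filter forward? U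
  backwards = filter (λ α → ¬? (forward? α)) U

  U↭ : U ↭ backwards ++ forwards
  U↭ = filter-↭ forward? U

  all-forward : All Forward forwards
  all-forward = Allₚ.all-filter forward? U

  all-backward : All (λ α → ¬ Forward α) backwards
  all-backward = Allₚ.all-filter (λ α → ¬? (forward? α)) U

  -- A set of forward arcs that completes a given backward part: confined to the nodes `ms` that
  -- this part admits, and obliged to cover only the nodes `rs` that it leaves bare.
  record Partial (r : Bool) (ms rs : List Node) (φ : List Arc) : Set where
    constructor partial
    field
      inside : ∀ {α} → α ∈ φ → Inside ms α
      clique : ∀ {α β} → α ∈ φ → β ∈ φ → Compatibility.compatible (ρ r) α β ≡ true
      covers : ∀ {n} → n ∈ rs → Covered n φ
  open Partial

  abstract
    partial? : ∀ r ms rs φ → Dec (Partial r ms rs φ)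
    partial? r ms rs φ = map′
      (λ { (i , c , v) → partial (All.lookup i) (λ α∈ → All.lookup (All.lookup c α∈)) (All.lookup v) })
      (λ v → All.tabulate (inside v) , All.tabulate (λ α∈ → All.tabulate (clique v α∈)) , All.tabulate (covers v))
      (All.all? (inside? ms) φ ×-dec All.all? (λ α → All.all? (λ β → Compatibility.compatible (ρ r) α β Boolₚ.≟ true) φ) φ ×-dec All.all? (λ n → covered? n φ) rs)

  Count : Bool → List Node → List Node → Carrier
  Count r ms rs = Σ⊆ forwards (λ φ → ind (partial? r ms rs φ) * wt φ)

  only-empty : ∀ {L f} → All (λ α → ¬ Forward α) L → (∀ {α} σ → ¬ Forward α → f (α ∷ σ) ≈ 0#) → Σ⊆ L f ≈ f []
  only-empty []       z = refl
  only-empty {α ∷ L} (¬f ∷ ps) z = trans (+-cong (only-empty ps z) (Σ⊆-0 L (λ σ → z σ ¬f))) (+-identityʳ _)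

  count-all : ∀ r ms rs → (∀ {n} → n ∈ rs → n ∈ ms) → (∀ {n} → n ∈ ms → n ∈ rs) →
              Count r ms rs ≈ Faces.Universe.Sum K x 0# (ρ r) U U! ms
  count-all r ms rs sub sup = sym (begin
    Σ⊆ U (F.face ms)
      ≈⟨ Σ⊆-↭ (F.face-↭ ms) U↭ ⟩
    Σ⊆ (backwards ++ forwards) (F.face ms)
      ≈⟨ Σ⊆-++ backwards forwards (F.face ms) ⟩
    Σ⊆ backwards (λ τ → Σ⊆ forwards (λ φ → F.face ms (τ ++ φ)))
      ≈⟨ only-empty {f = λ τ → Σ⊆ forwards (λ φ → F.face ms (τ ++ φ))} all-backward
           (λ σ ¬f → Σ⊆-0 forwards (λ φ → trans (*-congˡ (trans (*-congʳ (forward-zero ¬f)) (zeroˡ _))) (zeroʳ _))) ⟩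
    Σ⊆ forwards (F.face ms)
      ≈⟨ Σ⊆-cong-All all-forward (λ φ fw → *-cong
           (ind-⇔ (λ v → partial (F.inside v) (F.clique v) (λ n∈ → F.covers v (sub n∈))) (λ v → F.valid (inside v) (clique v) (λ n∈ → covers v (sup n∈))) _ _)
           (wt-cong same-weight fw)) ⟩
    Count r ms rs ∎)
    where
    module F = Faces K x 0# (ρ r)
    same-weight : ∀ {α} → Forward α → Weights.weight K x 0# α ≈ Weights.weight K x y α
    same-weight {a , b} a<b rewrite <⇒<ᵇ≡true a<b = refl

  count-none : ∀ r ms rs {n} → n ∈ rs → n ∉ ms → Count r ms rs ≈ 0#
  count-none r ms rs {n} n∈ n∉ = Σ⊆-0 forwards (λ φ → trans (*-congʳ (ind-no (partial? r ms rs φ) (λ v →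
    let α , α∈ , inc = find (covers v n∈) in n∉ (inside-node n (inside v α∈) inc)))) (zeroˡ _))

  count-split : ∀ r us {n} vs rs → n ∉ us ++ vs → Count r (us ++ n ∷ vs) rs ≈ Count r (us ++ n ∷ vs) (n ∷ rs) + Count r (us ++ vs) rs
  count-split r us {n} vs rs n∉ = trans
    (Σ⊆-cong forwards (λ φ → trans (*-congʳ (pointwise φ (covered? n φ))) (distribʳ _ _ _)))
    (Σ⊆-+ forwards _ _)
    where
    grow : ∀ {m} → m ∈ us ++ vs → m ∈ us ++ n ∷ vs
    grow m∈ = [ Membershipₚ.∈-++⁺ˡ , (λ q → Membershipₚ.∈-++⁺ʳ us (there q)) ]′ (split-∈ us m∈)
    shrink : ∀ {m} → m ≢ n → m ∈ us ++ n ∷ vs → m ∈ us ++ vs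
    shrink m≢n m∈ = [ Membershipₚ.∈-++⁺ˡ , (λ { (here m≡n) → ⊥-elim (m≢n m≡n) ; (there q) → Membershipₚ.∈-++⁺ʳ us q }) ]′ (split-∈ us m∈)
    pointwise : ∀ φ → Dec (Covered n φ) → ind (partial? r (us ++ n ∷ vs) rs φ) ≈ ind (partial? r (us ++ n ∷ vs) (n ∷ rs) φ) + ind (partial? r (us ++ vs) rs φ)
    pointwise φ (yes c) = trans
      (ind-⇔ (λ v → partial (inside v) (clique v) (λ { (here ≡.refl) → c ; (there q) → covers v q }))
             (λ v → partial (inside v) (clique v) (λ q → covers v (there q))) (partial? r (us ++ n ∷ vs) rs φ) (partial? r (us ++ n ∷ vs) (n ∷ rs) φ))
      (sym (trans (+-congˡ (ind-no (partial? r (us ++ vs) rs φ) (λ v → let α , α∈ , inc = find c in n∉ (inside-node n (inside v α∈) inc)))) (+-identityʳ _)))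
    pointwise φ (no ¬c) = trans
      (ind-⇔ (λ v → partial (λ {α} α∈ → shrink (λ { ≡.refl → ¬c (lose α∈ ≡.refl) }) (proj₁ (inside v α∈)) , shrink (λ { ≡.refl → ¬c (lose α∈ ≡.refl) }) (proj₂ (inside v α∈)))
                            (clique v) (covers v))
             (λ v → partial (λ α∈ → inside-weaken grow (inside v α∈)) (clique v) (covers v)) (partial? r (us ++ n ∷ vs) rs φ) (partial? r (us ++ vs) rs φ))
      (sym (trans (+-congʳ (ind-no (partial? r (us ++ n ∷ vs) (n ∷ rs) φ) (λ v → ¬c (covers v (here ≡.refl))))) (+-identityˡ _)))

  -- Each optional node is either covered, and becomes an obligation, or avoided, and is deleted.
  -- When no optional node is left, the count is a full count of forward faces, or zero if an
  -- obligation cannot be met.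
  count-independent : ∀ us vs rs → Sorted (us ++ vs) → Complete (us ++ vs) → (∀ {n} → n ∈ us → n ∈ rs) →
                      Count false (us ++ vs) rs ≈ Count true (us ++ vs) rs
  count-independent us [] rs srt c sub rewrite Listₚ.++-identityʳ us with All.all? (_∈ₙ? us) rs
  ... | yes all = trans (count-all false us rs (All.lookup all) sub) (trans (forward-counts p q s srt c) (sym (count-all true us rs (All.lookup all) sub)))
  ... | no ¬all with find (Allₚ.¬All⇒Any¬ (_∈ₙ? us) rs ¬all)
  ...   | n , n∈ , n∉ = trans (count-none false us rs n∈ n∉) (sym (count-none true us rs n∈ n∉))
  count-independent us (n ∷ vs) rs srt c sub with n ∈ₙ? rs
  ... | yes n∈ = ≡.subst (λ ms → Count false ms rs ≈ Count true ms rs) assoc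
    (count-independent (us ++ n ∷ []) vs rs (≡.subst Sorted (≡.sym assoc) srt) (≡.subst Complete (≡.sym assoc) c)
      (λ m∈ → [ sub , (λ { (here ≡.refl) → n∈ }) ]′ (split-∈ us m∈)))
    where
    assoc : (us ++ n ∷ []) ++ vs ≡ us ++ n ∷ vs
    assoc = Listₚ.++-assoc us _ _
  ... | no _ = begin
    Count false (us ++ n ∷ vs) rs
      ≈⟨ count-split false us vs rs n∉ ⟩
    Count false (us ++ n ∷ vs) (n ∷ rs) + Count false (us ++ vs) rs
      ≈⟨ +-cong (≡.subst (λ ms → Count false ms (n ∷ rs) ≈ Count true ms (n ∷ rs)) assoc
                  (count-independent (us ++ n ∷ []) vs (n ∷ rs) (≡.subst Sorted (≡.sym assoc) srt) (≡.subst Complete (≡.sym assoc) c)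
                    (λ m∈ → [ (λ q → there (sub q)) , (λ { (here ≡.refl) → here ≡.refl }) ]′ (split-∈ us m∈))))
                (count-independent us vs rs (sorted-⊆ smaller srt) (Counting.complete-⊆ K x y (ρ true) U U! smaller c) sub) ⟩
    Count true (us ++ n ∷ vs) (n ∷ rs) + Count true (us ++ vs) rs
      ≈⟨ count-split true us vs rs n∉ ⟨
    Count true (us ++ n ∷ vs) rs ∎
    where
    assoc : (us ++ n ∷ []) ++ vs ≡ us ++ n ∷ vs
    assoc = Listₚ.++-assoc us _ _
    smaller : us ++ vs ⊆ us ++ n ∷ vs
    smaller = Sublistₚ.++⁺ ⊆-refl (skip n ⊆-refl)
    n∉ : n ∉ us ++ vs
    n∉ n∈ = [ (λ m∈ → ℕₚ.<-irrefl ≡.refl (All.lookup (sorted-before us srt) m∈)) , (λ m∈ → ℕₚ.<-irrefl ≡.refl (All.lookup (sorted-after us srt) m∈)) ]′ (split-∈ us n∈)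

  module _ {ns : List Node} (srt : Sorted ns) (cpl : Complete ns) where

    private
      Admits : List Arc → Node → Set
      Admits τ (𝐀 , e) = All (λ γ → admits𝐀 q e γ ≡ true) τ
      Admits τ (𝐁 , f) = All (λ γ → admits𝐁 p f γ ≡ true) τ

      admits? : ∀ τ n → Dec (Admits τ n)
      admits? τ (𝐀 , e) = All.all? (λ γ → admits𝐀 q e γ Boolₚ.≟ true) τ
      admits? τ (𝐁 , f) = All.all? (λ γ → admits𝐁 p f γ Boolₚ.≟ true) τ

      -- By `separation`, compatibility with τ is a condition on each end of a forward arc
      -- separately, hence a condition on nodes.
      open-nodes bare-nodes : List Arc → List Node
      open-nodes τ = filter (admits? τ) ns
      bare-nodes τ = filter (λ n → ¬? (covered? n τ)) ns

      record Base (r : Bool) (τ : List Arc) : Set where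
        constructor base
        field
          within : ∀ {α} → α ∈ τ → Inside ns α
          pairwise : ∀ {α β} → α ∈ τ → β ∈ τ → Compatibility.compatible (ρ r) α β ≡ true
      open Base

      base? : ∀ r τ → Dec (Base r τ)
      base? r τ = map′
        (λ { (i , c) → base (All.lookup i) (λ α∈ → All.lookup (All.lookup c α∈)) })
        (λ v → All.tabulate (within v) , All.tabulate (λ α∈ → All.tabulate (pairwise v α∈)))
        (All.all? (inside? ns) τ ×-dec All.all? (λ α → All.all? (λ β → Compatibility.compatible (ρ r) α β Boolₚ.≟ true) τ) τ)

      is-backward : ∀ {a b} → ¬ Forward (a , b) → Inside ns (a , b) → b < a
      is-backward ¬f (a∈ , b∈) = ℕₚ.≤∧≢⇒< (ℕₚ.≮⇒≥ ¬f) (λ { ≡.refl → Counting.sorted-distinct K x y (ρ true) U U! srt a∈ b∈ })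

      base-switch : ∀ r r′ {τ} → All (λ α → ¬ Forward α) τ → Base r τ → Base r′ τ
      base-switch r r′ bw v = base (within v) (λ α∈ β∈ → ≡.trans
        (Agreement.agreement-backward (ρ r′) (ρ r) ≡.refl (is-backward (All.lookup bw α∈) (within v α∈)) (is-backward (All.lookup bw β∈) (within v β∈)))
        (pairwise v α∈ β∈))

      module _ (r : Bool) where
        module F = Faces K x y (ρ r)
        open Compatibility (ρ r) using (compatible; compatible-sym)

        separated : ∀ {α β} → ¬ Forward α → Inside ns α → Forward β → Inside ns β →
                    compatible α β ≡ admits𝐀 q (proj₁ β) α ∧ admits𝐁 p (proj₂ β) α
        separated ¬f in₁ f in₂ = separation p q r s ¬pq (is-backward ¬f in₁) f
          (λ { ≡.refl → distinct (proj₁ in₂) (proj₂ in₁) }) (λ { ≡.refl → distinct (proj₁ in₁) (proj₂ in₂) })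
          where
          distinct : Counting.Distinct K x y (ρ r) U U! ns
          distinct = Counting.sorted-distinct K x y (ρ r) U U! srt

        ∧-true : ∀ {u v} → u ∧ v ≡ true → u ≡ true × v ≡ true
        ∧-true {true} {true} _ = ≡.refl , ≡.refl

        module _ {τ : List Arc} (bw : All (λ α → ¬ Forward α) τ) (v₀ : Base r τ) {φ : List Arc} (fw : All Forward φ) where

          to : F.Valid ns (τ ++ φ) → Partial r (open-nodes τ) (bare-nodes τ) φ
          to v = partial ins (λ α∈ β∈ → F.clique v (Membershipₚ.∈-++⁺ʳ τ α∈) (Membershipₚ.∈-++⁺ʳ τ β∈)) cov
            where
            ins : ∀ {β} → β ∈ φ → Inside (open-nodes τ) β
            ins {e , f} β∈ = Membershipₚ.∈-filter⁺ (admits? τ) (proj₁ in′) (All.tabulate (λ γ∈ → proj₁ (adm γ∈)))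
                           , Membershipₚ.∈-filter⁺ (admits? τ) (proj₂ in′) (All.tabulate (λ γ∈ → proj₂ (adm γ∈)))
              where
              in′ : Inside ns (e , f)
              in′ = F.inside v (Membershipₚ.∈-++⁺ʳ τ β∈)
              adm : ∀ {γ} → γ ∈ τ → admits𝐀 q e γ ≡ true × admits𝐁 p f γ ≡ true
              adm γ∈ = ∧-true (≡.trans (≡.sym (separated (All.lookup bw γ∈) (within v₀ γ∈) (All.lookup fw β∈) in′))
                (F.clique v (Membershipₚ.∈-++⁺ˡ γ∈) (Membershipₚ.∈-++⁺ʳ τ β∈)))
            cov : ∀ {n} → n ∈ bare-nodes τ → Covered n φ
            cov n∈ with Membershipₚ.∈-filter⁻ (λ n → ¬? (covered? n τ)) {xs = ns} n∈
            ... | n∈ns , ¬c = [ (λ c → ⊥-elim (¬c c)) , (λ c → c) ]′ (Anyₚ.++⁻ τ (F.covers v n∈ns))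

          from : Partial r (open-nodes τ) (bare-nodes τ) φ → F.Valid ns (τ ++ φ)
          from v = F.valid ins (λ α∈ β∈ → clq (Membershipₚ.∈-++⁻ τ α∈) (Membershipₚ.∈-++⁻ τ β∈)) cov
            where
            kept : ∀ {n} → n ∈ open-nodes τ → n ∈ ns × Admits τ n
            kept = Membershipₚ.∈-filter⁻ (admits? τ) {xs = ns}
            in-φ : ∀ {β} → β ∈ φ → Inside ns β
            in-φ β∈ = proj₁ (kept (proj₁ (inside v β∈))) , proj₁ (kept (proj₂ (inside v β∈)))
            ins : ∀ {α} → α ∈ τ ++ φ → Inside ns α
            ins α∈ = [ within v₀ , in-φ ]′ (Membershipₚ.∈-++⁻ τ α∈)
            mixed : ∀ {α β} → α ∈ τ → β ∈ φ → compatible α β ≡ true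
            mixed α∈ β∈ = ≡.trans (separated (All.lookup bw α∈) (within v₀ α∈) (All.lookup fw β∈) (in-φ β∈))
              (≡.cong₂ _∧_ (All.lookup (proj₂ (kept (proj₁ (inside v β∈)))) α∈) (All.lookup (proj₂ (kept (proj₂ (inside v β∈)))) α∈))
            clq : ∀ {α β} → α ∈ τ ⊎ α ∈ φ → β ∈ τ ⊎ β ∈ φ → compatible α β ≡ true
            clq (inj₁ α∈) (inj₁ β∈) = pairwise v₀ α∈ β∈
            clq (inj₁ α∈) (inj₂ β∈) = mixed α∈ β∈
            clq {α} {β} (inj₂ α∈) (inj₁ β∈) = ≡.trans (compatible-sym α β) (mixed β∈ α∈)
            clq (inj₂ α∈) (inj₂ β∈) = clique v α∈ β∈
            cov : ∀ {n} → n ∈ ns → Covered n (τ ++ φ)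
            cov {n} n∈ with covered? n τ
            ... | yes c = Anyₚ.++⁺ˡ c
            ... | no ¬c = Anyₚ.++⁺ʳ τ (covers v (Membershipₚ.∈-filter⁺ (λ n → ¬? (covered? n τ)) n∈ ¬c))

        wt-++ : ∀ τ φ → wt (τ ++ φ) ≈ wt τ * wt φ
        wt-++ []      φ = sym (*-identityˡ _)
        wt-++ (α ∷ τ) φ = trans (*-congˡ (wt-++ τ φ)) (sym (*-assoc _ _ _))

        fibre : ∀ {τ} → All (λ α → ¬ Forward α) τ → Base r τ →
                Σ⊆ forwards (λ φ → F.face ns (τ ++ φ)) ≈ wt τ * Count r (open-nodes τ) (bare-nodes τ)
        fibre {τ} bw v₀ = trans (Σ⊆-cong-All all-forward (λ φ fw → trans
            (*-cong (ind-⇔ (to bw v₀ fw) (from bw v₀ fw) (F.valid? ns (τ ++ φ)) (partial? r (open-nodes τ) (bare-nodes τ) φ)) (wt-++ τ φ))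
            (solve 3 (λ i a b → i :* (a :* b) := a :* (i :* b)) refl _ _ _)))
          (Σ⊆-* forwards (wt τ) _)

        empty-fibre : ∀ {τ} → ¬ Base r τ → Σ⊆ forwards (λ φ → F.face ns (τ ++ φ)) ≈ 0#
        empty-fibre {τ} ¬v = Σ⊆-0 forwards (λ φ → F.face-no (λ v → ¬v
          (base (λ α∈ → F.inside v (Membershipₚ.∈-++⁺ˡ α∈)) (λ α∈ β∈ → F.clique v (Membershipₚ.∈-++⁺ˡ α∈) (Membershipₚ.∈-++⁺ˡ β∈)))))

        fibred : F.Universe.Sum U U! ns ≈ Σ⊆ backwards (λ τ → Σ⊆ forwards (λ φ → F.face ns (τ ++ φ)))
        fibred = trans (Σ⊆-↭ (F.face-↭ ns) U↭) (Σ⊆-++ backwards forwards (F.face ns))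

    -- The faces are fibred over their backward parts. Which backward parts occur, and which nodes
    -- they leave open or bare, does not depend on the rule for 𝐀𝐀𝐁𝐁; the fibres have equal counts
    -- by `count-independent`.
    switch : Faces.Universe.Sum K x y (ρ false) U U! ns ≈ Faces.Universe.Sum K x y (ρ true) U U! ns
    switch = trans (fibred false) (trans (Σ⊆-cong-All all-backward pointwise) (sym (fibred true)))
      where
      pointwise : ∀ τ → All (λ α → ¬ Forward α) τ →
        Σ⊆ forwards (λ φ → Faces.face K x y (ρ false) ns (τ ++ φ)) ≈ Σ⊆ forwards (λ φ → Faces.face K x y (ρ true) ns (τ ++ φ))
      pointwise τ bw with base? false τ
      ... | no ¬v = trans (empty-fibre false ¬v) (sym (empty-fibre true (λ v → ¬v (base-switch true false bw v))))
      ... | yes v = trans (fibre false bw v) (trans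
        (*-congˡ (count-independent [] (open-nodes τ) (bare-nodes τ)
          (sorted-⊆ sub srt) (Counting.complete-⊆ K x y (ρ true) U U! sub cpl) (λ ())))
        (sym (fibre true bw (base-switch false true bw v))))
        where
        sub : open-nodes τ ⊆ ns
        sub = Sublistₚ.filter-⊆ (admits? τ) ns

-- From arrows and rule sets to arcs and patterns.

-- When THTH nests, 𝐀-ends are tails; when HTHT nests, they are heads.
toArc : Bool → Arrow → Arc
toArc true  (t , h) = t , h
toArc false (t , h) = h , t

-- Exchanging tails and heads swaps THHT with HTTH and TTHH with HHTT, so the flags trade places in
-- the second clause.
patternOf : Bool → RuleSet → Pattern
patternOf true  R = pattern′ (shape≡ᵇ cross (rule R THHT)) (shape≡ᵇ cross (rule R HTTH)) (shape≡ᵇ nest (rule R TTHH)) (shape≡ᵇ nest (rule R HHTT))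
patternOf false R = pattern′ (shape≡ᵇ cross (rule R HTTH)) (shape≡ᵇ cross (rule R THHT)) (shape≡ᵇ nest (rule R HHTT)) (shape≡ᵇ nest (rule R TTHH))

Oriented : Bool → RuleSet → Set
Oriented true  R = rule R THTH ≡ nest × rule R HTHT ≢ nest
Oriented false R = rule R HTHT ≡ nest × rule R THTH ≢ nest

private
  nests serials : Shape → Bool
  nests   = shape≡ᵇ nest
  serials = shape≡ᵇ serial

  nest-true : ∀ {v} → v ≡ nest → nests v ≡ true
  nest-true ≡.refl = ≡.refl

  serial-false : ∀ {v} → v ≡ nest → serials v ≡ false
  serial-false ≡.refl = ≡.refl

  nest-false : ∀ {v} → v ≢ nest → nests v ≡ false
  nest-false {nest}   v≢ = ⊥-elim (v≢ ≡.refl)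
  nest-false {cross}  v≢ = ≡.refl
  nest-false {serial} v≢ = ≡.refl

  serial-THTH : ∀ v → T (allowed THTH v) → v ≢ nest → serials v ≡ true
  serial-THTH nest   _ v≢ = ⊥-elim (v≢ ≡.refl)
  serial-THTH serial _ v≢ = ≡.refl

  serial-HTHT : ∀ v → T (allowed HTHT v) → v ≢ nest → serials v ≡ true
  serial-HTHT nest   _ v≢ = ⊥-elim (v≢ ≡.refl)
  serial-HTHT serial _ v≢ = ≡.refl

  serial-THHT : ∀ v → T (allowed THHT v) → serials v ≡ not (shape≡ᵇ cross v)
  serial-THHT cross  _ = ≡.refl
  serial-THHT serial _ = ≡.refl

  serial-HTTH : ∀ v → T (allowed HTTH v) → serials v ≡ not (shape≡ᵇ cross v)
  serial-HTTH cross  _ = ≡.refl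
  serial-HTTH serial _ = ≡.refl

  cross-TTHH : ∀ v → T (allowed TTHH v) → shape≡ᵇ cross v ≡ not (nests v)
  cross-TTHH nest  _ = ≡.refl
  cross-TTHH cross _ = ≡.refl

  cross-HHTT : ∀ v → T (allowed HHTT v) → shape≡ᵇ cross v ≡ not (nests v)
  cross-HHTT nest  _ = ≡.refl
  cross-HHTT cross _ = ≡.refl

-- Together with `classify′` a global copy of the local functions in `pairType`, so that equations
-- between their values can be stated.
labelAt : ℕ → ℕ → ℕ → ℕ → ℕ → Label
labelAt t₁ h₁ t₂ h₂ k = if (count< t₁ pts ≡ᵇ k) ∨ (count< t₂ pts ≡ᵇ k) then Tl else Hd
  where
  pts : List ℕ
  pts = t₁ ∷ h₁ ∷ t₂ ∷ h₂ ∷ []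

classify′ : Label → Label → Label → Label → Maybe PairType
classify′ Tl Hd Tl Hd = just THTH
classify′ Hd Tl Hd Tl = just HTHT
classify′ Tl Hd Hd Tl = just THHT
classify′ Hd Tl Tl Hd = just HTTH
classify′ Tl Tl Hd Hd = just TTHH
classify′ Hd Hd Tl Tl = just HHTT
classify′ _  _  _  _  = nothing

pairType-classify : ∀ t₁ h₁ t₂ h₂ → pairType (t₁ , h₁) (t₂ , h₂) ≡
  classify′ (labelAt t₁ h₁ t₂ h₂ 0) (labelAt t₁ h₁ t₂ h₂ 1) (labelAt t₁ h₁ t₂ h₂ 2) (labelAt t₁ h₁ t₂ h₂ 3)
pairType-classify t₁ h₁ t₂ h₂
  with labelAt t₁ h₁ t₂ h₂ 0 | labelAt t₁ h₁ t₂ h₂ 1 | labelAt t₁ h₁ t₂ h₂ 2 | labelAt t₁ h₁ t₂ h₂ 3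
... | Tl | Tl | Tl | Tl = ≡.refl
... | Tl | Tl | Tl | Hd = ≡.refl
... | Tl | Tl | Hd | Tl = ≡.refl
... | Tl | Tl | Hd | Hd = ≡.refl
... | Tl | Hd | Tl | Tl = ≡.refl
... | Tl | Hd | Tl | Hd = ≡.refl
... | Tl | Hd | Hd | Tl = ≡.refl
... | Tl | Hd | Hd | Hd = ≡.refl
... | Hd | Tl | Tl | Tl = ≡.refl
... | Hd | Tl | Tl | Hd = ≡.refl
... | Hd | Tl | Hd | Tl = ≡.refl
... | Hd | Tl | Hd | Hd = ≡.refl
... | Hd | Hd | Tl | Tl = ≡.refl
... | Hd | Hd | Tl | Hd = ≡.refl
... | Hd | Hd | Hd | Tl = ≡.refl
... | Hd | Hd | Hd | Hd = ≡.refl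

ruleEdge′ : RuleSet → Shape → Maybe PairType → Bool
ruleEdge′ R shape (just τ) = shape≡ᵇ shape (rule R τ)
ruleEdge′ R shape nothing  = false

edge-rule : ∀ R α β → edge R α β ≡
  (tail α ≡ᵇ tail β) ∨ (head α ≡ᵇ head β) ∨ (fourDistinct α β ∧ ruleEdge′ R (pairShape α β) (pairType α β))
edge-rule R α β with pairType α β
... | just τ  = ≡.refl
... | nothing = ≡.refl

-- Both sides only see the relative order of the four endpoints.
module _ (f : ℕ → ℕ) (<-f : ∀ i j → (f i <ᵇ f j) ≡ (i <ᵇ j)) (≡-f : ∀ i j → (f i ≡ᵇ f j) ≡ (i ≡ᵇ j))
         (⊓-f : ∀ i j → f i ⊓ f j ≡ f (i ⊓ j)) (⊔-f : ∀ i j → f i ⊔ f j ≡ f (i ⊔ j)) where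

  count<-embedding : ∀ p xs → count< (f p) (map f xs) ≡ count< p xs
  count<-embedding p []       = ≡.refl
  count<-embedding p (x ∷ xs) rewrite <-f x p with x <ᵇ p
  ... | true  = ≡.cong suc (count<-embedding p xs)
  ... | false = count<-embedding p xs

  pairType-embedding : ∀ t₁ h₁ t₂ h₂ → pairType (f t₁ , f h₁) (f t₂ , f h₂) ≡ pairType (t₁ , h₁) (t₂ , h₂)
  pairType-embedding t₁ h₁ t₂ h₂ = ≡.trans (pairType-classify (f t₁) (f h₁) (f t₂) (f h₂))
    (≡.trans (classify-cong (same 0) (same 1) (same 2) (same 3)) (≡.sym (pairType-classify t₁ h₁ t₂ h₂)))
    where
    pts : List ℕ
    pts = t₁ ∷ h₁ ∷ t₂ ∷ h₂ ∷ []
    same : ∀ k → labelAt (f t₁) (f h₁) (f t₂) (f h₂) k ≡ labelAt t₁ h₁ t₂ h₂ k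
    same k = ≡.cong₂ (λ m n → if (m ≡ᵇ k) ∨ (n ≡ᵇ k) then Tl else Hd) (count<-embedding t₁ pts) (count<-embedding t₂ pts)
    classify-cong : ∀ {a b c d a′ b′ c′ d′} → a ≡ a′ → b ≡ b′ → c ≡ c′ → d ≡ d′ → classify′ a b c d ≡ classify′ a′ b′ c′ d′
    classify-cong ≡.refl ≡.refl ≡.refl ≡.refl = ≡.refl

  pairShape-embedding : ∀ t₁ h₁ t₂ h₂ → pairShape (f t₁ , f h₁) (f t₂ , f h₂) ≡ pairShape (t₁ , h₁) (t₂ , h₂)
  pairShape-embedding t₁ h₁ t₂ h₂
    rewrite ⊓-f t₁ h₁ | ⊔-f t₁ h₁ | ⊓-f t₂ h₂ | ⊔-f t₂ h₂
      | <-f (t₁ ⊓ h₁) (t₂ ⊓ h₂) | <-f (t₂ ⊓ h₂) (t₁ ⊓ h₁) | <-f (t₂ ⊔ h₂) (t₁ ⊔ h₁) | <-f (t₁ ⊔ h₁) (t₂ ⊔ h₂)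
      | <-f (t₂ ⊓ h₂) (t₁ ⊔ h₁) | <-f (t₁ ⊓ h₁) (t₂ ⊔ h₂) = ≡.refl

  edge-embedding : ∀ R t₁ h₁ t₂ h₂ → edge R (f t₁ , f h₁) (f t₂ , f h₂) ≡ edge R (t₁ , h₁) (t₂ , h₂)
  edge-embedding R t₁ h₁ t₂ h₂
    rewrite edge-rule R (f t₁ , f h₁) (f t₂ , f h₂) | edge-rule R (t₁ , h₁) (t₂ , h₂)
      | pairType-embedding t₁ h₁ t₂ h₂ | pairShape-embedding t₁ h₁ t₂ h₂
      | ≡-f t₁ t₂ | ≡-f h₁ h₂ | ≡-f t₁ h₂ | ≡-f h₁ t₂ = ≡.refl

  compatible-embedding : ∀ ρ a b c d → Compatibility.compatible ρ (f a , f b) (f c , f d) ≡ Compatibility.compatible ρ (a , b) (c , d)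
  compatible-embedding ρ a b c d
    rewrite ≡-f a c | ≡-f b d | <-f a c | <-f b d | <-f d b | <-f a b | <-f c b | <-f c d | <-f d a | <-f d c
      | <-f a d | <-f b a | <-f b c = ≡.refl

-- One line of the finite dictionary. The four digits in the names below are the ranks of t₁, h₁,
-- t₂, h₂; the 24 orders at 0, 1, 2, 3 are transported to arbitrary positions.
Entry : Bool → RuleSet → ℕ → ℕ → ℕ → ℕ → Set
Entry o R t₁ h₁ t₂ h₂ = edge R (t₁ , h₁) (t₂ , h₂) ≡ Compatibility.compatible (patternOf o R) (toArc o (t₁ , h₁)) (toArc o (t₂ , h₂))

private
  entry-0123 : ∀ o R → Oriented o R → Entry o R 0 1 2 3
  entry-0123 true R or = serial-false (proj₁ or)
  entry-0123 false R or = serial-THTH (rule R THTH) (admissible R THTH) (proj₂ or)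
  entry-0132 : ∀ o R → Oriented o R → Entry o R 0 1 3 2
  entry-0132 true R or = serial-THHT (rule R THHT) (admissible R THHT)
  entry-0132 false R or = serial-THHT (rule R THHT) (admissible R THHT)
  entry-0213 : ∀ o R → Oriented o R → Entry o R 0 2 1 3
  entry-0213 true R or = cross-TTHH (rule R TTHH) (admissible R TTHH)
  entry-0213 false R or = cross-TTHH (rule R TTHH) (admissible R TTHH)
  entry-0231 : ∀ o R → Oriented o R → Entry o R 0 2 3 1
  entry-0231 true R or = ≡.refl
  entry-0231 false R or = ≡.refl
  entry-0312 : ∀ o R → Oriented o R → Entry o R 0 3 1 2
  entry-0312 true R or = ≡.refl
  entry-0312 false R or = ≡.refl
  entry-0321 : ∀ o R → Oriented o R → Entry o R 0 3 2 1
  entry-0321 true R or = nest-true (proj₁ or)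
  entry-0321 false R or = nest-false (proj₂ or)
  entry-1023 : ∀ o R → Oriented o R → Entry o R 1 0 2 3
  entry-1023 true R or = serial-HTTH (rule R HTTH) (admissible R HTTH)
  entry-1023 false R or = serial-HTTH (rule R HTTH) (admissible R HTTH)
  entry-1032 : ∀ o R → Oriented o R → Entry o R 1 0 3 2
  entry-1032 true R or = serial-HTHT (rule R HTHT) (admissible R HTHT) (proj₂ or)
  entry-1032 false R or = serial-false (proj₁ or)
  entry-1203 : ∀ o R → Oriented o R → Entry o R 1 2 0 3
  entry-1203 true R or = ≡.refl
  entry-1203 false R or = ≡.refl
  entry-1230 : ∀ o R → Oriented o R → Entry o R 1 2 3 0
  entry-1230 true R or = nest-false (proj₂ or)
  entry-1230 false R or = nest-true (proj₁ or)
  entry-1302 : ∀ o R → Oriented o R → Entry o R 1 3 0 2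
  entry-1302 true R or = cross-TTHH (rule R TTHH) (admissible R TTHH)
  entry-1302 false R or = cross-TTHH (rule R TTHH) (admissible R TTHH)
  entry-1320 : ∀ o R → Oriented o R → Entry o R 1 3 2 0
  entry-1320 true R or = ≡.refl
  entry-1320 false R or = ≡.refl
  entry-2013 : ∀ o R → Oriented o R → Entry o R 2 0 1 3
  entry-2013 true R or = ≡.refl
  entry-2013 false R or = ≡.refl
  entry-2031 : ∀ o R → Oriented o R → Entry o R 2 0 3 1
  entry-2031 true R or = cross-HHTT (rule R HHTT) (admissible R HHTT)
  entry-2031 false R or = cross-HHTT (rule R HHTT) (admissible R HHTT)
  entry-2103 : ∀ o R → Oriented o R → Entry o R 2 1 0 3
  entry-2103 true R or = nest-true (proj₁ or)
  entry-2103 false R or = nest-false (proj₂ or)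
  entry-2130 : ∀ o R → Oriented o R → Entry o R 2 1 3 0
  entry-2130 true R or = ≡.refl
  entry-2130 false R or = ≡.refl
  entry-2301 : ∀ o R → Oriented o R → Entry o R 2 3 0 1
  entry-2301 true R or = serial-false (proj₁ or)
  entry-2301 false R or = serial-THTH (rule R THTH) (admissible R THTH) (proj₂ or)
  entry-2310 : ∀ o R → Oriented o R → Entry o R 2 3 1 0
  entry-2310 true R or = serial-HTTH (rule R HTTH) (admissible R HTTH)
  entry-2310 false R or = serial-HTTH (rule R HTTH) (admissible R HTTH)
  entry-3012 : ∀ o R → Oriented o R → Entry o R 3 0 1 2
  entry-3012 true R or = nest-false (proj₂ or)
  entry-3012 false R or = nest-true (proj₁ or)
  entry-3021 : ∀ o R → Oriented o R → Entry o R 3 0 2 1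
  entry-3021 true R or = ≡.refl
  entry-3021 false R or = ≡.refl
  entry-3102 : ∀ o R → Oriented o R → Entry o R 3 1 0 2
  entry-3102 true R or = ≡.refl
  entry-3102 false R or = ≡.refl
  entry-3120 : ∀ o R → Oriented o R → Entry o R 3 1 2 0
  entry-3120 true R or = cross-HHTT (rule R HHTT) (admissible R HHTT)
  entry-3120 false R or = cross-HHTT (rule R HHTT) (admissible R HHTT)
  entry-3201 : ∀ o R → Oriented o R → Entry o R 3 2 0 1
  entry-3201 true R or = serial-THHT (rule R THHT) (admissible R THHT)
  entry-3201 false R or = serial-THHT (rule R THHT) (admissible R THHT)
  entry-3210 : ∀ o R → Oriented o R → Entry o R 3 2 1 0
  entry-3210 true R or = serial-HTHT (rule R HTHT) (admissible R HTHT) (proj₂ or)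
  entry-3210 false R or = serial-false (proj₁ or)

  module _ {p₀ p₁ p₂ p₃ : ℕ} (p₀<p₁ : p₀ < p₁) (p₁<p₂ : p₁ < p₂) (p₂<p₃ : p₂ < p₃) where

    -- It is continued beyond 3 so as to be strictly increasing on all of ℕ, as the embedding lemmas
    -- require.
    embed : ℕ → ℕ
    embed 0 = p₀
    embed 1 = p₁
    embed 2 = p₂
    embed (suc (suc (suc k))) = k ℕ.+ p₃

    embed-suc : ∀ k → embed k < embed (suc k)
    embed-suc 0 = p₀<p₁
    embed-suc 1 = p₁<p₂
    embed-suc 2 = p₂<p₃
    embed-suc (suc (suc (suc k))) = ℕₚ.≤-refl

    embed-mono : ∀ {i j} → i < j → embed i < embed j
    embed-mono {i} {suc j} (s≤s i≤j) with ℕₚ.m≤n⇒m<n∨m≡n i≤j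
    ... | inj₁ i<j  = ℕₚ.<-trans (embed-mono i<j) (embed-suc j)
    ... | inj₂ ≡.refl = embed-suc i

    embed-< : ∀ i j → (embed i <ᵇ embed j) ≡ (i <ᵇ j)
    embed-< i j with ℕₚ.<-cmp i j
    ... | tri< i<j _ _  = ≡.trans (<⇒<ᵇ≡true (embed-mono i<j)) (≡.sym (<⇒<ᵇ≡true i<j))
    ... | tri≈ _ ≡.refl _ = ≡.trans (≤⇒<ᵇ≡false (ℕₚ.≤-refl {embed i})) (≡.sym (≤⇒<ᵇ≡false (ℕₚ.≤-refl {i})))
    ... | tri> _ _ j<i  = ≡.trans (>⇒<ᵇ≡false (embed-mono j<i)) (≡.sym (>⇒<ᵇ≡false j<i))

    embed-≡ : ∀ i j → (embed i ≡ᵇ embed j) ≡ (i ≡ᵇ j)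
    embed-≡ i j with ℕₚ.<-cmp i j
    ... | tri< i<j _ _  = ≡.trans (≢⇒≡ᵇ≡false (ℕₚ.<⇒≢ (embed-mono i<j))) (≡.sym (≢⇒≡ᵇ≡false (ℕₚ.<⇒≢ i<j)))
    ... | tri≈ _ ≡.refl _ = ≡.trans (≡ᵇ-refl (embed i)) (≡.sym (≡ᵇ-refl i))
    ... | tri> _ _ j<i  = ≡.trans (≢⇒≡ᵇ≡false (ℕₚ.>⇒≢ (embed-mono j<i))) (≡.sym (≢⇒≡ᵇ≡false (ℕₚ.>⇒≢ j<i)))

    embed-≤ : ∀ {i j} → i ≤ j → embed i ≤ embed j
    embed-≤ i≤j with ℕₚ.m≤n⇒m<n∨m≡n i≤j
    ... | inj₁ i<j  = ℕₚ.<⇒≤ (embed-mono i<j)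
    ... | inj₂ ≡.refl = ℕₚ.≤-refl

    embed-⊓ : ∀ i j → embed i ⊓ embed j ≡ embed (i ⊓ j)
    embed-⊓ i j with ℕₚ.≤-total i j
    ... | inj₁ i≤j = ≡.trans (ℕₚ.m≤n⇒m⊓n≡m (embed-≤ i≤j)) (≡.cong embed (≡.sym (ℕₚ.m≤n⇒m⊓n≡m i≤j)))
    ... | inj₂ j≤i = ≡.trans (ℕₚ.m≥n⇒m⊓n≡n (embed-≤ j≤i)) (≡.cong embed (≡.sym (ℕₚ.m≥n⇒m⊓n≡n j≤i)))

    embed-⊔ : ∀ i j → embed i ⊔ embed j ≡ embed (i ⊔ j)
    embed-⊔ i j with ℕₚ.≤-total i j
    ... | inj₁ i≤j = ≡.trans (ℕₚ.m≤n⇒m⊔n≡n (embed-≤ i≤j)) (≡.cong embed (≡.sym (ℕₚ.m≤n⇒m⊔n≡n i≤j)))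
    ... | inj₂ j≤i = ≡.trans (ℕₚ.m≥n⇒m⊔n≡m (embed-≤ j≤i)) (≡.cong embed (≡.sym (ℕₚ.m≥n⇒m⊔n≡m j≤i)))

    embed-compatible : ∀ ρ o t₁ h₁ t₂ h₂ → Compatibility.compatible ρ (toArc o (embed t₁ , embed h₁)) (toArc o (embed t₂ , embed h₂))
                       ≡ Compatibility.compatible ρ (toArc o (t₁ , h₁)) (toArc o (t₂ , h₂))
    embed-compatible ρ true  t₁ h₁ t₂ h₂ = compatible-embedding embed embed-< embed-≡ embed-⊓ embed-⊔ ρ t₁ h₁ t₂ h₂
    embed-compatible ρ false t₁ h₁ t₂ h₂ = compatible-embedding embed embed-< embed-≡ embed-⊓ embed-⊔ ρ h₁ t₁ h₂ t₂

    transport : ∀ o R t₁ h₁ t₂ h₂ → Entry o R t₁ h₁ t₂ h₂ → Entry o R (embed t₁) (embed h₁) (embed t₂) (embed h₂)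
    transport o R t₁ h₁ t₂ h₂ e = ≡.trans (edge-embedding embed embed-< embed-≡ embed-⊓ embed-⊔ R t₁ h₁ t₂ h₂)
      (≡.trans e (≡.sym (embed-compatible (patternOf o R) o t₁ h₁ t₂ h₂)))

  merge : ∀ {P : Set} {a b c d : ℕ} → a < b → c < d → a ≢ c → a ≢ d → b ≢ c → b ≢ d →
    (b < c → P) → (a < c → c < b → b < d → P) → (a < c → d < b → P) →
    (c < a → a < d → d < b → P) → (c < a → b < d → P) → (d < a → P) → P
  merge {P} {a} {b} {c} {d} a<b c<d a≢c a≢d b≢c b≢d abcd acbd acdb cadb cabd cdab
    with ℕₚ.<-cmp b c | ℕₚ.<-cmp a c | ℕₚ.<-cmp b d | ℕₚ.<-cmp a d
  ... | tri≈ _ e _ | _ | _ | _ = ⊥-elim (b≢c e)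
  ... | _ | tri≈ _ e _ | _ | _ = ⊥-elim (a≢c e)
  ... | _ | _ | tri≈ _ e _ | _ = ⊥-elim (b≢d e)
  ... | _ | _ | _ | tri≈ _ e _ = ⊥-elim (a≢d e)
  ... | tri< b<c _ _ | _ | _ | _ = abcd b<c
  ... | tri> _ _ c<b | tri< a<c _ _ | tri< b<d _ _ | _ = acbd a<c c<b b<d
  ... | tri> _ _ c<b | tri< a<c _ _ | tri> _ _ d<b | _ = acdb a<c d<b
  ... | tri> _ _ c<b | tri> _ _ c<a | tri< b<d _ _ | _ = cabd c<a b<d
  ... | tri> _ _ c<b | tri> _ _ c<a | tri> _ _ d<b | tri< a<d _ _ = cadb c<a a<d d<b
  ... | tri> _ _ c<b | tri> _ _ c<a | tri> _ _ d<b | tri> _ _ d<a = cdab d<a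

  distinct-entry : ∀ o R → Oriented o R → ∀ {t₁ h₁ t₂ h₂} → t₁ ≢ h₁ → t₂ ≢ h₂ → t₁ ≢ t₂ → t₁ ≢ h₂ → h₁ ≢ t₂ → h₁ ≢ h₂ → Entry o R t₁ h₁ t₂ h₂
  distinct-entry o R or {t₁} {h₁} {t₂} {h₂} n₁ n₂ tt th ht hh with ℕₚ.<-cmp t₁ h₁ | ℕₚ.<-cmp t₂ h₂
  ... | tri≈ _ e _ | _ = ⊥-elim (n₁ e)
  ... | _ | tri≈ _ e _ = ⊥-elim (n₂ e)
  ... | tri< a<b _ _ | tri< c<d _ _ = merge a<b c<d tt th ht hh
      (λ b<c → transport a<b b<c c<d o R 0 1 2 3 (entry-0123 o R or))
      (λ a<c c<b b<d → transport a<c c<b b<d o R 0 2 1 3 (entry-0213 o R or))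
      (λ a<c d<b → transport a<c c<d d<b o R 0 3 1 2 (entry-0312 o R or))
      (λ c<a a<d d<b → transport c<a a<d d<b o R 1 3 0 2 (entry-1302 o R or))
      (λ c<a b<d → transport c<a a<b b<d o R 1 2 0 3 (entry-1203 o R or))
      (λ d<a → transport c<d d<a a<b o R 2 3 0 1 (entry-2301 o R or))
  ... | tri< a<b _ _ | tri> _ _ c<d = merge a<b c<d th tt hh ht
      (λ b<c → transport a<b b<c c<d o R 0 1 3 2 (entry-0132 o R or))
      (λ a<c c<b b<d → transport a<c c<b b<d o R 0 2 3 1 (entry-0231 o R or))
      (λ a<c d<b → transport a<c c<d d<b o R 0 3 2 1 (entry-0321 o R or))
      (λ c<a a<d d<b → transport c<a a<d d<b o R 1 3 2 0 (entry-1320 o R or))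
      (λ c<a b<d → transport c<a a<b b<d o R 1 2 3 0 (entry-1230 o R or))
      (λ d<a → transport c<d d<a a<b o R 2 3 1 0 (entry-2310 o R or))
  ... | tri> _ _ a<b | tri< c<d _ _ = merge a<b c<d ht hh tt th
      (λ b<c → transport a<b b<c c<d o R 1 0 2 3 (entry-1023 o R or))
      (λ a<c c<b b<d → transport a<c c<b b<d o R 2 0 1 3 (entry-2013 o R or))
      (λ a<c d<b → transport a<c c<d d<b o R 3 0 1 2 (entry-3012 o R or))
      (λ c<a a<d d<b → transport c<a a<d d<b o R 3 1 0 2 (entry-3102 o R or))
      (λ c<a b<d → transport c<a a<b b<d o R 2 1 0 3 (entry-2103 o R or))
      (λ d<a → transport c<d d<a a<b o R 3 2 0 1 (entry-3201 o R or))
  ... | tri> _ _ a<b | tri> _ _ c<d = merge a<b c<d hh ht th tt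
      (λ b<c → transport a<b b<c c<d o R 1 0 3 2 (entry-1032 o R or))
      (λ a<c c<b b<d → transport a<c c<b b<d o R 2 0 3 1 (entry-2031 o R or))
      (λ a<c d<b → transport a<c c<d d<b o R 3 0 2 1 (entry-3021 o R or))
      (λ c<a a<d d<b → transport c<a a<d d<b o R 3 1 2 0 (entry-3120 o R or))
      (λ c<a b<d → transport c<a a<b b<d o R 2 1 3 0 (entry-2130 o R or))
      (λ d<a → transport c<d d<a a<b o R 3 2 1 0 (entry-3210 o R or))

compatible-shared : ∀ ρ o {α β} → tail α ≡ tail β ⊎ head α ≡ head β → Compatibility.compatible ρ (toArc o α) (toArc o β) ≡ true
compatible-shared ρ true  {t₁ , h₁} {t₂ , h₂} (inj₁ ≡.refl) = Compatibility.compatible-≡ˡ ρ t₁ h₁ h₂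
compatible-shared ρ true  {t₁ , h₁} {t₂ , h₂} (inj₂ ≡.refl) = Compatibility.compatible-≡ʳ ρ t₁ t₂ h₁
compatible-shared ρ false {t₁ , h₁} {t₂ , h₂} (inj₁ ≡.refl) = Compatibility.compatible-≡ʳ ρ h₁ h₂ t₁
compatible-shared ρ false {t₁ , h₁} {t₂ , h₂} (inj₂ ≡.refl) = Compatibility.compatible-≡ˡ ρ h₁ t₁ t₂

edge-compatible : ∀ o R → Oriented o R → ∀ {α β} → tail α ≢ head α → tail β ≢ head β → tail α ≢ head β → head α ≢ tail β →
  edge R α β ≡ Compatibility.compatible (patternOf o R) (toArc o α) (toArc o β)
edge-compatible o R or {t₁ , h₁} {t₂ , h₂} n₁ n₂ th ht with t₁ ℕₚ.≟ t₂ | h₁ ℕₚ.≟ h₂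
... | yes ≡.refl | _ rewrite edge-rule R (t₁ , h₁) (t₁ , h₂) | ≡ᵇ-refl t₁ = ≡.sym (compatible-shared (patternOf o R) o (inj₁ ≡.refl))
... | no _ | yes ≡.refl rewrite edge-rule R (t₁ , h₁) (t₂ , h₁) | ≡ᵇ-refl h₁ | Boolₚ.∨-zeroʳ (t₁ ≡ᵇ t₂) = ≡.sym (compatible-shared (patternOf o R) o (inj₂ ≡.refl))
... | no tt | no hh = distinct-entry o R or n₁ n₂ tt th ht hh

-- A node that is the head of one arrow and the tail of the other violates `fourDistinct` and, there
-- being no loops, rules out the wanted common tail or head. So a face assigns every node a single
-- role.
edge-disjoint-roles : ∀ R {α β} → tail α ≢ head α → tail β ≢ head β → edge R α β ≡ true → tail α ≢ head β × head α ≢ tail β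
edge-disjoint-roles R {t₁ , h₁} {t₂ , h₂} n₁ n₂ eq = (λ { ≡.refl → false≢true (≡.trans (≡.sym (first {_} {_} {_} {n₁} {n₂})) eq) }) , (λ { ≡.refl → false≢true (≡.trans (≡.sym (second {_} {_} {_} {n₁} {n₂})) eq) })
  where
  false≢true : false ≢ true
  false≢true ()
  first : ∀ {t₁ h₁ t₂} → {t₁ ≢ h₁} → {t₂ ≢ t₁} → edge R (t₁ , h₁) (t₂ , t₁) ≡ false
  first {t₁} {h₁} {t₂} {n₁} {n₂}
    rewrite edge-rule R (t₁ , h₁) (t₂ , t₁) | ≢⇒≡ᵇ≡false {t₁} {t₂} (λ e → n₂ (≡.sym e)) | ≢⇒≡ᵇ≡false {h₁} {t₁} (λ e → n₁ (≡.sym e)) | ≡ᵇ-refl t₁ = ≡.refl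
  second : ∀ {t₁ h₁ h₂} → {t₁ ≢ h₁} → {h₁ ≢ h₂} → edge R (t₁ , h₁) (h₁ , h₂) ≡ false
  second {t₁} {h₁} {h₂} {n₁} {n₂}
    rewrite edge-rule R (t₁ , h₁) (h₁ , h₂) | ≢⇒≡ᵇ≡false {t₁} {h₁} n₁ | ≢⇒≡ᵇ≡false {h₁} {h₂} n₂ | ≡ᵇ-refl h₁ | Boolₚ.∧-zeroʳ (not (t₁ ≡ᵇ h₂)) = ≡.refl

-- Saturated faces as valid arc sets on exactly one word.

module _ where

  open import Data.Nat.Base using (_+_)

  nodes : ℕ → Word → List Node
  nodes k []      = []
  nodes k (l ∷ w) = (l , k) ∷ nodes (suc k) w

  letters-nodes : ∀ k w → letters (nodes k w) ≡ w
  letters-nodes k []      = ≡.refl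
  letters-nodes k (l ∷ w) = ≡.cong (l ∷_) (letters-nodes (suc k) w)

  nodes-range : ∀ k w {l i} → (l , i) ∈ nodes k w → k ≤ i × i < k + length w
  nodes-range k (l ∷ w) (here ≡.refl) = ℕₚ.≤-refl , ℕₚ.m<m+n k (s≤s z≤n)
  nodes-range k (l ∷ w) {i = i} (there p) with nodes-range (suc k) w p
  ... | k<i , i<  = ℕₚ.<⇒≤ k<i , ≡.subst (i <_) (≡.sym (ℕₚ.+-suc k (length w))) i<

  nodes-sorted : ∀ k w → Sorted (nodes k w)
  nodes-sorted k []      = []
  nodes-sorted k (l ∷ w) = All.tabulate (λ p → proj₁ (nodes-range (suc k) w p)) ∷ nodes-sorted (suc k) w

  module WordSumLemmas (K : CommutativeRing 0ℓ 0ℓ) where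

    open CommutativeRing K hiding (zero; _+_)
    open SubsetSums K
    open WordSums K

    Σwords-congᴸ : ∀ n {f g} → (∀ w → length w ≡ n → f w ≈ g w) → Σwords n f ≈ Σwords n g
    Σwords-congᴸ zero    p = p [] ≡.refl
    Σwords-congᴸ (suc n) p = +-cong (Σwords-congᴸ n (λ w eq → p (𝐀 ∷ w) (≡.cong suc eq))) (Σwords-congᴸ n (λ w eq → p (𝐁 ∷ w) (≡.cong suc eq)))

    Σwords-zero : ∀ n {f} → (∀ w → length w ≡ n → f w ≈ 0#) → Σwords n f ≈ 0#
    Σwords-zero zero    p = p [] ≡.refl
    Σwords-zero (suc n) p = trans (+-cong (Σwords-zero n (λ w eq → p (𝐀 ∷ w) (≡.cong suc eq))) (Σwords-zero n (λ w eq → p (𝐁 ∷ w) (≡.cong suc eq)))) (+-identityˡ 0#)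

    Σwords-single : ∀ w₀ {f} → (∀ w → length w ≡ length w₀ → w ≢ w₀ → f w ≈ 0#) → Σwords (length w₀) f ≈ f w₀
    Σwords-single []       p = refl
    Σwords-single (𝐀 ∷ w₀) p = trans (+-cong (Σwords-single w₀ (λ w eq w≢ → p (𝐀 ∷ w) (≡.cong suc eq) (λ { ≡.refl → w≢ ≡.refl })))
      (Σwords-zero (length w₀) (λ w eq → p (𝐁 ∷ w) (≡.cong suc eq) (λ ())))) (+-identityʳ _)
    Σwords-single (𝐁 ∷ w₀) p = trans (+-cong (Σwords-zero (length w₀) (λ w eq → p (𝐀 ∷ w) (≡.cong suc eq) (λ ())))
      (Σwords-single w₀ (λ w eq w≢ → p (𝐁 ∷ w) (≡.cong suc eq) (λ { ≡.refl → w≢ ≡.refl })))) (+-identityˡ _)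

    Σwords-Σ⊆ : ∀ {X : Set} n (L : List X) (F : Word → List X → Carrier) →
                Σwords n (λ w → Σ⊆ L (F w)) ≈ Σ⊆ L (λ σ → Σwords n (λ w → F w σ))
    Σwords-Σ⊆ n []      F = refl
    Σwords-Σ⊆ n (z ∷ L) F = trans (Σwords-+ n _ _) (+-cong (Σwords-Σ⊆ n L F) (Σwords-Σ⊆ n L (λ w σ → F w (z ∷ σ))))

    Σ⊆-map : ∀ {X Y : Set} (h : X → Y) (L : List X) F → Σ⊆ (map h L) F ≈ Σ⊆ L (λ σ → F (map h σ))
    Σ⊆-map h []      F = refl
    Σ⊆-map h (z ∷ L) F = +-cong (Σ⊆-map h L F) (Σ⊆-map h L (F ∘ (h z ∷_)))

  -- Every clique that uses no position in both roles and covers all positions below N is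
  -- valid for exactly one word.
  module Labelling (ρ : Pattern) (σ : List Arc) where

    open Compatibility ρ
    open Validity ρ

    -- The default 𝐁 is correct at every position that is covered but not by an 𝐀-end.
    letterAt : ℕ → Letter
    letterAt i = if does (covered? (𝐀 , i) σ) then 𝐀 else 𝐁

    wordFrom : ℕ → ℕ → Word
    wordFrom k zero    = []
    wordFrom k (suc n) = letterAt k ∷ wordFrom (suc k) n

    length-wordFrom : ∀ k n → length (wordFrom k n) ≡ n
    length-wordFrom k zero    = ≡.refl
    length-wordFrom k (suc n) = ≡.cong suc (length-wordFrom (suc k) n)

    letterAt-𝐀 : ∀ {i} → Covered (𝐀 , i) σ → letterAt i ≡ 𝐀
    letterAt-𝐀 {i} c with covered? (𝐀 , i) σ
    ... | yes _ = ≡.refl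
    ... | no ¬c = ⊥-elim (¬c c)

    letterAt-𝐁 : ∀ {i} → ¬ Covered (𝐀 , i) σ → letterAt i ≡ 𝐁
    letterAt-𝐁 {i} ¬c with covered? (𝐀 , i) σ
    ... | yes c = ⊥-elim (¬c c)
    ... | no _  = ≡.refl

    wordFrom-unique : ∀ k w → (∀ {l i} → (l , i) ∈ nodes k w → l ≡ letterAt i) → w ≡ wordFrom k (length w)
    wordFrom-unique k []      p = ≡.refl
    wordFrom-unique k (l ∷ w) p = ≡.cong₂ _∷_ (p (here ≡.refl)) (wordFrom-unique (suc k) w (λ q → p (there q)))

    wordFrom-letter : ∀ k n {l i} → (l , i) ∈ nodes k (wordFrom k n) → l ≡ letterAt i
    wordFrom-letter k (suc n) (here ≡.refl) = ≡.refl
    wordFrom-letter k (suc n) (there p)     = wordFrom-letter (suc k) n p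

    wordFrom-∈ : ∀ k n {i} → k ≤ i → i < k + n → (letterAt i , i) ∈ nodes k (wordFrom k n)
    wordFrom-∈ k zero    {i} k≤i i< = ⊥-elim (ℕₚ.<⇒≱ i< (≡.subst (_≤ i) (≡.sym (ℕₚ.+-identityʳ k)) k≤i))
    wordFrom-∈ k (suc n) {i} k≤i i< with ℕₚ.m≤n⇒m<n∨m≡n k≤i
    ... | inj₁ k<i    = there (wordFrom-∈ (suc k) n k<i (≡.subst (i <_) (ℕₚ.+-suc k n) i<))
    ... | inj₂ ≡.refl = here ≡.refl

    -- Validity expressed through positions instead of nodes, hence without reference to a word. It
    -- links the saturated faces to the valid sets.
    record Saturating (N : ℕ) : Set where
      constructor saturating
      field
        in-range : ∀ {a b} → (a , b) ∈ σ → a < N × b < N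
        disjoint : ∀ {a b c d} → (a , b) ∈ σ → (c , d) ∈ σ → a ≢ d
        pairwise : ∀ {α β} → α ∈ σ → β ∈ σ → compatible α β ≡ true
        covering : ∀ {i} → i < N → Covered (𝐀 , i) σ ⊎ Covered (𝐁 , i) σ
    open Saturating

    distinct-nodes : ∀ k w {i} → (𝐀 , i) ∈ nodes k w → (𝐁 , i) ∉ nodes k w
    distinct-nodes k (𝐀 ∷ w) (here ≡.refl) (there q)      = ℕₚ.<-irrefl ≡.refl (proj₁ (nodes-range (suc k) w q))
    distinct-nodes k (𝐁 ∷ w) (there p)     (here ≡.refl)  = ℕₚ.<-irrefl ≡.refl (proj₁ (nodes-range (suc k) w p))
    distinct-nodes k (l ∷ w) (there p)     (there q)      = distinct-nodes (suc k) w p q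

    valid⇒letters : ∀ {w} → Valid (nodes 0 w) σ → ∀ {l i} → (l , i) ∈ nodes 0 w → l ≡ letterAt i
    valid⇒letters v {𝐀} p = ≡.sym (letterAt-𝐀 (covers v p))
    valid⇒letters {w} v {𝐁} p = ≡.sym (letterAt-𝐁 (λ c → let α , α∈ , inc = find c in distinct-nodes 0 w (inside-node _ (inside v α∈) inc) p))

    valid⇒word : ∀ {w} → Valid (nodes 0 w) σ → w ≡ wordFrom 0 (length w)
    valid⇒word v = wordFrom-unique 0 _ (valid⇒letters v)

    valid⇒saturating : ∀ {w} → Valid (nodes 0 w) σ → Saturating (length w)
    valid⇒saturating {w} v = saturating
      (λ α∈ → proj₂ (nodes-range 0 w (proj₁ (inside v α∈))) , proj₂ (nodes-range 0 w (proj₂ (inside v α∈))))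
      (λ { α∈ β∈ ≡.refl → distinct-nodes 0 w (proj₁ (inside v α∈)) (proj₂ (inside v β∈)) })
      (clique v)
      (λ {i} i< → cov (wordFrom-∈ 0 (length w) {i} z≤n i<))
      where
      cov : ∀ {l i} → (l , i) ∈ nodes 0 (wordFrom 0 (length w)) → Covered (𝐀 , i) σ ⊎ Covered (𝐁 , i) σ
      cov {𝐀} p = inj₁ (covers v (≡.subst (λ z → _ ∈ nodes 0 z) (≡.sym (valid⇒word v)) p))
      cov {𝐁} p = inj₂ (covers v (≡.subst (λ z → _ ∈ nodes 0 z) (≡.sym (valid⇒word v)) p))

    saturating⇒valid : ∀ {N} → Saturating N → Valid (nodes 0 (wordFrom 0 N)) σ
    saturating⇒valid {N} s = valid
      (λ {α} α∈ → ≡.subst (λ l → (l , proj₁ α) ∈ nodes 0 (wordFrom 0 N)) (letterAt-𝐀 (lose α∈ ≡.refl)) (wordFrom-∈ 0 N z≤n (proj₁ (in-range s α∈)))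
                , ≡.subst (λ l → (l , proj₂ α) ∈ nodes 0 (wordFrom 0 N))
                    (letterAt-𝐁 (λ c → let β , β∈ , inc = find c in disjoint s β∈ α∈ inc)) (wordFrom-∈ 0 N z≤n (proj₂ (in-range s α∈))))
      (pairwise s) cov
      where
      cov : ∀ {n} → n ∈ nodes 0 (wordFrom 0 N) → Covered n σ
      cov {l , i} p with covered? (𝐀 , i) σ | wordFrom-letter 0 N p
      ... | yes c | ≡.refl = c
      ... | no ¬c | ≡.refl = [ (λ c → ⊥-elim (¬c c)) , (λ c → c) ]′ (covering s (≡.subst (i <_) (length-wordFrom 0 N) (proj₂ (nodes-range 0 (wordFrom 0 N) p))))

  Proper : ℕ → Arrow → Set
  Proper N (t , h) = t ≢ h × t < N × h < N

  ∧-true : ∀ {u v} → u ∧ v ≡ true → u ≡ true × v ≡ true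
  ∧-true {true} {true} _ = ≡.refl , ≡.refl

  all-true : ∀ {X : Set} (p : X → Bool) xs → all p xs ≡ true → ∀ {z} → z ∈ xs → p z ≡ true
  all-true p (x ∷ xs) eq (here ≡.refl) = proj₁ (∧-true eq)
  all-true p (x ∷ xs) eq (there z∈)    = all-true p xs (proj₂ (∧-true {p x} eq)) z∈

  true-all : ∀ {X : Set} (p : X → Bool) xs → (∀ {z} → z ∈ xs → p z ≡ true) → all p xs ≡ true
  true-all p []       f = ≡.refl
  true-all p (x ∷ xs) f = ≡.cong₂ _∧_ (f (here ≡.refl)) (true-all p xs (λ z∈ → f (there z∈)))

  any-true : ∀ {X : Set} (p : X → Bool) xs → any p xs ≡ true → ∃ λ z → z ∈ xs × p z ≡ true
  any-true p (x ∷ xs) eq with p x in px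
  ... | true  = x , here ≡.refl , px
  ... | false with any-true p xs eq
  ...   | z , z∈ , pz = z , there z∈ , pz

  true-any : ∀ {X : Set} (p : X → Bool) xs {z} → z ∈ xs → p z ≡ true → any p xs ≡ true
  true-any p (x ∷ xs) (here ≡.refl) pz = ≡.cong (_∨ any p xs) pz
  true-any p (x ∷ xs) (there z∈)    pz = ≡.trans (≡.cong (p x ∨_) (true-any p xs z∈ pz)) (Boolₚ.∨-zeroʳ (p x))

  module Translation (o : Bool) (R : RuleSet) (or : Oriented o R) where

    private
      ρ : Pattern
      ρ = patternOf o R

    open Compatibility ρ using (compatible; compatible-sym; compatible-refl)

    -- The disjointness of roles is added because `compatible` is meaningful only for arcs that
    -- share no position in opposite roles.
    Linked : Arrow → Arrow → Set
    Linked α β = tail α ≢ head β × head α ≢ tail β × compatible (toArc o α) (toArc o β) ≡ true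

    linked-sym : ∀ {α β} → Linked α β → Linked β α
    linked-sym {α} {β} (th , ht , c) = (λ e → ht (≡.sym e)) , (λ e → th (≡.sym e)) , ≡.trans (compatible-sym (toArc o β) (toArc o α)) c

    edge⇒linked : ∀ {α β} → tail α ≢ head α → tail β ≢ head β → edge R α β ≡ true → Linked α β
    edge⇒linked n₁ n₂ eq with edge-disjoint-roles R n₁ n₂ eq
    ... | th , ht = th , ht , ≡.trans (≡.sym (edge-compatible o R or n₁ n₂ th ht)) eq

    clique⇒linked : ∀ {N} σ → All (Proper N) σ → isClique R σ ≡ true → ∀ {α β} → α ∈ σ → β ∈ σ → Linked α β
    clique⇒linked (α ∷ σ) (p ∷ ps) eq (here ≡.refl) (here ≡.refl) = proj₁ p , (λ e → proj₁ p (≡.sym e)) , compatible-refl (toArc o α)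
    clique⇒linked (α ∷ σ) (p ∷ ps) eq (here ≡.refl) (there β∈)    = edge⇒linked (proj₁ p) (proj₁ (All.lookup ps β∈)) (all-true (edge R α) σ (proj₁ (∧-true eq)) β∈)
    clique⇒linked (α ∷ σ) (p ∷ ps) eq (there β∈)    (here ≡.refl) = linked-sym (edge⇒linked (proj₁ p) (proj₁ (All.lookup ps β∈)) (all-true (edge R α) σ (proj₁ (∧-true eq)) β∈))
    clique⇒linked (α ∷ σ) (p ∷ ps) eq (there α∈)    (there β∈)    = clique⇒linked σ ps (proj₂ (∧-true {all (edge R α) σ} eq)) α∈ β∈

    linked⇒clique : ∀ {N} σ → All (Proper N) σ → (∀ {α β} → α ∈ σ → β ∈ σ → Linked α β) → isClique R σ ≡ true
    linked⇒clique []      ps       l = ≡.refl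
    linked⇒clique (α ∷ σ) (p ∷ ps) l = ≡.cong₂ _∧_
      (true-all (edge R α) σ (λ β∈ → let th , ht , c = l (here ≡.refl) (there β∈) in
        ≡.trans (edge-compatible o R or (proj₁ p) (proj₁ (All.lookup ps β∈)) th ht) c))
      (linked⇒clique σ ps (λ α∈ β∈ → l (there α∈) (there β∈)))

    roles : ∀ o {α β} → proj₁ (toArc o α) ≡ proj₂ (toArc o β) → tail α ≡ head β ⊎ head α ≡ tail β
    roles true  e = inj₁ e
    roles false e = inj₂ e

    roles⁻ : ∀ o {α β} → tail α ≡ head β ⊎ head α ≡ tail β →
             proj₁ (toArc o α) ≡ proj₂ (toArc o β) ⊎ proj₁ (toArc o β) ≡ proj₂ (toArc o α)
    roles⁻ true  (inj₁ e) = inj₁ e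
    roles⁻ true  (inj₂ e) = inj₂ (≡.sym e)
    roles⁻ false (inj₁ e) = inj₂ (≡.sym e)
    roles⁻ false (inj₂ e) = inj₁ e

    touches : ℕ → Arrow → Bool
    touches k α = (tail α ≡ᵇ k) ∨ (head α ≡ᵇ k)

    touching : ∀ o {k} α → touches k α ≡ true → Incident (𝐀 , k) (toArc o α) ⊎ Incident (𝐁 , k) (toArc o α)
    touching o {k} (t , h) eq with t ℕₚ.≟ k | h ℕₚ.≟ k
    touching true  (t , h) eq | yes e | _     = inj₁ e
    touching false (t , h) eq | yes e | _     = inj₂ e
    touching true  (t , h) eq | no _  | yes e = inj₂ e
    touching false (t , h) eq | no _  | yes e = inj₁ e
    touching o {k} (t , h) eq | no ¬t | no ¬h rewrite ≢⇒≡ᵇ≡false ¬t | ≢⇒≡ᵇ≡false ¬h with eq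
    ... | ()

    touching⁻ : ∀ o {k} α → Incident (𝐀 , k) (toArc o α) ⊎ Incident (𝐁 , k) (toArc o α) → touches k α ≡ true
    touching⁻ true  {k} (t , h) (inj₁ ≡.refl) = ≡.cong (_∨ (h ≡ᵇ k)) (≡ᵇ-refl t)
    touching⁻ true  {k} (t , h) (inj₂ ≡.refl) = ≡.trans (≡.cong ((t ≡ᵇ k) ∨_) (≡ᵇ-refl h)) (Boolₚ.∨-zeroʳ (t ≡ᵇ k))
    touching⁻ false {k} (t , h) (inj₁ ≡.refl) = ≡.trans (≡.cong ((t ≡ᵇ k) ∨_) (≡ᵇ-refl h)) (Boolₚ.∨-zeroʳ (t ≡ᵇ k))
    touching⁻ false {k} (t , h) (inj₂ ≡.refl) = ≡.cong (_∨ (h ≡ᵇ k)) (≡ᵇ-refl t)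

    proper-arc : ∀ {N} o {α} → Proper N α → proj₁ (toArc o α) < N × proj₂ (toArc o α) < N
    proper-arc true  (_ , t< , h<) = t< , h<
    proper-arc false (_ , t< , h<) = h< , t<

    module _ {m : ℕ} (σ : List Arrow) (ps : All (Proper (suc (suc m))) σ) where

      private
        N : ℕ
        N = suc (suc m)

      open Labelling ρ (map (toArc o) σ)
      open Saturating

      arrow : ∀ {β} → β ∈ map (toArc o) σ → ∃ λ α → α ∈ σ × β ≡ toArc o α
      arrow β∈ = Membershipₚ.∈-map⁻ (toArc o) β∈

      arc : ∀ {α} → α ∈ σ → toArc o α ∈ map (toArc o) σ
      arc α∈ = Membershipₚ.∈-map⁺ (toArc o) α∈

      face⇒saturating : isClique R σ ≡ true → saturated (suc m) σ ≡ true → Saturating N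
      face⇒saturating cl sat = saturating range dis pair cov
        where
        linked : ∀ {α β} → α ∈ σ → β ∈ σ → Linked α β
        linked = clique⇒linked σ ps cl
        range : ∀ {a b} → (a , b) ∈ map (toArc o) σ → a < N × b < N
        range β∈ with arrow β∈
        ... | α , α∈ , ≡.refl = proper-arc o (All.lookup ps α∈)
        dis : ∀ {a b c d} → (a , b) ∈ map (toArc o) σ → (c , d) ∈ map (toArc o) σ → a ≢ d
        dis β∈ γ∈ e with arrow β∈ | arrow γ∈
        ... | α , α∈ , ≡.refl | α′ , α′∈ , ≡.refl = [ proj₁ (linked α∈ α′∈) , proj₁ (proj₂ (linked α∈ α′∈)) ]′ (roles o e)
        pair : ∀ {β γ} → β ∈ map (toArc o) σ → γ ∈ map (toArc o) σ → compatible β γ ≡ true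
        pair β∈ γ∈ with arrow β∈ | arrow γ∈
        ... | α , α∈ , ≡.refl | α′ , α′∈ , ≡.refl = proj₂ (proj₂ (linked α∈ α′∈))
        cov : ∀ {i} → i < N → Covered (𝐀 , i) (map (toArc o) σ) ⊎ Covered (𝐁 , i) (map (toArc o) σ)
        cov {i} i< with any-true (touches i) σ (all-true (λ k → any (touches k) σ) (upTo N) sat (Membershipₚ.∈-upTo⁺ i<))
        ... | α , α∈ , t = [ (λ inc → inj₁ (lose (arc α∈) inc)) , (λ inc → inj₂ (lose (arc α∈) inc)) ]′ (touching o α t)

      saturating⇒face : Saturating N → isClique R σ ≡ true × saturated (suc m) σ ≡ true
      saturating⇒face s = linked⇒clique σ ps linked , true-all (λ k → any (touches k) σ) (upTo N) cov
        where
        linked : ∀ {α β} → α ∈ σ → β ∈ σ → Linked α β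
        linked {α} {β} α∈ β∈ = (λ e → clash (inj₁ e)) , (λ e → clash (inj₂ e)) , pairwise s (arc α∈) (arc β∈)
          where
          clash : tail α ≡ head β ⊎ head α ≡ tail β → ⊥
          clash e = [ disjoint s (arc α∈) (arc β∈) , disjoint s (arc β∈) (arc α∈) ]′ (roles⁻ o e)
        cov : ∀ {k} → k ∈ upTo N → any (touches k) σ ≡ true
        cov {k} k∈ = [ found 𝐀 inj₁ , found 𝐁 inj₂ ]′ (covering s (Membershipₚ.∈-upTo⁻ k∈))
          where
          found : ∀ l → (∀ {α} → Incident (l , k) (toArc o α) → Incident (𝐀 , k) (toArc o α) ⊎ Incident (𝐁 , k) (toArc o α)) →
                  Covered (l , k) (map (toArc o) σ) → any (touches k) σ ≡ true
          found l inj c with find c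
          ... | β , β∈ , inc with arrow β∈
          ...   | α , α∈ , ≡.refl = true-any (touches k) σ α∈ (touching⁻ o α (inj {α} inc))

-- The list of all arrows and the coefficients of weights.

module _ where

  open import Data.Nat.Base using (_+_)

  module _ {X Y : Set} (f : X → List Y) (tag : Y → X) where

    -- The tag recovers the block an element comes from, so different blocks are disjoint.
    unique-concatMap : ∀ {xs} → Unique xs → (∀ x → Unique (f x)) → (∀ x {y} → y ∈ f x → tag y ≡ x) → Unique (concatMap f xs)
    unique-concatMap {[]}     []        uf tf = []
    unique-concatMap {x ∷ xs} (x∉ ∷ uxs) uf tf = Uniqueₚ.++⁺ (uf x) (unique-concatMap uxs uf tf)
      (λ { (p , q) → let z , z∈ , y∈ = find (Membershipₚ.∈-concatMap⁻ f {xs = xs} q) in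
           All.lookup x∉ z∈ (≡.trans (≡.sym (tf x p)) (tf z y∈)) })

  private
    row : ℕ → ℕ → List Arrow
    row i j = if i ≡ᵇ j then [] else (i , j) ∷ []

    row-unique : ∀ i j → Unique (row i j)
    row-unique i j with i ≡ᵇ j
    ... | true  = []
    ... | false = [] ∷ []

    row-∈ : ∀ i j {α} → α ∈ row i j → α ≡ (i , j) × i ≢ j
    row-∈ i j α∈ with i ≡ᵇ j in eq
    row-∈ i j (here ≡.refl) | false = ≡.refl , λ { ≡.refl → false≢true (≡.trans (≡.sym eq) (≡ᵇ-refl i)) }
      where
      false≢true : false ≢ true
      false≢true ()

    ∈-row : ∀ {i j} → i ≢ j → (i , j) ∈ row i j
    ∈-row {i} {j} i≢j rewrite ≢⇒≡ᵇ≡false i≢j = here ≡.refl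

  allArrows-unique : ∀ n → Unique (allArrows n)
  allArrows-unique n = unique-concatMap _ proj₁ (Uniqueₚ.upTo⁺ (suc n))
    (λ i → unique-concatMap (row i) proj₂ (Uniqueₚ.upTo⁺ (suc n)) (row-unique i) (λ j p → ≡.cong proj₂ (proj₁ (row-∈ i j p))))
    (λ i p → let j , _ , q = find (Membershipₚ.∈-concatMap⁻ (row i) {xs = upTo (suc n)} p) in ≡.cong proj₁ (proj₁ (row-∈ i j q)))

  allArrows-proper : ∀ n → All (Proper (suc n)) (allArrows n)
  allArrows-proper n = All.tabulate λ p →
    let i , i∈ , q = find (Membershipₚ.∈-concatMap⁻ (λ i → concatMap (row i) (upTo (suc n))) {xs = upTo (suc n)} p)
        j , j∈ , r = find (Membershipₚ.∈-concatMap⁻ (row i) {xs = upTo (suc n)} q)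
    in proper (row-∈ i j r) (Membershipₚ.∈-upTo⁻ i∈) (Membershipₚ.∈-upTo⁻ j∈)
    where
    proper : ∀ {α i j} → α ≡ (i , j) × i ≢ j → i < suc n → j < suc n → Proper (suc n) α
    proper (≡.refl , i≢j) i< j< = i≢j , i< , j<

  ∈-allArrows : ∀ n {α} → Proper (suc n) α → α ∈ allArrows n
  ∈-allArrows n {i , j} (i≢j , i< , j<) = Membershipₚ.∈-concatMap⁺ (λ i → concatMap (row i) (upTo (suc n)))
    (lose (Membershipₚ.∈-upTo⁺ i<) (Membershipₚ.∈-concatMap⁺ (row i) (lose (Membershipₚ.∈-upTo⁺ j<) (∈-row i≢j))))

  toArc-injective : ∀ o {α β} → toArc o α ≡ toArc o β → α ≡ β
  toArc-injective true  ≡.refl = ≡.refl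
  toArc-injective false ≡.refl = ≡.refl

  fromArc : ∀ o α → ∃ λ β → toArc o β ≡ α × (proj₁ α ≢ proj₂ α → ∀ {N} → proj₁ α < N → proj₂ α < N → Proper N β)
  fromArc true  (a , b) = (a , b) , ≡.refl , λ n p q → n , p , q
  fromArc false (a , b) = (b , a) , ≡.refl , λ n p q → (λ e → n (≡.sym e)) , q , p

  forwardWeight backwardWeight : Bool → Series
  forwardWeight  o = if o then Xs else Ys
  backwardWeight o = if o then Ys else Xs

  indicator : Bool → ℤ
  indicator b = if b then 1ℤ else 0ℤ

  open Weights seriesRing using (weight; wt)

  -- Reversing the orientation exchanges the two weights as well as the ends, so a forward arrow
  -- weighs `Xs` and a backward one `Ys` in either orientation.
  wt-coefficient : ∀ o {N} σ → All (Proper N) σ → ∀ a b →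
    wt (forwardWeight o) (backwardWeight o) (map (toArc o) σ) a b 0 ≡ indicator ((fw σ ≡ᵇ a) ∧ (bw σ ≡ᵇ b))
  wt-coefficient o [] [] zero    zero    = ≡.refl
  wt-coefficient o [] [] zero    (suc b) = ≡.refl
  wt-coefficient o [] [] (suc a) b       = ≡.refl
  wt-coefficient o ((t , h) ∷ σ) ((t≢h , _) ∷ ps) a b with ℕₚ.<-cmp t h
  ... | tri≈ _ t≡h _ = ⊥-elim (t≢h t≡h)
  ... | tri< t<h _ _ rewrite <⇒<ᵇ≡true t<h | >⇒<ᵇ≡false t<h = ≡.trans (≡.cong (λ u → (u *S w) a b 0) (weight-fw o)) (step a)
    where
    w : Series
    w = wt (forwardWeight o) (backwardWeight o) (map (toArc o) σ)
    weight-fw : ∀ o → weight (forwardWeight o) (backwardWeight o) (toArc o (t , h)) ≡ Xs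
    weight-fw true  rewrite <⇒<ᵇ≡true t<h = ≡.refl
    weight-fw false rewrite >⇒<ᵇ≡false t<h = ≡.refl
    step : ∀ a → (Xs *S w) a b 0 ≡ indicator ((suc (fw σ) ≡ᵇ a) ∧ (bw σ ≡ᵇ b))
    step zero    = Xs-*-zero w b 0
    step (suc a) = ≡.trans (Xs-*-suc w a b 0) (wt-coefficient o σ ps a b)
  ... | tri> _ _ h<t rewrite >⇒<ᵇ≡false h<t | <⇒<ᵇ≡true h<t = ≡.trans (≡.cong (λ u → (u *S w) a b 0) (weight-bw o)) (step b)
    where
    w : Series
    w = wt (forwardWeight o) (backwardWeight o) (map (toArc o) σ)
    weight-bw : ∀ o → weight (forwardWeight o) (backwardWeight o) (toArc o (t , h)) ≡ Ys
    weight-bw true  rewrite >⇒<ᵇ≡false h<t = ≡.refl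
    weight-bw false rewrite <⇒<ᵇ≡true h<t = ≡.refl
    step : ∀ b → (Ys *S w) a b 0 ≡ indicator ((fw σ ≡ᵇ a) ∧ (suc (bw σ) ≡ᵇ b))
    step zero    = ≡.trans (Ys-*-zero w a 0) (≡.cong indicator (≡.sym (Boolₚ.∧-zeroʳ (fw σ ≡ᵇ a))))
    step (suc b) = ≡.trans (Ys-*-suc w a b 0) (wt-coefficient o σ ps a b)

  private
    filterᵇ-++ : ∀ {X : Set} (p : X → Bool) xs ys → length (filterᵇ p (xs ++ ys)) ≡ length (filterᵇ p xs) + length (filterᵇ p ys)
    filterᵇ-++ p []       ys = ≡.refl
    filterᵇ-++ p (x ∷ xs) ys with p x
    ... | true  = ≡.cong suc (filterᵇ-++ p xs ys)
    ... | false = filterᵇ-++ p xs ys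

    filterᵇ-map : ∀ {X Y : Set} (p : Y → Bool) (f : X → Y) xs → length (filterᵇ p (map f xs)) ≡ length (filterᵇ (p ∘ f) xs)
    filterᵇ-map p f []       = ≡.refl
    filterᵇ-map p f (x ∷ xs) with p (f x)
    ... | true  = ≡.cong suc (filterᵇ-map p f xs)
    ... | false = filterᵇ-map p f xs

  open SubsetSums seriesRing using (Σ⊆)

  count-sublists : ∀ {X : Set} {Q : X → Set} {L} → All Q L → ∀ (p : List X → Bool) (F : List X → Series) a b →
    (∀ σ → All Q σ → F σ a b 0 ≡ indicator (p σ)) → Σ⊆ L F a b 0 ≡ + length (filterᵇ p (sublists L))
  count-sublists [] p F a b eq = ≡.trans (eq [] []) single
    where
    single : indicator (p []) ≡ + length (filterᵇ p ([] ∷ []))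
    single with p []
    ... | true  = ≡.refl
    ... | false = ≡.refl
  count-sublists {L = z ∷ L} (q ∷ qs) p F a b eq = begin
    Σ⊆ L F a b 0 ℤ.+ Σ⊆ L (F ∘ (z ∷_)) a b 0
      ≡⟨ ≡.cong₂ ℤ._+_ (count-sublists qs p F a b eq) (count-sublists qs (p ∘ (z ∷_)) (F ∘ (z ∷_)) a b (λ σ ps → eq (z ∷ σ) (q ∷ ps))) ⟩
    + length (filterᵇ p (sublists L)) ℤ.+ + length (filterᵇ (p ∘ (z ∷_)) (sublists L))
      ≡⟨ ≡.cong (λ k → + (length (filterᵇ p (sublists L)) + k)) (filterᵇ-map p (z ∷_) (sublists L)) ⟨
    + (length (filterᵇ p (sublists L)) + length (filterᵇ p (map (z ∷_) (sublists L))))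
      ≡⟨ ≡.cong +_ (filterᵇ-++ p (sublists L) _) ⟨
    + length (filterᵇ p (sublists (z ∷ L))) ∎
    where open ≡.≡-Reasoning

-- The count for the whole class and the generating function.

module _ where

  open import Data.Nat.Base using (_+_)

  open import Algebra.Properties.AbelianGroup ℤₚ.+-0-abelianGroup using (∙-cancelʳ)

  open CommutativeRing seriesRing using (refl; sym; trans; *-congʳ; distribʳ; *-identityˡ; zeroˡ; _≈_)

  Cancellable : Series → Set
  Cancellable u = ∀ {f g} → (u *S f) ≈S (u *S g) → f ≈S g

  cancel-Xs : Cancellable Xs
  cancel-Xs {f} {g} eq a b n = ≡.trans (≡.sym (Xs-*-suc f a b n)) (≡.trans (eq (suc a) b n) (Xs-*-suc g a b n))

  cancel-Ys : Cancellable Ys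
  cancel-Ys {f} {g} eq a b n = ≡.trans (≡.sym (Ys-*-suc f a b n)) (≡.trans (eq a (suc b) n) (Ys-*-suc g a b n))

  private
    expand : ∀ u f → ((oneS +S u) *S f) ≈S (f +S u *S f)
    expand u f a b n = ≡.trans (distribʳ f oneS u a b n) (≡.cong (ℤ._+ (u *S f) a b n) (*-identityˡ f a b n))

  -- The constant coefficient of 1 + x is 1, so coefficients are recovered one after another in
  -- ascending degree in x.
  cancel-1+Xs : Cancellable (oneS +S Xs)
  cancel-1+Xs {f} {g} eq = go
    where
    eq′ : (f +S Xs *S f) ≈S (g +S Xs *S g)
    eq′ a b n = ≡.trans (≡.sym (expand Xs f a b n)) (≡.trans (eq a b n) (expand Xs g a b n))
    go : f ≈S g
    go zero    b n = ∙-cancelʳ 0ℤ _ _ (≡.subst₂ (λ u v → f 0 b n ℤ.+ u ≡ g 0 b n ℤ.+ v) (Xs-*-zero f b n) (Xs-*-zero g b n) (eq′ 0 b n))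
    go (suc a) b n = ∙-cancelʳ (f a b n) _ _ (≡.subst₂ (λ u v → f (suc a) b n ℤ.+ u ≡ g (suc a) b n ℤ.+ v)
      (Xs-*-suc f a b n) (≡.trans (Xs-*-suc g a b n) (≡.sym (go a b n))) (eq′ (suc a) b n))

  cancel-1+Ys : Cancellable (oneS +S Ys)
  cancel-1+Ys {f} {g} eq = go
    where
    eq′ : (f +S Ys *S f) ≈S (g +S Ys *S g)
    eq′ a b n = ≡.trans (≡.sym (expand Ys f a b n)) (≡.trans (eq a b n) (expand Ys g a b n))
    go : f ≈S g
    go a zero    n = ∙-cancelʳ 0ℤ _ _ (≡.subst₂ (λ u v → f a 0 n ℤ.+ u ≡ g a 0 n ℤ.+ v) (Ys-*-zero f a n) (Ys-*-zero g a n) (eq′ a 0 n))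
    go a (suc b) n = ∙-cancelʳ (f a b n) _ _ (≡.subst₂ (λ u v → f a (suc b) n ℤ.+ u ≡ g a (suc b) n ℤ.+ v)
      (Ys-*-suc f a b n) (≡.trans (Ys-*-suc g a b n) (≡.sym (go a b n))) (eq′ a (suc b) n))

  module ClassCount (K : CommutativeRing 0ℓ 0ℓ) (x y : CommutativeRing.Carrier K) (U : List Arc) (U! : Unique U) where

    module K = CommutativeRing K

    module _ (y-cancel : ∀ {f g} → (y K.* f) K.≈ (y K.* g) → f K.≈ g)
             (1+y-cancel : ∀ {f g} → ((K.1# K.+ y) K.* f) K.≈ ((K.1# K.+ y) K.* g) → f K.≈ g) where

      Correct : Pattern → Set
      Correct ρ = ∀ {ns} → Sorted ns → Counting.Complete K x y ρ U U! ns →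
                  Faces.Universe.Sum K x y ρ U U! ns K.≈ Canonical.κ K x y (letters ns)

      -- If both mixed types cross, the class condition makes all flags true, which is the
      -- exceptional pattern. Otherwise a crossing 𝐀𝐀𝐁𝐁 is switched to a nesting one, for which the
      -- recursion applies.
      class-correct : ∀ p q r s → (p ≡ true → q ≡ true → r ≡ true × s ≡ true) → Correct (pattern′ p q r s)
      class-correct true true r s both with both ≡.refl ≡.refl
      ... | ≡.refl , ≡.refl = AllCrossing.all-crossing-correct K x y U U! y-cancel 1+y-cancel
      class-correct false q true s _ = NestingForward.nesting-correct K x y (pattern′ false q true s) U U! ≡.refl (λ _ _ _ ())
      class-correct true false true s _ = NestingForward.nesting-correct K x y (pattern′ true false true s) U U! ≡.refl (λ _ _ _ _ ())
      class-correct false q false s _ srt c = K.trans (Switch.switch K x y U U! false q s (inj₁ ≡.refl) srt c)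
        (NestingForward.nesting-correct K x y (pattern′ false q true s) U U! ≡.refl (λ _ _ _ ()) srt c)
      class-correct true false false s _ srt c = K.trans (Switch.switch K x y U U! true false s (inj₂ ≡.refl) srt c)
        (NestingForward.nesting-correct K x y (pattern′ true false true s) U U! ≡.refl (λ _ _ _ _ ()) srt c)

  module Final (o : Bool) (R : RuleSet) (or : Oriented o R) (simion : SimionClass R) where

    private
      x y : Series
      x = forwardWeight o
      y = backwardWeight o

      ρ : Pattern
      ρ = patternOf o R

      is-cross : ∀ {v} → shape≡ᵇ cross v ≡ true → v ≡ cross
      is-cross {cross} _ = ≡.refl

      is-nest : ∀ {v} → v ≡ nest → shape≡ᵇ nest v ≡ true
      is-nest ≡.refl = ≡.refl

      y-cancel : ∀ o → Cancellable (backwardWeight o)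
      y-cancel true  {f} {g} = cancel-Ys {f} {g}
      y-cancel false {f} {g} = cancel-Xs {f} {g}

      1+y-cancel : ∀ o → Cancellable (oneS +S backwardWeight o)
      1+y-cancel true  {f} {g} = cancel-1+Ys {f} {g}
      1+y-cancel false {f} {g} = cancel-1+Xs {f} {g}

      correct : ∀ U (U! : Unique U) {ns} → Sorted ns → Counting.Complete seriesRing x y ρ U U! ns →
                Faces.Universe.Sum seriesRing x y ρ U U! ns ≈S Canonical.κ seriesRing x y (letters ns)
      correct U U! {ns} = go o
        where
        go : ∀ o → Sorted ns → Counting.Complete seriesRing (forwardWeight o) (backwardWeight o) (patternOf o R) U U! ns →
             Faces.Universe.Sum seriesRing (forwardWeight o) (backwardWeight o) (patternOf o R) U U! ns
               ≈S Canonical.κ seriesRing (forwardWeight o) (backwardWeight o) (letters ns)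
        go true  = ClassCount.class-correct seriesRing Xs Ys U U! (λ {f} {g} → y-cancel true {f} {g}) (λ {f} {g} → 1+y-cancel true {f} {g}) _ _ _ _
          (λ p q → let n₁ , n₂ = proj₂ simion (is-cross p) (is-cross q) in is-nest n₁ , is-nest n₂)
        go false = ClassCount.class-correct seriesRing Ys Xs U U! (λ {f} {g} → y-cancel false {f} {g}) (λ {f} {g} → 1+y-cancel false {f} {g}) _ _ _ _
          (λ p q → let n₁ , n₂ = proj₂ simion (is-cross q) (is-cross p) in is-nest n₂ , is-nest n₁)

    open Canonical seriesRing x y using (κ)
    open WordSums seriesRing using (Σwords)
    open WordSumLemmas seriesRing
    open SubsetSums seriesRing
    open Faces seriesRing x y ρ using (face; face-no; wt; valid?)

    module _ (m : ℕ) where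

      private
        N : ℕ
        -- The complex with index m + 1 has the m + 2 nodes 0, ..., m + 1.
        N = suc (suc m)

        L : List Arrow
        L = allArrows (suc m)

        U : List Arc
        U = map (toArc o) L

        U! : Unique U
        U! = Uniqueₚ.map⁺ (toArc-injective o) (allArrows-unique (suc m))

        isFace : List Arrow → Bool
        isFace σ = isClique R σ ∧ saturated (suc m) σ

        complete : ∀ w → length w ≡ N → Counting.Complete seriesRing x y ρ U U! (nodes 0 w)
        complete w len {a} {b} a∈ b∈ with fromArc o (a , b)
        ... | α , eq , proper = ≡.subst (_∈ U) eq (Membershipₚ.∈-map⁺ (toArc o) (∈-allArrows (suc m)
          (proper (λ { ≡.refl → Labelling.distinct-nodes ρ [] 0 w a∈ b∈ }) (bound a∈) (bound b∈))))
          where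
          bound : ∀ {l i} → (l , i) ∈ nodes 0 w → i < N
          bound {l} {i} i∈ = ≡.subst (i <_) len (proj₂ (nodes-range 0 w i∈))

        term : List Arrow → Series
        term σ = (if isFace σ then oneS else zeroS) *S wt (map (toArc o) σ)

        -- A saturated face determines the letter of each position, so one word contributes its
        -- weight; a set that is not a saturated face is valid for no word.
        labellings : ∀ σ → All (Proper N) σ → Σwords N (λ w → face (nodes 0 w) (map (toArc o) σ)) ≈S term σ
        labellings σ ps = go (isFace σ) ≡.refl
          where
          open Labelling ρ (map (toArc o) σ)
          open Translation o R or using (face⇒saturating; saturating⇒face)
          w₀ : Word
          w₀ = wordFrom 0 N
          go : ∀ v → isFace σ ≡ v → Σwords N (λ w → face (nodes 0 w) (map (toArc o) σ)) ≈S ((if v then oneS else zeroS) *S wt (map (toArc o) σ))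
          go true eq = ≡.subst (λ k → Σwords k (λ w → face (nodes 0 w) (map (toArc o) σ)) ≈S (oneS *S wt (map (toArc o) σ))) (length-wordFrom 0 N)
            (trans {i = Σwords (length w₀) (λ w → face (nodes 0 w) (map (toArc o) σ))} {j = face (nodes 0 w₀) (map (toArc o) σ)} {k = oneS *S wt (map (toArc o) σ)}
              (Σwords-single w₀ (λ w len w≢ → face-no {nodes 0 w} (λ v → w≢ (≡.trans (valid⇒word v) (≡.cong (wordFrom 0) (≡.trans len (length-wordFrom 0 N)))))))
              (*-congʳ {wt (map (toArc o) σ)} {ind (valid? (nodes 0 w₀) (map (toArc o) σ))} {oneS}
                (ind-yes (valid? (nodes 0 w₀) (map (toArc o) σ)) (saturating⇒valid (face⇒saturating σ ps (proj₁ (∧-true eq)) (proj₂ (∧-true {isClique R σ} eq)))))))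
          go false eq = trans {i = Σwords N (λ w → face (nodes 0 w) (map (toArc o) σ))} {j = zeroS} {k = zeroS *S wt (map (toArc o) σ)}
            (Σwords-zero N (λ w len → face-no {nodes 0 w} (λ v → false≢true (≡.trans (≡.sym eq)
              (let c , s = saturating⇒face σ ps (≡.subst Saturating len (valid⇒saturating v)) in ≡.cong₂ _∧_ c s)))))
            (λ a b n → ≡.sym (zeroˡ (wt (map (toArc o) σ)) a b n))
            where
            false≢true : false ≢ true
            false≢true ()

        words-to-faces : Σwords N κ ≈S Σ⊆ L term
        words-to-faces = λ a b n → ≡.trans (step₁ a b n) (≡.trans (step₂ a b n) (≡.trans (step₃ a b n) (step₄ a b n)))
          where
          F : Word → List Arc → Series
          F w σ = face (nodes 0 w) σ
          step₁ : Σwords N κ ≈S Σwords N (λ w → Σ⊆ U (F w))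
          step₁ = Σwords-congᴸ N (λ w len a b n → ≡.sym (≡.trans (correct U U! (nodes-sorted 0 w) (complete w len) a b n)
            (≡.cong (λ z → κ z a b n) (letters-nodes 0 w))))
          step₂ : Σwords N (λ w → Σ⊆ U (F w)) ≈S Σ⊆ U (λ σ → Σwords N (λ w → F w σ))
          step₂ = Σwords-Σ⊆ N U F
          step₃ : Σ⊆ U (λ σ → Σwords N (λ w → F w σ)) ≈S Σ⊆ L (λ σ → Σwords N (λ w → F w (map (toArc o) σ)))
          step₃ = Σ⊆-map (toArc o) L (λ σ → Σwords N (λ w → F w σ))
          step₄ : Σ⊆ L (λ σ → Σwords N (λ w → F w (map (toArc o) σ))) ≈S Σ⊆ L term
          step₄ = Σ⊆-cong-All (allArrows-proper (suc m)) labellings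

      face-coefficient : ∀ a b → Fgen R a b (suc m) ≡ Σwords (suc (suc m)) κ a b 0
      face-coefficient a b = ≡.sym (≡.trans (words-to-faces a b 0)
        (count-sublists (allArrows-proper (suc m)) (λ σ → isClique R σ ∧ saturated (suc m) σ ∧ (fw σ ≡ᵇ a) ∧ (bw σ ≡ᵇ b)) term a b pointwise))
        where
        pointwise : ∀ σ → All (Proper N) σ → term σ a b 0 ≡ indicator (isClique R σ ∧ saturated (suc m) σ ∧ (fw σ ≡ᵇ a) ∧ (bw σ ≡ᵇ b))
        pointwise σ ps = ≡.trans (go (isFace σ)) (≡.cong indicator (Boolₚ.∧-assoc (isClique R σ) (saturated (suc m) σ) _))
          where
          go : ∀ v → ((if v then oneS else zeroS) *S wt (map (toArc o) σ)) a b 0 ≡ indicator (v ∧ (fw σ ≡ᵇ a) ∧ (bw σ ≡ᵇ b))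
          go true  = ≡.trans (*-identityˡ (wt (map (toArc o) σ)) a b 0) (wt-coefficient o σ ps a b)
          go false = zeroˡ (wt (map (toArc o) σ)) a b 0

    point-coefficient : ∀ a b → Fgen R a b 0 ≡ oneS a b 0
    point-coefficient zero    zero    = ≡.refl
    point-coefficient zero    (suc b) = ≡.refl
    point-coefficient (suc a) b       = ≡.refl

    generating-function : Fgen R ≈S rhs y x
    generating-function = go o (Fgen R) point-coefficient (λ a b n → face-coefficient n a b)
      where
      go : ∀ o F → (∀ a b → F a b 0 ≡ oneS a b 0) →
           (∀ a b n → F a b (suc n) ≡ Σwords (suc (suc n)) (Canonical.κ seriesRing (forwardWeight o) (backwardWeight o)) a b 0) →
           F ≈S rhs (backwardWeight o) (forwardWeight o)
      go true  = SeriesFormula.series-formula Xs Ys (λ {h} → pure-Xs {h}) (λ {h} → pure-Ys {h})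
      go false = SeriesFormula.series-formula Ys Xs (λ {h} → pure-Ys {h}) (λ {h} → pure-Xs {h})

theorem7p1 : (R : RuleSet) → SimionClass R →
    (rule R THTH ≡ nest → rule R HTHT ≢ nest → Fgen R ≈S rhs Ys Xs)
    × (rule R THTH ≢ nest → rule R HTHT ≡ nest → Fgen R ≈S rhs Xs Ys)
theorem7p1 R simion = (λ nests serial → Final.generating-function true R (nests , serial) simion)
                    , (λ serial nests → Final.generating-function false R (nests , serial) simion)
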